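{- For every $\epsilon > 0$ there exists a constant $c$ such that for all positive rationals $\alpha = \frac{p}{q}$ (with $p, q$ positive integers) we have $$n_{\alpha} < \frac{c\, q \log^3 q}{\min(\alpha, 1) \log \log q} + c\,(e + \epsilon)^{2\alpha}.$$
   Context: For a positive rational $\alpha$ and a positive integer $n$, an $\alpha$-partition of $n$ is a finite set $\{a_1, \ldots, a_r\}$ of distinct positive integers with $a_1 + \cdots + a_r = n$ and $\frac{1}{a_1} + \cdots + \frac{1}{a_r} = \alpha$. The quantity $n_{\alpha}$ is the smallest positive integer such that for every integer $n \ge n_{\alpha}$ an $\alpha$-partition of $n$ exists (it is known, by a theorem of Graham, that $n_\alpha$ exists for every positive rational $\alpha$). Convention on logarithms: $\log$ is the natural logarithm, except that $\log(x)$ is interpreted as $1$ whenever $x < e$ (this applies also to each logarithm in an iterated expression such as $\log\log q$). Here $\log^3 q = (\log q)^3$, and $e$ is the base of the natural logarithm. -}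

module Defs where

open import Data.Nat.Base as ℕ using (ℕ; zero; suc; _!)
import Data.Nat.Properties as ℕ
import Data.Nat.Coprimality as Coprime
open import Data.Integer.Base as ℤ using (+_; +0; +[1+_]; -[1+_])
import Data.Integer.Properties as ℤ
open import Data.Rational.Base as ℚ using (ℚ; mkℚ; 0ℚ; 1ℚ)
import Data.Rational.Properties as ℚ
open import Data.Rational.Solver using (module +-*-Solver)
open import Algebra.Definitions.RawSemiring ℚ.+-*-rawSemiring using () renaming (_^_ to _^ℚ_)
open import Data.List.Base using (List; sum; map; foldr)
open import Data.List.Relation.Unary.All using (All)
open import Data.List.Relation.Unary.Unique.Propositional using (Unique)
open import Data.Product.Base using (Σ-syntax; ∃-syntax; _×_; _,_; proj₁; proj₂)
open import Data.Sum.Base using (inj₁; inj₂)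
open import Relation.Nullary using (contradiction)
open import Relation.Binary.PropositionalEquality hiding (J)

fromℕℚ : ℕ → ℚ
fromℕℚ n = + n ℚ./ 1

-- Totalised reciprocal; the value at 0 is junk.
inv : ℚ → ℚ
inv (mkℚ +0 _ _) = 0ℚ
inv p@(mkℚ +[1+ _ ] _ _) = ℚ.1/ p
inv p@(mkℚ -[1+ _ ] _ _) = ℚ.1/ p

∑ : ℕ → (ℕ → ℚ) → ℚ
∑ zero    f = 0ℚ
∑ (suc n) f = ∑ n f ℚ.+ f n

syntax ∑ n (λ k → t) = ∑[ k < n ] t

expSum : ℕ → ℚ → ℚ
expSum n x = ∑[ k < n ] (x ^ℚ k ℚ.* inv (fromℕℚ (k !)))

mesh : ℕ → ℚ → ℚ
mesh n x = (x ℚ.- 1ℚ) ℚ.* inv (fromℕℚ n)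

-- Left Riemann sum of ∫₁ˣ dt/t for the subdivision of [1, x] into n equal parts.
lnSum : ℕ → ℚ → ℚ
lnSum n x = ∑[ k < n ] (mesh n x ℚ.* inv (1ℚ ℚ.+ fromℕℚ k ℚ.* mesh n x))

Small : (ℕ → ℕ → ℚ) → Set
Small d = ∀ ε → 0ℚ ℚ.< ε → ∃[ N ] (∀ m n → N ℕ.≤ m → N ℕ.≤ n → d m n ℚ.≤ ε)

Cauchy : (ℕ → ℚ) → Set
Cauchy x = Small (λ m n → ℚ.∣ x m ℚ.- x n ∣)

-- The gap δ makes this the strict order of the limits.
EventuallyBelow : (ℕ → ℚ) → (ℕ → ℚ) → Set
EventuallyBelow x y =
  Σ[ δ ∈ ℚ ] (0ℚ ℚ.< δ) × (∃[ N ] (∀ n → N ℕ.≤ n → x n ℚ.+ δ ℚ.≤ y n))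

module Estimates where

  open import Data.Rational.Base using (_+_; _*_; _-_; -_; _≤_; _<_; _⊔_; _⊓_; ∣_∣)
  open +-*-Solver using (solve; _:+_; _:*_; _:-_; :-_; con; _:=_)

  ι : ℕ → ℚ
  ι = fromℕℚ

  c1 : ∀ n → Coprime.Coprime n 1
  c1 n = Coprime.sym (Coprime.1-coprimeTo n)

  ι≡ : ∀ n → ι n ≡ mkℚ (+ n) 0 (c1 n)
  ι≡ n = ℚ.normalize-coprime (c1 n)

  ι-+ : ∀ m n → ι (m ℕ.+ n) ≡ ι m + ι n
  ι-+ m n = sym (trans (cong₂ _+_ (ι≡ m) (ι≡ n))
    (cong (λ z → z ℚ./ 1) (trans (cong₂ ℤ._+_ (ℤ.*-identityʳ (+ m)) (ℤ.*-identityʳ (+ n))) refl)))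

  ι-* : ∀ m n → ι (m ℕ.* n) ≡ ι m * ι n
  ι-* m n = sym (trans (cong₂ _*_ (ι≡ m) (ι≡ n))
    (cong (λ z → z ℚ./ 1) (sym (ℤ.pos-* m n))))

  ι-suc : ∀ n → ι (suc n) ≡ 1ℚ + ι n
  ι-suc n = ι-+ 1 n

  ι-mono : ∀ m n → m ℕ.≤ n → ι m ≤ ι n
  ι-mono m n m≤n rewrite ι≡ m | ι≡ n =
    ℚ.*≤* (subst₂ ℤ._≤_ (sym (ℤ.*-identityʳ (+ m))) (sym (ℤ.*-identityʳ (+ n))) (ℤ.+≤+ m≤n))

  0≤ι : ∀ n → 0ℚ ≤ ι n
  0≤ι n = ι-mono 0 n ℕ.z≤n

  0<1 : 0ℚ < 1ℚ
  0<1 = ℚ.positive⁻¹ 1ℚ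

  0≤1 : 0ℚ ≤ 1ℚ
  0≤1 = ℚ.<⇒≤ 0<1

  0<ι : ∀ n → 0 ℕ.< n → 0ℚ < ι n
  0<ι n h = ℚ.<-≤-trans 0<1 (ι-mono 1 n h)

  archimedean : ∀ r → ∃[ N ] (r ≤ ι N)
  archimedean r@(mkℚ n d _) = ℤ.∣ n ∣ ,
    subst (r ≤_) (sym (ι≡ ℤ.∣ n ∣))
      (ℚ.*≤* (ℤ.≤-trans (ℤ.≤-reflexive (ℤ.*-identityʳ n)) (aux n)))
    where
    aux : ∀ n → n ℤ.≤ + ℤ.∣ n ∣ ℤ.* + suc d
    aux (+ n) = subst (+ n ℤ.≤_) (ℤ.pos-* n (suc d)) (ℤ.+≤+ (ℕ.m≤m*n n (suc d)))
    aux -[1+ n ] = subst (-[1+ n ] ℤ.≤_) (ℤ.pos-* (suc n) (suc d)) ℤ.-≤+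

  *-mono-l : ∀ {r p q} → 0ℚ ≤ r → p ≤ q → r * p ≤ r * q
  *-mono-l {r} h = ℚ.*-monoˡ-≤-nonNeg r {{ℚ.nonNegative h}}

  *-mono-r : ∀ {r p q} → 0ℚ ≤ r → p ≤ q → p * r ≤ q * r
  *-mono-r {r} h = ℚ.*-monoʳ-≤-nonNeg r {{ℚ.nonNegative h}}

  *-mono : ∀ {p q r s} → 0ℚ ≤ r → 0ℚ ≤ q → p ≤ q → r ≤ s → p * r ≤ q * s
  *-mono 0≤r 0≤q pq rs = ℚ.≤-trans (*-mono-r 0≤r pq) (*-mono-l 0≤q rs)

  0≤* : ∀ {p q} → 0ℚ ≤ p → 0ℚ ≤ q → 0ℚ ≤ p * q
  0≤* {p} {q} hp hq = subst (_≤ p * q) (ℚ.*-zeroʳ p) (*-mono-l hp hq)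

  0<* : ∀ {p q} → 0ℚ < p → 0ℚ < q → 0ℚ < p * q
  0<* {p} {q} hp hq =
    ℚ.positive⁻¹ (p * q) {{ℚ.pos*pos⇒pos p {{ℚ.positive hp}} q {{ℚ.positive hq}}}}

  0≤+ : ∀ {p q} → 0ℚ ≤ p → 0ℚ ≤ q → 0ℚ ≤ p + q
  0≤+ = ℚ.+-mono-≤

  p≤p+q : ∀ {p q} → 0ℚ ≤ q → p ≤ p + q
  p≤p+q {p} {q} h = subst (_≤ p + q) (ℚ.+-identityʳ p) (ℚ.+-monoʳ-≤ p h)

  p≤q+p : ∀ {p q} → 0ℚ ≤ q → p ≤ q + p
  p≤q+p {p} {q} h = subst (_≤ q + p) (ℚ.+-identityˡ p) (ℚ.+-monoˡ-≤ p h)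

  p≤∣p∣ : ∀ p → p ≤ ∣ p ∣
  p≤∣p∣ p with ℚ.≤-total 0ℚ p
  ... | inj₁ h = ℚ.≤-reflexive (sym (ℚ.0≤p⇒∣p∣≡p h))
  ... | inj₂ h = ℚ.≤-trans h (ℚ.0≤∣p∣ p)

  ∣∣-sym : ∀ p q → ∣ p - q ∣ ≡ ∣ q - p ∣
  ∣∣-sym p q = trans (sym (ℚ.∣-p∣≡∣p∣ (p - q)))
    (cong ∣_∣ (solve 2 (λ p q → :- (p :- q) := q :- p) refl p q))

  ∣∣-tri : ∀ p q r → ∣ p - r ∣ ≤ ∣ p - q ∣ + ∣ q - r ∣
  ∣∣-tri p q r = subst (λ z → ∣ z ∣ ≤ ∣ p - q ∣ + ∣ q - r ∣)
    (solve 3 (λ p q r → (p :- q) :+ (q :- r) := p :- r) refl p q r)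
    (ℚ.∣p+q∣≤∣p∣+∣q∣ (p - q) (q - r))

  ∣∣≤ : ∀ {p c} → p ≤ c → - p ≤ c → ∣ p ∣ ≤ c
  ∣∣≤ {p} h h' with ℚ.∣p∣≡p∨∣p∣≡-p p
  ... | inj₁ e = subst (_≤ _) (sym e) h
  ... | inj₂ e = subst (_≤ _) (sym e) h'

  ∣p-q∣≤ : ∀ {p q c} → p ≤ q + c → q ≤ p + c → ∣ p - q ∣ ≤ c
  ∣p-q∣≤ {p} {q} {c} h h' = ∣∣≤
    (subst (p - q ≤_) (solve 2 (λ q c → q :+ c :- q := c) refl q c) (ℚ.+-monoˡ-≤ (- q) h))
    (subst₂ _≤_ (solve 2 (λ p q → q :- p := :- (p :- q)) refl p q)
                (solve 2 (λ p c → p :+ c :- p := c) refl p c) (ℚ.+-monoˡ-≤ (- p) h'))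

  p≤q+∣p-q∣ : ∀ p q → p ≤ q + ∣ p - q ∣
  p≤q+∣p-q∣ p q = subst (_≤ q + ∣ p - q ∣) (solve 2 (λ p q → q :+ (p :- q) := p) refl p q)
    (ℚ.+-monoʳ-≤ q (p≤∣p∣ (p - q)))

  inv≡ : ∀ p → 0ℚ < p → p * inv p ≡ 1ℚ
  inv≡ p@(mkℚ +[1+ _ ] _ _) h = ℚ.*-inverseʳ p
  inv≡ p@(mkℚ +0 _ _) h = contradiction (ℚ.positive h) λ ()
  inv≡ p@(mkℚ -[1+ _ ] _ _) h = contradiction (ℚ.positive h) λ ()

  0<inv : ∀ p → 0ℚ < p → 0ℚ < inv p
  0<inv p@(mkℚ +[1+ _ ] _ _) h = ℚ.positive⁻¹ (ℚ.1/ p) {{ℚ.1/pos⇒pos p}}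
  0<inv p@(mkℚ +0 _ _) h = contradiction (ℚ.positive h) λ ()
  0<inv p@(mkℚ -[1+ _ ] _ _) h = contradiction (ℚ.positive h) λ ()

  0≤inv : ∀ p → 0ℚ < p → 0ℚ ≤ inv p
  0≤inv p h = ℚ.<⇒≤ (0<inv p h)

  inv-anti : ∀ {p q} → 0ℚ < p → p ≤ q → inv q ≤ inv p
  inv-anti {p} {q} 0<p p≤q =
    subst₂ _≤_
      (trans (cong (_* inv q) (trans (ℚ.*-comm (inv p) p) (inv≡ p 0<p))) (ℚ.*-identityˡ (inv q)))
      (trans (ℚ.*-assoc (inv p) q (inv q)) (trans (cong (inv p *_) (inv≡ q 0<q)) (ℚ.*-identityʳ (inv p))))
      (*-mono-r (0≤inv q 0<q) (*-mono-l (0≤inv p 0<p) p≤q))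
    where
    0<q : 0ℚ < q
    0<q = ℚ.<-≤-trans 0<p p≤q

  ∣inv∣≤ : ∀ {ρ u} → 0ℚ < ρ → ρ ≤ u → ∣ inv u ∣ ≤ inv ρ
  ∣inv∣≤ {ρ} {u} h h' = subst (_≤ inv ρ)
    (sym (ℚ.0≤p⇒∣p∣≡p (0≤inv u (ℚ.<-≤-trans h h')))) (inv-anti h h')

  ∣*∣≤ : ∀ p q {a b} → ∣ p ∣ ≤ a → ∣ q ∣ ≤ b → ∣ p * q ∣ ≤ a * b
  ∣*∣≤ p q {a} {b} hp hq = subst (_≤ a * b) (sym (ℚ.∣p*q∣≡∣p∣*∣q∣ p q))
    (*-mono (ℚ.0≤∣p∣ q) (ℚ.≤-trans (ℚ.0≤∣p∣ p) hp) hp hq)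

  ∣scaled∣≤ : ∀ {ρ u v} d → 0ℚ < ρ → ρ ≤ u → ρ ≤ v →
              ∣ d * (inv u * inv v) ∣ ≤ ∣ d ∣ * (inv ρ * inv ρ)
  ∣scaled∣≤ {_} {u} {v} d h hu hv = ∣*∣≤ d (inv u * inv v) ℚ.≤-refl (∣*∣≤ (inv u) (inv v) (∣inv∣≤ h hu) (∣inv∣≤ h hv))

  fraction-diff : ∀ {u v} h h' → 0ℚ < u → 0ℚ < v →
                  h * inv u - h' * inv v ≡ (h * v - h' * u) * (inv u * inv v)
  fraction-diff {u} {v} h h' 0<u 0<v = begin
    h * U - h' * V
      ≡⟨ sym (cong₂ (λ a b → a - b) (ℚ.*-identityʳ (h * U)) (ℚ.*-identityʳ (h' * V))) ⟩
    h * U * 1ℚ - h' * V * 1ℚ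
      ≡⟨ sym (cong₂ (λ a b → h * U * a - h' * V * b) (inv≡ v 0<v) (inv≡ u 0<u)) ⟩
    h * U * (v * V) - h' * V * (u * U)
      ≡⟨ solve 6 (λ h h' u v U V → h :* U :* (v :* V) :- h' :* V :* (u :* U)
            := (h :* v :- h' :* u) :* (U :* V)) refl h h' u v U V ⟩
    (h * v - h' * u) * (U * V) ∎
    where
    open ≡-Reasoning
    U = inv u
    V = inv v

  ∑-diff : ∀ n f g c → (∀ k → k ℕ.< n → ∣ f k - g k ∣ ≤ c k) → ∣ ∑ n f - ∑ n g ∣ ≤ ∑ n c
  ∑-diff zero f g c h = ℚ.≤-refl
  ∑-diff (suc n) f g c h = subst (λ z → ∣ z ∣ ≤ ∑ n c + c n)
    (solve 4 (λ s t x y → (s :- t) :+ (x :- y) := (s :+ x) :- (t :+ y)) refl (∑ n f) (∑ n g) (f n) (g n))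
    (ℚ.≤-trans (ℚ.∣p+q∣≤∣p∣+∣q∣ (∑ n f - ∑ n g) (f n - g n))
      (ℚ.+-mono-≤ (∑-diff n f g c (λ k k<n → h k (ℕ.m<n⇒m<1+n k<n))) (h n ℕ.≤-refl)))

  ∑-cong : ∀ n f g → (∀ k → f k ≡ g k) → ∑ n f ≡ ∑ n g
  ∑-cong zero f g h = refl
  ∑-cong (suc n) f g h = cong₂ _+_ (∑-cong n f g h) (h n)

  ∑-const : ∀ n c → ∑ n (λ _ → c) ≡ ι n * c
  ∑-const zero c = sym (ℚ.*-zeroˡ c)
  ∑-const (suc n) c = begin
    ∑ n (λ _ → c) + c ≡⟨ cong (_+ c) (∑-const n c) ⟩
    ι n * c + c       ≡⟨ cong (λ z → ι n * c + z) (sym (ℚ.*-identityˡ c)) ⟩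
    ι n * c + 1ℚ * c  ≡⟨ solve 3 (λ a b c → a :* c :+ b :* c := (b :+ a) :* c) refl (ι n) 1ℚ c ⟩
    (1ℚ + ι n) * c    ≡⟨ cong (_* c) (sym (ι-suc n)) ⟩
    ι (suc n) * c     ∎
    where open ≡-Reasoning

  ∑-scale : ∀ n c f → ∑ n (λ k → c * f k) ≡ c * ∑ n f
  ∑-scale zero c f = sym (ℚ.*-zeroʳ c)
  ∑-scale (suc n) c f = trans (cong (_+ c * f n) (∑-scale n c f)) (sym (ℚ.*-distribˡ-+ c (∑ n f) (f n)))

  ∑-split : ∀ a b f → ∑ (a ℕ.+ b) f ≡ ∑ a f + ∑ b (λ j → f (a ℕ.+ j))
  ∑-split a zero f rewrite ℕ.+-identityʳ a = sym (ℚ.+-identityʳ (∑ a f))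
  ∑-split a (suc b) f rewrite ℕ.+-suc a b = trans (cong (_+ f (a ℕ.+ b)) (∑-split a b f))
    (ℚ.+-assoc (∑ a f) (∑ b (λ j → f (a ℕ.+ j))) (f (a ℕ.+ b)))

  ∑-blocks : ∀ n m f → ∑ (n ℕ.* m) f ≡ ∑ n (λ k → ∑ m (λ j → f (k ℕ.* m ℕ.+ j)))
  ∑-blocks zero m f = refl
  ∑-blocks (suc n) m f rewrite ℕ.+-comm m (n ℕ.* m) =
    trans (∑-split (n ℕ.* m) m f) (cong (_+ ∑ m (λ j → f (n ℕ.* m ℕ.+ j))) (∑-blocks n m f))

  ∑-mono-n : ∀ {m n} f → (∀ k → 0ℚ ≤ f k) → m ℕ.≤ n → ∑ m f ≤ ∑ n f
  ∑-mono-n {m} f h m≤n = go (ℕ.≤⇒≤′ m≤n)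
    where
    go : ∀ {n} → m ℕ.≤′ n → ∑ m f ≤ ∑ n f
    go (ℕ.≤′-reflexive refl) = ℚ.≤-refl
    go {suc n} (ℕ.≤′-step p) = ℚ.≤-trans (go p) (p≤p+q (h n))

  small-≤ : ∀ {d e} N → (∀ m n → N ℕ.≤ m → N ℕ.≤ n → d m n ≤ e m n) → Small e → Small d
  small-≤ N h se ε 0<ε with se ε 0<ε
  ... | M , k = N ℕ.⊔ M , λ m n p q →
    ℚ.≤-trans (h m n (ℕ.≤-trans (ℕ.m≤m⊔n N M) p) (ℕ.≤-trans (ℕ.m≤m⊔n N M) q))
              (k m n (ℕ.≤-trans (ℕ.m≤n⊔m N M) p) (ℕ.≤-trans (ℕ.m≤n⊔m N M) q))

  half : ∀ ε → 0ℚ < ε → ∃[ η ] (0ℚ < η × η + η ≡ ε)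
  half ε h = ε * ℚ.½ , 0<* h (ℚ.positive⁻¹ ℚ.½) ,
    trans (sym (ℚ.*-distribˡ-+ ε ℚ.½ ℚ.½)) (ℚ.*-identityʳ ε)

  small-+ : ∀ {d e} → Small d → Small e → Small (λ m n → d m n + e m n)
  small-+ sd se ε 0<ε with half ε 0<ε
  ... | η , 0<η , refl with sd η 0<η | se η 0<η
  ... | N , h | M , k = N ℕ.⊔ M , λ m n p q → ℚ.+-mono-≤
    (h m n (ℕ.≤-trans (ℕ.m≤m⊔n N M) p) (ℕ.≤-trans (ℕ.m≤m⊔n N M) q))
    (k m n (ℕ.≤-trans (ℕ.m≤n⊔m N M) p) (ℕ.≤-trans (ℕ.m≤n⊔m N M) q))

  small-* : ∀ {d} C → 0ℚ < C → Small d → Small (λ m n → C * d m n)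
  small-* {d} C 0<C sd ε 0<ε with sd (inv C * ε) (0<* (0<inv C 0<C) 0<ε)
  ... | N , h = N , λ m n p q → ℚ.≤-trans (*-mono-l (ℚ.<⇒≤ 0<C) (h m n p q))
    (ℚ.≤-reflexive (trans (sym (ℚ.*-assoc C (inv C) ε))
      (trans (cong (_* ε) (inv≡ C 0<C)) (ℚ.*-identityˡ ε))))

  small-swap : ∀ {d} → Small d → Small (λ m n → d n m)
  small-swap sd ε 0<ε with sd ε 0<ε
  ... | N , h = N , λ m n p q → h n m q p

  small-inv : Small (λ m n → inv (ι m))
  small-inv ε 0<ε with archimedean (inv ε)
  ... | N , h = suc N , λ m n p _ →
    let 0<m = 0<ι m (ℕ.≤-trans (ℕ.s≤s ℕ.z≤n) p)
        1≤mε : 1ℚ ≤ ι m * ε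
        1≤mε = subst (_≤ ι m * ε) (trans (ℚ.*-comm (inv ε) ε) (inv≡ ε 0<ε))
          (*-mono-r (ℚ.<⇒≤ 0<ε) (ℚ.≤-trans h (ι-mono N m (ℕ.≤-trans (ℕ.n≤1+n N) p))))
    in subst₂ _≤_ (ℚ.*-identityʳ (inv (ι m)))
         (trans (sym (ℚ.*-assoc (inv (ι m)) (ι m) ε))
           (trans (cong (_* ε) (trans (ℚ.*-comm (inv (ι m)) (ι m)) (inv≡ (ι m) 0<m))) (ℚ.*-identityˡ ε)))
         (*-mono-l (0≤inv (ι m) 0<m) 1≤mε)

  bounded : ∀ {x} → Cauchy x → ∃[ B ] ∃[ N ] (0ℚ < B × (∀ n → N ℕ.≤ n → ∣ x n ∣ ≤ B))
  bounded {x} cx = 1ℚ + ∣ x N ∣ , N , ℚ.<-≤-trans 0<1 (p≤p+q (ℚ.0≤∣p∣ (x N))) , λ n p → begin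
    ∣ x n ∣                ≡⟨ cong ∣_∣ (solve 2 (λ a b → a := (a :- b) :+ b) refl (x n) (x N)) ⟩
    ∣ (x n - x N) + x N ∣  ≤⟨ ℚ.∣p+q∣≤∣p∣+∣q∣ (x n - x N) (x N) ⟩
    ∣ x n - x N ∣ + ∣ x N ∣ ≤⟨ ℚ.+-monoˡ-≤ ∣ x N ∣ (proj₂ (cx 1ℚ 0<1) n N p ℕ.≤-refl) ⟩
    1ℚ + ∣ x N ∣           ∎
    where
    open ℚ.≤-Reasoning
    N : ℕ
    N = proj₁ (cx 1ℚ 0<1)

  const-cauchy : ∀ p → Cauchy (λ _ → p)
  const-cauchy p ε 0<ε = 0 , λ _ _ _ _ →
    subst (_≤ ε) (sym (cong ∣_∣ (ℚ.+-inverseʳ p))) (ℚ.<⇒≤ 0<ε)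

  +-cauchy : ∀ {x y} → Cauchy x → Cauchy y → Cauchy (λ n → x n + y n)
  +-cauchy {x} {y} cx cy = small-≤ 0 (λ m n _ _ →
    subst (λ z → ∣ z ∣ ≤ ∣ x m - x n ∣ + ∣ y m - y n ∣)
      (solve 4 (λ a b c d → (a :- b) :+ (c :- d) := (a :+ c) :- (b :+ d)) refl (x m) (x n) (y m) (y n))
      (ℚ.∣p+q∣≤∣p∣+∣q∣ (x m - x n) (y m - y n)))
    (small-+ cx cy)

  *-estimate : ∀ {A B a b c d} → ∣ a ∣ ≤ A → ∣ d ∣ ≤ B →
               ∣ a * c - b * d ∣ ≤ A * ∣ c - d ∣ + B * ∣ a - b ∣
  *-estimate {A} {B} {a} {b} {c} {d} ha hd = begin
    ∣ a * c - b * d ∣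
      ≡⟨ cong ∣_∣ (solve 4 (λ a b c d → a :* c :- b :* d := a :* (c :- d) :+ d :* (a :- b)) refl a b c d) ⟩
    ∣ a * (c - d) + d * (a - b) ∣
      ≤⟨ ℚ.∣p+q∣≤∣p∣+∣q∣ (a * (c - d)) (d * (a - b)) ⟩
    ∣ a * (c - d) ∣ + ∣ d * (a - b) ∣
      ≤⟨ ℚ.+-mono-≤ (∣*∣≤ a (c - d) ha ℚ.≤-refl) (∣*∣≤ d (a - b) hd ℚ.≤-refl) ⟩
    A * ∣ c - d ∣ + B * ∣ a - b ∣ ∎
    where open ℚ.≤-Reasoning

  *-cauchy : ∀ {x y} → Cauchy x → Cauchy y → Cauchy (λ n → x n * y n)
  *-cauchy {x} {y} cx cy = from-bounds (bounded {x} cx) (bounded {y} cy)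
    where
    from-bounds : ∃[ A ] ∃[ M ] (0ℚ < A × (∀ n → M ℕ.≤ n → ∣ x n ∣ ≤ A)) →
                  ∃[ B ] ∃[ N ] (0ℚ < B × (∀ n → N ℕ.≤ n → ∣ y n ∣ ≤ B)) →
                  Cauchy (λ n → x n * y n)
    from-bounds (A , M , 0<A , hA) (B , N , 0<B , hB) =
      small-≤ {λ m n → ∣ x m * y m - x n * y n ∣}
              {λ m n → A * ∣ y m - y n ∣ + B * ∣ x m - x n ∣} (M ℕ.⊔ N)
        (λ m n p q → *-estimate {A} {B} {x m} {x n} {y m} {y n}
          (hA m (ℕ.≤-trans (ℕ.m≤m⊔n M N) p)) (hB n (ℕ.≤-trans (ℕ.m≤n⊔m M N) q)))
        (small-+ {λ m n → A * ∣ y m - y n ∣} {λ m n → B * ∣ x m - x n ∣}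
          (small-* {λ m n → ∣ y m - y n ∣} A 0<A cy)
          (small-* {λ m n → ∣ x m - x n ∣} B 0<B cx))

  ⊔-cauchy : ∀ {x y} → Cauchy x → Cauchy y → Cauchy (λ n → x n ⊔ y n)
  ⊔-cauchy {x} {y} cx cy = small-≤ 0 (λ m n _ _ → ∣p-q∣≤ (step m n)
      (subst (λ z → x n ⊔ y n ≤ (x m ⊔ y m) + z)
        (cong₂ _+_ (∣∣-sym (x n) (x m)) (∣∣-sym (y n) (y m))) (step n m)))
    (small-+ cx cy)
    where
    step : ∀ m n → x m ⊔ y m ≤ (x n ⊔ y n) + (∣ x m - x n ∣ + ∣ y m - y n ∣)
    step m n = ℚ.⊔-lub
      (ℚ.≤-trans (p≤q+∣p-q∣ (x m) (x n)) (ℚ.+-mono-≤ (ℚ.p≤p⊔q (x n) (y n)) (p≤p+q (ℚ.0≤∣p∣ (y m - y n)))))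
      (ℚ.≤-trans (p≤q+∣p-q∣ (y m) (y n)) (ℚ.+-mono-≤ (ℚ.p≤q⊔p (x n) (y n)) (p≤q+p (ℚ.0≤∣p∣ (x m - x n)))))

  ⊓-cauchy : ∀ {x y} → Cauchy x → Cauchy y → Cauchy (λ n → x n ⊓ y n)
  ⊓-cauchy {x} {y} cx cy = small-≤ {λ m n → ∣ (x m ⊓ y m) - (x n ⊓ y n) ∣}
    {λ m n → ∣ x m - x n ∣ + ∣ y m - y n ∣} 0 (λ m n _ _ → ∣p-q∣≤ (step m n)
      (subst (λ z → x n ⊓ y n ≤ (x m ⊓ y m) + z)
        (cong₂ _+_ (∣∣-sym (x n) (x m)) (∣∣-sym (y n) (y m))) (step n m)))
    (small-+ {λ m n → ∣ x m - x n ∣} {λ m n → ∣ y m - y n ∣} cx cy)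
    where
    step : ∀ m n → x m ⊓ y m ≤ (x n ⊓ y n) + (∣ x m - x n ∣ + ∣ y m - y n ∣)
    step m n with ℚ.⊓-sel (x n) (y n)
    ... | inj₁ eq = subst (λ z → x m ⊓ y m ≤ z + (∣ x m - x n ∣ + ∣ y m - y n ∣)) (sym eq)
      (ℚ.≤-trans (ℚ.p⊓q≤p (x m) (y m)) (ℚ.≤-trans (p≤q+∣p-q∣ (x m) (x n))
        (ℚ.+-monoʳ-≤ (x n) (p≤p+q (ℚ.0≤∣p∣ (y m - y n))))))
    ... | inj₂ eq = subst (λ z → x m ⊓ y m ≤ z + (∣ x m - x n ∣ + ∣ y m - y n ∣)) (sym eq)
      (ℚ.≤-trans (ℚ.p⊓q≤q (x m) (y m)) (ℚ.≤-trans (p≤q+∣p-q∣ (y m) (y n))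
        (ℚ.+-monoʳ-≤ (y n) (p≤q+p (ℚ.0≤∣p∣ (x m - x n))))))

  inv-cauchy : ∀ {x} → EventuallyBelow (λ _ → 0ℚ) x → Cauchy x → Cauchy (λ n → inv (x n))
  inv-cauchy {x} (ρ , 0<ρ , N , h) cx = small-≤ N (λ m n p q → begin
      ∣ inv (x m) - inv (x n) ∣
        ≡⟨ cong ∣_∣ (sym (cong₂ _-_ (ℚ.*-identityˡ (inv (x m))) (ℚ.*-identityˡ (inv (x n))))) ⟩
      ∣ 1ℚ * inv (x m) - 1ℚ * inv (x n) ∣
        ≡⟨ cong ∣_∣ (fraction-diff {x m} {x n} 1ℚ 1ℚ (ℚ.<-≤-trans 0<ρ (ρ≤ m p)) (ℚ.<-≤-trans 0<ρ (ρ≤ n q))) ⟩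
      ∣ (1ℚ * x n - 1ℚ * x m) * (inv (x m) * inv (x n)) ∣
        ≤⟨ ∣scaled∣≤ {ρ} {x m} {x n} (1ℚ * x n - 1ℚ * x m) 0<ρ (ρ≤ m p) (ρ≤ n q) ⟩
      ∣ 1ℚ * x n - 1ℚ * x m ∣ * (inv ρ * inv ρ)
        ≡⟨ cong (_* (inv ρ * inv ρ)) (trans
             (cong₂ (λ a b → ∣ a - b ∣) (ℚ.*-identityˡ (x n)) (ℚ.*-identityˡ (x m))) (∣∣-sym (x n) (x m))) ⟩
      ∣ x m - x n ∣ * (inv ρ * inv ρ)
        ≡⟨ ℚ.*-comm ∣ x m - x n ∣ (inv ρ * inv ρ) ⟩
      (inv ρ * inv ρ) * ∣ x m - x n ∣ ∎)
    (small-* (inv ρ * inv ρ) (0<* (0<inv ρ 0<ρ) (0<inv ρ 0<ρ)) cx)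
    where
    open ℚ.≤-Reasoning
    ρ≤ : ∀ n → N ℕ.≤ n → ρ ≤ x n
    ρ≤ n p = subst (_≤ x n) (ℚ.+-identityˡ ρ) (h n p)

  0≤- : ∀ {p q} → q ≤ p → 0ℚ ≤ p - q
  0≤- {p} {q} h = subst (_≤ p - q) (ℚ.+-inverseʳ q) (ℚ.+-monoˡ-≤ (- q) h)

  module _ {ρ : ℚ} (0<ρ : 0ℚ < ρ) (ρ≤1 : ρ ≤ 1ℚ) where

    J : ℚ
    J = inv ρ * inv ρ

    0<J : 0ℚ < J
    0<J = 0<* (0<inv ρ 0<ρ) (0<inv ρ 0<ρ)

    0≤J : 0ℚ ≤ J
    0≤J = ℚ.<⇒≤ 0<J

    node≥ρ : ∀ {a} N i → ρ ≤ a → 0 ℕ.< N → i ℕ.≤ N → ρ ≤ 1ℚ + ι i * mesh N a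
    node≥ρ {a} N i ρ≤a 0<N i≤N = subst (ρ ≤_)
      (solve 4 (λ ρ a i I → ρ :+ ((con 1ℚ :- i :* I) :* (con 1ℚ :- ρ) :+ (i :* I) :* (a :- ρ))
           := con 1ℚ :+ i :* ((a :- con 1ℚ) :* I)) refl ρ a (ι i) (inv (ι N)))
      (p≤p+q (0≤+ (0≤* (0≤- t≤1) (0≤- ρ≤1)) (0≤* 0≤t (0≤- ρ≤a))))
      where
      0≤I : 0ℚ ≤ inv (ι N)
      0≤I = 0≤inv (ι N) (0<ι N 0<N)
      0≤t : 0ℚ ≤ ι i * inv (ι N)
      0≤t = 0≤* (0≤ι i) 0≤I
      t≤1 : ι i * inv (ι N) ≤ 1ℚ
      t≤1 = subst (ι i * inv (ι N) ≤_) (inv≡ (ι N) (0<ι N 0<N)) (*-mono-r 0≤I (ι-mono i N i≤N))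

    lnSum-lipschitz : ∀ {a b} n → 0 ℕ.< n → ρ ≤ a → ρ ≤ b →
                      ∣ lnSum n a - lnSum n b ∣ ≤ J * ∣ a - b ∣
    lnSum-lipschitz {a} {b} n 0<n ρ≤a ρ≤b = ℚ.≤-trans
      (∑-diff n (λ k → mesh n a * inv (1ℚ + ι k * mesh n a)) (λ k → mesh n b * inv (1ℚ + ι k * mesh n b))
        (λ _ → ∣ a - b ∣ * I * J) term)
      (ℚ.≤-reflexive (trans (∑-const n (∣ a - b ∣ * I * J))
        (trans (solve 4 (λ n d I J → n :* (d :* I :* J) := (n :* I) :* (J :* d)) refl (ι n) ∣ a - b ∣ I J)
          (trans (cong (_* (J * ∣ a - b ∣)) (inv≡ (ι n) (0<ι n 0<n))) (ℚ.*-identityˡ (J * ∣ a - b ∣))))))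
      where
      I h h' : ℚ
      I = inv (ι n)
      h = mesh n a
      h' = mesh n b
      term : ∀ k → k ℕ.< n →
             ∣ h * inv (1ℚ + ι k * h) - h' * inv (1ℚ + ι k * h') ∣ ≤ ∣ a - b ∣ * I * J
      term k k<n = begin
        ∣ h * inv u - h' * inv v ∣
          ≡⟨ cong ∣_∣ (fraction-diff {u} {v} h h' (ℚ.<-≤-trans 0<ρ ρ≤u) (ℚ.<-≤-trans 0<ρ ρ≤v)) ⟩
        ∣ (h * v - h' * u) * (inv u * inv v) ∣
          ≤⟨ ∣scaled∣≤ {ρ} {u} {v} (h * v - h' * u) 0<ρ ρ≤u ρ≤v ⟩
        ∣ h * v - h' * u ∣ * J
          ≡⟨ cong (λ z → ∣ z ∣ * J) (solve 4 (λ a b I k →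
               (a :- con 1ℚ) :* I :* (con 1ℚ :+ k :* ((b :- con 1ℚ) :* I))
               :- (b :- con 1ℚ) :* I :* (con 1ℚ :+ k :* ((a :- con 1ℚ) :* I))
               := (a :- b) :* I) refl a b I (ι k)) ⟩
        ∣ (a - b) * I ∣ * J
          ≡⟨ cong (_* J) (ℚ.∣p*q∣≡∣p∣*∣q∣ (a - b) I) ⟩
        ∣ a - b ∣ * ∣ I ∣ * J
          ≡⟨ cong (λ z → ∣ a - b ∣ * z * J) (ℚ.0≤p⇒∣p∣≡p (0≤inv (ι n) (0<ι n 0<n))) ⟩
        ∣ a - b ∣ * I * J ∎
        where
        open ℚ.≤-Reasoning
        u v : ℚ
        u = 1ℚ + ι k * h
        v = 1ℚ + ι k * h'
        ρ≤u : ρ ≤ u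
        ρ≤u = node≥ρ n k ρ≤a 0<n (ℕ.<⇒≤ k<n)
        ρ≤v : ρ ≤ v
        ρ≤v = node≥ρ n k ρ≤b 0<n (ℕ.<⇒≤ k<n)

    lnSum-refine : ∀ {a} n m → 0 ℕ.< n → 0 ℕ.< m → ρ ≤ a →
                   ∣ lnSum n a - lnSum (n ℕ.* m) a ∣ ≤ (∣ a - 1ℚ ∣ * ∣ a - 1ℚ ∣ * J) * inv (ι n)
    lnSum-refine {a} n m 0<n 0<m ρ≤a = begin
      ∣ lnSum n a - lnSum N a ∣
        ≡⟨ cong₂ (λ y z → ∣ y - z ∣) coarse≡ (∑-blocks n m (λ i → g * inv (1ℚ + ι i * g))) ⟩
      ∣ ∑ n (λ k → ∑ m (λ j → g * inv (u k))) - ∑ n (λ k → ∑ m (λ j → g * inv (v k j))) ∣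
        ≤⟨ ∑-diff n (λ k → ∑ m (λ j → g * inv (u k))) (λ k → ∑ m (λ j → g * inv (v k j)))
             (λ _ → ∑ m (λ _ → C))
             (λ k k<n → ∑-diff m (λ j → g * inv (u k)) (λ j → g * inv (v k j)) (λ _ → C) (term k k<n)) ⟩
      ∑ n (λ _ → ∑ m (λ _ → C))
        ≡⟨ trans (∑-const n (∑ m (λ _ → C))) (cong (ι n *_) (∑-const m C)) ⟩
      ι n * (ι m * C)
        ≡⟨ solve 5 (λ n m d I J → n :* (m :* ((d :* I) :* (m :* (d :* I)) :* J))
              := (n :* m :* I) :* (d :* d :* J :* (m :* I))) refl (ι n) (ι m) d I' J ⟩
      (ι n * ι m * I') * (d * d * J * (ι m * I'))
        ≡⟨ cong₂ (λ y z → y * (d * d * J * z)) nmI'≡1 mI'≡I ⟩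
      1ℚ * (d * d * J * I)
        ≡⟨ ℚ.*-identityˡ (d * d * J * I) ⟩
      d * d * J * I ∎
      where
      open ℚ.≤-Reasoning
      N : ℕ
      N = n ℕ.* m
      0<N : 0 ℕ.< N
      0<N = ℕ.*-mono-< 0<n 0<m
      I I' d g h C : ℚ
      I = inv (ι n)
      I' = inv (ι N)
      d = ∣ a - 1ℚ ∣
      g = mesh N a
      h = mesh n a
      C = (d * I') * (ι m * (d * I')) * J
      u : ℕ → ℚ
      u k = 1ℚ + ι k * h
      v : ℕ → ℕ → ℚ
      v k j = 1ℚ + ι (k ℕ.* m ℕ.+ j) * g
      nmI'≡1 : ι n * ι m * I' ≡ 1ℚ
      nmI'≡1 = trans (cong (_* I') (sym (ι-* n m))) (inv≡ (ι N) (0<ι N 0<N))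
      mI'≡I : ι m * I' ≡ I
      mI'≡I = trans (sym (ℚ.*-identityˡ (ι m * I')))
        (trans (cong (_* (ι m * I')) (sym (inv≡ (ι n) (0<ι n 0<n))))
        (trans (solve 4 (λ n m I I' → (n :* I) :* (m :* I') := I :* (n :* m :* I')) refl (ι n) (ι m) I I')
        (trans (cong (I *_) nmI'≡1) (ℚ.*-identityʳ I))))
      mg≡h : ι m * g ≡ h
      mg≡h = trans (solve 3 (λ m a I' → m :* ((a :- con 1ℚ) :* I') := (a :- con 1ℚ) :* (m :* I')) refl (ι m) a I')
        (cong ((a - 1ℚ) *_) mI'≡I)
      coarse≡ : lnSum n a ≡ ∑ n (λ k → ∑ m (λ j → g * inv (u k)))
      coarse≡ = ∑-cong n (λ k → h * inv (u k)) (λ k → ∑ m (λ j → g * inv (u k))) (λ k →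
        trans (cong (_* inv (u k)) (sym mg≡h))
          (trans (ℚ.*-assoc (ι m) g (inv (u k))) (sym (∑-const m (g * inv (u k))))))
      ∣g∣≡ : ∣ g ∣ ≡ d * I'
      ∣g∣≡ = trans (ℚ.∣p*q∣≡∣p∣*∣q∣ (a - 1ℚ) I')
        (cong (d *_) (ℚ.0≤p⇒∣p∣≡p (0≤inv (ι N) (0<ι N 0<N))))
      block< : ∀ k j → k ℕ.< n → j ℕ.< m → k ℕ.* m ℕ.+ j ℕ.≤ N
      block< k j k<n j<m = ℕ.≤-trans (ℕ.+-monoʳ-≤ (k ℕ.* m) (ℕ.<⇒≤ j<m))
        (subst (ℕ._≤ N) (ℕ.+-comm m (k ℕ.* m)) (ℕ.*-monoˡ-≤ m k<n))
      cross : ∀ k j → g * v k j - g * u k ≡ g * (ι j * g)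
      cross k j = trans
        (cong₂ (λ y z → g * (1ℚ + y * g) - g * (1ℚ + ι k * z))
          (trans (ι-+ (k ℕ.* m) j) (cong (_+ ι j) (ι-* k m))) (sym mg≡h))
        (solve 4 (λ g k m j → g :* (con 1ℚ :+ (k :* m :+ j) :* g) :- g :* (con 1ℚ :+ k :* (m :* g))
           := g :* (j :* g)) refl g (ι k) (ι m) (ι j))
      ∣jg∣≤ : ∀ j → j ℕ.< m → ∣ ι j * g ∣ ≤ ι m * (d * I')
      ∣jg∣≤ j j<m = ∣*∣≤ (ι j) g
        (ℚ.≤-trans (ℚ.≤-reflexive (ℚ.0≤p⇒∣p∣≡p (0≤ι j))) (ι-mono j m (ℕ.<⇒≤ j<m)))
        (ℚ.≤-reflexive ∣g∣≡)
      term : ∀ k → k ℕ.< n → ∀ j → j ℕ.< m → ∣ g * inv (u k) - g * inv (v k j) ∣ ≤ C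
      term k k<n j j<m = begin
        ∣ g * inv (u k) - g * inv (v k j) ∣
          ≡⟨ cong ∣_∣ (fraction-diff {u k} {v k j} g g (ℚ.<-≤-trans 0<ρ ρ≤u) (ℚ.<-≤-trans 0<ρ ρ≤v)) ⟩
        ∣ (g * v k j - g * u k) * (inv (u k) * inv (v k j)) ∣
          ≤⟨ ∣scaled∣≤ {ρ} {u k} {v k j} (g * v k j - g * u k) 0<ρ ρ≤u ρ≤v ⟩
        ∣ g * v k j - g * u k ∣ * J
          ≡⟨ cong (λ z → ∣ z ∣ * J) (cross k j) ⟩
        ∣ g * (ι j * g) ∣ * J
          ≤⟨ *-mono-r 0≤J (∣*∣≤ g (ι j * g) (ℚ.≤-reflexive ∣g∣≡) (∣jg∣≤ j j<m)) ⟩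
        C ∎
        where
        ρ≤u : ρ ≤ u k
        ρ≤u = node≥ρ n k ρ≤a 0<n (ℕ.<⇒≤ k<n)
        ρ≤v : ρ ≤ v k j
        ρ≤v = node≥ρ N (k ℕ.* m ℕ.+ j) ρ≤a 0<N (block< k j k<n j<m)

    lnSum-estimate : ∀ {a b D} m n → 0 ℕ.< m → 0 ℕ.< n → ρ ≤ a → ρ ≤ b →
      ∣ a - 1ℚ ∣ * ∣ a - 1ℚ ∣ * J ≤ D → ∣ b - 1ℚ ∣ * ∣ b - 1ℚ ∣ * J ≤ D →
      ∣ lnSum m a - lnSum n b ∣ ≤ D * inv (ι m) + (J * ∣ a - b ∣ + D * inv (ι n))
    lnSum-estimate {a} {b} {D} m n 0<m 0<n ρ≤a ρ≤b ha hb = begin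
      ∣ lnSum m a - lnSum n b ∣
        ≤⟨ ∣∣-tri (lnSum m a) (lnSum N a) (lnSum n b) ⟩
      ∣ lnSum m a - lnSum N a ∣ + ∣ lnSum N a - lnSum n b ∣
        ≤⟨ ℚ.+-monoʳ-≤ ∣ lnSum m a - lnSum N a ∣ (∣∣-tri (lnSum N a) (lnSum N b) (lnSum n b)) ⟩
      ∣ lnSum m a - lnSum N a ∣ + (∣ lnSum N a - lnSum N b ∣ + ∣ lnSum N b - lnSum n b ∣)
        ≤⟨ ℚ.+-mono-≤ (ℚ.≤-trans (lnSum-refine m n 0<m 0<n ρ≤a) (*-mono-r (0≤inv (ι m) (0<ι m 0<m)) ha))
             (ℚ.+-mono-≤ (lnSum-lipschitz N (ℕ.*-mono-< 0<m 0<n) ρ≤a ρ≤b)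
               (subst (_≤ D * inv (ι n))
                 (trans (∣∣-sym (lnSum n b) (lnSum (n ℕ.* m) b)) (cong (λ z → ∣ lnSum z b - lnSum n b ∣) (ℕ.*-comm n m)))
                 (ℚ.≤-trans (lnSum-refine n m 0<n 0<m ρ≤b) (*-mono-r (0≤inv (ι n) (0<ι n 0<n)) hb)))) ⟩
      D * inv (ι m) + (J * ∣ a - b ∣ + D * inv (ι n)) ∎
      where
      open ℚ.≤-Reasoning
      N : ℕ
      N = m ℕ.* n

  lnSum-cauchy : ∀ {x} → EventuallyBelow (λ _ → 0ℚ) x → Cauchy x → Cauchy (λ n → lnSum n (x n))
  lnSum-cauchy {x} (δ , 0<δ , N , h) cx = from-bound (bounded {x} cx)
    where
    ρ : ℚ
    ρ = δ ⊓ 1ℚ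
    0<ρ : 0ℚ < ρ
    0<ρ with ℚ.⊓-sel δ 1ℚ
    ... | inj₁ e = subst (0ℚ <_) (sym e) 0<δ
    ... | inj₂ e = subst (0ℚ <_) (sym e) 0<1
    ρ≤1 : ρ ≤ 1ℚ
    ρ≤1 = ℚ.p⊓q≤q δ 1ℚ
    ρ≤ : ∀ n → N ℕ.≤ n → ρ ≤ x n
    ρ≤ n p = ℚ.≤-trans (ℚ.p⊓q≤p δ 1ℚ) (subst (_≤ x n) (ℚ.+-identityˡ δ) (h n p))
    K : ℚ
    K = J 0<ρ ρ≤1
    from-bound : ∃[ B ] ∃[ M ] (0ℚ < B × (∀ n → M ℕ.≤ n → ∣ x n ∣ ≤ B)) →
                 Cauchy (λ n → lnSum n (x n))
    from-bound (B , M , 0<B , hB) =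
      small-≤ {λ m n → ∣ lnSum m (x m) - lnSum n (x n) ∣}
              {λ m n → D * inv (ι m) + (K * ∣ x m - x n ∣ + D * inv (ι n))} (suc (N ℕ.⊔ M))
        (λ m n p q → lnSum-estimate 0<ρ ρ≤1 m n (ℕ.≤-trans (ℕ.s≤s ℕ.z≤n) p) (ℕ.≤-trans (ℕ.s≤s ℕ.z≤n) q)
          (ρ≤ m (≥N p)) (ρ≤ n (≥N q)) (D-bound m (≥M p)) (D-bound n (≥M q)))
        (small-+ {λ m n → D * inv (ι m)} {λ m n → K * ∣ x m - x n ∣ + D * inv (ι n)}
          (small-* {λ m n → inv (ι m)} D 0<D small-inv)
          (small-+ {λ m n → K * ∣ x m - x n ∣} {λ m n → D * inv (ι n)}
            (small-* {λ m n → ∣ x m - x n ∣} K (0<J 0<ρ ρ≤1) cx)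
            (small-* {λ m n → inv (ι n)} D 0<D (small-swap {λ m n → inv (ι m)} small-inv))))
      where
      b D : ℚ
      b = B + 1ℚ
      D = b * b * K
      0<b : 0ℚ < b
      0<b = ℚ.<-≤-trans 0<B (p≤p+q 0≤1)
      0<D : 0ℚ < D
      0<D = 0<* (0<* 0<b 0<b) (0<J 0<ρ ρ≤1)
      ≥N : ∀ {n} → suc (N ℕ.⊔ M) ℕ.≤ n → N ℕ.≤ n
      ≥N p = ℕ.≤-trans (ℕ.m≤m⊔n N M) (ℕ.<⇒≤ p)
      ≥M : ∀ {n} → suc (N ℕ.⊔ M) ℕ.≤ n → M ℕ.≤ n
      ≥M p = ℕ.≤-trans (ℕ.m≤n⊔m N M) (ℕ.<⇒≤ p)
      d≤b : ∀ n → M ℕ.≤ n → ∣ x n - 1ℚ ∣ ≤ b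
      d≤b n p = ℚ.≤-trans (ℚ.∣p-q∣≤∣p∣+∣q∣ (x n) 1ℚ) (ℚ.+-monoˡ-≤ 1ℚ (hB n p))
      D-bound : ∀ n → M ℕ.≤ n → ∣ x n - 1ℚ ∣ * ∣ x n - 1ℚ ∣ * K ≤ D
      D-bound n p = *-mono-r (0≤J 0<ρ ρ≤1)
        (*-mono (ℚ.0≤∣p∣ (x n - 1ℚ)) (ℚ.<⇒≤ 0<b) (d≤b n p) (d≤b n p))

  expTerm : ℕ → ℚ → ℚ
  expTerm k x = x ^ℚ k * inv (ι (k !))

  F : ℕ → ℚ
  F k = inv (ι (k !))

  0<k! : ∀ k → 0ℚ < ι (k !)
  0<k! k = 0<ι (k !) (ℕ.n≢0⇒n>0 (ℕ.≢-nonZero⁻¹ (k !) {{k ℕ.!≢0}}))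

  0≤F : ∀ k → 0ℚ ≤ F k
  0≤F k = 0≤inv (ι (k !)) (0<k! k)

  F-suc : ∀ k → ι (suc k) * F (suc k) ≡ F k
  F-suc k = trans (sym (ℚ.*-identityʳ (s * F (suc k))))
    (trans (cong (s * F (suc k) *_) (sym (inv≡ (ι (k !)) (0<k! k))))
    (trans (solve 4 (λ s t u f → s :* u :* (f :* t) := (s :* f :* u) :* t) refl s (F k) (F (suc k)) (ι (k !)))
    (trans (cong (λ z → z * F (suc k) * F k) (sym (ι-* (suc k) (k !))))
    (trans (cong (_* F k) (inv≡ (ι (suc k !)) (0<k! (suc k)))) (ℚ.*-identityˡ (F k))))))
    where
    s : ℚ
    s = ι (suc k)

  pow-nonneg : ∀ {B} k → 0ℚ ≤ B → 0ℚ ≤ B ^ℚ k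
  pow-nonneg zero h = 0≤1
  pow-nonneg (suc k) h = 0≤* h (pow-nonneg k h)

  pow-bound : ∀ {x B} k → ∣ x ∣ ≤ B → ∣ x ^ℚ k ∣ ≤ B ^ℚ k
  pow-bound zero h = ℚ.≤-refl
  pow-bound {x} (suc k) h = ∣*∣≤ x (x ^ℚ k) h (pow-bound k h)

  pow-lipschitz : ∀ {x y B} k → 0ℚ ≤ B → ∣ x ∣ ≤ B → ∣ y ∣ ≤ B →
                  ∣ x ^ℚ suc k - y ^ℚ suc k ∣ ≤ ι (suc k) * B ^ℚ k * ∣ x - y ∣
  pow-lipschitz {x} {y} {B} zero 0≤B hx hy = ℚ.≤-reflexive
    (trans (cong₂ (λ a b → ∣ a - b ∣) (ℚ.*-identityʳ x) (ℚ.*-identityʳ y)) (sym (ℚ.*-identityˡ ∣ x - y ∣)))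
  pow-lipschitz {x} {y} {B} (suc k) 0≤B hx hy = begin
    ∣ x * X - y * Y ∣
      ≡⟨ cong ∣_∣ (solve 4 (λ x y X Y → x :* X :- y :* Y := x :* (X :- Y) :+ Y :* (x :- y)) refl x y X Y) ⟩
    ∣ x * (X - Y) + Y * (x - y) ∣
      ≤⟨ ℚ.∣p+q∣≤∣p∣+∣q∣ (x * (X - Y)) (Y * (x - y)) ⟩
    ∣ x * (X - Y) ∣ + ∣ Y * (x - y) ∣
      ≤⟨ ℚ.+-mono-≤ (∣*∣≤ x (X - Y) hx (pow-lipschitz k 0≤B hx hy))
                    (∣*∣≤ Y (x - y) (pow-bound (suc k) hy) ℚ.≤-refl) ⟩
    B * (ι (suc k) * B ^ℚ k * D) + B * B ^ℚ k * D
      ≡⟨ solve 4 (λ b s p d → b :* (s :* p :* d) :+ b :* p :* d := (con 1ℚ :+ s) :* (b :* p) :* d)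
           refl B (ι (suc k)) (B ^ℚ k) D ⟩
    (1ℚ + ι (suc k)) * (B * B ^ℚ k) * D
      ≡⟨ cong (λ z → z * (B * B ^ℚ k) * D) (sym (ι-suc (suc k))) ⟩
    ι (suc (suc k)) * (B * B ^ℚ k) * D ∎
    where
    open ℚ.≤-Reasoning
    X Y D : ℚ
    X = x ^ℚ suc k
    Y = y ^ℚ suc k
    D = ∣ x - y ∣

  expTerm-nonneg : ∀ {B} k → 0ℚ ≤ B → 0ℚ ≤ expTerm k B
  expTerm-nonneg k h = 0≤* (pow-nonneg k h) (0≤F k)

  expTerm-bound : ∀ {x B} k → ∣ x ∣ ≤ B → ∣ expTerm k x ∣ ≤ expTerm k B
  expTerm-bound {x} k h = ∣*∣≤ (x ^ℚ k) (F k) (pow-bound k h)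
    (ℚ.≤-reflexive (ℚ.0≤p⇒∣p∣≡p (0≤F k)))

  expTerm-lipschitz : ∀ {x y B} k → 0ℚ ≤ B → ∣ x ∣ ≤ B → ∣ y ∣ ≤ B →
                      ∣ expTerm (suc k) x - expTerm (suc k) y ∣ ≤ ∣ x - y ∣ * expTerm k B
  expTerm-lipschitz {x} {y} {B} k 0≤B hx hy = begin
    ∣ X * f - Y * f ∣
      ≡⟨ cong ∣_∣ (solve 3 (λ X Y f → X :* f :- Y :* f := (X :- Y) :* f) refl X Y f) ⟩
    ∣ (X - Y) * f ∣
      ≤⟨ ∣*∣≤ (X - Y) f (pow-lipschitz k 0≤B hx hy) (ℚ.≤-reflexive (ℚ.0≤p⇒∣p∣≡p (0≤F (suc k)))) ⟩
    ι (suc k) * B ^ℚ k * D * f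
      ≡⟨ solve 4 (λ s p d f → s :* p :* d :* f := d :* (p :* (s :* f))) refl (ι (suc k)) (B ^ℚ k) D f ⟩
    D * (B ^ℚ k * (ι (suc k) * f))
      ≡⟨ cong (λ z → D * (B ^ℚ k * z)) (F-suc k) ⟩
    D * expTerm k B ∎
    where
    open ℚ.≤-Reasoning
    X Y D f : ℚ
    X = x ^ℚ suc k
    Y = y ^ℚ suc k
    D = ∣ x - y ∣
    f = F (suc k)

  expSum-lipschitz : ∀ {x y B} n → 0ℚ ≤ B → ∣ x ∣ ≤ B → ∣ y ∣ ≤ B →
                     ∣ expSum (suc n) x - expSum (suc n) y ∣ ≤ ∣ x - y ∣ * expSum n B
  expSum-lipschitz {x} {y} zero 0≤B hx hy = ℚ.≤-reflexive (sym (ℚ.*-zeroʳ ∣ x - y ∣))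
  expSum-lipschitz {x} {y} {B} (suc n) 0≤B hx hy = begin
    ∣ (S + s) - (T + t) ∣
      ≡⟨ cong ∣_∣ (solve 4 (λ S s T t → (S :+ s) :- (T :+ t) := (S :- T) :+ (s :- t)) refl S s T t) ⟩
    ∣ (S - T) + (s - t) ∣
      ≤⟨ ℚ.∣p+q∣≤∣p∣+∣q∣ (S - T) (s - t) ⟩
    ∣ S - T ∣ + ∣ s - t ∣
      ≤⟨ ℚ.+-mono-≤ (expSum-lipschitz n 0≤B hx hy) (expTerm-lipschitz n 0≤B hx hy) ⟩
    ∣ x - y ∣ * expSum n B + ∣ x - y ∣ * expTerm n B
      ≡⟨ sym (ℚ.*-distribˡ-+ ∣ x - y ∣ (expSum n B) (expTerm n B)) ⟩
    ∣ x - y ∣ * expSum (suc n) B ∎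
    where
    open ℚ.≤-Reasoning
    S T s t : ℚ
    S = expSum (suc n) x
    T = expSum (suc n) y
    s = expTerm (suc n) x
    t = expTerm (suc n) y

  expSum-tail : ∀ {x B} m n → ∣ x ∣ ≤ B → m ℕ.≤ n →
                ∣ expSum n x - expSum m x ∣ ≤ expSum n B - expSum m B
  expSum-tail {x} {B} m n h m≤n = go (ℕ.≤⇒≤′ m≤n)
    where
    go : ∀ {n} → m ℕ.≤′ n → ∣ expSum n x - expSum m x ∣ ≤ expSum n B - expSum m B
    go (ℕ.≤′-reflexive refl) = ℚ.≤-reflexive
      (trans (cong ∣_∣ (ℚ.+-inverseʳ (expSum m x))) (sym (ℚ.+-inverseʳ (expSum m B))))
    go {suc n} (ℕ.≤′-step p) = begin
      ∣ (expSum n x + t) - expSum m x ∣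
        ≡⟨ cong ∣_∣ (solve 3 (λ S s T → (S :+ s) :- T := (S :- T) :+ s) refl (expSum n x) t (expSum m x)) ⟩
      ∣ (expSum n x - expSum m x) + t ∣
        ≤⟨ ℚ.∣p+q∣≤∣p∣+∣q∣ (expSum n x - expSum m x) t ⟩
      ∣ expSum n x - expSum m x ∣ + ∣ t ∣
        ≤⟨ ℚ.+-mono-≤ (go p) (expTerm-bound n h) ⟩
      (expSum n B - expSum m B) + expTerm n B
        ≡⟨ solve 3 (λ S s T → (S :- T) :+ s := (S :+ s) :- T) refl (expSum n B) (expTerm n B) (expSum m B) ⟩
      expSum (suc n) B - expSum m B ∎
      where
      open ℚ.≤-Reasoning
      t : ℚ
      t = expTerm n x

  -- From M on, the terms of the series at B at least halve.
  module Halving {B : ℚ} (0≤B : 0ℚ ≤ B) (M : ℕ) (0<M : 0 ℕ.< M) (2B≤M : B + B ≤ ι M) where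

    t : ℕ → ℚ
    t n = expTerm n B

    E : ℕ → ℚ
    E n = expSum n B

    0≤t : ∀ n → 0ℚ ≤ t n
    0≤t n = expTerm-nonneg n 0≤B

    halve : ∀ n → M ℕ.≤ n → t (suc n) + t (suc n) ≤ t n
    halve n M≤n = begin
      t (suc n) + t (suc n)
        ≡⟨ solve 3 (λ b p f → b :* p :* f :+ b :* p :* f := p :* ((b :+ b) :* f)) refl B (B ^ℚ n) (F (suc n)) ⟩
      B ^ℚ n * ((B + B) * F (suc n))
        ≤⟨ *-mono-l (pow-nonneg n 0≤B) (*-mono-r (0≤F (suc n))
             (ℚ.≤-trans 2B≤M (ι-mono M (suc n) (ℕ.m≤n⇒m≤1+n M≤n)))) ⟩
      B ^ℚ n * (ι (suc n) * F (suc n))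
        ≡⟨ cong (B ^ℚ n *_) (F-suc n) ⟩
      t n ∎
      where open ℚ.≤-Reasoning

    G : ℕ → ℚ
    G n = E n + (t n + t n)

    E≤G : ∀ n → E n ≤ G n
    E≤G n = p≤p+q (0≤+ (0≤t n) (0≤t n))

    G-anti : ∀ {m n} → M ℕ.≤ m → m ℕ.≤ n → G n ≤ G m
    G-anti {m} M≤m m≤n = go (ℕ.≤⇒≤′ m≤n)
      where
      go : ∀ {n} → m ℕ.≤′ n → G n ≤ G m
      go (ℕ.≤′-reflexive refl) = ℚ.≤-refl
      go {suc n} (ℕ.≤′-step p) = ℚ.≤-trans
        (subst ((E n + t n) + (t (suc n) + t (suc n)) ≤_) (ℚ.+-assoc (E n) (t n) (t n))
          (ℚ.+-monoʳ-≤ (E n + t n) (halve n (ℕ.≤-trans M≤m (ℕ.≤′⇒≤ p)))))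
        (go p)

    E-bound : ∀ n → E n ≤ G M
    E-bound n with ℕ.≤-total M n
    ... | inj₁ M≤n = ℚ.≤-trans (E≤G n) (G-anti ℕ.≤-refl M≤n)
    ... | inj₂ n≤M = ℚ.≤-trans (∑-mono-n (λ k → expTerm k B) 0≤t n≤M) (E≤G M)

    C : ℚ
    C = 1ℚ + t M * ι M

    0<C : 0ℚ < C
    0<C = ℚ.<-≤-trans 0<1 (p≤p+q (0≤* (0≤t M) (0≤ι M)))

    t-decay : ∀ {n} → M ℕ.≤′ n → t n * ι n ≤ C
    t-decay (ℕ.≤′-reflexive refl) = p≤q+p 0≤1
    t-decay {suc n} (ℕ.≤′-step p) = ℚ.≤-trans (begin
      t (suc n) * ι (suc n)          ≡⟨ cong (t (suc n) *_) (ι-suc n) ⟩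
      t (suc n) * (1ℚ + ι n)         ≤⟨ *-mono-l (0≤t (suc n)) (ℚ.+-monoˡ-≤ (ι n)
                                          (ι-mono 1 n (ℕ.≤-trans 0<M (ℕ.≤′⇒≤ p)))) ⟩
      t (suc n) * (ι n + ι n)        ≡⟨ solve 2 (λ t i → t :* (i :+ i) := (t :+ t) :* i) refl (t (suc n)) (ι n) ⟩
      (t (suc n) + t (suc n)) * ι n  ≤⟨ *-mono-r (0≤ι n) (halve n (ℕ.≤′⇒≤ p)) ⟩
      t n * ι n                      ∎) (t-decay p)
      where open ℚ.≤-Reasoning

    t≤ : ∀ n → M ℕ.≤ n → t n ≤ C * inv (ι n)
    t≤ n M≤n = subst (_≤ C * inv (ι n))
      (trans (ℚ.*-assoc (t n) (ι n) (inv (ι n)))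
        (trans (cong (t n *_) (inv≡ (ι n) 0<n)) (ℚ.*-identityʳ (t n))))
      (*-mono-r (0≤inv (ι n) 0<n) (t-decay (ℕ.≤⇒≤′ M≤n)))
      where
      0<n : 0ℚ < ι n
      0<n = 0<ι n (ℕ.≤-trans 0<M M≤n)

    e : ℕ → ℚ
    e n = C * inv (ι n) + C * inv (ι n)

    0≤e : ∀ n → M ℕ.≤ n → 0ℚ ≤ e n
    0≤e n h = ℚ.≤-trans (0≤+ (0≤t n) (0≤t n)) (ℚ.+-mono-≤ (t≤ n h) (t≤ n h))

    tail-ordered : ∀ {x} m n → ∣ x ∣ ≤ B → M ℕ.≤ m → m ℕ.≤ n → ∣ expSum n x - expSum m x ∣ ≤ e m
    tail-ordered {x} m n h M≤m m≤n = begin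
      ∣ expSum n x - expSum m x ∣ ≤⟨ expSum-tail m n h m≤n ⟩
      E n - E m                   ≤⟨ ℚ.+-monoˡ-≤ (- E m) (ℚ.≤-trans (E≤G n) (G-anti M≤m m≤n)) ⟩
      G m - E m                   ≡⟨ solve 2 (λ s t → s :+ (t :+ t) :- s := t :+ t) refl (E m) (t m) ⟩
      t m + t m                   ≤⟨ ℚ.+-mono-≤ (t≤ m M≤m) (t≤ m M≤m) ⟩
      e m                         ∎
      where open ℚ.≤-Reasoning

    tail : ∀ {x} m n → ∣ x ∣ ≤ B → M ℕ.≤ m → M ℕ.≤ n → ∣ expSum m x - expSum n x ∣ ≤ e m + e n
    tail {x} m n h M≤m M≤n with ℕ.≤-total m n
    ... | inj₁ m≤n = ℚ.≤-trans (subst (_≤ e m) (∣∣-sym (expSum n x) (expSum m x)) (tail-ordered m n h M≤m m≤n))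
                       (p≤p+q (0≤e n M≤n))
    ... | inj₂ n≤m = ℚ.≤-trans (tail-ordered n m h M≤n n≤m) (p≤q+p (0≤e m M≤m))

    K : ℚ
    K = 1ℚ + G M

    0<K : 0ℚ < K
    0<K = ℚ.<-≤-trans 0<1 (p≤p+q (E-bound 0))

    estimate : ∀ {x y} m n → ∣ x ∣ ≤ B → ∣ y ∣ ≤ B → M ℕ.≤ m → M ℕ.≤ n →
               ∣ expSum m x - expSum n y ∣ ≤ K * ∣ x - y ∣ + (e m + e n)
    estimate {x} {y} zero n hx hy M≤m M≤n = contradiction (ℕ.≤-trans 0<M M≤m) λ ()
    estimate {x} {y} m@(suc k) n hx hy M≤m M≤n = ℚ.≤-trans
      (∣∣-tri (expSum m x) (expSum m y) (expSum n y))
      (ℚ.+-mono-≤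
        (ℚ.≤-trans (expSum-lipschitz k 0≤B hx hy)
          (subst (∣ x - y ∣ * E k ≤_) (ℚ.*-comm ∣ x - y ∣ K)
            (*-mono-l (ℚ.0≤∣p∣ (x - y)) (ℚ.≤-trans (E-bound k) (p≤q+p 0≤1)))))
        (tail m n hy M≤m M≤n))

  expSum-cauchy : ∀ {x} → Cauchy x → Cauchy (λ n → expSum n (x n))
  expSum-cauchy {x} cx = from-bound (bounded {x} cx)
    where
    from-bound : ∃[ B ] ∃[ N ] (0ℚ < B × (∀ n → N ℕ.≤ n → ∣ x n ∣ ≤ B)) →
                 Cauchy (λ n → expSum n (x n))
    from-bound (B , N , 0<B , hB) =
      small-≤ {λ m n → ∣ expSum m (x m) - expSum n (x n) ∣}
              {λ m n → K * ∣ x m - x n ∣ + (e m + e n)} (M ℕ.⊔ N)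
        (λ m n p q → estimate m n
          (hB m (ℕ.≤-trans (ℕ.m≤n⊔m M N) p)) (hB n (ℕ.≤-trans (ℕ.m≤n⊔m M N) q))
          (ℕ.≤-trans (ℕ.m≤m⊔n M N) p) (ℕ.≤-trans (ℕ.m≤m⊔n M N) q))
        (small-+ {λ m n → K * ∣ x m - x n ∣} {λ m n → e m + e n}
          (small-* {λ m n → ∣ x m - x n ∣} K 0<K cx)
          (small-+ {λ m n → e m} {λ m n → e n} e-small (small-swap {λ m n → e m} e-small)))
      where
      M : ℕ
      M = suc (proj₁ (archimedean (B + B)))
      2B≤M : B + B ≤ ι M
      2B≤M = ℚ.≤-trans (proj₂ (archimedean (B + B)))
        (ι-mono (proj₁ (archimedean (B + B))) M (ℕ.n≤1+n (proj₁ (archimedean (B + B)))))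
      open Halving {B} (ℚ.<⇒≤ 0<B) M (ℕ.s≤s ℕ.z≤n) 2B≤M
      half-small : Small (λ m n → C * inv (ι m))
      half-small = small-* {λ m n → inv (ι m)} C 0<C small-inv
      e-small : Small (λ m n → e m)
      e-small = small-+ {λ m n → C * inv (ι m)} {λ m n → C * inv (ι m)} half-small half-small

  Pos : (ℕ → ℚ) → Set
  Pos = EventuallyBelow (λ _ → 0ℚ)

  bounded-below : ∀ {x} δ N → 0ℚ < δ → (∀ n → N ℕ.≤ n → δ ≤ x n) → Pos x
  bounded-below {x} δ N 0<δ h = δ , 0<δ , N , λ n p → subst (_≤ x n) (sym (ℚ.+-identityˡ δ)) (h n p)

  lower : ∀ {x} ((δ , _ , N , _) : Pos x) → ∀ n → N ℕ.≤ n → δ ≤ x n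
  lower {x} (δ , _ , N , h) n p = subst (_≤ x n) (ℚ.+-identityˡ δ) (h n p)

  const-pos : ∀ {p} → 0ℚ < p → Pos (λ _ → p)
  const-pos {p} 0<p = bounded-below p 0 0<p (λ _ _ → ℚ.≤-refl)

  ⊔-pos : ∀ {x y : ℕ → ℚ} → Pos x → Pos (λ n → x n ⊔ y n)
  ⊔-pos {x} {y} px@(δ , 0<δ , M , _) =
    bounded-below δ M 0<δ (λ n p → ℚ.≤-trans (lower px n p) (ℚ.p≤p⊔q (x n) (y n)))

  +-pos : ∀ {x y} → Pos x → Pos y → Pos (λ n → x n + y n)
  +-pos {x} {y} px@(δ , 0<δ , M , _) py@(η , 0<η , N , _) =
    bounded-below (δ + η) (M ℕ.⊔ N) (ℚ.+-mono-< 0<δ 0<η)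
      (λ n p → ℚ.+-mono-≤ (lower px n (ℕ.≤-trans (ℕ.m≤m⊔n M N) p)) (lower py n (ℕ.≤-trans (ℕ.m≤n⊔m M N) p)))

  *-pos : ∀ {x y} → Pos x → Pos y → Pos (λ n → x n * y n)
  *-pos {x} {y} px@(δ , 0<δ , M , _) py@(η , 0<η , N , _) =
    bounded-below (δ * η) (M ℕ.⊔ N) (0<* 0<δ 0<η) (λ n p →
      let δ≤ = lower px n (ℕ.≤-trans (ℕ.m≤m⊔n M N) p)
          η≤ = lower py n (ℕ.≤-trans (ℕ.m≤n⊔m M N) p)
      in *-mono (ℚ.<⇒≤ 0<η) (ℚ.≤-trans (ℚ.<⇒≤ 0<δ) δ≤) δ≤ η≤)

  ⊓-pos : ∀ {x y} → Pos x → Pos y → Pos (λ n → x n ⊓ y n)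
  ⊓-pos {x} {y} px@(δ , 0<δ , M , _) py@(η , 0<η , N , _) =
    bounded-below (δ ⊓ η) (M ℕ.⊔ N) 0<δ⊓η
      (λ n p → ℚ.⊓-mono-≤ (lower px n (ℕ.≤-trans (ℕ.m≤m⊔n M N) p)) (lower py n (ℕ.≤-trans (ℕ.m≤n⊔m M N) p)))
    where
    0<δ⊓η : 0ℚ < δ ⊓ η
    0<δ⊓η with ℚ.⊓-sel δ η
    ... | inj₁ eq = subst (0ℚ <_) (sym eq) 0<δ
    ... | inj₂ eq = subst (0ℚ <_) (sym eq) 0<η

  exp1-pos : Pos (λ n → expSum n 1ℚ)
  exp1-pos = bounded-below 1ℚ 1 0<1
    (λ n p → ∑-mono-n (λ k → expTerm k 1ℚ) (λ k → expTerm-nonneg k 0≤1) p)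

record ℝ : Set where
  no-eta-equality
  field
    seq    : ℕ → ℚ
    cauchy : Cauchy seq

open ℝ public

infix  4 _<_
infixl 6 _+_ _⊔_
infixl 7 _*_ _/_ _⊓_
infix  8 _⁻¹
infixr 8 _^_ _^ᵣ_

_<_ : ℝ → ℝ → Set
x < y = EventuallyBelow (x .seq) (y .seq)

fromℚ : ℚ → ℝ
fromℚ p .seq _  = p
fromℚ p .cauchy = Estimates.const-cauchy p

fromℕ : ℕ → ℝ
fromℕ n .seq _  = fromℕℚ n
fromℕ n .cauchy = Estimates.const-cauchy (fromℕℚ n)

0ℝ 1ℝ : ℝ
0ℝ = fromℚ 0ℚ
1ℝ = fromℚ 1ℚ

_+_ _*_ _⊔_ _⊓_ : ℝ → ℝ → ℝ
(x + y) .seq n  = x .seq n ℚ.+ y .seq n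
(x + y) .cauchy = Estimates.+-cauchy {x .seq} {y .seq} (x .cauchy) (y .cauchy)
(x * y) .seq n  = x .seq n ℚ.* y .seq n
(x * y) .cauchy = Estimates.*-cauchy {x .seq} {y .seq} (x .cauchy) (y .cauchy)
(x ⊔ y) .seq n  = x .seq n ℚ.⊔ y .seq n
(x ⊔ y) .cauchy = Estimates.⊔-cauchy {x .seq} {y .seq} (x .cauchy) (y .cauchy)
(x ⊓ y) .seq n  = x .seq n ℚ.⊓ y .seq n
(x ⊓ y) .cauchy = Estimates.⊓-cauchy {x .seq} {y .seq} (x .cauchy) (y .cauchy)

_^_ : ℝ → ℕ → ℝ
x ^ zero  = 1ℝ
x ^ suc n = x * x ^ n

record Positive (x : ℝ) : Set where
  constructor mkPositive
  field
    0<x : 0ℝ < x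

open Positive public

_⁻¹ : (x : ℝ) {{_ : Positive x}} → ℝ
(x ⁻¹) .seq n             = inv (x .seq n)
(_⁻¹ x {{x>0}}) .cauchy = Estimates.inv-cauchy {x .seq} (x>0 .0<x) (x .cauchy)

_/_ : (x y : ℝ) {{_ : Positive y}} → ℝ
x / y = x * y ⁻¹

exp : ℝ → ℝ
exp x .seq n  = expSum n (x .seq n)
exp x .cauchy = Estimates.expSum-cauchy {x .seq} (x .cauchy)

e : ℝ
e = exp 1ℝ

ln : (x : ℝ) {{_ : Positive x}} → ℝ
ln x .seq n              = lnSum n (x .seq n)
ln x {{x>0}} .cauchy = Estimates.lnSum-cauchy {x .seq} (x>0 .0<x) (x .cauchy)

-- The logarithm that is read as 1 below e: since ln is increasing and ln e = 1,
-- this is max (1, ln x).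
log : (x : ℝ) {{_ : Positive x}} → ℝ
log x = 1ℝ ⊔ ln x

_^ᵣ_ : (x : ℝ) {{_ : Positive x}} → ℝ → ℝ
x ^ᵣ y = exp (y * ln x)

instance
  fromℚ-positive : ∀ {p} .{{_ : ℚ.Positive p}} → Positive (fromℚ p)
  fromℚ-positive {p} .0<x = Estimates.const-pos (ℚ.positive⁻¹ p)

  fromℕ-positive : ∀ {n} .{{_ : ℕ.NonZero n}} → Positive (fromℕ n)
  fromℕ-positive {n} .0<x = Estimates.const-pos (Estimates.0<ι n (ℕ.n≢0⇒n>0 (ℕ.≢-nonZero⁻¹ n)))

  +-positive : ∀ {x y} {{_ : Positive x}} {{_ : Positive y}} → Positive (x + y)
  +-positive {x} {y} {{x>0}} {{y>0}} .0<x = Estimates.+-pos {x .seq} {y .seq} (x>0 .0<x) (y>0 .0<x)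

  *-positive : ∀ {x y} {{_ : Positive x}} {{_ : Positive y}} → Positive (x * y)
  *-positive {x} {y} {{x>0}} {{y>0}} .0<x = Estimates.*-pos {x .seq} {y .seq} (x>0 .0<x) (y>0 .0<x)

  ⊓-positive : ∀ {x y} {{_ : Positive x}} {{_ : Positive y}} → Positive (x ⊓ y)
  ⊓-positive {x} {y} {{x>0}} {{y>0}} .0<x = Estimates.⊓-pos {x .seq} {y .seq} (x>0 .0<x) (y>0 .0<x)

  ⊔-positive : ∀ {x y} {{_ : Positive x}} → Positive (x ⊔ y)
  ⊔-positive {x} {y} {{x>0}} .0<x = Estimates.⊔-pos {x .seq} {y .seq} (x>0 .0<x)

  e-positive : Positive e
  e-positive .0<x = Estimates.exp1-pos

record Partition (α : ℚ) (n : ℕ) : Set where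
  field
    parts          : List ℕ
    distinct       : Unique parts
    positive       : All (0 ℕ.<_) parts
    sum≡n          : sum parts ≡ n
    reciprocal-sum : foldr ℚ._+_ 0ℚ (map (λ a → inv (fromℕℚ a)) parts) ≡ α

-- N is n_α.
record IsThreshold (α : ℚ) (N : ℕ) : Set where
  field
    N>0     : 0 ℕ.< N
    beyond  : ∀ n → N ℕ.≤ n → Partition α n
    minimal : ∀ M → 0 ℕ.< M → (∀ n → M ℕ.≤ n → Partition α n) → N ℕ.≤ M

{-# OPTIONS --safe #-}
-- Let M be a power of 32 with M α ≥ 1, minimal, and α = p / q. The parts come in four families.
-- (1) A gadget grown by Graham's doubling step from {4, 12}: its reciprocal sum is the fixed number
--     44 / (129 M W), while its sum can be any n ≥ 211244 (M W)². It absorbs the prescribed total.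
-- (2) M x for x chosen greedily in an interval [I, S). As ∑ 1/x ≈ log (S / I) must exceed M α, they cost
--     about M S², whence the term (e + ε)^(2 α).
-- (3) M P x′ with ∑ 1/x′ = t / G, where G is a common multiple of 1, …, y and t < G is left by the greedy choice.
-- (4) M P Q x″ with ∑ 1/x″ = r / D, where Q is a multiple of q, D is a common multiple of 1, …, y₁
--     with D ≥ 2 Q, so that y₁ ≈ 2 log Q. They cost about q y₁² y₁^(1/2), within q log³ q / log log q.
-- The factor 31 of P and the numbers avoided in (2) keep the families disjoint.
-- For (3) and (4), fractions t / G are expanded by induction on y. Going from G to p G takes distinct k with
-- ∑ N/k in a prescribed class modulo p: a set of residues grows under translation by suitable N/k until it
-- has more than p / 2 elements, and two such sets add up to everything.
module Submission where

-- In family (4), y is only about 2 log Q, so an expansion step from G to p G may use no k beyond a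
-- small power of y, although p can be as large as y. Growth of a residue set needs generators
-- reaching every class by short words, and a single unit gives words of length p. For large p the
-- generators are instead values N/(l a) at consecutive a near J Y, where y is about Y^H and J = 2
-- H: their finite differences are explicit, and a mixed radix expansion writes every class as a
-- word of length O(Y). So all k are at most Y^15, and H ≥ 44 keeps the total cost y² Y^22 within
-- y^(5/2). Each step takes ∑ N/k from the numerator. Fractions in [1/2, 1) survive this, since the
-- losses for y between Y^H and (2 Y)^H with Y = 2^s are at most 2^(-s-1) in total. The greedy
-- choice therefore stops inside this window, and a shifted division puts r / D there. From ε comes
-- τ with log (e + ε) ≥ 1 + 1/τ. Avoided multiples cost 7 / W₀ per doubling of x, hence W₀ = 56 τ;
-- the factor Y^22 and a cubed logarithm raise S² to S^(2 + 23/H), hence H = 44 τ. Both losses then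
-- fit into the factor 1 + 1/τ of the exponent 2 α.

-- Rational arithmetic and reciprocals of natural numbers.

module Rationals where

  open import Defs using (fromℕℚ; inv; module Estimates)
  open Estimates using (0≤1; 0<1; *-mono-l; *-mono-r; *-mono; 0≤*; 0<*; 0≤+; p≤p+q; p≤q+p; inv≡; 0<inv; 0≤inv; inv-anti; 0≤-) public
  open import Data.Product.Base using (∃-syntax)
  open import Data.Nat.Base as ℕ using (ℕ; suc)
  import Data.Nat.Properties as ℕ
  open import Data.Rational.Base
  open import Data.Rational.Properties as ℚ using (*-identityˡ; *-identityʳ; *-assoc; *-comm; ≤-trans)
  open import Level using (0ℓ)
  open import Relation.Nullary.Decidable using (dec⇒maybe)
  open import Relation.Nullary using (¬_; yes; no; contradiction)
  open import Tactic.RingSolver using (solve-∀)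
  open import Tactic.RingSolver.Core.AlmostCommutativeRing using (AlmostCommutativeRing; fromCommutativeRing)
  open import Relation.Binary.PropositionalEquality

  ℚ-ring : AlmostCommutativeRing 0ℓ 0ℓ
  ℚ-ring = fromCommutativeRing ℚ.+-*-commutativeRing (λ x → dec⇒maybe (0ℚ ℚ.≟ x))

  -- Opaque, so that the type checker never computes the normal form of a fraction.
  opaque

    ι : ℕ → ℚ
    ι = fromℕℚ

    ι-def : ∀ n → ι n ≡ fromℕℚ n
    ι-def n = refl

    ι-0 : ι 0 ≡ 0ℚ
    ι-0 = refl

    ι-1 : ι 1 ≡ 1ℚ
    ι-1 = refl

    ι-+ : ∀ m n → ι (m ℕ.+ n) ≡ ι m + ι n
    ι-+ = Estimates.ι-+

    ι-* : ∀ m n → ι (m ℕ.* n) ≡ ι m * ι n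
    ι-* = Estimates.ι-*

    ι-suc : ∀ n → ι (suc n) ≡ 1ℚ + ι n
    ι-suc = Estimates.ι-suc

    ι-mono : ∀ m n → m ℕ.≤ n → ι m ≤ ι n
    ι-mono = Estimates.ι-mono

    0≤ι : ∀ n → 0ℚ ≤ ι n
    0≤ι = Estimates.0≤ι

    0<ι : ∀ n → 0 ℕ.< n → 0ℚ < ι n
    0<ι = Estimates.0<ι

    archimedean : ∀ r → ∃[ N ] (r ≤ ι N)
    archimedean = Estimates.archimedean

  <⇒≱ℚ : ∀ {p q} → p < q → ¬ q ≤ p
  <⇒≱ℚ p<q q≤p = ℚ.<-irrefl refl (ℚ.<-≤-trans p<q q≤p)

  cancel-≤ : ∀ {c p q} → 0ℚ < c → c * p ≤ c * q → p ≤ q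
  cancel-≤ {c} h = ℚ.*-cancelˡ-≤-pos c {{positive h}}

  cancel-< : ∀ {c p q} → 0ℚ < c → c * p < c * q → p < q
  cancel-< {c} h = ℚ.*-cancelˡ-<-nonNeg c {{nonNegative (ℚ.<⇒≤ h)}}

  cancel-+-≤ : ∀ c {p q} → c + p ≤ c + q → p ≤ q
  cancel-+-≤ c {p} {q} h = subst₂ _≤_ (lem c p) (lem c q) (ℚ.+-monoʳ-≤ (- c) h)
    where
    lem : ∀ c p → - c + (c + p) ≡ p
    lem = solve-∀ ℚ-ring

  ≤-by : ∀ {p q} r → 0ℚ ≤ r → p + r ≡ q → p ≤ q
  ≤-by {p} r h eq = subst (p ≤_) eq (p≤p+q h)

  ι-cancel-≤ : ∀ {m n} → ι m ≤ ι n → m ℕ.≤ n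
  ι-cancel-≤ {m} {n} h with m ℕ.≤? n
  ... | yes le = le
  ... | no gt = contradiction (ℚ.≤-trans (subst (_≤ ι m) (trans (ι-suc n) (ℚ.+-comm 1ℚ (ι n))) (ι-mono (suc n) m (ℕ.≰⇒> gt))) h)
    (<⇒≱ℚ (subst (_< ι n + 1ℚ) (ℚ.+-identityʳ (ι n)) (ℚ.+-monoʳ-< (ι n) 0<1)))

  inv-cancelˡ : ∀ m {q} → 0 ℕ.< m → inv (ι m) * (ι m * q) ≡ q
  inv-cancelˡ m {q} 0<m = trans (sym (*-assoc (inv (ι m)) (ι m) q))
    (trans (cong (_* q) (trans (*-comm (inv (ι m)) (ι m)) (inv≡ (ι m) (0<ι m 0<m)))) (*-identityˡ q))

  inv-unique : ∀ {p q} → 0ℚ < p → p * q ≡ 1ℚ → q ≡ inv p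
  inv-unique {p} {q} 0<p eq = begin
    q               ≡⟨ sym (*-identityʳ q) ⟩
    q * 1ℚ          ≡⟨ cong (q *_) (sym (inv≡ p 0<p)) ⟩
    q * (p * inv p) ≡⟨ lem q p (inv p) ⟩
    p * q * inv p   ≡⟨ cong (_* inv p) eq ⟩
    1ℚ * inv p      ≡⟨ *-identityˡ (inv p) ⟩
    inv p           ∎
    where
    open ≡-Reasoning
    lem : ∀ q p i → q * (p * i) ≡ p * q * i
    lem = solve-∀ ℚ-ring

  inv-* : ∀ {p q} → 0ℚ < p → 0ℚ < q → inv (p * q) ≡ inv p * inv q
  inv-* {p} {q} 0<p 0<q = sym (inv-unique (0<* 0<p 0<q) (begin
    p * q * (inv p * inv q)   ≡⟨ lem p q (inv p) (inv q) ⟩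
    p * inv p * (q * inv q)   ≡⟨ cong₂ _*_ (inv≡ p 0<p) (inv≡ q 0<q) ⟩
    1ℚ                        ∎))
    where
    open ≡-Reasoning
    lem : ∀ p q i j → p * q * (i * j) ≡ p * i * (q * j)
    lem = solve-∀ ℚ-ring

  inv-ι-* : ∀ {m n} → 0 ℕ.< m → 0 ℕ.< n → inv (ι (m ℕ.* n)) ≡ inv (ι m) * inv (ι n)
  inv-ι-* {m} {n} 0<m 0<n = trans (cong inv (ι-* m n)) (inv-* (0<ι m 0<m) (0<ι n 0<n))

  -- This is how sums of unit fractions become integer sums over a common multiple `n`.
  inv-quotient : ∀ {k q n} → 0 ℕ.< k → 0 ℕ.< n → q ℕ.* k ≡ n → inv (ι k) ≡ ι q * inv (ι n)
  inv-quotient {k} {q} {n} 0<k 0<n eq = sym (inv-unique (0<ι k 0<k) (begin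
    ι k * (ι q * inv (ι n))   ≡⟨ lem (ι k) (ι q) (inv (ι n)) ⟩
    ι q * ι k * inv (ι n)     ≡⟨ cong (_* inv (ι n)) (trans (sym (ι-* q k)) (cong ι eq)) ⟩
    ι n * inv (ι n)           ≡⟨ inv≡ (ι n) (0<ι n 0<n) ⟩
    1ℚ                        ∎))
    where
    open ≡-Reasoning
    lem : ∀ k q i → k * (q * i) ≡ q * k * i
    lem = solve-∀ ℚ-ring

  ι-≤-inv : ∀ {a m b} → 0 ℕ.< m → m ℕ.* a ℕ.≤ b → ι a ≤ inv (ι m) * ι b
  ι-≤-inv {a} {m} {b} 0<m h = subst (_≤ inv (ι m) * ι b) (inv-cancelˡ m 0<m)
    (*-mono-l (0≤inv (ι m) (0<ι m 0<m)) (subst (_≤ ι b) (ι-* m a) (ι-mono (m ℕ.* a) b h)))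

-- Counting over residues modulo p: how a set changes under translation.

module Counting where

  open import Data.Bool.Base using (Bool; true; false; not; _∧_; _∨_)
  open import Data.Nat.Base
  open import Data.Nat.Properties
  open import Data.Integer.Base as ℤ using (ℤ; +_; -[1+_]; 0ℤ; 1ℤ)
  import Data.Integer.Properties as ℤ
  import Data.Nat.Tactic.RingSolver as ℕ-Ring
  import Data.Integer.Tactic.RingSolver as ℤ-Ring
  open import Data.Product.Base using (∃-syntax; _×_; _,_)
  open import Data.Sum.Base using (_⊎_; inj₁; inj₂)
  open import Function.Base using (_∘_)
  open import Relation.Binary.PropositionalEquality

  sum< : ℕ → (ℕ → ℕ) → ℕ
  sum< zero    f = 0
  sum< (suc n) f = sum< n f + f n

  sum<-cong : ∀ n {f g} → (∀ i → f i ≡ g i) → sum< n f ≡ sum< n g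
  sum<-cong zero    h = refl
  sum<-cong (suc n) h = cong₂ _+_ (sum<-cong n h) (h n)

  sum<-mono : ∀ n {f g} → (∀ i → f i ≤ g i) → sum< n f ≤ sum< n g
  sum<-mono zero    h = z≤n
  sum<-mono (suc n) h = +-mono-≤ (sum<-mono n h) (h n)

  sum<-bound : ∀ n {f} c → (∀ i → i < n → f i ≤ c) → sum< n f ≤ n * c
  sum<-bound zero    c h = z≤n
  sum<-bound (suc n) {f} c h = begin
    sum< n f + f n ≤⟨ +-mono-≤ (sum<-bound n c (λ i i<n → h i (m<n⇒m<1+n i<n))) (h n ≤-refl) ⟩
    n * c + c      ≡⟨ +-comm (n * c) c ⟩
    c + n * c      ∎
    where open ≤-Reasoning

  interchange : ∀ a b c d → (a + b) + (c + d) ≡ (a + c) + (b + d)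
  interchange = ℕ-Ring.solve-∀

  sum<-+ : ∀ n f g → sum< n (λ i → f i + g i) ≡ sum< n f + sum< n g
  sum<-+ zero    f g = refl
  sum<-+ (suc n) f g = trans (cong (_+ (f n + g n)) (sum<-+ n f g)) (interchange (sum< n f) (sum< n g) (f n) (g n))

  sum<-*ˡ : ∀ n c f → sum< n (λ i → c * f i) ≡ c * sum< n f
  sum<-*ˡ zero    c f = sym (*-zeroʳ c)
  sum<-*ˡ (suc n) c f = trans (cong (_+ c * f n) (sum<-*ˡ n c f)) (sym (*-distribˡ-+ c (sum< n f) (f n)))

  sum<-*ʳ : ∀ n f c → sum< n (λ i → f i * c) ≡ sum< n f * c
  sum<-*ʳ zero    f c = refl
  sum<-*ʳ (suc n) f c = trans (cong (_+ f n * c) (sum<-*ʳ n f c)) (sym (*-distribʳ-+ c (sum< n f) (f n)))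

  sum<-1 : ∀ n → sum< n (λ _ → 1) ≡ n
  sum<-1 zero    = refl
  sum<-1 (suc n) = trans (cong (_+ 1) (sum<-1 n)) (+-comm n 1)

  sum<-0 : ∀ n → sum< n (λ _ → 0) ≡ 0
  sum<-0 zero    = refl
  sum<-0 (suc n) = trans (+-identityʳ _) (sum<-0 n)

  sum<-swap : ∀ m n (f : ℕ → ℕ → ℕ) → sum< m (λ i → sum< n (f i)) ≡ sum< n (λ j → sum< m (λ i → f i j))
  sum<-swap zero    n f = sym (sum<-0 n)
  sum<-swap (suc m) n f = trans (cong (_+ sum< n (f m)) (sum<-swap m n f))
    (sym (sum<-+ n (λ j → sum< m (λ i → f i j)) (f m)))

  sum<-shift : ∀ n f → sum< n (f ∘ suc) + f 0 ≡ sum< n f + f n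
  sum<-shift zero    f = refl
  sum<-shift (suc n) f = trans (swap (sum< n (f ∘ suc)) (f (suc n)) (f 0)) (cong (_+ f (suc n)) (sum<-shift n f))
    where
    swap : ∀ a b c → a + b + c ≡ a + c + b
    swap = ℕ-Ring.solve-∀

  sum<-member : ∀ n f i → i < n → f i ≤ sum< n f
  sum<-member (suc n) f i i<1+n with m≤n⇒m<n∨m≡n (≤-pred i<1+n)
  ... | inj₁ i<n  = ≤-trans (sum<-member n f i i<n) (m≤m+n _ _)
  ... | inj₂ refl = m≤n+m (f i) (sum< n f)

  argmax : ∀ n (f : ℕ → ℕ) → ∃[ i ] (i ≤ n × (∀ j → j ≤ n → f j ≤ f i))
  argmax zero    f = 0 , z≤n , λ { zero z≤n → ≤-refl }
  argmax (suc n) f with argmax n f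
  ... | i , i≤n , h with ≤-total (f (suc n)) (f i)
  ... | inj₁ le = i , m≤n⇒m≤1+n i≤n , λ j j≤ → case-le j (m≤n⇒m<n∨m≡n j≤)
    where
    case-le : ∀ j → j < suc n ⊎ j ≡ suc n → f j ≤ f i
    case-le j (inj₁ j<) = h j (≤-pred j<)
    case-le j (inj₂ refl) = le
  ... | inj₂ ge = suc n , ≤-refl , λ j j≤ → case-ge j (m≤n⇒m<n∨m≡n j≤)
    where
    case-ge : ∀ j → j < suc n ⊎ j ≡ suc n → f j ≤ f (suc n)
    case-ge j (inj₁ j<) = ≤-trans (h j (≤-pred j<)) ge
    case-ge j (inj₂ refl) = ≤-refl

  ind : Bool → ℕ
  ind true  = 1
  ind false = 0

  ind-not : ∀ b → ind b + ind (not b) ≡ 1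
  ind-not true  = refl
  ind-not false = refl

  ind-∧ : ∀ a b → ind (a ∧ b) ≡ ind a * ind b
  ind-∧ true  b = sym (+-identityʳ (ind b))
  ind-∧ false b = refl

  module Period (p : ℕ) where

    over : (ℤ → ℕ) → ℕ
    over g = sum< p (λ i → g (+ i))

    -- Sets of residues are kept as periodic functions on the integers, so that they can be
    -- translated by arbitrary integers without reducing modulo `p`.
    Periodic : {A : Set} → (ℤ → A) → Set
    Periodic g = ∀ z → g (z ℤ.+ + p) ≡ g z

    over-shift-suc : ∀ g → Periodic g → over (λ z → g (z ℤ.+ 1ℤ)) ≡ over g
    over-shift-suc g per = trans (sum<-cong p (λ i → cong (g ∘ +_) (+-comm i 1)))
      (+-cancelʳ-≡ (g 0ℤ) _ _ (trans (sum<-shift p (g ∘ +_))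
        (cong (λ t → over g + t) (trans (cong g (sym (ℤ.+-identityˡ (+ p)))) (per 0ℤ)))))

    over-cong : ∀ {f g} → (∀ z → f z ≡ g z) → over f ≡ over g
    over-cong h = sum<-cong p (λ i → h (+ i))

    periodic-shift : {A : Set} (g : ℤ → A) → Periodic g → ∀ w → Periodic (λ z → g (z ℤ.+ w))
    periodic-shift g per w z = trans (cong g (swap z (+ p) w)) (per (z ℤ.+ w))
      where
      swap : ∀ z p w → (z ℤ.+ p) ℤ.+ w ≡ (z ℤ.+ w) ℤ.+ p
      swap = ℤ-Ring.solve-∀

    over-shift-+ : ∀ g → Periodic g → ∀ n → over (λ z → g (z ℤ.+ + n)) ≡ over g
    over-shift-+ g per zero    = over-cong (λ z → cong g (ℤ.+-identityʳ z))
    over-shift-+ g per (suc n) = trans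
      (over-cong (λ z → cong g (trans (cong (λ t → z ℤ.+ t) (ℤ.pos-+ 1 n)) (sym (ℤ.+-assoc z 1ℤ (+ n))))))
      (trans (over-shift-suc (λ z → g (z ℤ.+ + n)) (periodic-shift g per (+ n))) (over-shift-+ g per n))

    over-shift : ∀ g → Periodic g → ∀ w → over (λ z → g (z ℤ.+ w)) ≡ over g
    over-shift g per (+ n)      = over-shift-+ g per n
    over-shift g per w@(-[1+ n ]) = trans
      (sym (over-shift-+ (λ z → g (z ℤ.+ w)) (periodic-shift g per w) (suc n)))
      (over-cong (λ z → cong g (trans (ℤ.+-assoc z (+ suc n) w)
        (trans (cong (λ t → z ℤ.+ t) (ℤ.+-inverseʳ (+ suc n))) (ℤ.+-identityʳ z)))))

    periodic-multiple-+ : {A : Set} (g : ℤ → A) → Periodic g → ∀ z n → g (z ℤ.+ + n ℤ.* + p) ≡ g z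
    periodic-multiple-+ g per z zero    = cong g (trans (cong (λ t → z ℤ.+ t) (ℤ.*-zeroˡ (+ p))) (ℤ.+-identityʳ z))
    periodic-multiple-+ g per z (suc n) = trans
      (cong g (trans (cong (λ t → z ℤ.+ t ℤ.* + p) (ℤ.pos-+ 1 n)) (lem z (+ n) (+ p))))
      (trans (per (z ℤ.+ + n ℤ.* + p)) (periodic-multiple-+ g per z n))
      where
      lem : ∀ z n p → z ℤ.+ (1ℤ ℤ.+ n) ℤ.* p ≡ (z ℤ.+ n ℤ.* p) ℤ.+ p
      lem = ℤ-Ring.solve-∀

    periodic-multiple : {A : Set} (g : ℤ → A) → Periodic g → ∀ z w → g (z ℤ.+ w ℤ.* + p) ≡ g z
    periodic-multiple g per z (+ n)      = periodic-multiple-+ g per z n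
    periodic-multiple g per z w@(-[1+ n ]) = trans
      (sym (periodic-multiple-+ g per (z ℤ.+ w ℤ.* + p) (suc n)))
      (cong g (lem z (+ suc n) (+ p)))
      where
      lem : ∀ z m p → (z ℤ.+ (ℤ.- m) ℤ.* p) ℤ.+ m ℤ.* p ≡ z
      lem = ℤ-Ring.solve-∀

    -- Abstracts the number of points that leave a fixed set under translation by z. A bound on
    -- generators passes to every word in them, whatever the set is; `Span` therefore quantifies
    -- over all such `d`.
    record Seminorm (d : ℤ → ℕ) : Set where
      field
        zero≡    : d 0ℤ ≡ 0
        subadd   : ∀ a b → d (a ℤ.+ b) ≤ d a + d b
        negate   : ∀ a → d (ℤ.- a) ≤ d a
        periodic : ∀ a w → d (a ℤ.+ w ℤ.* + p) ≤ d a

      subadd-minus : ∀ a b → d (a ℤ.- b) ≤ d a + d b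
      subadd-minus a b = ≤-trans (subadd a (ℤ.- b)) (+-monoʳ-≤ (d a) (negate b))

      multiple : ∀ n a → d (+ n ℤ.* a) ≤ n * d a
      multiple zero    a = ≤-reflexive (trans (cong d (ℤ.*-zeroˡ a)) zero≡)
      multiple (suc n) a = subst (λ z → d z ≤ suc n * d a)
        (sym (trans (cong (ℤ._* a) (ℤ.pos-+ 1 n)) (lem (+ n) a)))
        (≤-trans (subadd a (+ n ℤ.* a)) (+-monoʳ-≤ (d a) (multiple n a)))
        where
        lem : ∀ n a → (1ℤ ℤ.+ n) ℤ.* a ≡ a ℤ.+ n ℤ.* a
        lem = ℤ-Ring.solve-∀

    card : (ℤ → Bool) → ℕ
    card S = over (ind ∘ S)

    leaving : (ℤ → Bool) → ℤ → ℕ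
    leaving S z = over (λ x → ind (S x ∧ not (S (x ℤ.+ z))))

    staying : (ℤ → Bool) → ℤ → ℕ
    staying S z = over (λ x → ind (S x ∧ S (x ℤ.+ z)))

    leaving+staying : ∀ S z → leaving S z + staying S z ≡ card S
    leaving+staying S z = trans (sym (sum<-+ p _ _)) (over-cong (λ x → lem (S x) (S (x ℤ.+ z))))
      where
      lem : ∀ a b → ind (a ∧ not b) + ind (a ∧ b) ≡ ind a
      lem true  true  = refl
      lem true  false = refl
      lem false b     = refl

    module _ (S : ℤ → Bool) (per : Periodic S) where

      private
        cancel : ∀ x z → (x ℤ.+ z) ℤ.+ ℤ.- z ≡ x
        cancel = ℤ-Ring.solve-∀

      ind-periodic : (f : Bool → Bool → Bool) (z : ℤ) → Periodic (λ x → ind (f (S x) (S (x ℤ.+ z))))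
      ind-periodic f z x = cong₂ (λ a b → ind (f a b)) (per x) (periodic-shift S per z x)

      staying-neg : ∀ z → staying S (ℤ.- z) ≡ staying S z
      staying-neg z = trans (sym (over-shift _ (ind-periodic _∧_ (ℤ.- z)) z))
        (over-cong (λ x → trans (cong (λ y → ind (S (x ℤ.+ z) ∧ S y)) (cancel x z)) (cong ind (∧-comm (S (x ℤ.+ z)) (S x)))))
        where open import Data.Bool.Properties using (∧-comm)

      -- A point leaving under a + b leaves under a, or its translate by a leaves under b; shifting
      -- the period turns the second count into `leaving S b`. Symmetry holds because `staying` is
      -- symmetric and the two counts add up to `card S`.
      leaving-seminorm : Seminorm (leaving S)
      leaving-seminorm = record
        { zero≡    = trans (over-cong (λ x → trans (cong (λ y → ind (S x ∧ not (S y))) (ℤ.+-identityʳ x)) (never (S x)))) (sum<-0 p)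
        ; subadd   = λ a b → begin
            leaving S (a ℤ.+ b)
              ≤⟨ sum<-mono p (λ i → subst (λ y → ind (S (+ i) ∧ not (S y)) ≤
                   ind (S (+ i) ∧ not (S (+ i ℤ.+ a))) + ind (S (+ i ℤ.+ a) ∧ not (S ((+ i ℤ.+ a) ℤ.+ b))))
                   (ℤ.+-assoc (+ i) a b) (triangle (S (+ i)) (S (+ i ℤ.+ a)) (S ((+ i ℤ.+ a) ℤ.+ b)))) ⟩
            over (λ x → ind (S x ∧ not (S (x ℤ.+ a))) + ind (S (x ℤ.+ a) ∧ not (S ((x ℤ.+ a) ℤ.+ b))))
              ≡⟨ sum<-+ p _ _ ⟩
            leaving S a + over (λ x → ind (S (x ℤ.+ a) ∧ not (S ((x ℤ.+ a) ℤ.+ b))))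
              ≡⟨ cong (λ t → leaving S a + t) (over-shift _ (ind-periodic (λ s t → s ∧ not t) b) a) ⟩
            leaving S a + leaving S b ∎
        ; negate   = λ a → ≤-reflexive (+-cancelʳ-≡ (staying S a) _ _
            (trans (cong (λ t → leaving S (ℤ.- a) + t) (sym (staying-neg a)))
              (trans (leaving+staying S (ℤ.- a)) (sym (leaving+staying S a)))))
        ; periodic = λ a w → ≤-reflexive (over-cong (λ x → cong (λ b → ind (S x ∧ not b))
            (trans (cong S (sym (ℤ.+-assoc x a (w ℤ.* + p)))) (periodic-multiple S per (x ℤ.+ a) w))))
        }
        where
        open ≤-Reasoning
        never : ∀ b → ind (b ∧ not b) ≡ 0
        never true  = refl
        never false = refl
        triangle : ∀ a b c → ind (a ∧ not c) ≤ ind (a ∧ not b) + ind (b ∧ not c)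
        triangle false b     c     = z≤n
        triangle true  true  c     = ≤-refl
        triangle true  false true  = z≤n
        triangle true  false false = ≤-refl

      card-complement : card S + card (not ∘ S) ≡ p
      card-complement = trans (sym (sum<-+ p _ _)) (trans (over-cong (λ x → ind-not (S x))) (sum<-1 p))

      -- Double counting: for fixed x in S, the shifts that carry x outside S are as many as the
      -- residues outside S.
      total-leaving : over (leaving S) ≡ card S * card (not ∘ S)
      total-leaving = begin
        over (λ z → over (λ x → ind (S x ∧ not (S (x ℤ.+ z)))))
          ≡⟨ sum<-swap p p (λ z x → ind (S (+ x) ∧ not (S (+ x ℤ.+ + z)))) ⟩
        over (λ x → over (λ z → ind (S x ∧ not (S (x ℤ.+ z)))))
          ≡⟨ over-cong (λ x → trans (over-cong (λ z → ind-∧ (S x) (not (S (x ℤ.+ z))))) (sum<-*ˡ p (ind (S x)) _)) ⟩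
        over (λ x → ind (S x) * over (λ z → ind (not (S (x ℤ.+ z)))))
          ≡⟨ over-cong (λ x → cong (ind (S x) *_) (trans
               (over-cong (λ z → cong (ind ∘ not ∘ S) (ℤ.+-comm x z)))
               (over-shift (ind ∘ not ∘ S) (λ z → cong (ind ∘ not) (per z)) x))) ⟩
        over (λ x → ind (S x) * card (not ∘ S))
          ≡⟨ sum<-*ʳ p (λ i → ind (S (+ i))) (card (not ∘ S)) ⟩
        card S * card (not ∘ S) ∎
        where open ≡-Reasoning

      -- The maximum of `leaving S` over a period is at least its mean, which `total-leaving`
      -- computes.
      some-leaving : 0 < p → ∃[ a ] (card S * card (not ∘ S) ≤ p * leaving S a)
      some-leaving 0<p with argmax (pred p) (λ i → leaving S (+ i))
      ... | i , _ , h = + i , (begin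
        card S * card (not ∘ S) ≡⟨ sym total-leaving ⟩
        over (leaving S)        ≤⟨ sum<-bound p (leaving S (+ i)) (λ j j<p → h j (≤-pred (subst (j <_) (sym (suc-pred p {{>-nonZero 0<p}})) j<p))) ⟩
        p * leaving S (+ i)     ∎)
        where open ≤-Reasoning

      extend : ℤ → ℤ → Bool
      extend v z = S z ∨ S (z ℤ.+ ℤ.- v)

      extend-periodic : ∀ v → Periodic (extend v)
      extend-periodic v z = cong₂ _∨_ (per z) (periodic-shift S per (ℤ.- v) z)

      -- Adjoining the translate S + v gains one point for each point of S that leaves S under v, so
      -- a value with large `leaving` is a good next summand.
      card-extend : ∀ v → card (extend v) ≡ card S + leaving S v
      card-extend v = begin
        card (extend v)
          ≡⟨ trans (over-cong (λ z → lem (S z) (S (z ℤ.+ ℤ.- v)))) (sum<-+ p _ _) ⟩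
        card S + over (λ z → ind (S (z ℤ.+ ℤ.- v) ∧ not (S z)))
          ≡⟨ cong (λ t → card S + t) (sym (over-shift _ (λ z → cong₂ (λ a b → ind (a ∧ not b)) (periodic-shift S per (ℤ.- v) z) (per z)) v)) ⟩
        card S + over (λ z → ind (S ((z ℤ.+ v) ℤ.+ ℤ.- v) ∧ not (S (z ℤ.+ v))))
          ≡⟨ cong (λ t → card S + t) (over-cong (λ z → cong (λ y → ind (S y ∧ not (S (z ℤ.+ v)))) (cancel z v))) ⟩
        card S + leaving S v ∎
        where
        open ≡-Reasoning
        lem : ∀ a b → ind (a ∨ b) ≡ ind a + ind (b ∧ not a)
        lem true  true  = refl
        lem true  false = refl
        lem false true  = refl
        lem false false = refl

    common-point : ∀ S R → p < card S + card R → ∃[ z ] (S z ≡ true × R z ≡ true)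
    common-point S R lt = go p (≤-trans lt (≤-reflexive (sym (sum<-+ p (λ i → ind (S (+ i))) (λ i → ind (R (+ i)))))))
      where
      go : ∀ n → n < sum< n (λ i → ind (S (+ i)) + ind (R (+ i))) → ∃[ z ] (S z ≡ true × R z ≡ true)
      go (suc n) lt with S (+ n) in s | R (+ n) in r
      ... | true  | true  = + n , s , r
      ... | true  | false = go n (≤-pred (subst (suc n <_) (+-comm _ 1) lt))
      ... | false | true  = go n (≤-pred (subst (suc n <_) (+-comm _ 1) lt))
      ... | false | false = go n (<-trans (n<1+n n) (subst (suc n <_) (+-identityʳ _) lt))

-- Growing sets of residues by sums of distinct candidates.

module Growth where

  open Counting
  open import Data.Bool.Base using (Bool; true; false; not)
  open import Data.Nat.Base
  open import Data.Nat.Properties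
  open import Data.Integer.Base as ℤ using (ℤ; +_; 0ℤ; 1ℤ)
  import Data.Integer.Properties as ℤ
  open import Data.Integer.Divisibility.Signed as ℤ-Div using (divides)
  import Data.Nat.Tactic.RingSolver as ℕ-Ring
  import Data.Integer.Tactic.RingSolver as ℤ-Ring
  open import Data.List.Base using (List; []; _∷_; _++_; length)
  open import Data.List.Properties using (length-++)
  open import Data.List.Relation.Unary.All as All using (All; []; _∷_)
  import Data.List.Relation.Unary.All.Properties as All
  open import Data.List.Relation.Unary.AllPairs using ([]; _∷_)
  open import Data.List.Relation.Unary.Unique.Propositional using (Unique)
  import Data.List.Relation.Unary.Unique.Propositional.Properties as Unique
  open import Data.Product.Base using (∃-syntax; _×_; _,_)
  open import Data.Sum.Base using (_⊎_; inj₁; inj₂)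
  open import Function.Base using (_∘_)
  open import Function.Bundles using (mk⇔)
  open import Relation.Nullary using (¬_; yes; no; does)
  open import Relation.Nullary.Decidable using (Dec; does-⇔; dec-true)
  open import Relation.Binary.PropositionalEquality

  total : (ℕ → ℤ) → List ℕ → ℤ
  total v []       = 0ℤ
  total v (k ∷ ks) = v k ℤ.+ total v ks

  total-++ : ∀ v ks ls → total v (ks ++ ls) ≡ total v ks ℤ.+ total v ls
  total-++ v []       ls = sym (ℤ.+-identityˡ _)
  total-++ v (k ∷ ks) ls = trans (cong (λ t → v k ℤ.+ t) (total-++ v ks ls)) (sym (ℤ.+-assoc (v k) _ _))

  total-neg : ∀ v ks → total (ℤ.-_ ∘ v) ks ≡ ℤ.- total v ks
  total-neg v []       = refl
  total-neg v (k ∷ ks) = trans (cong (λ t → ℤ.- v k ℤ.+ t) (total-neg v ks)) (sym (ℤ.neg-distrib-+ (v k) _))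

  witness : {A : Set} (a? : Dec A) → does a? ≡ true → A
  witness (yes a) _ = a

  module Modulo (p : ℕ) (0<p : 0 < p) where

    open Period p

    -- The values g 0, …, g J generate ℤ/p within word length t.
    Span : ℕ → ℕ → (ℕ → ℤ) → Set
    Span t J g = ∀ d → Seminorm d → ∀ η → (∀ i → i ≤ J → d (g i) ≤ η) → ∀ a → d a ≤ t * η

    -- In `residues` the second of the two sets grows with the negated values.
    span-neg : ∀ {t J g} → Span t J g → Span t J (ℤ.-_ ∘ g)
    span-neg {g = g} sp d sn η h = sp d sn η (λ i i≤J →
      ≤-trans (subst (λ z → d z ≤ d (ℤ.- g i)) (ℤ.neg-involutive (g i)) (Seminorm.negate sn (ℤ.- g i))) (h i i≤J))

    -- The j-th step of the growth uses one of the candidates fam j 0, …, fam j J.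
    module Families (J : ℕ) (fam : ℕ → ℕ → ℕ) where

      -- The steps form a window, so that two growths can run on disjoint windows and thus use
      -- disjoint candidates.
      InFamilies : ℕ → ℕ → ℕ → Set
      InFamilies lo n k = ∃[ j ] ∃[ i ] (lo ≤ j × j < lo + n × i ≤ J × k ≡ fam j i)

      record Reached (v : ℕ → ℤ) (lo n : ℕ) (z : ℤ) : Set where
        field
          ks      : List ℕ
          unique  : Unique ks
          members : All (InFamilies lo n) ks
          short   : length ks ≤ n
          w       : ℤ
          sums    : total v ks ≡ z ℤ.+ w ℤ.* + p

      open Reached

      record State (v : ℕ → ℤ) (lo n : ℕ) : Set where
        field
          S     : ℤ → Bool
          per   : Periodic S
          sound : ∀ z → S z ≡ true → Reached v lo n z

      open State

      widen : ∀ {lo n m k} → n ≤ m → InFamilies lo n k → InFamilies lo m k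
      widen n≤m (j , i , lo≤j , j< , i≤J , eq) = j , i , lo≤j , ≤-trans j< (+-monoʳ-≤ _ n≤m) , i≤J , eq

      weaken : ∀ {v lo n m} → n ≤ m → State v lo n → State v lo m
      weaken n≤m st .S = st .S
      weaken n≤m st .per = st .per
      weaken n≤m st .sound z eq = let r = st .sound z eq in record
        { ks = r .ks ; unique = r .unique ; members = All.map (widen n≤m) (r .members)
        ; short = ≤-trans (r .short) n≤m ; w = r .w ; sums = r .sums }

      initial : ∀ v lo → ∃[ st ] (1 ≤ card (S {v} {lo} {0} st))
      initial v lo = st , ≤-trans (≤-reflexive (sym at-zero)) (sum<-member p (λ i → ind (St (+ i))) 0 0<p)
        where
        St : ℤ → Bool
        St z = does (+ p ℤ-Div.∣? z)
        at-zero : ind (St 0ℤ) ≡ 1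
        at-zero = cong ind (dec-true (+ p ℤ-Div.∣? 0ℤ) (divides 0ℤ (sym (ℤ.*-zeroˡ (+ p)))))
        suc* : ∀ q p → q ℤ.* p ℤ.+ p ≡ (q ℤ.+ 1ℤ) ℤ.* p
        suc* = ℤ-Ring.solve-∀
        pred* : ∀ z p → z ≡ (z ℤ.+ p) ℤ.- p
        pred* = ℤ-Ring.solve-∀
        pred*′ : ∀ q p → q ℤ.* p ℤ.- p ≡ (q ℤ.- 1ℤ) ℤ.* p
        pred*′ = ℤ-Ring.solve-∀
        neg* : ∀ q p → 0ℤ ≡ q ℤ.* p ℤ.+ ℤ.- q ℤ.* p
        neg* = ℤ-Ring.solve-∀
        st : State v lo 0
        st .S = St
        st .per z = does-⇔ (mk⇔
          (λ { (divides q eq) → divides (q ℤ.- 1ℤ) (trans (pred* z (+ p)) (trans (cong (ℤ._- + p) eq) (pred*′ q (+ p)))) })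
          (λ { (divides q eq) → divides (q ℤ.+ 1ℤ) (trans (cong (ℤ._+ + p) eq) (suc* q (+ p))) })) (+ p ℤ-Div.∣? (z ℤ.+ + p)) (+ p ℤ-Div.∣? z)
        st .sound z eq with witness (+ p ℤ-Div.∣? z) eq
        ... | divides q e = record { ks = [] ; unique = [] ; members = [] ; short = z≤n ; w = ℤ.- q
                                         ; sums = trans (neg* q (+ p)) (cong (ℤ._+ ℤ.- q ℤ.* + p) (sym e)) }

      module Run (v : ℕ → ℤ) (M : ℕ)
                 (distinct : ∀ {j j′ i i′} → j < M → j′ < M → i ≤ J → i′ ≤ J → fam j i ≡ fam j′ i′ → j ≡ j′)
                 (t : ℕ) (0<t : 0 < t)
                 (spans : ∀ j → j < M → Span t J (λ i → v (fam j i))) where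

        -- Take the candidate with the largest `leaving` value g. By `some-leaving` some shift a
        -- moves at least 1/p of the product of the sizes of S and its complement out of S, and by
        -- the span hypothesis the count at a is at most t g.
        step : ∀ {lo n} → lo + n < M → (st : State v lo n) →
               ∃[ st′ ] ∃[ g ] (card (S {v} {lo} {suc n} st′) ≡ card (st .S) + g ×
                                card (st .S) * card (not ∘ st .S) ≤ p * (t * g))
        step {lo} {n} lt st with some-leaving (st .S) (st .per) 0<p | argmax J (λ i → leaving (st .S) (v (fam (lo + n) i)))
        ... | a , ha | i , i≤J , hi = st′ , leaving (st .S) (v k) , card-extend (st .S) (st .per) (v k) ,
          ≤-trans ha (*-monoʳ-≤ p (spans (lo + n) lt (leaving (st .S)) (leaving-seminorm (st .S) (st .per))
            (leaving (st .S) (v k)) hi a))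
          where
          k : ℕ
          k = fam (lo + n) i
          fresh : ∀ {k′} → InFamilies lo n k′ → ¬ k ≡ k′
          fresh (j′ , i′ , _ , j′< , i′≤J , refl) eq =
            <⇒≢ j′< (sym (distinct lt (<-trans j′< lt) i≤J i′≤J eq))
          in-new : InFamilies lo (suc n) k
          in-new = lo + n , i , m≤m+n lo n , ≤-reflexive (sym (+-suc lo n)) , i≤J , refl
          move : ∀ v z w p → v ℤ.+ ((z ℤ.+ ℤ.- v) ℤ.+ w ℤ.* p) ≡ z ℤ.+ w ℤ.* p
          move = ℤ-Ring.solve-∀
          st′ : State v lo (suc n)
          st′ .S = extend (st .S) (st .per) (v k)
          st′ .per = extend-periodic (st .S) (st .per) (v k)
          st′ .sound z eq with st .S z in old
          ... | true = weaken (n≤1+n n) st .sound z old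
          ... | false = let r = st .sound (z ℤ.+ ℤ.- v k) eq in record
            { ks      = k ∷ r .ks
            ; unique  = All.map fresh (r .members) ∷ r .unique
            ; members = in-new ∷ All.map (widen (n≤1+n n)) (r .members)
            ; short   = s≤s (r .short)
            ; w       = r .w
            ; sums    = trans (cong (λ y → v k ℤ.+ y) (r .sums)) (move (v k) z (r .w) (+ p)) }

        Big : ℕ → Set
        Big c = p < c + c

        -- While S has at most half of the residues, p times its size is at most twice the product
        -- of its size and that of its complement, so each gain g satisfies |S| ≤ 2 t g. As S never
        -- shrinks, m steps add at least m / (2 t) times the initial size, and 2 t steps double it.
        run : ∀ {lo n} m → lo + (m + n) ≤ M → (st : State v lo n) →
              ∃[ st′ ] (Big (card (S {v} {lo} {m + n} st′)) ⊎
                        ((t + t + m) * card (st .S) ≤ (t + t) * card (S {v} {lo} {m + n} st′) ×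
                         card (st .S) ≤ card (S {v} {lo} {m + n} st′)))
        run zero    le st = st , inj₂ (≤-reflexive (cong (_* card (st .S)) (+-identityʳ (t + t))) , ≤-refl)
        run {lo} {n} (suc m) le st with run m (≤-trans (+-monoʳ-≤ lo (n≤1+n (m + n))) le) st
        ... | st₁ , inj₁ big = weaken (n≤1+n _) st₁ , inj₁ big
        ... | st₁ , inj₂ (h , mono) with p <? card (st₁ .S) + card (st₁ .S)
        ...   | yes big = weaken (n≤1+n _) st₁ , inj₁ big
        ...   | no ¬big with step (≤-trans (≤-reflexive (sym (+-suc lo (m + n)))) le) st₁
        ...     | st₂ , g , eq , grow = st₂ , inj₂ (bound , ≤-trans mono (≤-trans (m≤m+n c₁ g) (≤-reflexive (sym eq))))
          where
          c₀ c₁ u : ℕ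
          c₀ = card (st .S)
          c₁ = card (st₁ .S)
          u = card (not ∘ st₁ .S)
          c₁+u : c₁ + u ≡ p
          c₁+u = card-complement (st₁ .S) (st₁ .per)
          c₁≤u : c₁ ≤ u
          c₁≤u = +-cancelˡ-≤ c₁ c₁ u (≤-trans (≮⇒≥ ¬big) (≤-reflexive (sym c₁+u)))
          p*c₁ : p * c₁ ≤ p * ((t + t) * g)
          p*c₁ = begin
            p * c₁            ≡⟨ cong (_* c₁) (sym c₁+u) ⟩
            (c₁ + u) * c₁     ≤⟨ *-monoˡ-≤ c₁ (+-monoˡ-≤ u c₁≤u) ⟩
            (u + u) * c₁      ≡⟨ lem₁ u c₁ ⟩
            c₁ * u + c₁ * u   ≤⟨ +-mono-≤ grow grow ⟩
            p * (t * g) + p * (t * g) ≡⟨ lem₂ p t g ⟩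
            p * ((t + t) * g) ∎
            where
            open ≤-Reasoning
            lem₁ : ∀ u c → (u + u) * c ≡ c * u + c * u
            lem₁ = ℕ-Ring.solve-∀
            lem₂ : ∀ p t g → p * (t * g) + p * (t * g) ≡ p * ((t + t) * g)
            lem₂ = ℕ-Ring.solve-∀
          c₁≤ : c₁ ≤ (t + t) * g
          c₁≤ = *-cancelˡ-≤ p {{>-nonZero 0<p}} p*c₁
          bound : (t + t + suc m) * c₀ ≤ (t + t) * card (st₂ .S)
          bound = begin
            (t + t + suc m) * c₀              ≡⟨ lem t m c₀ ⟩
            (t + t + m) * c₀ + c₀             ≤⟨ +-mono-≤ h (≤-trans mono c₁≤) ⟩
            (t + t) * c₁ + (t + t) * g        ≡⟨ sym (*-distribˡ-+ (t + t) c₁ g) ⟩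
            (t + t) * (c₁ + g)                ≡⟨ cong ((t + t) *_) (sym eq) ⟩
            (t + t) * card (st₂ .S)           ∎
            where
            open ≤-Reasoning
            lem : ∀ t m c → (t + t + suc m) * c ≡ (t + t + m) * c + c
            lem = ℕ-Ring.solve-∀

        doubling : ∀ {lo} e → lo + e * (t + t) ≤ M →
                   ∃[ st ] (Big (card (S {v} {lo} {e * (t + t)} st)) ⊎ 2 ^ e ≤ card (S {v} {lo} {e * (t + t)} st))
        doubling {lo} zero le with initial v lo
        ... | st , h = st , inj₂ h
        doubling {lo} (suc e) le with doubling {lo} e (≤-trans (+-monoʳ-≤ lo (m≤n+m (e * (t + t)) (t + t))) le)
        ... | st , inj₁ big = weaken (m≤n+m _ (t + t)) st , inj₁ big
        ... | st , inj₂ h with run (t + t) le st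
        ...   | st′ , inj₁ big = st′ , inj₁ big
        ...   | st′ , inj₂ (h′ , _) = st′ , inj₂ (*-cancelˡ-≤ (t + t) {{>-nonZero (≤-trans 0<t (m≤m+n t t))}} (begin
            (t + t) * (2 * 2 ^ e)         ≡⟨ lem (t + t) (2 ^ e) ⟩
            (t + t + (t + t)) * 2 ^ e     ≤⟨ *-monoʳ-≤ (t + t + (t + t)) h ⟩
            (t + t + (t + t)) * card (st .S) ≤⟨ h′ ⟩
            (t + t) * card (st′ .S)       ∎))
          where
          open ≤-Reasoning
          lem : ∀ a b → a * (2 * b) ≡ (a + a) * b
          lem = ℕ-Ring.solve-∀

        large : ∀ lo e → lo + e * (t + t) ≤ M → p ≤ 2 ^ e →
                ∃[ st ] Big (card (S {v} {lo} {e * (t + t)} st))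
        large lo e le p≤ with doubling {lo} e le
        ... | st , inj₁ big = st , big
        ... | st , inj₂ h = st , ≤-trans (s≤s p≤) (≤-trans (+-monoˡ-≤ (2 ^ e) (≤-trans 0<p p≤)) (+-mono-≤ h h))

      -- One set S grows with the values v on the first half of the steps, another set R with -v on
      -- the second half. Both have more than p / 2 elements, so S meets R + r. A common point is a
      -- first sum Σ₁ and also r - Σ₂, whence r = Σ₁ + Σ₂ modulo p, with disjoint candidates.
      residues : ∀ v t e → 0 < t → p ≤ 2 ^ e →
        (∀ {j j′ i i′} → j < e * (t + t) + e * (t + t) → j′ < e * (t + t) + e * (t + t) →
          i ≤ J → i′ ≤ J → fam j i ≡ fam j′ i′ → j ≡ j′) →
        (∀ j → j < e * (t + t) + e * (t + t) → Span t J (λ i → v (fam j i))) →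
        ∀ r → Reached v 0 (e * (t + t) + e * (t + t)) r
      residues v t e 0<t p≤ distinct spans r
        with Run.large v (e * (t + t) + e * (t + t)) distinct t 0<t spans 0 e (m≤m+n _ _) p≤
           | Run.large (ℤ.-_ ∘ v) (e * (t + t) + e * (t + t)) distinct t 0<t
               (λ j j< → span-neg {t} (spans j j<)) (e * (t + t)) e ≤-refl p≤
      ... | st₁ , big₁ | st₂ , big₂ = glue (common-point (st₁ .S) (λ z → st₂ .S (z ℤ.+ ℤ.- r)) (lt {card (st₁ .S)} big₁
              (subst (λ c → p < c + c) (sym (over-shift (ind ∘ st₂ .S) (λ z → cong ind (st₂ .per z)) (ℤ.- r))) big₂)))
        where
        w₀ : ℕ
        w₀ = e * (t + t)
        lt : ∀ {a b} → p < a + a → p < b + b → p < a + b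
        lt {a} {b} ha hb with ≤-total a b
        ... | inj₁ a≤b = ≤-trans ha (+-monoʳ-≤ a a≤b)
        ... | inj₂ b≤a = ≤-trans hb (+-monoˡ-≤ b b≤a)
        shift-members : ∀ {k} → InFamilies w₀ w₀ k → InFamilies 0 (w₀ + w₀) k
        shift-members (j , i , _ , rest) = j , i , z≤n , rest
        apart : ∀ {k} → InFamilies 0 w₀ k → InFamilies w₀ w₀ k → k ≡ k → ∃[ j ] (j < w₀ × w₀ ≤ j)
        apart (j , i , _ , j< , i≤J , refl) (j′ , i′ , ≤j′ , j′< , i′≤J , eq) _ =
          j , j< , subst (w₀ ≤_) (sym (distinct (≤-trans j< (m≤m+n w₀ w₀)) j′< i≤J i′≤J eq)) ≤j′
        lem : ∀ z r a b p → (z ℤ.+ a ℤ.* p) ℤ.+ ℤ.- ((z ℤ.+ ℤ.- r) ℤ.+ b ℤ.* p) ≡ r ℤ.+ (a ℤ.- b) ℤ.* p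
        lem = ℤ-Ring.solve-∀
        glue : ∃[ z ] (st₁ .S z ≡ true × st₂ .S (z ℤ.+ ℤ.- r) ≡ true) → Reached v 0 (w₀ + w₀) r
        glue (z , in₁ , in₂) with st₁ .sound z in₁ | st₂ .sound _ in₂
        ... | R₁ | R₂ = record
          { ks      = R₁ .ks ++ R₂ .ks
          ; unique  = Unique.++⁺ (R₁ .unique) (R₂ .unique) (λ { (∈₁ , ∈₂) →
              let j , j< , ≤j = apart (All.lookup (R₁ .members) ∈₁) (All.lookup (R₂ .members) ∈₂) refl
              in <⇒≱ j< ≤j })
          ; members = All.++⁺ (All.map (widen (m≤m+n w₀ w₀)) (R₁ .members)) (All.map shift-members (R₂ .members))
          ; short   = ≤-trans (≤-reflexive (length-++ (R₁ .ks))) (+-mono-≤ (R₁ .short) (R₂ .short))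
          ; w       = R₁ .w ℤ.- R₂ .w
          ; sums    = trans (total-++ v (R₁ .ks) (R₂ .ks))
              (trans (cong₂ ℤ._+_ (R₁ .sums) (trans (sym (ℤ.neg-involutive _))
                (cong ℤ.-_ (trans (sym (total-neg v (R₂ .ks))) (R₂ .sums)))))
                (lem z r (R₁ .w) (R₂ .w) (+ p))) }

-- Exact quotients, Bézout coefficients and primes.

module Arith where

  open import Data.Nat.Base
  open import Data.Nat.Properties
  open import Data.Nat.Divisibility
  open import Data.Nat.DivMod using (m*n/n≡m)
  open import Data.Nat.Coprimality as Coprime using (Coprime)
  open import Data.Nat.GCD using (module Bézout)
  open import Data.Nat.Primality
  open import Data.Integer.Base as ℤ using (ℤ; +_; -[1+_]; 1ℤ; ∣_∣)
  import Data.Integer.Properties as ℤ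
  open import Data.Integer.DivMod using (_%ℕ_; _/ℕ_; n%ℕd<d; a≡a%ℕn+[a/ℕn]*n)
  import Data.Integer.Tactic.RingSolver as ℤ-Ring
  open import Data.Product.Base using (∃-syntax; _×_; _,_)
  open import Data.Sum.Base using (_⊎_; inj₁; inj₂)
  open import Relation.Nullary using (¬_; contradiction)
  open import Relation.Binary.PropositionalEquality

  infixl 7 _÷_

  -- Division totalised by n ÷ 0 = 0; it is only used when the divisor divides.
  _÷_ : ℕ → ℕ → ℕ
  n ÷ zero  = 0
  n ÷ suc k = n / suc k

  ÷-exact : ∀ {k n} → k ∣ n → n ÷ k * k ≡ n
  ÷-exact {zero}  k∣n = sym (0∣⇒≡0 k∣n)
  ÷-exact {suc k} (divides q refl) = cong (_* suc k) (m*n/n≡m q (suc k))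

  ÷-unique : ∀ {k n q} → 0 < k → q * k ≡ n → n ÷ k ≡ q
  ÷-unique {suc k} {q = q} _ refl = m*n/n≡m q (suc k)

  prime-coprime : ∀ {p n} → Prime p → ¬ p ∣ n → Coprime p n
  prime-coprime {p} pr p∤n {i} (i∣p , i∣n) with prime⇒irreducible pr i∣p
  ... | inj₁ i≡1  = i≡1
  ... | inj₂ refl = contradiction i∣n p∤n

  bezout : ∀ {m n} → Coprime m n → ∃[ s ] ∃[ t ] (s ℤ.* + m ℤ.+ t ℤ.* + n ≡ 1ℤ)
  bezout {m} {n} c with Coprime.coprime-Bézout c
  ... | Bézout.+- x y eq = + x , ℤ.- + y , trans (cong (ℤ._+ ℤ.- + y ℤ.* + n) (trans (sym (ℤ.pos-* x m))
          (trans (cong +_ (sym eq)) (trans (ℤ.pos-+ 1 (y * n)) (cong (λ t → 1ℤ ℤ.+ t) (ℤ.pos-* y n)))))) (lem (+ y) (+ n))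
    where
    lem : ∀ y n → (1ℤ ℤ.+ y ℤ.* n) ℤ.+ ℤ.- y ℤ.* n ≡ 1ℤ
    lem = ℤ-Ring.solve-∀
  ... | Bézout.-+ x y eq = ℤ.- + x , + y , trans (cong (λ t → ℤ.- + x ℤ.* + m ℤ.+ t) (trans (sym (ℤ.pos-* y n))
          (trans (cong +_ (sym eq)) (trans (ℤ.pos-+ 1 (x * m)) (cong (λ t → 1ℤ ℤ.+ t) (ℤ.pos-* x m)))))) (lem (+ x) (+ m))
    where
    lem : ∀ x m → ℤ.- x ℤ.* m ℤ.+ (1ℤ ℤ.+ x ℤ.* m) ≡ 1ℤ
    lem = ℤ-Ring.solve-∀

  bezout-abs : ∀ h {n} → Coprime ∣ h ∣ n → ∃[ s ] ∃[ t ] (s ℤ.* h ℤ.+ t ℤ.* + n ≡ 1ℤ)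
  bezout-abs (+ m)    c = bezout c
  bezout-abs -[1+ m ] {n} c with bezout c
  ... | s , t , eq = ℤ.- s , t , trans (cong (ℤ._+ t ℤ.* + n) (lem s (+ suc m))) eq
    where
    lem : ∀ s m → ℤ.- s ℤ.* ℤ.- m ≡ s ℤ.* m
    lem = ℤ-Ring.solve-∀

  -- The bound on the multiplier A limits how often a unit `h` is used when it generates a residue,
  -- or how many digits A has.
  multiple-mod : ∀ h {n} → 0 < n → Coprime ∣ h ∣ n → ∀ a →
                 ∃[ A ] (A < n × ∃[ w ] (a ≡ + A ℤ.* h ℤ.+ w ℤ.* + n))
  multiple-mod h {n@(suc _)} _ c a with bezout-abs h c
  ... | s , t , eq = (a ℤ.* s) %ℕ n , n%ℕd<d (a ℤ.* s) n , (a ℤ.* s) /ℕ n ℤ.* h ℤ.+ a ℤ.* t ,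
    (begin
      a                                                ≡⟨ sym (ℤ.*-identityʳ a) ⟩
      a ℤ.* 1ℤ                                         ≡⟨ cong (λ z → a ℤ.* z) (sym eq) ⟩
      a ℤ.* (s ℤ.* h ℤ.+ t ℤ.* + n)                    ≡⟨ lem₁ a s h t (+ n) ⟩
      a ℤ.* s ℤ.* h ℤ.+ a ℤ.* t ℤ.* + n                ≡⟨ cong (λ z → z ℤ.* h ℤ.+ a ℤ.* t ℤ.* + n) (a≡a%ℕn+[a/ℕn]*n (a ℤ.* s) n) ⟩
      (r ℤ.+ q ℤ.* + n) ℤ.* h ℤ.+ a ℤ.* t ℤ.* + n      ≡⟨ lem₂ r q (+ n) h (a ℤ.* t) ⟩
      r ℤ.* h ℤ.+ (q ℤ.* h ℤ.+ a ℤ.* t) ℤ.* + n        ∎)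
    where
    open ≡-Reasoning
    r q : ℤ
    r = + ((a ℤ.* s) %ℕ n)
    q = (a ℤ.* s) /ℕ n
    lem₁ : ∀ a s h t n → a ℤ.* (s ℤ.* h ℤ.+ t ℤ.* n) ≡ a ℤ.* s ℤ.* h ℤ.+ a ℤ.* t ℤ.* n
    lem₁ = ℤ-Ring.solve-∀
    lem₂ : ∀ r q n h u → (r ℤ.+ q ℤ.* n) ℤ.* h ℤ.+ u ℤ.* n ≡ r ℤ.* h ℤ.+ (q ℤ.* h ℤ.+ u) ℤ.* n
    lem₂ = ℤ-Ring.solve-∀

  euclid-abs : ∀ {p} (a b : ℤ) → Prime p → p ∣ ∣ a ℤ.* b ∣ → (p ∣ (∣ a ∣)) ⊎ (p ∣ (∣ b ∣))
  euclid-abs a b pr h = euclidsLemma (∣ a ∣) (∣ b ∣) pr (subst (λ t → _ ∣ t) (ℤ.abs-* a b) h)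

  small∤ : ∀ {p k} → 0 < k → k < p → ¬ p ∣ k
  small∤ {k = suc k} _ k<p p∣k = <⇒≱ k<p (∣⇒≤ p∣k)

-- Short words in the reciprocals N / a modulo p.

module Spans where

  open Counting
  open Growth
  open Arith
  open import Data.Nat.Base
  open import Data.Nat.Properties
  open import Data.Nat.Divisibility using (_∣_; n∣m*n; ∣-trans)
  open import Data.Nat.DivMod using (m≡m%n+[m/n]*n; m%n<n)
  open import Data.Nat.Coprimality as Coprime using (Coprime)
  open import Data.Nat.Primality
  open import Data.Integer.Base as ℤ using (ℤ; +_; 1ℤ; ∣_∣)
  import Data.Integer.Properties as ℤ
  import Data.Nat.Tactic.RingSolver as ℕ-Ring
  import Data.Integer.Tactic.RingSolver as ℤ-Ring
  open import Data.Product.Base using (_×_; _,_; proj₁; proj₂)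
  open import Data.Sum.Base using (inj₁; inj₂)
  open import Relation.Nullary using (¬_)
  open import Relation.Binary.PropositionalEquality

  -- The i-th finite difference. For v a = N / a it equals i! N / (a (a+1) … (a+i)).
  diff : (ℕ → ℤ) → ℕ → ℕ → ℤ
  diff v zero    a = v a
  diff v (suc i) a = diff v i a ℤ.- diff v i (suc a)

  module Reciprocals (v : ℕ → ℤ) (N : ℤ) (x J : ℕ)
                     (v-spec : ∀ a → x ≤ a → a ≤ x + J → + a ℤ.* v a ≡ N) where

    private
      pos-suc : ∀ n → + suc n ≡ 1ℤ ℤ.+ + n
      pos-suc n = ℤ.pos-+ 1 n
      le-step : ∀ {a i} → a + suc (suc i) ≤ x + J → a + suc i ≤ x + J
      le-step {a} {i} h = ≤-trans (+-monoʳ-≤ a (n≤1+n (suc i))) h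
      le-shift : ∀ {a i} → a + suc (suc i) ≤ x + J → suc a + suc i ≤ x + J
      le-shift {a} {i} h = ≤-trans (≤-reflexive (sym (+-suc a (suc i)))) h

    -- The closed form of the differences, stated as recurrences between integers so that no
    -- division occurs. Each follows by induction from the defining difference at a and a + 1.
    diff-step : ∀ i a → x ≤ a → a + suc i ≤ x + J →
                (+ (a + suc i) ℤ.* diff v (suc i) a ≡ + suc i ℤ.* diff v i a) ×
                (+ a ℤ.* diff v (suc i) a ≡ + suc i ℤ.* diff v i (suc a))
    diff-step zero a x≤a le =
      trans (cong (λ z → z ℤ.* (v a ℤ.- v (suc a))) (ℤ.pos-+ a 1)) (trans (lem₁ (+ a) (v a) (v (suc a)))
        (trans (cong₂ (λ s t → s ℤ.+ v a ℤ.- t) e₀ e₁) (lem₂ N (v a)))) ,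
      trans (lem₃ (+ a) (v a) (v (suc a))) (trans (cong₂ (λ s t → s ℤ.- t ℤ.+ v (suc a)) e₀ e₁) (lem₄ N (v (suc a))))
      where
      e₀ : + a ℤ.* v a ≡ N
      e₀ = v-spec a x≤a (≤-trans (m≤m+n a 1) le)
      e₁ : (+ a ℤ.+ 1ℤ) ℤ.* v (suc a) ≡ N
      e₁ = trans (cong (λ z → z ℤ.* v (suc a)) (trans (sym (ℤ.pos-+ a 1)) (cong +_ (+-comm a 1))))
        (v-spec (suc a) (m≤n⇒m≤1+n x≤a) (≤-trans (≤-reflexive (+-comm 1 a)) le))
      lem₁ : ∀ a v w → (a ℤ.+ 1ℤ) ℤ.* (v ℤ.- w) ≡ a ℤ.* v ℤ.+ v ℤ.- (a ℤ.+ 1ℤ) ℤ.* w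
      lem₁ = ℤ-Ring.solve-∀
      lem₂ : ∀ N v → N ℤ.+ v ℤ.- N ≡ 1ℤ ℤ.* v
      lem₂ = ℤ-Ring.solve-∀
      lem₃ : ∀ a v w → a ℤ.* (v ℤ.- w) ≡ a ℤ.* v ℤ.- (a ℤ.+ 1ℤ) ℤ.* w ℤ.+ w
      lem₃ = ℤ-Ring.solve-∀
      lem₄ : ∀ N w → N ℤ.- N ℤ.+ w ≡ 1ℤ ℤ.* w
      lem₄ = ℤ-Ring.solve-∀
    diff-step (suc i) a x≤a le =
      trans (cong (λ z → z ℤ.* (h₁ a ℤ.- h₁ (suc a))) c₁) (trans (lem₁ (+ (a + suc i)) (h₁ a) (h₁ (suc a)))
        (trans (cong₂ (λ s t → s ℤ.+ h₁ a ℤ.- t) (proj₁ (diff-step i a x≤a (le-step le)))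
                 (trans (cong (λ z → z ℤ.* h₁ (suc a)) c₂) (proj₁ (diff-step i (suc a) (m≤n⇒m≤1+n x≤a) (le-shift le)))))
          (trans (lem₂ (+ suc i) (h₀ a) (h₀ (suc a))) (cong (λ z → z ℤ.* h₁ a) (sym (pos-suc (suc i))))))) ,
      trans (lem₃ (+ a) (h₁ a) (h₁ (suc a)))
        (trans (cong₂ (λ s t → s ℤ.- t ℤ.+ h₁ (suc a)) (proj₂ (diff-step i a x≤a (le-step le)))
                 (trans (cong (λ z → z ℤ.* h₁ (suc a)) (trans (ℤ.+-comm (+ a) 1ℤ) (sym (pos-suc a))))
                   (proj₂ (diff-step i (suc a) (m≤n⇒m≤1+n x≤a) (le-shift le)))))
          (trans (lem₄ (+ suc i) (h₀ (suc a)) (h₀ (suc (suc a)))) (cong (λ z → z ℤ.* h₁ (suc a)) (sym (pos-suc (suc i))))))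
      where
      h₀ h₁ : ℕ → ℤ
      h₀ = diff v i
      h₁ = diff v (suc i)
      c₁ : + (a + suc (suc i)) ≡ + (a + suc i) ℤ.+ 1ℤ
      c₁ = trans (cong +_ (trans (+-suc a (suc i)) (+-comm 1 (a + suc i)))) (ℤ.pos-+ (a + suc i) 1)
      c₂ : + (a + suc i) ℤ.+ 1ℤ ≡ + (suc a + suc i)
      c₂ = trans (sym (ℤ.pos-+ (a + suc i) 1)) (cong +_ (+-comm (a + suc i) 1))
      lem₁ : ∀ c v w → (c ℤ.+ 1ℤ) ℤ.* (v ℤ.- w) ≡ c ℤ.* v ℤ.+ v ℤ.- (c ℤ.+ 1ℤ) ℤ.* w
      lem₁ = ℤ-Ring.solve-∀
      lem₂ : ∀ s v w → s ℤ.* v ℤ.+ (v ℤ.- w) ℤ.- s ℤ.* w ≡ (1ℤ ℤ.+ s) ℤ.* (v ℤ.- w)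
      lem₂ = ℤ-Ring.solve-∀
      lem₃ : ∀ a v w → a ℤ.* (v ℤ.- w) ≡ a ℤ.* v ℤ.- (a ℤ.+ 1ℤ) ℤ.* w ℤ.+ w
      lem₃ = ℤ-Ring.solve-∀
      lem₄ : ∀ s v w → s ℤ.* v ℤ.- s ℤ.* w ℤ.+ (v ℤ.- w) ≡ (1ℤ ℤ.+ s) ℤ.* (v ℤ.- w)
      lem₄ = ℤ-Ring.solve-∀

    -- In the recurrence (x + i + 1) h (i + 1) = (i + 1) h i, a prime dividing h (i + 1) divides the
    -- right side; i + 1 ≤ J < p excludes the first factor and induction the second. At the start, x
    -- h 0 = N.
    diff-unit : ∀ {p} → Prime p → J < p → ¬ p ∣ ∣ N ∣ → ∀ i → i ≤ J → ¬ p ∣ ∣ diff v i x ∣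
    diff-unit pr J<p p∤N zero    i≤J h = p∤N (subst (λ z → _ ∣ ∣ z ∣) (v-spec x ≤-refl (m≤m+n x J))
      (subst (λ z → _ ∣ z) (sym (ℤ.abs-* (+ x) (v x))) (∣-trans h (n∣m*n x))))
    diff-unit pr J<p p∤N (suc i) i≤J h
      with euclid-abs (+ suc i) (diff v i x) pr (subst (λ z → _ ∣ ∣ z ∣) (proj₁ (diff-step i x ≤-refl (+-monoʳ-≤ x i≤J)))
             (subst (λ z → _ ∣ z) (sym (ℤ.abs-* (+ (x + suc i)) (diff v (suc i) x))) (∣-trans h (n∣m*n (x + suc i)))))
    ... | inj₁ p∣i = small∤ (s≤s z≤n) (≤-<-trans i≤J J<p) p∣i
    ... | inj₂ p∣h = diff-unit pr J<p p∤N i (<⇒≤ i≤J) p∣h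

    -- For x > J the quotient |h (i-1) x| / |h i x| = (x + i) / i is at least 2.
    diff-size : J ≤ x → 0 < ∣ v x ∣ → ∀ i → i ≤ J → (0 < ∣ diff v i x ∣) × (2 ^ i ≤ ∣ v x ∣)
    diff-size J≤x pos i i≤J = proj₁ (go i i≤J) ,
      ≤-trans (m≤m*n (2 ^ i) _ {{>-nonZero (proj₁ (go i i≤J))}}) (proj₂ (go i i≤J))
      where
      go : ∀ i → i ≤ J → (0 < ∣ diff v i x ∣) × (2 ^ i * ∣ diff v i x ∣ ≤ ∣ v x ∣)
      go zero    _   = pos , ≤-reflexive (*-identityˡ _)
      go (suc i) i≤J with go i (<⇒≤ i≤J)
      ... | 0<h , bound = n≢0⇒n>0 h′≢0 , (begin
          2 * 2 ^ i * ∣h′∣     ≡⟨ lem₁ (2 ^ i) ∣h′∣ ⟩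
          2 ^ i * (2 * ∣h′∣)   ≤⟨ *-monoʳ-≤ (2 ^ i) (*-cancelˡ-≤ (suc i) scaled) ⟩
          2 ^ i * ∣h∣          ≤⟨ bound ⟩
          ∣ v x ∣              ∎)
        where
        open ≤-Reasoning
        ∣h∣ ∣h′∣ : ℕ
        ∣h∣ = ∣ diff v i x ∣
        ∣h′∣ = ∣ diff v (suc i) x ∣
        relation : (x + suc i) * ∣h′∣ ≡ suc i * ∣h∣
        relation = trans (sym (ℤ.abs-* (+ (x + suc i)) (diff v (suc i) x)))
          (trans (cong ∣_∣ (proj₁ (diff-step i x ≤-refl (+-monoʳ-≤ x i≤J)))) (ℤ.abs-* (+ suc i) (diff v i x)))
        h′≢0 : ¬ ∣h′∣ ≡ 0
        h′≢0 eq = <⇒≢ 0<h (sym (*-cancelˡ-≡ ∣h∣ 0 (suc i) (trans (sym relation) (trans (cong ((x + suc i) *_) eq)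
          (trans (*-zeroʳ (x + suc i)) (sym (*-zeroʳ (suc i))))))))
        lem₁ : ∀ a b → 2 * a * b ≡ a * (2 * b)
        lem₁ = ℕ-Ring.solve-∀
        lem₂ : ∀ i h → suc i * (2 * h) ≡ (suc i + suc i) * h
        lem₂ = ℕ-Ring.solve-∀
        scaled : suc i * (2 * ∣h′∣) ≤ suc i * ∣h∣
        scaled = begin
          suc i * (2 * ∣h′∣)      ≡⟨ lem₂ i ∣h′∣ ⟩
          (suc i + suc i) * ∣h′∣  ≤⟨ *-monoˡ-≤ ∣h′∣ (+-monoˡ-≤ (suc i) (≤-trans i≤J J≤x)) ⟩
          (x + suc i) * ∣h′∣      ≡⟨ relation ⟩
          suc i * ∣h∣             ∎

  -- Mixed radix expansion: (x + i) h i = i h (i-1) turns the carry of a digit of h i into digits of h (i-1).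
  module _ (p : ℕ) (0<p : 0 < p) where
    open Period p
    open Modulo p 0<p

    module Digits (d : ℤ → ℕ) (sn : Seminorm d) (v : ℕ → ℤ) (N : ℤ) (J Y : ℕ) (0<J : 0 < J)
                  (v-spec : ∀ a → J * Y ≤ a → a ≤ J * Y + J → + a ℤ.* v a ≡ N)
                  (η : ℕ) (small : ∀ i → i ≤ J → d (v (J * Y + i)) ≤ η) where
      open Seminorm sn
      open Reciprocals v N (J * Y) J v-spec

      x T : ℕ
      x = J * Y
      -- The price of one digit: at most x + J copies of a difference, which is a combination of
      -- values with at most 2^J terms.
      T = 2 ^ J * (x + J)

      diff-bound : ∀ i a → x ≤ a → a + i ≤ x + J → d (diff v i a) ≤ 2 ^ i * η
      diff-bound zero    a x≤a le = ≤-trans (subst (λ b → d (v b) ≤ η) (m+[n∸m]≡n x≤a)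
        (small (a ∸ x) (≤-trans (∸-monoˡ-≤ x (≤-trans (m≤m+n a 0) le)) (≤-reflexive (m+n∸m≡n x J))))) (≤-reflexive (sym (*-identityˡ η)))
      diff-bound (suc i) a x≤a le = ≤-trans (subadd-minus (diff v i a) (diff v i (suc a)))
        (≤-trans (+-mono-≤ (diff-bound i a x≤a (≤-trans (+-monoʳ-≤ a (n≤1+n i)) le))
                           (diff-bound i (suc a) (m≤n⇒m≤1+n x≤a) (≤-trans (≤-reflexive (sym (+-suc a i))) le)))
          (≤-reflexive (lem (2 ^ i) η)))
        where
        lem : ∀ a b → a * b + a * b ≡ 2 * a * b
        lem = ℕ-Ring.solve-∀

      digits : ∀ i → i ≤ J → ∀ A → A < Y ^ suc i → d (+ A ℤ.* diff v i x) ≤ suc i * T * η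
      digits zero    _   A A< = begin
        d (+ A ℤ.* v x)  ≤⟨ multiple A (v x) ⟩
        A * d (v x)      ≤⟨ *-mono-≤ (≤-trans (<⇒≤ A<) (≤-trans (≤-reflexive (*-identityʳ Y)) Y≤T)) (subst (λ b → d (v b) ≤ η) (+-identityʳ x) (small 0 z≤n)) ⟩
        T * η            ≡⟨ cong (_* η) (sym (*-identityˡ T)) ⟩
        1 * T * η        ∎
        where
        open ≤-Reasoning
        Y≤T : Y ≤ T
        Y≤T = ≤-trans (m≤n*m Y J {{>-nonZero 0<J}}) (≤-trans (m≤m+n x J) (m≤n*m (x + J) (2 ^ J) {{m^n≢0 2 J}}))
      digits (suc i) i<J A A< = begin
        d (+ A ℤ.* h)                                ≡⟨ cong d split ⟩
        d (+ D ℤ.* h ℤ.+ + (Q * suc i) ℤ.* diff v i x) ≤⟨ subadd _ _ ⟩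
        d (+ D ℤ.* h) + d (+ (Q * suc i) ℤ.* diff v i x)
          ≤⟨ +-mono-≤ low (digits i (<⇒≤ i<J) (Q * suc i) carry) ⟩
        T * η + suc i * T * η                        ≡⟨ lem T η (suc i) ⟩
        suc (suc i) * T * η                          ∎
        where
        open ≤-Reasoning
        h : ℤ
        h = diff v (suc i) x
        b D Q : ℕ
        b = x + suc i
        instance
          b≢0 : NonZero b
          b≢0 = subst NonZero (sym (+-suc x i)) _
        D = A % b
        Q = A / b
        lem : ∀ T η s → T * η + s * T * η ≡ (1 + s) * T * η
        lem = ℕ-Ring.solve-∀
        split : + A ℤ.* h ≡ + D ℤ.* h ℤ.+ + (Q * suc i) ℤ.* diff v i x
        split = trans (cong (λ z → + z ℤ.* h) (m≡m%n+[m/n]*n A b))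
          (trans (cong (λ z → z ℤ.* h) (trans (ℤ.pos-+ D (Q * b)) (cong (λ z → + D ℤ.+ z) (ℤ.pos-* Q b))))
          (trans (dist (+ D) (+ Q) (+ b) h)
          (trans (cong (λ z → + D ℤ.* h ℤ.+ + Q ℤ.* z) (proj₁ (diff-step i x ≤-refl (+-monoʳ-≤ x i<J))))
            (trans (cong (λ z → + D ℤ.* h ℤ.+ z) (sym (ℤ.*-assoc (+ Q) (+ suc i) (diff v i x))))
              (cong (λ z → + D ℤ.* h ℤ.+ z ℤ.* diff v i x) (sym (ℤ.pos-* Q (suc i))))))))
          where
          dist : ∀ D Q b h → (D ℤ.+ Q ℤ.* b) ℤ.* h ≡ D ℤ.* h ℤ.+ Q ℤ.* (b ℤ.* h)
          dist = ℤ-Ring.solve-∀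
        low : d (+ D ℤ.* h) ≤ T * η
        low = begin
          d (+ D ℤ.* h)                ≤⟨ multiple D h ⟩
          D * d h                      ≤⟨ *-mono-≤ (≤-trans (<⇒≤ (m%n<n A b)) (+-monoʳ-≤ x i<J)) (diff-bound (suc i) x ≤-refl (+-monoʳ-≤ x i<J)) ⟩
          (x + J) * (2 ^ suc i * η)    ≤⟨ *-monoʳ-≤ (x + J) (*-monoˡ-≤ η (^-monoʳ-≤ 2 i<J)) ⟩
          (x + J) * (2 ^ J * η)        ≡⟨ rearrange (x + J) (2 ^ J) η ⟩
          T * η                        ∎
          where
          rearrange : ∀ a b c → a * (b * c) ≡ b * a * c
          rearrange = ℕ-Ring.solve-∀
        -- The quotient loses a factor of at least J Y and the recurrence puts back i + 1 ≤ J, so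
        -- the carry is smaller than A by the factor Y. This is the reason for starting at x = J Y.
        carry : Q * suc i < Y ^ suc i
        carry = *-cancelˡ-< Y (Q * suc i) (Y ^ suc i) (begin-strict
          Y * (Q * suc i)   ≡⟨ rearrange Y Q (suc i) ⟩
          Q * (suc i * Y)   ≤⟨ *-monoʳ-≤ Q (*-monoˡ-≤ Y i<J) ⟩
          Q * x             ≤⟨ *-monoʳ-≤ Q (m≤m+n x (suc i)) ⟩
          Q * b             ≤⟨ m≤n+m (Q * b) D ⟩
          D + Q * b         ≡⟨ sym (m≡m%n+[m/n]*n A b) ⟩
          A                 <⟨ A< ⟩
          Y ^ suc (suc i)   ∎)
          where
          rearrange : ∀ a b c → a * (b * c) ≡ b * (c * a)
          rearrange = ℕ-Ring.solve-∀

    -- The trivial word length, which is good enough when p is a small power of Y.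
    unit-span : ∀ {g} → Prime p → ¬ p ∣ ∣ g 0 ∣ → Span p 0 g
    unit-span {g} pr p∤g d sn η h a with multiple-mod (g 0) 0<p (Coprime.sym (prime-coprime pr p∤g)) a
    ... | A , A<p , w , refl = ≤-trans (periodic (+ A ℤ.* g 0) w)
      (≤-trans (multiple A (g 0)) (*-mono-≤ (<⇒≤ A<p) (h 0 z≤n)))
      where open Seminorm sn

    -- The top difference h J is a unit modulo p, so every residue is A h J with A < p ≤ Y^(J+1),
    -- and A expands into J + 1 digits. The length is linear in Y for fixed J, although p may be as
    -- large as Y^(J+1).
    reciprocals-span : ∀ v N J Y → 0 < J →
      (∀ a → J * Y ≤ a → a ≤ J * Y + J → + a ℤ.* v a ≡ N) →
      Prime p → J < p → ¬ p ∣ ∣ N ∣ → p ≤ Y ^ suc J →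
      Span (suc J * (2 ^ J * (J * Y + J))) J (λ i → v (J * Y + i))
    reciprocals-span v N J Y 0<J v-spec pr J<p p∤N p≤ d sn η h a
      with multiple-mod (diff v J (J * Y)) 0<p
             (Coprime.sym (prime-coprime pr (Reciprocals.diff-unit v N (J * Y) J v-spec pr J<p p∤N J ≤-refl))) a
    ... | A , A<p , w , refl = ≤-trans (Seminorm.periodic sn (+ A ℤ.* diff v J (J * Y)) w)
      (Digits.digits d sn v N J Y 0<J v-spec η h J ≤-refl A (<-≤-trans A<p p≤))

-- Sums over lists.

module ListSum where

  open import Data.Nat.Base
  open import Data.Nat.Properties
  open import Data.List.Base using (List; []; _∷_; _++_; length; map)
  open import Data.List.Relation.Unary.All using (All; []; _∷_)
  open import Data.List.Relation.Unary.Any using (here; there)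
  open import Data.List.Membership.Propositional using (_∈_)
  open import Function.Base using (_∘_)
  open import Relation.Binary.PropositionalEquality

  sumBy : (ℕ → ℕ) → List ℕ → ℕ
  sumBy f []       = 0
  sumBy f (x ∷ xs) = f x + sumBy f xs

  sumBy-++ : ∀ f xs ys → sumBy f (xs ++ ys) ≡ sumBy f xs + sumBy f ys
  sumBy-++ f []       ys = refl
  sumBy-++ f (x ∷ xs) ys = trans (cong (f x +_) (sumBy-++ f xs ys)) (sym (+-assoc (f x) _ _))

  sumBy-map : ∀ f (g : ℕ → ℕ) xs → sumBy f (map g xs) ≡ sumBy (f ∘ g) xs
  sumBy-map f g []       = refl
  sumBy-map f g (x ∷ xs) = cong (f (g x) +_) (sumBy-map f g xs)

  sumBy-*ˡ : ∀ c f xs → sumBy (λ x → c * f x) xs ≡ c * sumBy f xs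
  sumBy-*ˡ c f []       = sym (*-zeroʳ c)
  sumBy-*ˡ c f (x ∷ xs) = trans (cong (c * f x +_) (sumBy-*ˡ c f xs)) (sym (*-distribˡ-+ c (f x) _))

  sumBy-cong : ∀ {f g xs} → All (λ x → f x ≡ g x) xs → sumBy f xs ≡ sumBy g xs
  sumBy-cong []       = refl
  sumBy-cong (h ∷ hs) = cong₂ _+_ h (sumBy-cong hs)

  sumBy-bound : ∀ {f xs} c → All (λ x → f x ≤ c) xs → sumBy f xs ≤ length xs * c
  sumBy-bound c []       = z≤n
  sumBy-bound c (h ∷ hs) = +-mono-≤ h (sumBy-bound c hs)

  ∈⇒≤sumBy : ∀ {f xs x} → x ∈ xs → f x ≤ sumBy f xs
  ∈⇒≤sumBy (here refl) = m≤m+n _ _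
  ∈⇒≤sumBy {f} {y ∷ _} (there h) = ≤-trans (∈⇒≤sumBy h) (m≤n+m _ (f y))

-- Prescribing ∑ N/k modulo p with few and small k.

module Covering where

  open Counting
  open Growth
  open Arith
  open Spans
  open ListSum
  open import Data.Nat.Base
  open import Data.Nat.Properties
  open import Data.Nat.Divisibility
  open import Data.Nat.Primality
  open import Data.Integer.Base as ℤ using (ℤ; +_)
  import Data.Integer.Properties as ℤ
  import Data.Nat.Tactic.RingSolver as ℕ-Ring
  open import Data.List.Base using (List; []; _∷_; length)
  open import Data.List.Relation.Unary.All as All using (All; []; _∷_)
  open import Data.List.Relation.Unary.Unique.Propositional using (Unique)
  open import Data.Product.Base using (_×_; _,_; proj₁; proj₂)
  open import Data.Sum.Base using (inj₁; inj₂)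
  open import Relation.Nullary using (¬_; yes; no; contradiction)
  open import Relation.Binary.Definitions using (tri<; tri≈; tri>)
  open import Relation.Binary.PropositionalEquality hiding (J)

  total-quotients : ∀ N ks → total (λ k → + (N ÷ k)) ks ≡ + sumBy (N ÷_) ks
  total-quotients N []       = refl
  total-quotients N (k ∷ ks) = trans (cong (λ t → + (N ÷ k) ℤ.+ t) (total-quotients N ks)) (sym (ℤ.pos-+ (N ÷ k) _))

  -- `light` limits what an expansion step takes from the numerator, `cheap` what it adds to the sum
  -- of the parts.
  record Cover (p N Y r : ℕ) : Set where
    field
      ks     : List ℕ
      unique : Unique ks
      good   : All (λ k → 0 < k × ¬ p ∣ k × k ∣ N) ks
      light  : Y ^ 2 * sumBy (N ÷_) ks ≤ N
      cheap  : sumBy (λ k → k) ks ≤ Y ^ 22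
      w      : ℤ
      sums   : + sumBy (N ÷_) ks ≡ + r ℤ.+ w ℤ.* + p

  -- With J = 2 H and e = H * suc s doublings, 4 e t steps are made with words of length t ≤ suc J *
  -- (2^J * (2 J)) * Y. The hypothesis `ready` makes their number at most Y².
  growthConstant : ℕ → ℕ
  growthConstant H = 4 * H * (suc (2 * H) * (2 ^ (2 * H) * (2 * (2 * H))))

  module _ (H s : ℕ) (0<H : 0 < H) (0<s : 0 < s) (ready : growthConstant H * suc s ≤ 2 ^ s)
           (p N : ℕ) (pr : Prime p) (p≤ : p ≤ 2 ^ (H * suc s)) (0<N : 0 < N) (p∤N : ¬ p ∣ N)
           (divisors : ∀ k → 0 < k → k ≤ (2 ^ s) ^ 15 → ¬ p ∣ k → k ∣ N) (r : ℕ) where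

    private
      Y e J : ℕ
      Y = 2 ^ s
      e = H * suc s
      J = 2 * H
      0<p : 0 < p
      0<p = n≢0⇒n>0 (≢-nonZero⁻¹ p {{prime⇒nonZero pr}})
      0<J : 0 < J
      0<J = ≤-trans 0<H (m≤m+n H (H + 0))
      2≤Y : 2 ≤ Y
      2≤Y = ^-monoʳ-≤ 2 0<s
      instance
        Y≢0 : NonZero Y
        Y≢0 = m^n≢0 2 s
      0<Y : 0 < Y
      0<Y = ≤-trans (s≤s z≤n) 2≤Y
      v : ℕ → ℤ
      v k = + (N ÷ k)
      Y^ : ∀ {a b} → a ≤ b → Y ^ a ≤ Y ^ b
      Y^ = ^-monoʳ-≤ Y

      -- At most w₂ numbers k are used. Each is at least kmin, so ∑ N/k ≤ w₂ N / kmin; each is at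
      -- most Y^15, so their sum is at most Y^7 * Y^15.
      assemble : ∀ {J fam w₂} → ∀ kmin → 0 < kmin →
        (∀ {k} → Modulo.Families.InFamilies p 0<p J fam 0 w₂ k → kmin ≤ k × k ≤ Y ^ 15 × ¬ p ∣ k) →
        w₂ ≤ Y ^ 7 → Y ^ 2 * w₂ ≤ kmin → Modulo.Families.Reached p 0<p J fam v 0 w₂ (+ r) → Cover p N Y r
      assemble {J} {fam} {w₂} kmin 0<kmin members w₂≤ light R = record
        { ks = ks ; unique = unique ; good = good
        ; light = *-cancelʳ-≤ (Y ^ 2 * Σ) N kmin {{>-nonZero 0<kmin}} (begin
            Y ^ 2 * Σ * kmin    ≡⟨ trans (*-assoc (Y ^ 2) Σ kmin) (cong (Y ^ 2 *_) (*-comm Σ kmin)) ⟩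
            Y ^ 2 * (kmin * Σ)  ≡⟨ cong (Y ^ 2 *_) (sym (sumBy-*ˡ kmin (N ÷_) ks)) ⟩
            Y ^ 2 * sumBy (λ k → kmin * (N ÷ k)) ks ≤⟨ *-monoʳ-≤ (Y ^ 2) (≤-trans (sumBy-bound N each) (*-monoˡ-≤ N short)) ⟩
            Y ^ 2 * (w₂ * N)    ≡⟨ sym (*-assoc (Y ^ 2) w₂ N) ⟩
            Y ^ 2 * w₂ * N      ≤⟨ *-monoˡ-≤ N light ⟩
            kmin * N            ≡⟨ *-comm kmin N ⟩
            N * kmin            ∎)
        ; cheap = begin
            sumBy (λ k → k) ks  ≤⟨ sumBy-bound (Y ^ 15) (All.map (λ m → proj₁ (proj₂ (members m))) in-families) ⟩
            length ks * Y ^ 15  ≤⟨ *-monoˡ-≤ (Y ^ 15) (≤-trans short w₂≤) ⟩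
            Y ^ 7 * Y ^ 15      ≡⟨ sym (^-distribˡ-+-* Y 7 15) ⟩
            Y ^ 22              ∎
        ; w = w
        ; sums = trans (sym (total-quotients N ks)) sums }
        where
        open ≤-Reasoning
        open Modulo p 0<p
        open Families.Reached R renaming (members to in-families)
        Σ : ℕ
        Σ = sumBy (N ÷_) ks
        good : All (λ k → 0 < k × ¬ p ∣ k × k ∣ N) ks
        good = All.map (λ m → let lo , hi , p∤k = members m; 0<k = ≤-trans 0<kmin lo in 0<k , p∤k , divisors _ 0<k hi p∤k) in-families
        each : All (λ k → kmin * (N ÷ k) ≤ N) ks
        each = All.zipWith (λ {k} (m , g) → ≤-trans (*-monoˡ-≤ (N ÷ k) (proj₁ (members m)))
                 (≤-reflexive (trans (*-comm k (N ÷ k)) (÷-exact (proj₂ (proj₂ g)))))) (in-families , good)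

      eH≤ : ∀ c → 4 * H * c * suc s ≤ 2 ^ s → 4 * e * c ≤ Y
      eH≤ c h = ≤-trans (≤-reflexive (lem H s c)) h
        where
        lem : ∀ H s c → 4 * (H * suc s) * c ≡ 4 * H * c * suc s
        lem = ℕ-Ring.solve-∀

      C : ℕ
      C = suc J * (2 ^ J * (2 * J))

      0<2^J : 0 < 2 ^ J
      0<2^J = n≢0⇒n>0 (≢-nonZero⁻¹ (2 ^ J) {{m^n≢0 2 J}})

      4e≤Y : 4 * e ≤ Y
      4e≤Y = ≤-trans (m≤m*n (4 * e) C {{>-nonZero 0<C}}) (eH≤ C ready)
        where
        0<C : 0 < C
        0<C = *-mono-≤ {1} {suc J} (s≤s z≤n) (*-mono-≤ {1} 0<2^J (*-mono-≤ {1} {2} (s≤s z≤n) 0<J))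

      w₂-form : ∀ e t → e * (t + t) + e * (t + t) ≡ 4 * e * t
      w₂-form = ℕ-Ring.solve-∀

    -- The candidates are 1 modulo p, so p divides no candidate, each N/k is a unit, and words of
    -- length p suffice. The summand p Y³ makes them large enough for the at most p Y steps to keep
    -- ∑ N/k below N / Y².
    cover-small : p ≤ Y ^ 6 → Cover p N Y r
    cover-small p≤Y⁶ = assemble {0} {fam} {w₂} kmin 0<kmin members w₂≤ light
      (residues v p e 0<p p≤ (λ {j} {j′} _ _ _ _ eq → distinct j j′ eq) (λ j j< → unit-span p 0<p pr (unit j j<)) (+ r))
      where
      open Modulo p 0<p
      fam : ℕ → ℕ → ℕ
      fam j _ = suc (p * (Y ^ 3 + j))
      open Families 0 fam
      w₂ kmin : ℕ
      w₂ = e * (p + p) + e * (p + p)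
      kmin = p * Y ^ 3
      0<kmin : 0 < kmin
      0<kmin = *-mono-≤ {1} 0<p (≤-trans (s≤s z≤n) (≤-trans 2≤Y (≤-trans (≤-reflexive (sym (^-identityʳ Y))) (Y^ {1} {3} (s≤s z≤n)))))
      distinct : ∀ j j′ → fam j 0 ≡ fam j′ 0 → j ≡ j′
      distinct j j′ eq = +-cancelˡ-≡ (Y ^ 3) j j′ (*-cancelˡ-≡ _ _ p {{>-nonZero 0<p}} (suc-injective eq))
      w₂≤pY : w₂ ≤ p * Y
      w₂≤pY = begin
        w₂          ≡⟨ w₂-form e p ⟩
        4 * e * p   ≤⟨ *-monoˡ-≤ p 4e≤Y ⟩
        Y * p       ≡⟨ *-comm Y p ⟩
        p * Y       ∎
        where open ≤-Reasoning
      w₂≤ : w₂ ≤ Y ^ 7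
      w₂≤ = ≤-trans w₂≤pY (≤-trans (*-monoˡ-≤ Y p≤Y⁶) (≤-reflexive (*-comm (Y ^ 6) Y)))
      light : Y ^ 2 * w₂ ≤ kmin
      light = ≤-trans (*-monoʳ-≤ (Y ^ 2) w₂≤pY) (≤-reflexive (lem Y p))
        where
        lem : ∀ Y p → Y * (Y * 1) * (p * Y) ≡ p * (Y * (Y * (Y * 1)))
        lem = ℕ-Ring.solve-∀
      p∤fam : ∀ j i → ¬ p ∣ fam j i
      p∤fam j i h = small∤ (s≤s z≤n) (nonTrivial⇒n>1 p {{prime⇒nonTrivial pr}})
        (∣m+n∣m⇒∣n (subst (p ∣_) (+-comm 1 _) h) (m∣m*n (Y ^ 3 + j)))
      fam≤ : ∀ j i → j < w₂ → fam j i ≤ Y ^ 15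
      fam≤ j i j< = begin
        suc (p * (Y ^ 3 + j))            ≤⟨ s≤s (*-mono-≤ p≤Y⁶ (+-mono-≤ (Y^ {3} {7} (s≤s (s≤s (s≤s z≤n)))) (<⇒≤ (≤-trans j< w₂≤)))) ⟩
        suc (Y ^ 6 * (Y ^ 7 + Y ^ 7))    ≤⟨ +-monoˡ-≤ _ (≤-trans 0<Y¹³ (m≤m+n _ _)) ⟩
        2 * Y ^ 13 + Y ^ 6 * (Y ^ 7 + Y ^ 7) ≡⟨ lem (Y ^ 6) (Y ^ 7) (Y ^ 13) (^-distribˡ-+-* Y 6 7) ⟩
        2 * (2 * Y ^ 13)                 ≤⟨ *-mono-≤ 2≤Y (*-monoˡ-≤ (Y ^ 13) 2≤Y) ⟩
        Y ^ 15                           ∎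
        where
        open ≤-Reasoning
        0<Y¹³ : 1 ≤ Y ^ 13
        0<Y¹³ = n≢0⇒n>0 (≢-nonZero⁻¹ (Y ^ 13) {{m^n≢0 Y 13}})
        lem : ∀ a b c → c ≡ a * b → 2 * c + a * (b + b) ≡ 2 * (2 * c)
        lem a b c refl = lem′ a b
          where
          lem′ : ∀ a b → 2 * (a * b) + a * (b + b) ≡ 2 * (2 * (a * b))
          lem′ = ℕ-Ring.solve-∀
      members : ∀ {k} → InFamilies 0 w₂ k → kmin ≤ k × k ≤ Y ^ 15 × ¬ p ∣ k
      members (j , i , _ , j< , _ , refl) =
        m≤n⇒m≤1+n (*-monoʳ-≤ p (m≤m+n (Y ^ 3) j)) , fam≤ j i j< , p∤fam j i
      unit : ∀ j → j < w₂ → ¬ p ∣ N ÷ fam j 0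
      unit j j< h = p∤N (subst (p ∣_) (÷-exact (divisors (fam j 0) (s≤s z≤n) (fam≤ j 0 j<) (p∤fam j 0))) (∣-trans h (m∣m*n (fam j 0))))

    -- For a fixed first factor l = Y^5 + j, the values N/(l a) are reciprocals of consecutive a
    -- with numerator N/l. So j is the number of the step and i the choice within it. Both factors
    -- of a candidate are below p, hence p does not divide it.
    cover-large : Y ^ 6 < p → Cover p N Y r
    cover-large Y⁶<p = assemble {J} {fam} {w₂} (Y ^ 5) 0<Y⁵ members w₂≤Y⁷ light
      (residues v t e 0<t p≤ distinct spans (+ r))
      where
      open Modulo p 0<p
      x : ℕ
      x = J * Y
      fam : ℕ → ℕ → ℕ
      fam j i = (Y ^ 5 + j) * (x + i)
      open Families J fam
      t w₂ : ℕ
      t = suc J * (2 ^ J * (x + J))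
      w₂ = e * (t + t) + e * (t + t)
      0<Y^ : ∀ n → 0 < Y ^ n
      0<Y^ n = n≢0⇒n>0 (≢-nonZero⁻¹ (Y ^ n) {{m^n≢0 Y n}})
      0<Y⁵ = 0<Y^ 5
      0<x : 0 < x
      0<x = *-mono-≤ {1} 0<J 0<Y
      0<t : 0 < t
      0<t = *-mono-≤ {1} {suc J} (s≤s z≤n) (*-mono-≤ {1} 0<2^J (≤-trans 0<x (m≤m+n x J)))
      x+J≤ : x + J ≤ 2 * J * Y
      x+J≤ = ≤-trans (+-monoʳ-≤ x (m≤m*n J Y)) (≤-reflexive (lem J Y))
        where
        lem : ∀ J Y → J * Y + J * Y ≡ 2 * J * Y
        lem = ℕ-Ring.solve-∀
      2J≤Y : 2 * J ≤ Y
      2J≤Y = ≤-trans (m≤n*m (2 * J) (4 * e * suc J * 2 ^ J) {{>-nonZero pos}}) (≤-trans (≤-reflexive (lem e (suc J) (2 ^ J) J)) (eH≤ C ready))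
        where
        pos : 0 < 4 * e * suc J * 2 ^ J
        pos = *-mono-≤ {1} (*-mono-≤ {1} {4 * e} (*-mono-≤ {1} {4} (s≤s z≤n) (*-mono-≤ {1} 0<H (s≤s z≤n))) (s≤s z≤n)) 0<2^J
        lem : ∀ e a b J → 4 * e * a * b * (2 * J) ≡ 4 * e * (a * (b * (2 * J)))
        lem = ℕ-Ring.solve-∀
      x+J≤Y² : x + J ≤ Y ^ 2
      x+J≤Y² = ≤-trans x+J≤ (≤-trans (*-monoˡ-≤ Y 2J≤Y) (≤-reflexive (cong (Y *_) (sym (*-identityʳ Y)))))
      w₂≤Y² : w₂ ≤ Y ^ 2
      w₂≤Y² = begin
        w₂                                             ≡⟨ w₂-form e t ⟩
        4 * e * (suc J * (2 ^ J * (x + J)))            ≤⟨ *-monoʳ-≤ (4 * e) (*-monoʳ-≤ (suc J) (*-monoʳ-≤ (2 ^ J) x+J≤)) ⟩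
        4 * e * (suc J * (2 ^ J * (2 * J * Y)))        ≡⟨ lem (4 * e) (suc J) (2 ^ J) (2 * J) Y ⟩
        4 * e * (suc J * (2 ^ J * (2 * J))) * Y        ≤⟨ *-monoˡ-≤ Y (eH≤ C ready) ⟩
        Y * Y                                          ≡⟨ cong (Y *_) (sym (*-identityʳ Y)) ⟩
        Y ^ 2                                          ∎
        where
        open ≤-Reasoning
        lem : ∀ a b c d Y → a * (b * (c * (d * Y))) ≡ a * (b * (c * d)) * Y
        lem = ℕ-Ring.solve-∀
      w₂≤Y⁷ : w₂ ≤ Y ^ 7
      w₂≤Y⁷ = ≤-trans w₂≤Y² (Y^ {2} {7} (s≤s (s≤s z≤n)))
      light : Y ^ 2 * w₂ ≤ Y ^ 5
      light = ≤-trans (*-monoʳ-≤ (Y ^ 2) w₂≤Y²) (≤-trans (≤-reflexive (sym (^-distribˡ-+-* Y 2 2))) (Y^ {4} {5} (n≤1+n 4)))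
      l≤ : ∀ {j} → j < w₂ → Y ^ 5 + j ≤ Y ^ 6
      l≤ {j} j< = begin
        Y ^ 5 + j      ≤⟨ +-monoʳ-≤ (Y ^ 5) (<⇒≤ (≤-trans j< (≤-trans w₂≤Y² (Y^ {2} {5} (s≤s (s≤s z≤n)))))) ⟩
        Y ^ 5 + Y ^ 5  ≡⟨ cong (λ z → Y ^ 5 + z) (sym (+-identityʳ (Y ^ 5))) ⟩
        2 * Y ^ 5      ≤⟨ *-monoˡ-≤ (Y ^ 5) 2≤Y ⟩
        Y ^ 6          ∎
        where open ≤-Reasoning
      i-range : ∀ {i} → i ≤ J → 0 < x + i × x + i ≤ Y ^ 2
      i-range i≤J = ≤-trans 0<x (m≤m+n x _) , ≤-trans (+-monoʳ-≤ x i≤J) x+J≤Y²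
      Y²<p : Y ^ 2 < p
      Y²<p = ≤-<-trans (Y^ {2} {6} (s≤s (s≤s z≤n))) Y⁶<p
      p∤prod : ∀ j a → j < w₂ → 0 < a → a ≤ Y ^ 2 → ¬ p ∣ (Y ^ 5 + j) * a
      p∤prod j a j< 0<a a≤ h with euclidsLemma (Y ^ 5 + j) a pr h
      ... | inj₁ p∣l = small∤ (≤-trans 0<Y⁵ (m≤m+n (Y ^ 5) j)) (≤-<-trans (l≤ j<) Y⁶<p) p∣l
      ... | inj₂ p∣a = small∤ 0<a (≤-<-trans a≤ Y²<p) p∣a
      prod≤ : ∀ j a → j < w₂ → a ≤ Y ^ 2 → (Y ^ 5 + j) * a ≤ Y ^ 15
      prod≤ j a j< a≤ = ≤-trans (*-mono-≤ (l≤ j<) a≤) (≤-trans (≤-reflexive (sym (^-distribˡ-+-* Y 6 2)))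
        (Y^ {8} {15} (m≤m+n 8 7)))
      members : ∀ {k} → InFamilies 0 w₂ k → Y ^ 5 ≤ k × k ≤ Y ^ 15 × ¬ p ∣ k
      members (j , i , _ , j< , i≤J , refl) with i-range i≤J
      ... | 0<a , a≤ = ≤-trans (m≤m+n (Y ^ 5) j) (m≤m*n (Y ^ 5 + j) (x + i) {{>-nonZero 0<a}}) ,
        prod≤ j (x + i) j< a≤ , p∤prod j (x + i) j< 0<a a≤
      -- As j′ is below Y² and x + i′ is at most Y², (Y^5 + j′) (x + i′) stays below Y^5 (x + i′ +
      -- 1). So a larger second factor outweighs any difference of the first ones.
      not-less : ∀ {j j′ i i′} → j < j′ → j′ < w₂ → i ≤ J → i′ ≤ J → ¬ fam j i ≡ fam j′ i′
      not-less {j} {j′} {i} {i′} j<j′ j′< i≤J i′≤J eq with i ≤? i′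
      ... | yes i≤i′ = <⇒≢ (≤-<-trans (*-monoʳ-≤ (Y ^ 5 + j) (+-monoʳ-≤ x i≤i′))
              (*-monoˡ-< (x + i′) {{>-nonZero (proj₁ (i-range i′≤J))}} (+-monoʳ-< (Y ^ 5) j<j′))) eq
      ... | no i≰i′ = <⇒≢ (begin-strict
          (Y ^ 5 + j′) * (x + i′)                ≡⟨ *-distribʳ-+ (x + i′) (Y ^ 5) j′ ⟩
          Y ^ 5 * (x + i′) + j′ * (x + i′)       <⟨ +-monoʳ-< (Y ^ 5 * (x + i′)) (<-≤-trans (*-monoˡ-< (x + i′) {{>-nonZero (proj₁ (i-range i′≤J))}} j′<) (*-mono-≤ w₂≤Y² (proj₂ (i-range i′≤J)))) ⟩
          Y ^ 5 * (x + i′) + Y ^ 2 * Y ^ 2       ≤⟨ +-monoʳ-≤ _ (≤-trans (≤-reflexive (sym (^-distribˡ-+-* Y 2 2))) (Y^ {4} {5} (n≤1+n 4))) ⟩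
          Y ^ 5 * (x + i′) + Y ^ 5               ≡⟨ lem (Y ^ 5) (x + i′) ⟩
          Y ^ 5 * suc (x + i′)                   ≤⟨ *-monoʳ-≤ (Y ^ 5) (≤-trans (≤-reflexive (sym (+-suc x i′))) (+-monoʳ-≤ x (≰⇒> i≰i′))) ⟩
          Y ^ 5 * (x + i)                        ≤⟨ *-monoˡ-≤ (x + i) (m≤m+n (Y ^ 5) j) ⟩
          (Y ^ 5 + j) * (x + i)                  ∎) (sym eq)
        where
        open ≤-Reasoning
        lem : ∀ a b → a * b + a ≡ a * suc b
        lem = ℕ-Ring.solve-∀
      distinct : ∀ {j j′ i i′} → j < w₂ → j′ < w₂ → i ≤ J → i′ ≤ J → fam j i ≡ fam j′ i′ → j ≡ j′
      distinct {j} {j′} j< j′< i≤J i′≤J eq with <-cmp j j′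
      ... | tri≈ _ j≡j′ _ = j≡j′
      ... | tri< j<j′ _ _ = contradiction eq (not-less j<j′ j′< i≤J i′≤J)
      ... | tri> _ _ j′<j = contradiction (sym eq) (not-less j′<j j< i′≤J i≤J)
      p≤Y^ : p ≤ Y ^ suc J
      p≤Y^ = ≤-trans p≤ (≤-trans (^-monoʳ-≤ 2 exponent) (≤-reflexive (sym (^-*-assoc 2 s (suc J)))))
        where
        -- J is 2 H rather than H because `suc s` is only bounded by 2 s.
        exponent : H * suc s ≤ s * suc J
        exponent = begin
          H * suc s         ≤⟨ *-monoʳ-≤ H (+-monoˡ-≤ s 0<s) ⟩
          H * (s + s)       ≤⟨ m≤n+m _ s ⟩
          s + H * (s + s)   ≡⟨ lem H s ⟩
          s * suc (2 * H)   ∎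
          where
          open ≤-Reasoning
          lem : ∀ H s → s + H * (s + s) ≡ s * suc (2 * H)
          lem = ℕ-Ring.solve-∀
      spans : ∀ j → j < w₂ → Span t J (λ i → v (fam j i))
      spans j j< = reciprocals-span p 0<p (λ a → v (l * a)) (+ (N ÷ l)) J Y 0<J spec pr
        (<-≤-trans (≤-<-trans (≤-trans (m≤n+m J x) x+J≤Y²) Y²<p) ≤-refl) p∤ p≤Y^
        where
        l : ℕ
        l = Y ^ 5 + j
        0<l : 0 < l
        0<l = ≤-trans 0<Y⁵ (m≤m+n (Y ^ 5) j)
        l∣N : l ∣ N
        l∣N = subst (_∣ N) (*-identityʳ l) (divisors (l * 1) (*-mono-≤ {1} 0<l ≤-refl) (prod≤ j 1 j< (0<Y^ 2)) (p∤prod j 1 j< ≤-refl (0<Y^ 2)))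
        p∤ : ¬ p ∣ N ÷ l
        p∤ h = p∤N (subst (p ∣_) (÷-exact l∣N) (∣-trans h (m∣m*n l)))
        spec : ∀ a → x ≤ a → a ≤ x + J → + a ℤ.* v (l * a) ≡ + (N ÷ l)
        spec a x≤a a≤ = trans (sym (ℤ.pos-* a (N ÷ (l * a)))) (cong +_ (sym (÷-unique 0<l
          (trans (lem a (N ÷ (l * a)) l) (÷-exact (divisors (l * a) (*-mono-≤ 0<l 0<a) (prod≤ j a j< a≤Y²) (p∤prod j a j< 0<a a≤Y²)))))))
          where
          0<a : 0 < a
          0<a = ≤-trans 0<x x≤a
          a≤Y² : a ≤ Y ^ 2
          a≤Y² = ≤-trans a≤ x+J≤Y²
          lem : ∀ a q l → a * q * l ≡ q * (l * a)
          lem = ℕ-Ring.solve-∀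

    cover : Cover p N Y r
    cover with p ≤? Y ^ 6
    ... | yes le = cover-small le
    ... | no gt  = cover-large (≰⇒> gt)

-- Expanding fractions t / G, one prime power at a time.

module Tower where

  open import Defs using (inv)
  open Arith
  open ListSum
  open Covering
  open Rationals
  open import Data.Nat.Base
  open import Data.Nat.Properties
  open import Data.Nat.Divisibility
  open import Data.Nat.DivMod using (m≡m%n+[m/n]*n; m%n<n)
  open import Data.Nat.Coprimality as Coprime using (Coprime; coprime-divisor)
  open import Data.Nat.GCD using (gcd; gcd[m,n]∣m; gcd[m,n]∣n; gcd-greatest)
  open import Data.Nat.LCM using (lcm; m∣lcm[m,n]; n∣lcm[m,n]; lcm-least; gcd*lcm)
  open import Data.Nat.Primality
  open import Data.Nat.Primality.Factorisation using (factorise)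
  import Data.Nat.Tactic.RingSolver as ℕ-Ring
  import Data.Integer.Tactic.RingSolver as ℤ-Ring
  open import Data.Integer.Base as ℤ using (ℤ) renaming (+_ to pos)
  import Data.Integer.Properties as ℤ
  open import Data.List.Base using (List; []; _∷_; _++_; map)
  open import Data.Nat.ListAction using (product)
  open import Data.List.Relation.Unary.All as All using (All; []; _∷_)
  import Data.List.Relation.Unary.All.Properties as All
  open import Data.List.Relation.Unary.AllPairs using ([]; _∷_)
  open import Data.List.Relation.Unary.Unique.Propositional using (Unique)
  import Data.List.Relation.Unary.Unique.Propositional.Properties as Unique
  open import Data.Product.Base using (∃-syntax; _×_; _,_; proj₁; proj₂)
  open import Data.Sum.Base using (inj₁; inj₂)
  open import Data.Rational.Base as ℚ using (ℚ; 0ℚ; 1ℚ)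
  import Data.Rational.Properties as ℚ
  open import Function.Base using (id)
  open import Relation.Nullary using (¬_; yes; no; contradiction)
  open import Tactic.RingSolver using (solve-∀)
  open import Relation.Binary.PropositionalEquality

  prime-divisor : ∀ n → 0 < n → ¬ n ≡ 1 → ∃[ p ] (Prime p × p ∣ n)
  prime-divisor n@(suc _) _ n≢1 with factorise n
  ... | record { factors = [] ; isFactorisation = eq } = contradiction eq n≢1
  ... | record { factors = p ∷ ps ; isFactorisation = eq ; factorsPrime = pr ∷ _ } =
    p , pr , divides (product ps) (trans eq (*-comm p (product ps)))

  -- Encodes t / G as a sum of distinct unit fractions 1 / x by the integers G ÷ x; K bounds the sum
  -- of the denominators.
  record Rep (G t K : ℕ) : Set where
    field
      xs      : List ℕ
      unique  : Unique xs
      members : All (λ x → 0 < x × x ∣ G) xs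
      sums    : sumBy (G ÷_) xs ≡ t
      cost    : sumBy id xs ≤ K

  ÷-scale : ∀ {x G} c → 0 < x → x ∣ G → (c * G) ÷ x ≡ c * (G ÷ x)
  ÷-scale {x} {G} c 0<x x∣G = ÷-unique 0<x (trans (*-assoc c (G ÷ x) x) (cong (c *_) (÷-exact x∣G)))

  -- Old parts divide G and new parts do not, which keeps them apart; quotients of old parts are
  -- multiplied by c.
  Rep-extend : ∀ {G t K c ys} → Unique ys → All (λ y → 0 < y × y ∣ c * G) ys → All (λ y → ¬ y ∣ G) ys →
               Rep G t K → Rep (c * G) (sumBy ((c * G) ÷_) ys + c * t) (sumBy id ys + K)
  Rep-extend {G} {c = c} {ys} uniq mem new rep = record
    { xs      = ys ++ xs
    ; unique  = Unique.++⁺ uniq unique (λ (∈ys , ∈xs) → All.lookup new ∈ys (proj₂ (All.lookup members ∈xs)))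
    ; members = All.++⁺ mem (All.map (λ (0<x , x∣G) → 0<x , ∣-trans x∣G (n∣m*n c)) members)
    ; sums    = trans (sumBy-++ _ ys xs) (cong (sumBy ((c * G) ÷_) ys +_)
        (trans (sumBy-cong (All.map (λ (0<x , x∣G) → ÷-scale c 0<x x∣G) members))
          (trans (sumBy-*ˡ c (G ÷_) xs) (cong (c *_) sums))))
    ; cost    = ≤-trans (≤-reflexive (sumBy-++ id ys xs)) (+-monoʳ-≤ (sumBy id ys) cost)
    }
    where open Rep rep

  -- Splitting off t mod n: the new part n! / (t mod n) does not divide (n - 1)!.
  factorial-rep : ∀ n t → t < n ! → Rep (n !) t (n * n !)
  factorial-rep zero zero t< = record { xs = [] ; unique = [] ; members = [] ; sums = refl ; cost = z≤n }
  factorial-rep zero (suc t) (s≤s ())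
  factorial-rep (suc n) t t< = build (t % suc n) refl
    where
    G A : ℕ
    G = n !
    A = t / suc n
    0<n! : ∀ n → 0 < n !
    0<n! n = n≢0⇒n>0 (≢-nonZero⁻¹ (n !) {{n !≢0}})
    A< : A < G
    A< = *-cancelˡ-< (suc n) A G (≤-<-trans (≤-trans (≤-reflexive (*-comm (suc n) A)) (m≤n+m _ (t % suc n)))
      (subst (_< suc n * G) (m≡m%n+[m/n]*n t (suc n)) t<))
    inner : Rep G A (n * G)
    inner = factorial-rep n A A<
    cost≤ : n * G ≤ n * (suc n * G)
    cost≤ = *-monoʳ-≤ n (m≤n*m G (suc n))
    build : ∀ B → B ≡ t % suc n → Rep (suc n !) t (suc n * suc n !)
    build zero eq = record
      { xs = xs ; unique = unique ; members = members
      ; sums = trans sums (trans (cong (_+ suc n * A) eq) (trans (cong (t % suc n +_) (*-comm (suc n) A)) (sym (m≡m%n+[m/n]*n t (suc n)))))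
      ; cost = ≤-trans cost (≤-trans cost≤ (m≤n+m _ (suc n * G))) }
      where open Rep (Rep-extend {c = suc n} [] [] [] inner)
    build B@(suc b) eq = record
      { xs = xs ; unique = unique ; members = members
      ; sums = trans sums (trans (cong (_+ suc n * A) (trans (+-identityʳ _) (trans back eq)))
          (trans (cong (t % suc n +_) (*-comm (suc n) A)) (sym (m≡m%n+[m/n]*n t (suc n)))))
      ; cost = ≤-trans cost (+-mono-≤ (≤-trans (≤-reflexive (+-identityʳ _)) y≤) cost≤) }
      where
      B<n : B < suc n
      B<n = subst (_< suc n) (sym eq) (m%n<n t (suc n))
      B∣n! : ∀ m → b < m → B ∣ m !
      B∣n! (suc m) b< with m≤n⇒m<n∨m≡n b<
      ... | inj₁ lt = ∣-trans (B∣n! m (≤-pred lt)) (n∣m*n (suc m))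
      ... | inj₂ e = subst (_∣ suc m !) (sym e) (m∣m*n (m !))
      y : ℕ
      y = (suc n !) ÷ B
      yB : y * B ≡ suc n !
      yB = ÷-exact (B∣n! (suc n) (<⇒≤ B<n))
      0<y : 0 < y
      0<y = n≢0⇒n>0 (λ y≡0 → <⇒≢ (0<n! (suc n)) (trans (sym (cong (_* B) y≡0)) yB))
      y∣ : y ∣ suc n !
      y∣ = divides B (trans (sym yB) (*-comm y B))
      y≤ : y ≤ suc n !
      y≤ = ∣⇒≤ {{>-nonZero (0<n! (suc n))}} y∣
      back : (suc n !) ÷ y ≡ B
      back = ÷-unique 0<y (trans (*-comm B y) yB)
      -- If y divided n!, then n + 1 would divide B, which is positive and smaller.
      y∤ : ¬ y ∣ G
      y∤ y∣G = small∤ (s≤s z≤n) B<n (*-cancelʳ-∣ G {{>-nonZero (0<n! n)}}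
        (subst (_∣ B * G) yB (subst (y * B ∣_) (*-comm G B) (*-monoˡ-∣ B y∣G))))
      open Rep (Rep-extend {c = suc n} ([] ∷ []) ((0<y , y∣) ∷ []) (y∤ ∷ []) inner)

  Complete : ℕ → ℕ → Set
  Complete n G = ∀ k → 0 < k → k ≤ n → k ∣ G

  -- Here n + 1 is a power of p.
  lcm-step : ∀ n G → 0 < G → Complete n G → ¬ suc n ∣ G →
             ∃[ p ] ∃[ N ] (Prime p × 0 < N × lcm G (suc n) ≡ p * G × p * G ≡ suc n * N × ¬ p ∣ N ×
                            p ≤ suc n × (∀ k → 0 < k → k ≤ n → ¬ p ∣ k → k ∣ N))
  lcm-step n G 0<G below n′∤G = p , N , p-prime , 0<N , lcm≡ , pG≡ , p∤N , ∣⇒≤ p∣n′ , k∣N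
    where
    n′ g c N : ℕ
    n′ = suc n
    g = gcd G n′
    c = n′ ÷ g
    N = G ÷ g
    cg : c * g ≡ n′
    cg = ÷-exact (gcd[m,n]∣n G n′)
    Ng : N * g ≡ G
    Ng = ÷-exact (gcd[m,n]∣m G n′)
    0<c : 0 < c
    0<c = n≢0⇒n>0 (λ c≡0 → <⇒≢ (s≤s z≤n) (trans (sym (cong (_* g) c≡0)) cg))
    0<g : 0 < g
    0<g = n≢0⇒n>0 (λ g≡0 → <⇒≢ (s≤s z≤n) (trans (sym (*-zeroʳ c)) (trans (cong (c *_) (sym g≡0)) cg)))
    0<N : 0 < N
    0<N = n≢0⇒n>0 (λ N≡0 → <⇒≢ 0<G (trans (sym (cong (_* g) N≡0)) Ng))
    c≢1 : ¬ c ≡ 1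
    c≢1 c≡1 = n′∤G (subst (_∣ G) (trans (trans (sym (*-identityˡ g)) (cong (_* g) (sym c≡1))) cg) (gcd[m,n]∣m G n′))
    -- For a prime r dividing n′, the number n′ / r is at most n, so it divides G and hence g;
    -- therefore n′ / g divides r. Only one prime can do this.
    c-only : ∀ {r} → Prime r → r ∣ n′ → c ≡ r
    c-only {r} r-prime (divides m n′≡mr) with prime⇒irreducible r-prime c∣r
      where
      0<m : 0 < m
      0<m = n≢0⇒n>0 (λ m≡0 → <⇒≢ (s≤s z≤n) (sym (trans n′≡mr (cong (_* r) m≡0))))
      m<n′ : m < n′
      m<n′ = subst (m <_) (sym n′≡mr) (m<m*n m r {{>-nonZero 0<m}} (nonTrivial⇒n>1 r {{prime⇒nonTrivial r-prime}}))
      m∣g : m ∣ g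
      m∣g = gcd-greatest (below m 0<m (≤-pred m<n′)) (divides r (trans n′≡mr (*-comm m r)))
      c∣r : c ∣ r
      c∣r = *-cancelʳ-∣ g {{>-nonZero 0<g}} (subst₂ _∣_ (trans (sym n′≡mr) (sym cg)) (*-comm g r) (*-monoˡ-∣ r m∣g))
    ... | inj₁ c≡1 = contradiction c≡1 c≢1
    ... | inj₂ c≡r = c≡r
    p : ℕ
    p = c
    factor : ∃[ r ] (Prime r × r ∣ c)
    factor = prime-divisor c 0<c c≢1
    p≡ : p ≡ proj₁ factor
    p≡ = c-only (proj₁ (proj₂ factor)) (∣-trans (proj₂ (proj₂ factor)) (divides g (trans (sym cg) (*-comm c g))))
    p-prime : Prime p
    p-prime = subst Prime (sym p≡) (proj₁ (proj₂ factor))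
    p∣n′ : p ∣ n′
    p∣n′ = divides g (trans (sym cg) (*-comm c g))
    pG≡ : p * G ≡ n′ * N
    pG≡ = trans (cong (p *_) (sym Ng)) (trans (lem p N g) (cong (_* N) cg))
      where
      lem : ∀ p N g → p * (N * g) ≡ p * g * N
      lem = ℕ-Ring.solve-∀
    lcm≡ : lcm G n′ ≡ p * G
    lcm≡ = *-cancelˡ-≡ _ _ g {{>-nonZero 0<g}} (trans (gcd*lcm G n′) (trans (cong (G *_) (sym cg)) (lem G p g)))
      where
      lem : ∀ G p g → G * (p * g) ≡ g * (p * G)
      lem = ℕ-Ring.solve-∀
    p∤N : ¬ p ∣ N
    p∤N p∣N = n′∤G (subst₂ _∣_ cg Ng (*-monoˡ-∣ g p∣N))
    -- k divides p G = n′ N and is coprime to n′, whose only prime divisor is p.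
    k∣N : ∀ k → 0 < k → k ≤ n → ¬ p ∣ k → k ∣ N
    k∣N k 0<k k≤n p∤k = coprime-divisor coprime (subst (k ∣_) pG≡ (∣-trans (below k 0<k k≤n) (n∣m*n p)))
      where
      coprime : Coprime k n′
      coprime {i} (i∣k , i∣n′) with i ≟ 1
      ... | yes i≡1 = i≡1
      ... | no i≢1 with prime-divisor i (n≢0⇒n>0 (λ i≡0 → <⇒≢ 0<k (sym (0∣⇒≡0 (subst (_∣ k) i≡0 i∣k))))) i≢1
      ...   | r , r-prime , r∣i = contradiction
                (subst (_∣ k) (sym (c-only r-prime (∣-trans r∣i i∣n′))) (∣-trans r∣i i∣k)) p∤k

  -- The common multiple starts from n₀!, which makes it constant for n up to n₀; there
  -- `factorial-rep` begins the induction.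
  modulus : ℕ → ℕ → ℕ
  modulus n₀ zero    = n₀ !
  modulus n₀ (suc n) = lcm (modulus n₀ n) (suc n)

  lcm>0 : ∀ {m n} → 0 < m → 0 < n → 0 < lcm m n
  lcm>0 {m} {n} 0<m 0<n = n≢0⇒n>0 (λ eq → <⇒≢ (*-mono-≤ 0<m 0<n) (trans (sym (*-zeroʳ (gcd m n))) (trans (cong (gcd m n *_) (sym eq)) (gcd*lcm m n))))

  modulus>0 : ∀ n₀ n → 0 < modulus n₀ n
  modulus>0 n₀ zero    = n≢0⇒n>0 (≢-nonZero⁻¹ (n₀ !) {{n₀ !≢0}})
  modulus>0 n₀ (suc n) = lcm>0 (modulus>0 n₀ n) (s≤s z≤n)

  modulus-mono : ∀ n₀ {m n} → m ≤ n → modulus n₀ m ∣ modulus n₀ n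
  modulus-mono n₀ {m} {n} m≤n = go (≤⇒≤′ m≤n)
    where
    go : ∀ {n} → m ≤′ n → modulus n₀ m ∣ modulus n₀ n
    go (≤′-reflexive refl) = ∣-refl
    go {suc n} (≤′-step h) = ∣-trans (go h) (m∣lcm[m,n] _ (suc n))

  modulus-complete : ∀ n₀ n → Complete n (modulus n₀ n)
  modulus-complete n₀ zero    k 0<k k≤0 = contradiction k≤0 (<⇒≱ 0<k)
  modulus-complete n₀ (suc n) k 0<k k≤ with m≤n⇒m<n∨m≡n k≤
  ... | inj₁ lt   = ∣-trans (modulus-complete n₀ n k 0<k (≤-pred lt)) (m∣lcm[m,n] _ (suc n))
  ... | inj₂ refl = n∣lcm[m,n] (modulus n₀ n) (suc n)

  lcm-absorb : ∀ {m n} → n ∣ m → lcm m n ≡ m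
  lcm-absorb {m} {n} n∣m = ∣-antisym (lcm-least ∣-refl n∣m) (m∣lcm[m,n] m n)

  modulus-base : ∀ n₀ n → n ≤ n₀ → modulus n₀ n ≡ n₀ !
  modulus-base n₀ zero    _  = refl
  modulus-base n₀ (suc n) n< = trans (cong (λ G → lcm G (suc n)) (modulus-base n₀ n (<⇒≤ n<))) (lcm-absorb (divides-! n₀ n<))
    where
    divides-! : ∀ m → n < m → suc n ∣ m !
    divides-! (suc m) n<m with m≤n⇒m<n∨m≡n n<m
    ... | inj₁ lt   = ∣-trans (divides-! m (≤-pred lt)) (n∣m*n (suc m))
    ... | inj₂ refl = m∣m*n (m !)

  -- Numerators are bounded below by a proportion λ₀ of G, since each step must be able to subtract
  -- its ∑ N/k.
  Reps : ℕ → ℚ → ℕ → Set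
  Reps G λ₀ K = ∀ t → t < G → λ₀ ℚ.* ι G ℚ.≤ ι t → Rep G t K

  module Steps (H s : ℕ) (0<H : 0 < H) (0<s : 0 < s) (15≤H : 15 ≤ H)
               (ready : growthConstant H * suc s ≤ 2 ^ s) where

    B Y : ℕ
    B = 2 ^ (H * s)
    Y = 2 ^ s

    0<BY² : 0 < B * Y ^ 2
    0<BY² = *-mono-≤ {1} (n≢0⇒n>0 (≢-nonZero⁻¹ B {{m^n≢0 2 (H * s)}})) (n≢0⇒n>0 (≢-nonZero⁻¹ (Y ^ 2) {{m^n≢0 Y 2 {{m^n≢0 2 s}}}}))

    -- A step takes at most N / Y² = p G / (n′ Y²) from the numerator, where n′ is at least B.
    loss : ℚ
    loss = inv (ι (B * Y ^ 2))

    0≤loss : 0ℚ ℚ.≤ loss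
    0≤loss = 0≤inv (ι (B * Y ^ 2)) (0<ι (B * Y ^ 2) 0<BY²)

    Y¹⁵≤B : Y ^ 15 ≤ B
    Y¹⁵≤B = ≤-trans (≤-reflexive (^-*-assoc 2 s 15)) (^-monoʳ-≤ 2 (≤-trans (*-monoʳ-≤ s 15≤H) (≤-reflexive (*-comm s H))))

    -- Choose ks with ∑ N/k ≡ t modulo p and take the parts n′ k, whose quotients are N/k because p
    -- G = n′ N. Then p divides t - ∑ N/k, and what remains is a fraction t′ / G. The new parts do
    -- not divide G, because n′ does not.
    reps-step : ∀ n G λ₀ K → 0ℚ ℚ.≤ λ₀ → 0 < G → Complete n G → B ≤ n → suc n ≤ 2 ^ (H * suc s) →
                Reps G λ₀ K → Reps (lcm G (suc n)) (λ₀ ℚ.+ loss) (K + suc n * Y ^ 22)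
    reps-step n G λ₀ K 0≤λ₀ 0<G complete B≤n n< reps t t< enough with suc n ∣? G
    ... | yes n′∣G = subst (λ D → Rep D t (K + suc n * Y ^ 22)) (sym D≡) (record
        { xs = xs ; unique = unique ; members = members ; sums = sums ; cost = ≤-trans cost (m≤m+n K _) })
      where
      D≡ : lcm G (suc n) ≡ G
      D≡ = lcm-absorb n′∣G
      open Rep (reps t (subst (t <_) D≡ t<) (ℚ.≤-trans (*-mono-r {ι G} {λ₀} {λ₀ ℚ.+ loss} (0≤ι G) (p≤p+q 0≤loss))
        (subst (λ D → (λ₀ ℚ.+ loss) ℚ.* ι D ℚ.≤ ι t) D≡ enough)))
    ... | no n′∤G with lcm-step n G 0<G complete n′∤G
    ...   | p , N , p-prime , 0<N , lcm≡ , pG≡ , p∤N , p≤n′ , k∣N = subst (λ D → Rep D t _) (sym lcm≡) result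
      where
      n′ : ℕ
      n′ = suc n
      enough′ : (λ₀ ℚ.+ loss) ℚ.* ι (p * G) ℚ.≤ ι t
      enough′ = subst (λ D → (λ₀ ℚ.+ loss) ℚ.* ι D ℚ.≤ ι t) lcm≡ enough
      0<p : 0 < p
      0<p = n≢0⇒n>0 (≢-nonZero⁻¹ p {{prime⇒nonZero p-prime}})
      C : Cover p N Y t
      C = cover H s 0<H 0<s ready p N p-prime (≤-trans p≤n′ n<) 0<N p∤N
            (λ k 0<k k≤ → k∣N k 0<k (≤-trans k≤ (≤-trans Y¹⁵≤B B≤n))) t
      open Cover C
      Σ t′ : ℕ
      Σ = sumBy (N ÷_) ks
      small-sum : B * Y ^ 2 * Σ ≤ p * G
      small-sum = begin
        B * Y ^ 2 * Σ   ≡⟨ *-assoc B (Y ^ 2) Σ ⟩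
        B * (Y ^ 2 * Σ) ≤⟨ *-mono-≤ (m≤n⇒m≤1+n B≤n) light ⟩
        n′ * N          ≡⟨ sym pG≡ ⟩
        p * G           ∎
        where open ≤-Reasoning
      Σ≤loss : ι Σ ℚ.≤ loss ℚ.* ι (p * G)
      Σ≤loss = ι-≤-inv 0<BY² small-sum
      split-enough : λ₀ ℚ.* ι (p * G) ℚ.+ ι Σ ℚ.≤ ι t
      split-enough = ℚ.≤-trans (ℚ.+-monoʳ-≤ (λ₀ ℚ.* ι (p * G)) Σ≤loss)
        (ℚ.≤-trans (ℚ.≤-reflexive (sym (ℚ.*-distribʳ-+ (ι (p * G)) λ₀ loss))) enough′)
      Σ≤t : Σ ≤ t
      Σ≤t = ι-cancel-≤ (ℚ.≤-trans (p≤q+p (0≤* 0≤λ₀ (0≤ι (p * G)))) split-enough)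
      -- t - Σ = -w p with Σ ≤ t, so the absolute value of w is the quotient.
      t′ = ℤ.∣ w ∣
      t≡ : t ≡ Σ + p * t′
      t≡ = trans (sym (m+[n∸m]≡n Σ≤t)) (cong (Σ +_) (trans diff≡ (*-comm t′ p)))
        where
        neg : pos (t ∸ Σ) ≡ ℤ.- (w ℤ.* pos p)
        neg = trans (trans (sym (ℤ.⊖-≥ Σ≤t)) (sym (ℤ.m-n≡m⊖n t Σ))) (trans (cong (λ z → pos t ℤ.- z) sums) (lem (pos t) (w ℤ.* pos p)))
          where
          lem : ∀ t z → t ℤ.- (t ℤ.+ z) ≡ ℤ.- z
          lem = ℤ-Ring.solve-∀
        diff≡ : t ∸ Σ ≡ t′ * p
        diff≡ = trans (cong ℤ.∣_∣ neg) (trans (ℤ.∣-i∣≡∣i∣ (w ℤ.* pos p)) (ℤ.abs-* w (pos p)))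
      t′< : t′ < G
      t′< = *-cancelˡ-< p t′ G (≤-<-trans (m≤n+m (p * t′) Σ) (subst₂ _<_ t≡ lcm≡ t<))
      enough-t′ : λ₀ ℚ.* ι G ℚ.≤ ι t′
      enough-t′ = cancel-≤ (0<ι p 0<p) (subst₂ ℚ._≤_ (lem₁ λ₀ (ι p) (ι G)) (ι-* p t′)
        (cancel-+-≤ (ι Σ) (subst₂ ℚ._≤_ (trans (ℚ.+-comm _ (ι Σ)) (cong (λ z → ι Σ ℚ.+ λ₀ ℚ.* z) (ι-* p G)))
          (trans (cong ι t≡) (ι-+ Σ (p * t′))) split-enough)))
        where
        lem₁ : ∀ l p G → l ℚ.* (p ℚ.* G) ≡ p ℚ.* (l ℚ.* G)
        lem₁ = solve-∀ ℚ-ring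
      ys : List ℕ
      ys = map (n′ *_) ks
      ys-div : All (λ y → 0 < y × y ∣ p * G) ys
      ys-div = All.map⁺ (All.map (λ {k} (0<k , _ , k∣N) → *-mono-≤ {1} {n′} (s≤s z≤n) 0<k ,
        subst (n′ * k ∣_) (sym pG≡) (*-monoʳ-∣ n′ k∣N)) good)
      ys-sum : sumBy ((p * G) ÷_) ys ≡ Σ
      ys-sum = trans (sumBy-map _ (n′ *_) ks) (sumBy-cong (All.map (λ {k} (0<k , _ , k∣N) →
        ÷-unique (*-mono-≤ {1} {n′} (s≤s z≤n) 0<k) (trans (lem (N ÷ k) n′ k) (trans (cong (n′ *_) (÷-exact k∣N)) (sym pG≡)))) good))
        where
        lem : ∀ q n k → q * (n * k) ≡ n * (q * k)
        lem = ℕ-Ring.solve-∀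
      result : Rep (p * G) t (K + n′ * Y ^ 22)
      result = record
        { xs = xs′ ; unique = unique′ ; members = members′
        ; sums = trans sums′ (trans (cong (_+ p * t′) ys-sum) (sym t≡))
        ; cost = ≤-trans cost′ (≤-trans (≤-reflexive (+-comm (sumBy id ys) K)) (+-monoʳ-≤ K
            (≤-trans (≤-reflexive (trans (sumBy-map id (n′ *_) ks) (sumBy-*ˡ n′ id ks))) (*-monoʳ-≤ n′ cheap)))) }
        where
        open Rep (Rep-extend {c = p} (Unique.map⁺ (*-cancelˡ-≡ _ _ n′) unique) ys-div
                   (All.map⁺ (All.universal (λ k n′k∣G → n′∤G (∣-trans (m∣m*n k) n′k∣G)) ks)) (reps t′ t′< enough-t′))
          renaming (xs to xs′; unique to unique′; members to members′; sums to sums′; cost to cost′)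

    -- A step to n + 1 costs (n + 1) Y^22, which is below the increment of n² Y^22; losses simply
    -- add up.
    reps-block : ∀ n₀ λ₀ C → 0ℚ ℚ.≤ λ₀ → Reps (modulus n₀ B) λ₀ (C + B * B * Y ^ 22) →
                 ∀ i → B + i ≤ 2 ^ (H * suc s) →
                 Reps (modulus n₀ (B + i)) (λ₀ ℚ.+ ι i ℚ.* loss) (C + (B + i) * (B + i) * Y ^ 22)
    reps-block n₀ λ₀ C 0≤λ₀ base zero _ = subst₂ (λ m l → Reps (modulus n₀ m) l (C + m * m * Y ^ 22)) (sym (+-identityʳ B))
      (trans (sym (ℚ.+-identityʳ λ₀)) (cong (λ₀ ℚ.+_) (sym (trans (cong (ℚ._* loss) ι-0) (ℚ.*-zeroˡ loss))))) base
    reps-block n₀ λ₀ C 0≤λ₀ base (suc i) le t t< enough = record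
      { xs = xs ; unique = unique ; members = subst (λ m → All (λ x → 0 < x × x ∣ modulus n₀ m) xs) (sym n≡) members
      ; sums = trans (cong (λ m → sumBy (modulus n₀ m ÷_) xs) n≡) sums ; cost = ≤-trans cost cost≤ }
      where
      n : ℕ
      n = B + i
      n≡ : B + suc i ≡ suc n
      n≡ = +-suc B i
      l≡ : λ₀ ℚ.+ ι (suc i) ℚ.* loss ≡ λ₀ ℚ.+ ι i ℚ.* loss ℚ.+ loss
      l≡ = trans (cong (λ z → λ₀ ℚ.+ z ℚ.* loss) (ι-suc i)) (lem λ₀ (ι i) loss)
        where
        lem : ∀ l i x → l ℚ.+ (1ℚ ℚ.+ i) ℚ.* x ≡ l ℚ.+ i ℚ.* x ℚ.+ x
        lem = solve-∀ ℚ-ring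
      cost≤ : C + n * n * Y ^ 22 + suc n * Y ^ 22 ≤ C + (B + suc i) * (B + suc i) * Y ^ 22
      cost≤ = subst (λ m → C + n * n * Y ^ 22 + suc n * Y ^ 22 ≤ C + m * m * Y ^ 22) (sym n≡)
        (≤-trans (m≤m+n _ (n * Y ^ 22)) (≤-reflexive (lem C n (Y ^ 22))))
        where
        lem : ∀ C n y → C + n * n * y + suc n * y + n * y ≡ C + suc n * suc n * y
        lem = ℕ-Ring.solve-∀
      le′ : suc n ≤ 2 ^ (H * suc s)
      le′ = subst (_≤ 2 ^ (H * suc s)) n≡ le
      open Rep (reps-step n (modulus n₀ n) (λ₀ ℚ.+ ι i ℚ.* loss) (C + n * n * Y ^ 22)
        (0≤+ 0≤λ₀ (0≤* (0≤ι i) 0≤loss)) (modulus>0 n₀ n) (modulus-complete n₀ n) (m≤m+n B i) le′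
        (reps-block n₀ λ₀ C 0≤λ₀ base i (<⇒≤ le′)) t (subst (λ m → t < modulus n₀ m) n≡ t<)
        (subst₂ (λ m l → l ℚ.* ι (modulus n₀ m) ℚ.≤ ι t) n≡ l≡ enough))

-- Expansions at every height, and the size of common multiples.

module TowerBound where

  open import Defs using (inv)
  open Arith
  open Spans
  open Covering
  open Rationals
  open Tower
  open import Data.Nat.Base
  open import Data.Nat.Properties
  open import Data.Nat.Divisibility
  import Data.Nat.Tactic.RingSolver as ℕ-Ring
  open import Data.Integer.Base as ℤ using (ℤ) renaming (+_ to pos)
  import Data.Integer.Properties as ℤ
  open import Data.Product.Base using (proj₂)
  open import Data.Rational.Base as ℚ using (ℚ; 0ℚ; 1ℚ; ½)
  import Data.Rational.Properties as ℚ
  open import Tactic.RingSolver using (solve-∀)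
  open import Relation.Binary.PropositionalEquality

  Reps-weaken : ∀ {G λ₀ λ₁ K L} → λ₀ ℚ.≤ λ₁ → K ≤ L → Reps G λ₀ K → Reps G λ₁ L
  Reps-weaken {G} λ≤ K≤L reps t t< h = record
    { xs = xs ; unique = unique ; members = members ; sums = sums ; cost = ≤-trans cost K≤L }
    where open Rep (reps t t< (ℚ.≤-trans (*-mono-r (0≤ι G) λ≤) h))

  -- For v a = G / a, the J-th difference at J + 1 is a nonzero integer, and by `diff-size` it is at
  -- least 2^J times smaller than v (J + 1). This elementary growth of common multiples replaces any
  -- use of prime counting.
  complete-size : ∀ J G → 0 < G → Complete (suc (J + J)) G → 2 ^ J ≤ G
  complete-size J G 0<G complete = ≤-trans (proj₂ (diff-size (n≤1+n J) 0<v J ≤-refl)) (≤-trans (m≤m*n (G ÷ suc J) (suc J)) (≤-reflexive exact))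
    where
    exact : (G ÷ suc J) * suc J ≡ G
    exact = ÷-exact (complete (suc J) (s≤s z≤n) (s≤s (m≤m+n J J)))
    0<v : 0 < G ÷ suc J
    0<v = n≢0⇒n>0 (λ eq → <⇒≢ 0<G (trans (sym (cong (_* suc J) eq)) exact))
    spec : ∀ a → suc J ≤ a → a ≤ suc J + J → pos a ℤ.* pos (G ÷ a) ≡ pos G
    spec a lo hi = trans (sym (ℤ.pos-* a (G ÷ a))) (cong pos (trans (*-comm a (G ÷ a)) (÷-exact (complete a (≤-trans (s≤s z≤n) lo) hi))))
    open Reciprocals (λ a → pos (G ÷ a)) (pos G) (suc J) J spec

  module Blocks (H s₀ : ℕ) (0<H : 0 < H) (15≤H : 15 ≤ H) (H<s₀ : H < s₀)
                (ready : ∀ s → s₀ ≤ s → growthConstant H * suc s ≤ 2 ^ s) where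

    n₀ C₀ : ℕ
    n₀ = 2 ^ (H * s₀)
    C₀ = n₀ * n₀ !

    cost : ℕ → ℕ → ℕ
    cost s n = C₀ + n * n * (2 ^ s) ^ 22

    private
      0<2^ : ∀ k → 0 < 2 ^ k
      0<2^ k = n≢0⇒n>0 (≢-nonZero⁻¹ (2 ^ k) {{m^n≢0 2 k}})

      -- The level rises by 2^(-s-1) across block s, which is room for the losses of the block, and
      -- it never reaches 1/2.
      level : ℕ → ℚ
      level s = ½ ℚ.- inv (ι (2 ^ s))

      halve : ∀ s → inv (ι (2 ^ s)) ≡ inv (ι (2 ^ suc s)) ℚ.+ inv (ι (2 ^ suc s))
      halve s = trans (inv-quotient (0<2^ s) (0<2^ (suc s)) refl)
        (trans (cong (ℚ._* i) (trans (ι-+ 1 1) (cong₂ ℚ._+_ ι-1 ι-1))) (lem i))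
        where
        i : ℚ
        i = inv (ι (2 ^ suc s))
        lem : ∀ i → (1ℚ ℚ.+ 1ℚ) ℚ.* i ≡ i ℚ.+ i
        lem = solve-∀ ℚ-ring

      0≤level : ∀ s → 0 < s → 0ℚ ℚ.≤ level s
      0≤level s 0<s = 0≤- (inv-≤½ s 0<s)
        where
        inv-≤½ : ∀ s → 0 < s → inv (ι (2 ^ s)) ℚ.≤ ½
        inv-≤½ s 0<s = ℚ.≤-trans (inv-anti (0<ι 2 (s≤s z≤n)) (ι-mono 2 (2 ^ s) (^-monoʳ-≤ 2 0<s)))
          (ℚ.≤-reflexive (sym (inv-unique (0<ι 2 (s≤s z≤n)) (trans (cong (ℚ._* ½) (trans (ι-+ 1 1) (cong₂ ℚ._+_ ι-1 ι-1))) refl))))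

      s>0 : ∀ {s} → s₀ ≤ s → 0 < s
      s>0 s₀≤s = ≤-trans (s≤s z≤n) (≤-trans H<s₀ s₀≤s)

    module Block (s : ℕ) (s₀≤s : s₀ ≤ s) where
      open Steps H s 0<H (s>0 s₀≤s) 15≤H (ready s s₀≤s)

      -- At most 2^(H (s+1)) steps, each losing 2^(-H s - 2 s), lose 2^(H - 2 s) together. This is
      -- at most 2^(-s-1) because H < s.
      total-loss : ∀ i → i ≤ 2 ^ (H * suc s) → level s ℚ.+ ι i ℚ.* loss ℚ.≤ level (suc s)
      total-loss i i≤ = subst₂ ℚ._≤_ refl (lem ½ (inv (ι (2 ^ suc s))))
        (ℚ.≤-trans (ℚ.+-monoʳ-≤ (level s) (ℚ.≤-trans (*-mono-r 0≤loss (ι-mono i (2 ^ (H * suc s)) i≤)) bound))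
          (ℚ.≤-reflexive (cong (λ z → ½ ℚ.- z ℚ.+ inv (ι (2 ^ suc s))) (halve s))))
        where
        lem : ∀ a b → a ℚ.- (b ℚ.+ b) ℚ.+ b ≡ a ℚ.- b
        lem = solve-∀ ℚ-ring
        M : ℕ
        M = 2 ^ (H * suc s)
        small : 2 ^ suc s * M ≤ B * Y ^ 2
        small = begin
          2 ^ suc s * M                    ≡⟨ sym (^-distribˡ-+-* 2 (suc s) (H * suc s)) ⟩
          2 ^ (suc s + H * suc s)          ≤⟨ ^-monoʳ-≤ 2 (≤-trans (≤-reflexive (lem₁ H s)) (+-monoʳ-≤ (H * s) (+-monoˡ-≤ s (≤-trans H<s₀ s₀≤s)))) ⟩
          2 ^ (H * s + (s + s))            ≡⟨ ^-distribˡ-+-* 2 (H * s) (s + s) ⟩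
          B * 2 ^ (s + s)                  ≡⟨ cong (B *_) (trans (cong (2 ^_) (lem₂ s)) (sym (^-*-assoc 2 s 2))) ⟩
          B * Y ^ 2                        ∎
          where
          open ≤-Reasoning
          lem₁ : ∀ H s → suc s + H * suc s ≡ H * s + (suc H + s)
          lem₁ = ℕ-Ring.solve-∀
          lem₂ : ∀ s → s + s ≡ s * 2
          lem₂ = ℕ-Ring.solve-∀
        bound : ι M ℚ.* loss ℚ.≤ inv (ι (2 ^ suc s))
        bound = subst₂ ℚ._≤_ refl (ℚ.*-identityʳ _) (ℚ.≤-trans (*-mono-r 0≤loss (ι-≤-inv (0<2^ (suc s)) small))
          (ℚ.≤-reflexive (trans (ℚ.*-assoc (inv (ι (2 ^ suc s))) (ι (B * Y ^ 2)) (inv (ι (B * Y ^ 2))))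
            (cong (inv (ι (2 ^ suc s)) ℚ.*_) (inv≡ (ι (B * Y ^ 2)) (0<ι (B * Y ^ 2) 0<BY²))))))

      block : Reps (modulus n₀ B) (level s) (cost s B) →
              ∀ n → B ≤ n → n ≤ 2 ^ (H * suc s) → Reps (modulus n₀ n) (level (suc s)) (cost s n)
      block base n B≤n n≤ = subst (λ m → Reps (modulus n₀ m) (level (suc s)) (cost s m)) (m+[n∸m]≡n B≤n)
        (Reps-weaken {λ₀ = level s ℚ.+ ι (n ∸ B) ℚ.* loss} {λ₁ = level (suc s)} (total-loss (n ∸ B) (≤-trans (m∸n≤m n B) n≤)) ≤-refl
          (reps-block n₀ (level s) C₀ (0≤level s (s>0 s₀≤s)) base (n ∸ B) (≤-trans (≤-reflexive (m+[n∸m]≡n B≤n)) n≤)))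

    -- At the bottom the modulus is n₀! and `factorial-rep` expands its fractions; afterwards the
    -- end of each block is the start of the next.
    start : ∀ k → Reps (modulus n₀ (2 ^ (H * (k + s₀)))) (level (k + s₀)) (cost (k + s₀) (2 ^ (H * (k + s₀))))
    start zero t t< _ = subst (λ G → Rep G t (cost s₀ n₀)) (sym G≡) (record
        { xs = xs ; unique = unique ; members = members ; sums = sums ; cost = ≤-trans cost′ (m≤m+n C₀ (n₀ * n₀ * (2 ^ s₀) ^ 22)) })
      where
      G≡ : modulus n₀ n₀ ≡ n₀ !
      G≡ = modulus-base n₀ n₀ ≤-refl
      open Rep (factorial-rep n₀ t (subst (t <_) G≡ t<)) renaming (cost to cost′)
    start (suc k) = Reps-weaken {λ₀ = level (suc (k + s₀))} {λ₁ = level (suc (k + s₀))} ℚ.≤-refl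
      (+-monoʳ-≤ C₀ (*-monoʳ-≤ (n * n) (^-monoˡ-≤ 22 (^-monoʳ-≤ 2 (n≤1+n (k + s₀))))))
      (Block.block (k + s₀) (m≤n+m s₀ k) (start k) n (^-monoʳ-≤ 2 (*-monoʳ-≤ H (n≤1+n (k + s₀)))) ≤-refl)
      where
      n : ℕ
      n = 2 ^ (H * suc (k + s₀))

    tower : ∀ s n → s₀ ≤ s → 2 ^ (H * s) ≤ n → n ≤ 2 ^ (H * suc s) → Reps (modulus n₀ n) ½ (cost s n)
    tower s n s₀≤s lo hi = Reps-weaken {λ₀ = level (suc s)} {λ₁ = ½} (≤-by (inv (ι (2 ^ suc s))) (0≤inv _ (0<ι _ (0<2^ (suc s)))) (lem ½ (inv (ι (2 ^ suc s))))) ≤-refl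
      (Block.block s s₀≤s (subst (λ u → Reps (modulus n₀ (2 ^ (H * u))) (level u) (cost u (2 ^ (H * u)))) (m∸n+n≡m s₀≤s) (start (s ∸ s₀))) n lo hi)
      where
      lem : ∀ a b → a ℚ.- b ℚ.+ b ≡ a
      lem = solve-∀ ℚ-ring

-- Sums of reciprocals over lists.

module Recip where

  open import Defs using (inv)
  open Arith using (_÷_; ÷-exact)
  open ListSum
  open Rationals
  open import Data.Nat.Base as ℕ using (ℕ)
  open import Data.Nat.Divisibility using (_∣_)
  open import Data.List.Base using (List; []; _∷_; _++_; map)
  open import Data.List.Relation.Unary.All as All using (All; []; _∷_)
  open import Data.Rational.Base hiding (_÷_)
  import Data.Rational.Properties as ℚ
  open import Data.Product.Base using (_×_; _,_)
  open import Relation.Binary.PropositionalEquality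

  recip : List ℕ → ℚ
  recip []       = 0ℚ
  recip (x ∷ xs) = inv (ι x) + recip xs

  recip-++ : ∀ xs ys → recip (xs ++ ys) ≡ recip xs + recip ys
  recip-++ []       ys = sym (ℚ.+-identityˡ _)
  recip-++ (x ∷ xs) ys = trans (cong (inv (ι x) +_) (recip-++ xs ys)) (sym (ℚ.+-assoc (inv (ι x)) _ _))

  recip-scale : ∀ {c xs} → 0 ℕ.< c → All (0 ℕ.<_) xs → recip (map (c ℕ.*_) xs) ≡ inv (ι c) * recip xs
  recip-scale {c} 0<c []       = sym (ℚ.*-zeroʳ (inv (ι c)))
  recip-scale {c} {x ∷ xs} 0<c (0<x ∷ hs) = trans (cong₂ _+_ (inv-ι-* 0<c 0<x) (recip-scale 0<c hs))
    (sym (ℚ.*-distribˡ-+ (inv (ι c)) (inv (ι x)) (recip xs)))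

  recip-quotients : ∀ {G xs} → 0 ℕ.< G → All (λ x → 0 ℕ.< x × x ∣ G) xs → recip xs ≡ ι (sumBy (G ÷_) xs) * inv (ι G)
  recip-quotients {G} 0<G [] = sym (trans (cong (_* inv (ι G)) ι-0) (ℚ.*-zeroˡ (inv (ι G))))
  recip-quotients {G} {x ∷ xs} 0<G ((0<x , x∣G) ∷ hs) = begin
    inv (ι x) + recip xs
      ≡⟨ cong₂ _+_ (inv-quotient 0<x 0<G (÷-exact x∣G)) (recip-quotients 0<G hs) ⟩
    ι (G ÷ x) * i + ι (sumBy (G ÷_) xs) * i
      ≡⟨ sym (ℚ.*-distribʳ-+ i (ι (G ÷ x)) _) ⟩
    (ι (G ÷ x) + ι (sumBy (G ÷_) xs)) * i
      ≡⟨ cong (_* i) (sym (ι-+ (G ÷ x) _)) ⟩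
    ι (sumBy (G ÷_) (x ∷ xs)) * i ∎
    where
    open ≡-Reasoning
    i : ℚ
    i = inv (ι G)

-- Graham's doubling chains and the gadget that absorbs the total.

module GrahamChains where

  open import Defs using (inv)
  open Arith
  open ListSum
  open Rationals
  open Recip
  open import Data.Nat.Base
  open import Data.Nat.Properties
  open import Data.Nat.Divisibility
  open import Data.Nat.DivMod using (m≡m%n+[m/n]*n; m%n<n; m<n*o⇒m/o<n)
  open import Data.Nat.Coprimality as Coprime using (Coprime; coprime-divisor)
  open import Data.Nat.Primality
  import Data.Nat.Tactic.RingSolver as ℕ-Ring
  import Data.Integer.Tactic.RingSolver as ℤ-Ring
  open import Data.Integer.Base as ℤ using (ℤ) renaming (+_ to pos)
  import Data.Integer.Properties as ℤ
  open import Data.List.Base using (List; []; _∷_; _++_; map)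
  open import Data.List.Membership.Propositional using (_∈_)
  open import Data.List.Membership.Propositional.Properties using (∈-map⁻)
  open import Data.List.Relation.Unary.Any using (here; there)
  open import Data.List.Relation.Unary.All as All using (All; []; _∷_)
  import Data.List.Relation.Unary.All.Properties as All
  open import Data.List.Relation.Unary.AllPairs using ([]; _∷_)
  open import Data.List.Relation.Unary.Unique.Propositional using (Unique)
  import Data.List.Relation.Unary.Unique.Propositional.Properties as Unique
  open import Data.Product.Base using (∃-syntax; _×_; _,_; proj₁; proj₂)
  open import Data.Sum.Base using (_⊎_; inj₁; inj₂; [_,_]′)
  open import Data.Rational.Base as ℚ using (ℚ; 1ℚ)
  import Data.Rational.Properties as ℚ
  open import Function.Base using (id)
  open import Relation.Nullary using (¬_; yes; no; contradiction)
  open import Relation.Nullary.Decidable using (from-yes; from-no)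
  open import Tactic.RingSolver using (solve-∀)
  open import Relation.Binary.PropositionalEquality

  -- The numbers that could collide with 6, 10, 15, 7 or 42 after doubling.
  Avoid : ℕ → Set
  Avoid x = ¬ x ≡ 3 × ¬ x ≡ 5 × ¬ x ≡ 21

  -- The odd part of x divides m, so 31, 43 and u can be excluded as divisors of x.
  Smooth : ℕ → ℕ → Set
  Smooth m x = ∃[ j ] (x ∣ 2 ^ j * m)

  -- Doubling all parts and adjoining 6 turns a sum s into 2 s + 6, so s + 6 doubles, starting from
  -- 22 for {4, 12}. Adjoining two parts with sum 6 + Δ instead of 6 adds Δ, so R is built up in
  -- binary. The reciprocals always return to 1/6 + 1/6.
  record Chain (m top Δ R : ℕ) : Set where
    field
      xs       : List ℕ
      unique   : Unique xs
      positive : All (0 <_) xs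
      smooth   : All (Smooth m) xs
      avoid    : All Avoid xs
      sums     : sumBy id xs + 6 ≡ 22 * top + Δ * R
      recips   : recip xs ≡ inv (ι 3)

  opaque
    unfolding ι

    ¼+¹⁄₁₂ : recip (4 ∷ 12 ∷ []) ≡ inv (ι 3)
    ¼+¹⁄₁₂ = refl

    half-third : inv (ι 6) ℚ.+ inv (ι 2) ℚ.* inv (ι 3) ≡ inv (ι 3)
    half-third = refl

    ⅐+¹⁄₄₂ : recip (7 ∷ 42 ∷ []) ≡ inv (ι 6)
    ⅐+¹⁄₄₂ = refl

    ⅒+¹⁄₁₅ : recip (10 ∷ 15 ∷ []) ≡ inv (ι 6)
    ⅒+¹⁄₁₅ = refl

    recip-6 : recip (6 ∷ []) ≡ inv (ι 6)
    recip-6 = refl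

  module _ {m : ℕ} (12∣m : 12 ∣ m) where

    chain-base : ∀ Δ → Chain m 1 Δ 0
    chain-base Δ = record
      { xs = 4 ∷ 12 ∷ []
      ; unique = ((λ ()) ∷ []) ∷ [] ∷ []
      ; positive = s≤s z≤n ∷ s≤s z≤n ∷ []
      ; smooth = (0 , ∣-trans (from-yes (4 ∣? 12)) 12∣) ∷ (0 , 12∣) ∷ []
      ; avoid = ((λ ()) , (λ ()) , λ ()) ∷ ((λ ()) , (λ ()) , λ ()) ∷ []
      ; sums = sym (trans (cong (22 +_) (*-zeroʳ Δ)) refl)
      ; recips = ¼+¹⁄₁₂ }
      where
      12∣ : 12 ∣ 1 * m
      12∣ = subst (12 ∣_) (sym (*-identityˡ m)) 12∣m

    -- Graham's step: double every part and adjoin parts with reciprocals adding up to 1/6.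
    chain-step : ∀ {top Δ R R′ ys} → Chain m top Δ R → Unique ys → All (λ y → 0 < y × y ∣ m) ys → All Avoid ys →
      (∀ {x y} → Avoid x → y ∈ ys → ¬ y ≡ 2 * x) →
      sumBy id ys + 2 * (Δ * R) ≡ 6 + Δ * R′ → recip ys ≡ inv (ι 6) → Chain m (2 * top) Δ R′
    chain-step {top} {Δ} {R} {R′} {ys} ch uniq ys-div ys-avoid no-double ys-sum ys-recip = record
      { xs       = ys ++ map (2 *_) xs
      ; unique   = Unique.++⁺ uniq (Unique.map⁺ (*-cancelˡ-≡ _ _ 2) unique) (λ (∈ys , ∈2xs) →
          let x , x∈ , eq = ∈-map⁻ (2 *_) ∈2xs in no-double (All.lookup avoid x∈) ∈ys eq)
      ; positive = All.++⁺ (All.map proj₁ ys-div) (All.map⁺ (All.map (λ 0<x → *-mono-≤ {1} {2} (s≤s z≤n) 0<x) positive))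
      ; smooth   = All.++⁺ (All.map (λ (_ , y∣m) → 0 , subst (_ ∣_) (sym (*-identityˡ m)) y∣m) ys-div)
          (All.map⁺ (All.map (λ { {x} (j , x∣) → suc j , subst (λ z → 2 * x ∣ z) (sym (*-assoc 2 (2 ^ j) m)) (*-monoʳ-∣ 2 x∣) }) smooth))
      ; avoid    = All.++⁺ ys-avoid (All.map⁺ (All.universal (λ x → even≢odd x 1 , even≢odd x 2 , even≢odd x 10) xs))
      ; sums     = trans (cong (_+ 6) (trans (sumBy-++ id ys _) (cong (sumBy id ys +_) (trans (sumBy-map id (2 *_) xs) (sumBy-*ˡ 2 id xs)))))
          (+-cancelʳ-≡ 6 _ _ (trans (lem₁ (sumBy id ys) (sumBy id xs)) (trans (cong (λ z → sumBy id ys + 2 * z) sums)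
            (trans (lem₂ (sumBy id ys) top (Δ * R)) (trans (cong (λ z → z + 22 * (2 * top)) ys-sum) (lem₃ (Δ * R′) top))))))
      ; recips   = trans (recip-++ ys _) (trans (cong₂ ℚ._+_ ys-recip (trans (recip-scale (s≤s z≤n) positive) (cong (inv (ι 2) ℚ.*_) recips))) half-third)
      }
      where
      open Chain ch
      lem₁ : ∀ a b → a + 2 * b + 6 + 6 ≡ a + 2 * (b + 6)
      lem₁ = ℕ-Ring.solve-∀
      lem₂ : ∀ a t d → a + 2 * (22 * t + d) ≡ a + 2 * d + 22 * (2 * t)
      lem₂ = ℕ-Ring.solve-∀
      lem₃ : ∀ d t → 6 + d + 22 * (2 * t) ≡ 22 * (2 * t) + d + 6
      lem₃ = ℕ-Ring.solve-∀

    module _ (b c Δ : ℕ) (b+c : b + (c + 0) ≡ 6 + Δ) (b≢c : ¬ b ≡ c) (b-div : 0 < b × b ∣ m) (c-div : 0 < c × c ∣ m)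
             (avoid-b : Avoid b) (avoid-c : Avoid c)
             (no-double : ∀ {x y} → Avoid x → y ∈ b ∷ c ∷ [] → ¬ y ≡ 2 * x)
             (recip-bc : recip (b ∷ c ∷ []) ≡ inv (ι 6)) where

      -- The binary digits of R choose between {6} and {b, c}, the lowest digit at the last
      -- doubling.
      chain : ∀ k R → R < 2 ^ k → Chain m (2 ^ k) Δ R
      chain zero    zero    _       = chain-base Δ
      chain zero    (suc R) (s≤s ())
      chain (suc k) R R< = by-parity (R % 2) refl (m%n<n R 2)
        where
        half : Chain m (2 ^ k) Δ (R / 2)
        half = chain k (R / 2) (m<n*o⇒m/o<n (subst (R <_) (*-comm 2 (2 ^ k)) R<))
        R≡ : ∀ r → r ≡ R % 2 → R ≡ r + R / 2 * 2
        R≡ r eq = trans (m≡m%n+[m/n]*n R 2) (cong (_+ R / 2 * 2) (sym eq))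
        by-parity : ∀ r → r ≡ R % 2 → r < 2 → Chain m (2 ^ suc k) Δ R
        by-parity zero eq _ = chain-step half ([] ∷ []) ((s≤s z≤n , ∣-trans (from-yes (6 ∣? 12)) 12∣m) ∷ [])
          (((λ ()) , (λ ()) , λ ()) ∷ [])
          (λ { {x} (x≢3 , _) (here refl) eq → x≢3 (*-cancelˡ-≡ x 3 2 (sym eq)) })
          (cong (6 +_) (trans (lem Δ (R / 2)) (cong (Δ *_) (sym (R≡ 0 eq))))) recip-6
          where
          lem : ∀ d r → 2 * (d * r) ≡ d * (r * 2)
          lem = ℕ-Ring.solve-∀
        by-parity (suc zero) eq _ = chain-step half ((b≢c ∷ []) ∷ [] ∷ []) (b-div ∷ c-div ∷ [])
          (avoid-b ∷ avoid-c ∷ []) no-double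
          (trans (cong (_+ 2 * (Δ * (R / 2))) b+c) (trans (lem Δ (R / 2)) (cong (λ z → 6 + Δ * z) (sym (R≡ 1 eq))))) recip-bc
          where
          lem : ∀ d r → 6 + d + 2 * (d * r) ≡ 6 + d * (1 + r * 2)
          lem = ℕ-Ring.solve-∀
        by-parity (suc (suc _)) _ (s≤s (s≤s ()))

  -- The increments 43 here and 19 in the other chain are coprime, so that two chains together can
  -- reach every large total.
  chain-7-42 : ∀ k R → R < 2 ^ k → Chain 84 (2 ^ k) 43 R
  chain-7-42 = chain (from-yes (12 ∣? 84)) 7 42 43 refl (λ ()) (s≤s z≤n , from-yes (7 ∣? 84)) (s≤s z≤n , from-yes (42 ∣? 84))
    ((λ ()) , (λ ()) , λ ()) ((λ ()) , (λ ()) , λ ())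
    (λ { {x} _ (here refl) eq → even≢odd x 3 (sym eq)
       ; {x} (_ , _ , x≢21) (there (here refl)) eq → x≢21 (*-cancelˡ-≡ x 21 2 (sym eq)) })
    ⅐+¹⁄₄₂

  chain-10-15 : ∀ k R → R < 2 ^ k → Chain 60 (2 ^ k) 19 R
  chain-10-15 = chain (from-yes (12 ∣? 60)) 10 15 19 refl (λ ()) (s≤s z≤n , from-yes (10 ∣? 60)) (s≤s z≤n , from-yes (15 ∣? 60))
    ((λ ()) , (λ ()) , λ ()) ((λ ()) , (λ ()) , λ ())
    (λ { {x} (_ , x≢5 , _) (here refl) eq → x≢5 (*-cancelˡ-≡ x 5 2 (sym eq))
       ; {x} _ (there (here refl)) eq → even≢odd x 7 (sym eq) })
    ⅒+¹⁄₁₅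

  smooth-factor : ∀ {q m x} → Coprime q 2 → q ∣ x → Smooth m x → q ∣ m
  smooth-factor {q} {m} {x} cop q∣x (j , x∣) = strip j (∣-trans q∣x x∣)
    where
    strip : ∀ j → q ∣ 2 ^ j * m → q ∣ m
    strip zero    h = subst (q ∣_) (*-identityˡ m) h
    strip (suc j) h = strip j (coprime-divisor cop (subst (q ∣_) (*-assoc 2 (2 ^ j) m) h))

  prime-31 : Prime 31
  prime-31 = from-yes (prime? 31)

  prime-43 : Prime 43
  prime-43 = from-yes (prime? 43)

  prime-19 : Prime 19
  prime-19 = from-yes (prime? 19)

  bracket : ∀ a b n k₀ → 0 < a → a * 2 ^ k₀ + b ≤ n → ∃[ k ] (k₀ ≤ k × a * 2 ^ k + b ≤ n × n < a * (2 * 2 ^ k) + b)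
  bracket a b n k₀ 0<a start = go n k₀ ≤-refl (m≤m+n n k₀) start
    where
    k<2^k : ∀ k → k < 2 ^ k
    k<2^k zero    = s≤s z≤n
    k<2^k (suc k) = begin-strict
      suc k             <⟨ s≤s (k<2^k k) ⟩
      suc (2 ^ k)       ≤⟨ +-monoˡ-≤ (2 ^ k) (≤-trans (s≤s z≤n) (k<2^k k)) ⟩
      2 ^ k + 2 ^ k     ≡⟨ cong (2 ^ k +_) (sym (+-identityʳ (2 ^ k))) ⟩
      2 ^ suc k         ∎
      where open ≤-Reasoning
    go : ∀ fuel k → k₀ ≤ k → n ≤ fuel + k → a * 2 ^ k + b ≤ n → ∃[ k ] (k₀ ≤ k × a * 2 ^ k + b ≤ n × n < a * (2 * 2 ^ k) + b)
    go zero k _ n≤k low = contradiction (≤-trans (≤-trans (≤-trans (k<2^k k) (m≤n*m (2 ^ k) a {{>-nonZero 0<a}})) (m≤m+n _ b)) low) (≤⇒≯ n≤k)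
    go (suc fuel) k k₀≤k n≤ low with n <? a * (2 * 2 ^ k) + b
    ... | yes lt = k , k₀≤k , low , lt
    ... | no ge  = go fuel (suc k) (m≤n⇒m≤1+n k₀≤k) (≤-trans n≤ (≤-reflexive (sym (+-suc fuel k)))) (≮⇒≥ ge)

  opaque

    -- 32 is a power of 2, which suits the doubling, and 1 modulo 31, so that 31 divides none of its
    -- powers.
    base : ℕ
    base = 32

    base≡ : base ≡ 32
    base≡ = refl

  power-mod : ∀ {a b} → b ≡ a + 1 → ∀ t → ∃[ z ] (b ^ t ≡ a * z + 1)
  power-mod {a} eq zero = 0 , cong (_+ 1) (sym (*-zeroʳ a))
  power-mod {a} {b} eq (suc t) with power-mod eq t
  ... | z , h = 1 + z + a * z , trans (cong₂ _*_ eq h) (lem a z)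
    where
    lem : ∀ a z → (a + 1) * (a * z + 1) ≡ a * (1 + z + a * z) + 1
    lem = ℕ-Ring.solve-∀

  affine∤ : ∀ {a m r} z → m ≡ a * z + r → ¬ a ∣ r → ¬ a ∣ m
  affine∤ {a} z eq a∤r a∣m = a∤r (∣m+n∣m⇒∣n (subst (a ∣_) eq a∣m) (m∣m*n z))

  affine-mod : ∀ a b z → b * (a * z + 1) + 1 ≡ a * (b * z) + (b + 1)
  affine-mod = ℕ-Ring.solve-∀

  module GadgetAt (T M u : ℕ) (M-def : M ≡ base ^ suc T) (u-def : u ≡ 43 * M + 1) where

    -- `∤31` and `shape` keep the gadget apart from the other families: some of these carry the
    -- factor P, a multiple of 31, and the greedy parts are chosen so as to be divisible by neither
    -- this `M` nor `u`.
    record Gadget (n : ℕ) : Set where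
      field
        xs       : List ℕ
        unique   : Unique xs
        positive : All (0 <_) xs
        ∤31      : All (λ x → ¬ 31 ∣ x) xs
        shape    : All (λ x → M ∣ x ⊎ u ∣ x) xs
        sums     : sumBy id xs ≡ n
        recips   : recip xs ≡ ι 44 ℚ.* inv (ι (129 * M))

    32≤M : 32 ≤ M
    32≤M = subst (32 ≤_) (sym M-def) (≤-trans (≤-reflexive (sym base≡)) (m≤m*n base (base ^ T) {{m^n≢0 base T {{subst NonZero (sym base≡) _}}}}))

    0<M : 0 < M
    0<M = ≤-trans (s≤s z≤n) 32≤M

    84<u : 84 < u
    84<u = subst (84 <_) (sym u-def) (≤-trans (≤ᵇ⇒≤ 85 (43 * 32) _) (≤-trans (*-monoʳ-≤ 43 32≤M) (m≤m+n (43 * M) 1)))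

    0<u : 0 < u
    0<u = ≤-trans (s≤s z≤n) 84<u

    private
      coprime-2 : ∀ {q} → Prime q → ¬ q ∣ 2 → Coprime q 2
      coprime-2 = prime-coprime

      M-mod : ∃[ z ] (M ≡ 31 * z + 1)
      M-mod = let z , eq = power-mod {31} base≡ (suc T) in z , trans M-def eq

      31∤M : ¬ 31 ∣ M
      31∤M = affine∤ (proj₁ M-mod) (proj₂ M-mod) (from-no (31 ∣? 1))

      31∤u : ¬ 31 ∣ u
      31∤u = affine∤ (43 * proj₁ M-mod) (trans u-def (trans (cong (λ m → 43 * m + 1) (proj₂ M-mod)) (affine-mod 31 43 (proj₁ M-mod)))) (from-no (31 ∣? 44))

      31∤* : ∀ {a b} → ¬ 31 ∣ a → ¬ 31 ∣ b → ¬ 31 ∣ a * b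
      31∤* {a} {b} ha hb h = [ ha , hb ]′ (euclidsLemma a b prime-31 h)

      u-coprime : ∀ {d} → d ∣ M → Coprime u d
      u-coprime d∣M {i} (i∣u , i∣d) = ∣1⇒≡1 (∣m+n∣m⇒∣n (subst (i ∣_) u-def i∣u) (∣-trans i∣d (∣-trans d∣M (n∣m*n 43))))

      u-coprime-2 : Coprime u 2
      u-coprime-2 = u-coprime (subst (2 ∣_) (sym M-def) (∣-trans (subst (2 ∣_) (sym base≡) (from-yes (2 ∣? 32))) (m∣m*n (base ^ T))))

      u∤smooth : ∀ {x} → Smooth 84 x → ¬ u ∣ x
      u∤smooth sm u∣x = >⇒∤ 84<u (smooth-factor u-coprime-2 u∣x sm)

      19∤43M : ¬ 19 ∣ 43 * M
      19∤43M h = [ from-no (19 ∣? 43) , (λ d → pow (suc T) (subst (19 ∣_) M-def d)) ]′ (euclidsLemma 43 M prime-19 h)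
        where
        pow : ∀ t → ¬ 19 ∣ base ^ t
        pow zero    d = from-no (19 ∣? 1) d
        pow (suc t) d = [ (λ d′ → from-no (19 ∣? 32) (subst (19 ∣_) base≡ d′)) , pow t ]′ (euclidsLemma base (base ^ t) prime-19 d)

    module Combine {k w R′ R} (X : Chain 84 (2 ^ k) 43 R′) (Z : Chain 60 (2 ^ w) 19 R) where

      private
        module X = Chain X
        module Z = Chain Z

        outer inner : List ℕ
        outer = map (M *_) X.xs
        inner = map (u *_) Z.xs
        closer : ℕ
        closer = u * (129 * M)

        -- 129 M has the prime factor 43, which a number with odd part dividing 60 cannot have.
        closer∉inner : ∀ {z} → z ∈ Z.xs → ¬ closer ≡ u * z
        closer∉inner {z} z∈ eq = from-no (43 ∣? 60) (smooth-factor (coprime-2 prime-43 (from-no (43 ∣? 2)))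
          (subst (43 ∣_) (*-cancelˡ-≡ (129 * M) z u {{>-nonZero 0<u}} eq) (∣-trans (from-yes (43 ∣? 129)) (m∣m*n M))) (All.lookup Z.smooth z∈))

        -- u is coprime to M and to 2, so it would divide 84; but u is larger.
        u∤outer : ∀ {x} → x ∈ X.xs → ¬ u ∣ M * x
        u∤outer x∈ h = u∤smooth (All.lookup X.smooth x∈) (coprime-divisor (u-coprime ∣-refl) h)

        clash : ∀ {y} → y ∈ outer → ¬ u ∣ y
        clash y∈ u∣y with ∈-map⁻ (M *_) y∈
        ... | x , x∈ , refl = u∤outer x∈ u∣y

        in-inner : ∀ {y} → y ∈ closer ∷ inner → u ∣ y
        in-inner (here refl) = m∣m*n (129 * M)
        in-inner (there y∈) with ∈-map⁻ (u *_) y∈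
        ... | z , _ , refl = m∣m*n z

      all : List ℕ
      all = outer ++ closer ∷ inner

      all-sum : sumBy id all + (6 * M + 6 * u) ≡ M * (22 * 2 ^ k + 43 * R′) + (u * (22 * 2 ^ w + 19 * R) + u * (129 * M))
      all-sum = trans (cong (_+ (6 * M + 6 * u)) (trans (sumBy-++ id outer _)
          (cong₂ (λ a b → a + (closer + b)) (trans (sumBy-map id (M *_) X.xs) (sumBy-*ˡ M id X.xs))
                                            (trans (sumBy-map id (u *_) Z.xs) (sumBy-*ˡ u id Z.xs)))))
        (trans (lem M u (sumBy id X.xs) (sumBy id Z.xs) closer) (cong₂ (λ a b → M * a + (u * b + closer)) X.sums Z.sums))
        where
        lem : ∀ M u a b c → M * a + (c + u * b) + (6 * M + 6 * u) ≡ M * (a + 6) + (u * (b + 6) + c)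
        lem = ℕ-Ring.solve-∀

      -- 1/(3 M) + 1/(129 M u) + 1/(3 u) has numerator 43 u + 1 + 43 M over 129 M u. Since u = 43 M
      -- + 1, this is 44 u, and u cancels. The single part 129 M u is there to supply the 1.
      all-recips : recip all ≡ ι 44 ℚ.* inv (ι (129 * M))
      all-recips = begin
        recip all
          ≡⟨ trans (recip-++ outer _) (cong₂ (λ a b → a ℚ.+ (inv (ι closer) ℚ.+ b))
               (trans (recip-scale 0<M X.positive) (cong (inv (ι M) ℚ.*_) X.recips))
               (trans (recip-scale 0<u Z.positive) (cong (inv (ι u) ℚ.*_) Z.recips))) ⟩
        inv (ι M) ℚ.* inv (ι 3) ℚ.+ (inv (ι closer) ℚ.+ inv (ι u) ℚ.* inv (ι 3))
          ≡⟨ cong₂ (λ a b → a ℚ.+ (inv (ι closer) ℚ.+ b)) (trans (sym (inv-ι-* 0<M (s≤s z≤n))) (over 43 u M 3 (lem₁ M u) 0<M (s≤s z≤n)))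
                   (trans (sym (inv-ι-* 0<u (s≤s z≤n))) (over 43 M u 3 (lem₂ M u) 0<u (s≤s z≤n))) ⟩
        ι (43 * u) ℚ.* i ℚ.+ (i ℚ.+ ι (43 * M) ℚ.* i)
          ≡⟨ lem₃ (ι (43 * u)) (ι (43 * M)) i ⟩
        (ι (43 * u) ℚ.+ (ι (43 * M) ℚ.+ 1ℚ)) ℚ.* i
          ≡⟨ cong (ℚ._* i) (trans (cong (ι (43 * u) ℚ.+_) (trans (cong (ι (43 * M) ℚ.+_) (sym ι-1)) (trans (sym (ι-+ (43 * M) 1)) (cong ι (sym u-def)))))
               (trans (sym (ι-+ (43 * u) u)) (trans (cong ι (lem₄ u)) (ι-* 44 u)))) ⟩
        ι 44 ℚ.* ι u ℚ.* i
          ≡⟨ trans (ℚ.*-assoc (ι 44) (ι u) i) (cong (ι 44 ℚ.*_) (trans (cong (λ z → ι u ℚ.* z) (inv-ι-* 0<u 0<129M))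
               (trans (sym (ℚ.*-assoc (ι u) (inv (ι u)) (inv (ι (129 * M))))) (trans (cong (ℚ._* inv (ι (129 * M))) (inv≡ (ι u) (0<ι u 0<u))) (ℚ.*-identityˡ _))))) ⟩
        ι 44 ℚ.* inv (ι (129 * M)) ∎
        where
        open ≡-Reasoning
        0<129M : 0 < 129 * M
        0<129M = *-mono-≤ {1} {129} (s≤s z≤n) 0<M
        i : ℚ
        i = inv (ι closer)
        over : ∀ a b x y → a * b * (x * y) ≡ closer → 0 < x → 0 < y → inv (ι (x * y)) ≡ ι (a * b) ℚ.* i
        over a b x y eq 0<x 0<y = inv-quotient (*-mono-≤ 0<x 0<y) (*-mono-≤ 0<u 0<129M) eq
        lem₁ : ∀ M u → 43 * u * (M * 3) ≡ u * (129 * M)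
        lem₁ = ℕ-Ring.solve-∀
        lem₂ : ∀ M u → 43 * M * (u * 3) ≡ u * (129 * M)
        lem₂ = ℕ-Ring.solve-∀
        lem₃ : ∀ a b i → a ℚ.* i ℚ.+ (i ℚ.+ b ℚ.* i) ≡ (a ℚ.+ (b ℚ.+ 1ℚ)) ℚ.* i
        lem₃ = solve-∀ ℚ-ring
        lem₄ : ∀ u → 43 * u + u ≡ 44 * u
        lem₄ = ℕ-Ring.solve-∀

      combine : ∀ {n} → n + (6 * M + 6 * u) ≡ M * (22 * 2 ^ k + 43 * R′) + (u * (22 * 2 ^ w + 19 * R) + u * (129 * M)) → Gadget n
      combine {n} eq = record
        { xs       = all
        ; unique   = Unique.++⁺ (Unique.map⁺ (*-cancelˡ-≡ _ _ M {{>-nonZero 0<M}}) X.unique)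
            (All.tabulate (λ y∈ eq → let z , z∈ , y≡ = ∈-map⁻ (u *_) y∈ in closer∉inner z∈ (trans eq y≡))
              ∷ Unique.map⁺ (*-cancelˡ-≡ _ _ u {{>-nonZero 0<u}}) Z.unique)
            (λ (∈o , ∈i) → clash ∈o (in-inner ∈i))
        ; positive = All.++⁺ (All.map⁺ (All.map (*-mono-≤ 0<M) X.positive))
            (*-mono-≤ 0<u (*-mono-≤ {1} {129} (s≤s z≤n) 0<M) ∷ All.map⁺ (All.map (*-mono-≤ 0<u) Z.positive))
        ; ∤31      = All.++⁺ (All.map⁺ (All.map (λ {x} sm → 31∤* 31∤M (λ d → from-no (31 ∣? 84) (smooth-factor (coprime-2 prime-31 (from-no (31 ∣? 2))) d sm))) X.smooth))
            (31∤* 31∤u (31∤* (from-no (31 ∣? 129)) 31∤M)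
              ∷ All.map⁺ (All.map (λ {x} sm → 31∤* 31∤u (λ d → from-no (31 ∣? 60) (smooth-factor (coprime-2 prime-31 (from-no (31 ∣? 2))) d sm))) Z.smooth))
        ; shape    = All.++⁺ (All.map⁺ (All.universal (λ x → inj₁ (m∣m*n x)) X.xs))
            (inj₂ (m∣m*n (129 * M)) ∷ All.map⁺ (All.universal (λ x → inj₂ (m∣m*n x)) Z.xs))
        ; sums     = +-cancelʳ-≡ (6 * M + 6 * u) _ _ (trans all-sum (sym eq))
        ; recips   = all-recips }

    private
      power-of-2 : ∀ a → ∃[ k ] (2 ^ k ≡ 2 ^ a * M)
      power-of-2 a = a + 5 * suc T , trans (^-distribˡ-+-* 2 a (5 * suc T)) (cong (2 ^ a *_)
        (trans (sym (^-*-assoc 2 5 (suc T))) (trans (cong (_^ suc T) (sym base≡)) (sym M-def))))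

      coprime-19 : Coprime 19 (43 * M)
      coprime-19 = prime-coprime prime-19 19∤43M

      0<43M : 0 < 43 * M
      0<43M = *-mono-≤ {1} {43} (s≤s z≤n) 0<M

      -- u ≡ 1 modulo 43 M, so the parts that are multiples of u fix n modulo 43 M.
      residue : ∀ E W → 43 * M ≤ W → 19 * (u * W) ≤ E →
                ∃[ R ] ∃[ R′ ] (R < W × E ≡ 19 * (u * R) + 43 * M * R′)
      residue E W 43M≤W low = from (multiple-mod (pos 19) 0<43M coprime-19 (pos E))
        where
        from : ∃[ A ] (A < 43 * M × ∃[ w ] (pos E ≡ pos A ℤ.* pos 19 ℤ.+ w ℤ.* pos (43 * M))) →
               ∃[ R ] ∃[ R′ ] (R < W × E ≡ 19 * (u * R) + 43 * M * R′)
        from (R , R< , w , eq) = R , ℤ.∣ w ℤ.- pos (19 * R) ∣ , <-≤-trans R< 43M≤W ,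
          trans (sym (m+[n∸m]≡n S≤E)) (cong (S +_) (trans (cong ℤ.∣_∣ diff) (trans (ℤ.abs-* (w ℤ.- pos (19 * R)) (pos (43 * M)))
            (*-comm _ (43 * M)))))
          where
          S : ℕ
          S = 19 * (u * R)
          S≤E : S ≤ E
          S≤E = ≤-trans (*-monoʳ-≤ 19 (*-monoʳ-≤ u (<⇒≤ (<-≤-trans R< 43M≤W)))) low
          S≡ : pos S ≡ pos (19 * R) ℤ.* pos (43 * M) ℤ.+ pos R ℤ.* pos 19
          S≡ = trans (cong pos (trans (cong (λ v → 19 * (v * R)) u-def) (lem (43 * M) R)))
            (trans (ℤ.pos-+ (19 * R * (43 * M)) (R * 19)) (cong₂ ℤ._+_ (ℤ.pos-* (19 * R) (43 * M)) (ℤ.pos-* R 19)))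
            where
            lem : ∀ m R → 19 * ((m + 1) * R) ≡ 19 * R * m + R * 19
            lem = ℕ-Ring.solve-∀
          diff : pos (E ∸ S) ≡ (w ℤ.- pos (19 * R)) ℤ.* pos (43 * M)
          diff = trans (trans (sym (ℤ.⊖-≥ S≤E)) (sym (ℤ.m-n≡m⊖n E S))) (trans (cong₂ ℤ._-_ eq S≡) (lem (pos R ℤ.* pos 19) w (pos (19 * R)) (pos (43 * M))))
            where
            lem : ∀ a w b m → (a ℤ.+ w ℤ.* m) ℤ.- (b ℤ.* m ℤ.+ a) ≡ (w ℤ.- b) ℤ.* m
            lem = ℤ-Ring.solve-∀

      u≤44M : u ≤ 44 * M
      u≤44M = ≤-trans (≤-reflexive u-def) (≤-trans (+-monoʳ-≤ (43 * M) 0<M) (≤-reflexive (lem M)))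
        where
        lem : ∀ M → 43 * M + M ≡ 44 * M
        lem = ℕ-Ring.solve-∀

      M≤M² : M ≤ M * M
      M≤M² = m≤m*n M M {{>-nonZero 0<M}}

    -- The chain times u has fixed length with 2^w = 64 M ≥ 43 M, so that its R meets every residue
    -- modulo 43 M; the length k of the other chain follows the size of n. The constant is 22 * 4096
    -- + 44 * (22 * 64 + 129 + 19 * 64), from the shortest chain 2^k = 4096 M and u ≤ 44 M.
    gadget : ∀ n → 211244 * (M * M) ≤ n → Gadget n
    gadget n big = at-exponents (power-of-2 6) (power-of-2 12)
     where
     at-exponents : ∃[ w ] (2 ^ w ≡ 64 * M) → ∃[ k ] (2 ^ k ≡ 4096 * M) → Gadget n
     at-exponents (w , W≡) (k₀ , k₀≡) = at-scale (bracket (22 * M) F n k₀ (*-mono-≤ {1} {22} (s≤s z≤n) 0<M) (≤-trans start big))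
      where
      W F : ℕ
      W = 2 ^ w
      F = u * (22 * W) + u * (129 * M) + 19 * (u * W)
      start : 22 * M * 2 ^ k₀ + F ≤ 211244 * (M * M)
      start = begin
        22 * M * 2 ^ k₀ + F                       ≡⟨ cong₂ (λ a b → 22 * M * a + (u * (22 * b) + u * (129 * M) + 19 * (u * b))) k₀≡ W≡ ⟩
        22 * M * (4096 * M) + (u * (22 * (64 * M)) + u * (129 * M) + 19 * (u * (64 * M))) ≡⟨ lem₁ 22 4096 22 64 129 19 M u ⟩
        90112 * (M * M) + 2753 * (u * M)          ≤⟨ +-monoʳ-≤ (90112 * (M * M)) (*-monoʳ-≤ 2753 (*-monoˡ-≤ M u≤44M)) ⟩
        90112 * (M * M) + 2753 * (44 * M * M)     ≡⟨ lem₂ 90112 2753 44 M ⟩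
        211244 * (M * M)                          ∎
        where
        open ≤-Reasoning
        lem₁ : ∀ a b c d e f M u → a * M * (b * M) + (u * (c * (d * M)) + u * (e * M) + f * (u * (d * M))) ≡ a * b * (M * M) + (c * d + e + f * d) * (u * M)
        lem₁ = ℕ-Ring.solve-∀
        lem₂ : ∀ a b c M → a * (M * M) + b * (c * M * M) ≡ (a + b * c) * (M * M)
        lem₂ = ℕ-Ring.solve-∀
      at-scale : ∃[ k ] (k₀ ≤ k × 22 * M * 2 ^ k + F ≤ n × n < 22 * M * (2 * 2 ^ k) + F) → Gadget n
      at-scale (k , k₀≤k , low , high) = finish (residue E W 43M≤W E≥)
        where
        K A₀ E : ℕ
        K = 2 ^ k
        A₀ = 22 * M * K + (u * (22 * W) + u * (129 * M))
        A₀+≤n : A₀ + 19 * (u * W) ≤ n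
        A₀+≤n = ≤-trans (≤-reflexive (+-assoc (22 * M * K) _ (19 * (u * W)))) low
        A₀≤ : A₀ ≤ n + (6 * M + 6 * u)
        A₀≤ = ≤-trans (≤-trans (m≤m+n A₀ _) A₀+≤n) (m≤m+n n _)
        E = (n + (6 * M + 6 * u)) ∸ A₀
        E≡ : A₀ + E ≡ n + (6 * M + 6 * u)
        E≡ = m+[n∸m]≡n A₀≤
        E≥ : 19 * (u * W) ≤ E
        E≥ = +-cancelˡ-≤ A₀ _ _ (≤-trans A₀+≤n (≤-trans (m≤m+n n _) (≤-reflexive (sym E≡))))
        43M≤W : 43 * M ≤ W
        43M≤W = ≤-trans (*-monoˡ-≤ M (≤ᵇ⇒≤ 43 64 _)) (≤-reflexive (sym W≡))
        rest : 19 * (u * W) + (6 * M + 6 * u) ≤ 21 * M * K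
        rest = begin
          19 * (u * W) + (6 * M + 6 * u)                        ≡⟨ cong (λ z → 19 * (u * z) + (6 * M + 6 * u)) W≡ ⟩
          19 * (u * (64 * M)) + (6 * M + 6 * u)                 ≤⟨ +-mono-≤ (*-monoʳ-≤ 19 (*-monoˡ-≤ (64 * M) u≤44M)) (+-monoʳ-≤ (6 * M) (*-monoʳ-≤ 6 u≤44M)) ⟩
          19 * (44 * M * (64 * M)) + (6 * M + 6 * (44 * M))     ≡⟨ lem₁ 19 44 64 6 M ⟩
          53504 * (M * M) + 270 * M                             ≤⟨ +-monoʳ-≤ (53504 * (M * M)) (*-monoʳ-≤ 270 M≤M²) ⟩
          53504 * (M * M) + 270 * (M * M)                       ≡⟨ sym (*-distribʳ-+ (M * M) 53504 270) ⟩
          53774 * (M * M)                                       ≤⟨ *-monoˡ-≤ (M * M) (≤ᵇ⇒≤ 53774 86016 _) ⟩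
          86016 * (M * M)                                       ≡⟨ lem₂ 21 4096 M ⟩
          21 * M * (4096 * M)                                   ≡⟨ cong (21 * M *_) (sym k₀≡) ⟩
          21 * M * 2 ^ k₀                                       ≤⟨ *-monoʳ-≤ (21 * M) (^-monoʳ-≤ 2 k₀≤k) ⟩
          21 * M * K                                            ∎
          where
          open ≤-Reasoning
          lem₁ : ∀ a b c d M → a * (b * M * (c * M)) + (d * M + d * (b * M)) ≡ a * b * c * (M * M) + (d + d * b) * M
          lem₁ = ℕ-Ring.solve-∀
          lem₂ : ∀ a b M → a * b * (M * M) ≡ a * M * (b * M)
          lem₂ = ℕ-Ring.solve-∀
        -- From one k to the next the total moves by 22 M K, and `rest` is at most 21 M K; together
        -- this is the range 43 M K of the digits R′.
        E< : E < 43 * M * K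
        E< = +-cancelˡ-< A₀ E (43 * M * K) (begin-strict
          A₀ + E                                            ≡⟨ E≡ ⟩
          n + (6 * M + 6 * u)                               <⟨ +-monoˡ-< (6 * M + 6 * u) high ⟩
          22 * M * (2 * K) + F + (6 * M + 6 * u)            ≡⟨ lem₁ (22 * M) K (u * (22 * W) + u * (129 * M)) (19 * (u * W)) (6 * M + 6 * u) ⟩
          A₀ + 22 * M * K + (19 * (u * W) + (6 * M + 6 * u)) ≤⟨ +-monoʳ-≤ (A₀ + 22 * M * K) rest ⟩
          A₀ + 22 * M * K + 21 * M * K                      ≡⟨ lem₂ A₀ M K ⟩
          A₀ + 43 * M * K                                   ∎)
          where
          open ≤-Reasoning
          lem₁ : ∀ a K b c d → a * (2 * K) + (b + c) + d ≡ a * K + b + a * K + (c + d)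
          lem₁ = ℕ-Ring.solve-∀
          lem₂ : ∀ A M K → A + 22 * M * K + 21 * M * K ≡ A + 43 * M * K
          lem₂ = ℕ-Ring.solve-∀
        finish : ∃[ R ] ∃[ R′ ] (R < W × E ≡ 19 * (u * R) + 43 * M * R′) → Gadget n
        finish (R , R′ , R< , eq) = Combine.combine {k} {w} {R′} {R} (chain-7-42 k R′ R′<) (chain-10-15 w R R<)
            (trans (sym E≡) (trans (cong (A₀ +_) eq) (lem M u K W R R′)))
          where
          R′< : R′ < 2 ^ k
          R′< = *-cancelˡ-< (43 * M) R′ K (≤-<-trans (≤-trans (m≤n+m _ (19 * (u * R))) (≤-reflexive (sym eq))) E<)
          lem : ∀ M u K W R R′ → 22 * M * K + (u * (22 * W) + u * (129 * M)) + (19 * (u * R) + 43 * M * R′) ≡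
                                 M * (22 * K + 43 * R′) + (u * (22 * W + 19 * R) + u * (129 * M))
          lem = ℕ-Ring.solve-∀

-- Deciding partitions and locating the threshold.

module Threshold where

  open import Defs using (inv; fromℕℚ; Partition; IsThreshold)
  open ListSum
  open Rationals
  open Recip
  open import Data.Nat.Base
  open import Data.Nat.Properties
  import Data.Nat.Tactic.RingSolver as ℕ-Ring
  open import Data.Nat.ListAction using (sum)
  open import Data.List.Base using (List; []; _∷_; map; foldr)
  open import Data.List.Membership.Propositional using (_∈_)
  import Data.List.Membership.DecPropositional as DecMembership
  open import Data.List.Relation.Unary.Any using (here; there)
  open import Data.List.Relation.Unary.All as All using (All; []; _∷_)
  open import Data.List.Relation.Unary.AllPairs using ([]; _∷_)
  open import Data.List.Relation.Unary.Unique.Propositional using (Unique)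
  open import Data.Product.Base using (∃-syntax; _×_; _,_; proj₁)
  open import Data.Sum.Base using (_⊎_; inj₁; inj₂)
  open import Data.Rational.Base as ℚ using (ℚ; 0ℚ)
  import Data.Rational.Properties as ℚ
  open import Function.Base using (id)
  open import Relation.Nullary using (¬_; Dec; yes; no)
  open import Relation.Nullary.Decidable using (map′)
  open import Tactic.RingSolver using (solve-∀)
  open import Relation.Binary.PropositionalEquality

  sum≡sumBy : ∀ xs → sum xs ≡ sumBy id xs
  sum≡sumBy []       = refl
  sum≡sumBy (x ∷ xs) = cong (x +_) (sum≡sumBy xs)

  reciprocals≡recip : ∀ xs → foldr ℚ._+_ 0ℚ (map (λ a → inv (fromℕℚ a)) xs) ≡ recip xs
  reciprocals≡recip []       = refl
  reciprocals≡recip (x ∷ xs) = cong₂ (λ a b → inv a ℚ.+ b) (sym (ι-def x)) (reciprocals≡recip xs)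

  record PartitionBelow (m n : ℕ) (α : ℚ) : Set where
    field
      xs       : List ℕ
      unique   : Unique xs
      bounds   : All (λ x → 0 < x × x ≤ m) xs
      sums     : sumBy id xs ≡ n
      recips   : recip xs ≡ α

  partition : ∀ {α n} xs → Unique xs → All (0 <_) xs → sumBy id xs ≡ n → recip xs ≡ α → Partition α n
  partition xs unique positive sums recips = record
    { parts = xs ; distinct = unique ; positive = positive
    ; sum≡n = trans (sum≡sumBy xs) sums ; reciprocal-sum = trans (reciprocals≡recip xs) recips }

  record Removed (x : ℕ) (xs : List ℕ) : Set₁ where
    field
      ys      : List ℕ
      unique  : Unique ys
      without : All (λ y → ¬ y ≡ x) ys
      keep    : ∀ {P : ℕ → Set} → All P xs → All P ys
      sums    : sumBy id xs ≡ x + sumBy id ys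
      recips  : recip xs ≡ inv (ι x) ℚ.+ recip ys

  remove : ∀ {x xs} → Unique xs → x ∈ xs → Removed x xs
  remove {x} {_ ∷ xs} (new ∷ uniq) (here refl) = record
    { ys = xs ; unique = uniq ; without = All.map (λ x≢y y≡x → x≢y (sym y≡x)) new
    ; keep = λ { (_ ∷ ps) → ps } ; sums = refl ; recips = refl }
  remove {x} {y ∷ xs} (new ∷ uniq) (there x∈) = record
    { ys = y ∷ ys ; unique = keep new ∷ unique ; without = All.lookup new x∈ ∷ without
    ; keep = λ { (p ∷ ps) → p ∷ keep ps }
    ; sums = trans (cong (y +_) sums) (lem y x (sumBy id ys))
    ; recips = trans (cong (inv (ι y) ℚ.+_) recips) (lemℚ (inv (ι y)) (inv (ι x)) (recip ys)) }
    where
    open Removed (remove uniq x∈)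
    lem : ∀ a b c → a + (b + c) ≡ b + (a + c)
    lem = ℕ-Ring.solve-∀
    lemℚ : ∀ a b c → a ℚ.+ (b ℚ.+ c) ≡ b ℚ.+ (a ℚ.+ c)
    lemℚ = solve-∀ ℚ-ring

  below-step : ∀ {m n α} → PartitionBelow (suc m) n α →
               PartitionBelow m n α ⊎ (suc m ≤ n × PartitionBelow m (n ∸ suc m) (α ℚ.- inv (ι (suc m))))
  below-step {m} {n} {α} P with DecMembership._∈?_ _≟_ (suc m) xs
    where open PartitionBelow P
  ... | no ∉ = inj₁ (record { xs = xs ; unique = unique ; sums = sums ; recips = recips
      ; bounds = All.tabulate (λ x∈ → let 0<x , x≤ = All.lookup bounds x∈ in
          0<x , ≤-pred (≤∧≢⇒< x≤ (λ { refl → ∉ x∈ }))) })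
    where open PartitionBelow P
  ... | yes ∈ = inj₂ (subst (suc m ≤_) (trans (sym R.sums) P.sums) (m≤m+n (suc m) _) , record
      { xs = R.ys ; unique = R.unique
      ; bounds = All.zipWith (λ ((0<x , x≤) , x≢) → 0<x , ≤-pred (≤∧≢⇒< x≤ x≢)) (R.keep P.bounds , R.without)
      ; sums = trans (sym (m+n∸m≡n (suc m) _)) (cong (_∸ suc m) (trans (sym R.sums) P.sums))
      ; recips = trans (lem (inv (ι (suc m))) (recip R.ys)) (cong (ℚ._- inv (ι (suc m))) (trans (sym R.recips) P.recips)) })
    where
    module P = PartitionBelow P
    module R = Removed (remove P.unique ∈)
    lem : ∀ i r → r ≡ (i ℚ.+ r) ℚ.- i
    lem = solve-∀ ℚ-ring

  below-skip : ∀ {m n α} → PartitionBelow m n α → PartitionBelow (suc m) n α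
  below-skip P = record { xs = xs ; unique = unique ; sums = sums ; recips = recips
                        ; bounds = All.map (λ (0<x , x≤) → 0<x , m≤n⇒m≤1+n x≤) bounds }
    where open PartitionBelow P

  below-take : ∀ {m n α} → suc m ≤ n → PartitionBelow m (n ∸ suc m) (α ℚ.- inv (ι (suc m))) → PartitionBelow (suc m) n α
  below-take {m} {n} {α} m<n P = record
    { xs = suc m ∷ xs ; unique = All.map (λ (_ , x≤) eq → <⇒≢ (s≤s x≤) (sym eq)) bounds ∷ unique
    ; bounds = (s≤s z≤n , ≤-refl) ∷ All.map (λ (0<x , x≤) → 0<x , m≤n⇒m≤1+n x≤) bounds
    ; sums = trans (cong (suc m +_) sums) (m+[n∸m]≡n m<n)
    ; recips = trans (cong (inv (ι (suc m)) ℚ.+_) recips) (lem (inv (ι (suc m))) α) }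
    where
    open PartitionBelow P
    lem : ∀ i a → i ℚ.+ (a ℚ.- i) ≡ a
    lem = solve-∀ ℚ-ring

  -- Recursion on the largest admissible part: either it is absent, or removing it reduces both the
  -- total and the reciprocal sum.
  partition-below? : ∀ m n α → Dec (PartitionBelow m n α)
  partition-below? zero n α with n ≟ 0 | α ℚ.≟ 0ℚ
  ... | yes refl | yes refl = yes (record { xs = [] ; unique = [] ; bounds = [] ; sums = refl ; recips = refl })
  ... | no n≢0   | _        = no (λ { record { xs = [] ; sums = eq } → n≢0 (sym eq)
                                    ; record { xs = _ ∷ _ ; bounds = (0<x , x≤0) ∷ _ } → <⇒≱ 0<x x≤0 })
  ... | yes _    | no α≢0   = no (λ { record { xs = [] ; recips = eq } → α≢0 (sym eq)
                                    ; record { xs = _ ∷ _ ; bounds = (0<x , x≤0) ∷ _ } → <⇒≱ 0<x x≤0 })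
  partition-below? (suc m) n α with partition-below? m n α
  ... | yes P = yes (below-skip P)
  ... | no ¬P with suc m ≤? n
  ...   | no m≮n = no (λ P → skip-only (below-step P))
    where
    skip-only : ¬ (PartitionBelow m n α ⊎ (suc m ≤ n × PartitionBelow m (n ∸ suc m) (α ℚ.- inv (ι (suc m)))))
    skip-only (inj₁ P) = ¬P P
    skip-only (inj₂ (le , _)) = m≮n le
  ...   | yes m<n with partition-below? m (n ∸ suc m) (α ℚ.- inv (ι (suc m)))
  ...     | yes P = yes (below-take m<n P)
  ...     | no ¬Q = no (λ P → neither (below-step P))
    where
    neither : ¬ (PartitionBelow m n α ⊎ (suc m ≤ n × PartitionBelow m (n ∸ suc m) (α ℚ.- inv (ι (suc m)))))
    neither (inj₁ P) = ¬P P
    neither (inj₂ (_ , Q)) = ¬Q Q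

  partition? : ∀ α n → Dec (Partition α n)
  partition? α n = map′ to from (partition-below? n n α)
    where
    to : PartitionBelow n n α → Partition α n
    to P = partition xs unique (All.map proj₁ bounds) sums recips
      where open PartitionBelow P
    from : Partition α n → PartitionBelow n n α
    from P = record
      { xs = parts ; unique = distinct ; sums = sums ; recips = trans (sym (reciprocals≡recip parts)) reciprocal-sum
      ; bounds = All.tabulate (λ x∈ → All.lookup positive x∈ , ≤-trans (∈⇒≤sumBy {id} x∈) (≤-reflexive sums)) }
      where
      open Partition P
      sums : sumBy id parts ≡ n
      sums = trans (sym (sum≡sumBy parts)) sum≡n

  -- A downward search from a known bound: the first total found to have no partition lies just
  -- below the minimum. If none is found the threshold is 1, as it has to be positive.
  threshold : ∀ α b → (∀ n → suc b ≤ n → Partition α n) → ∃[ N ] (IsThreshold α N × N ≤ suc b)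
  threshold α zero    h = 1 , record { N>0 = s≤s z≤n ; beyond = h ; minimal = λ M 0<M _ → 0<M } , ≤-refl
  threshold α (suc b) h = by-last (partition? α (suc b))
    where
    by-last : Dec (Partition α (suc b)) → ∃[ N ] (IsThreshold α N × N ≤ suc (suc b))
    by-last (no ¬P) = suc (suc b) , record { N>0 = s≤s z≤n ; beyond = h
      ; minimal = λ M 0<M hM → ≰⇒> (λ M≤B → ¬P (hM (suc b) M≤B)) } , ≤-refl
    by-last (yes P) = let N , isT , N≤B = threshold α b h′ in N , isT , m≤n⇒m≤1+n N≤B
      where
      h′ : ∀ n → suc b ≤ n → Partition α n
      h′ n B≤n with m≤n⇒m<n∨m≡n B≤n
      ... | inj₁ lt   = h n lt
      ... | inj₂ refl = P

-- Truncated exponentials and Riemann sums of the logarithm.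

module ExpLog where

  open import Defs using (inv; fromℕℚ; ∑; expSum; mesh; lnSum; module Estimates)
  open Estimates using (expTerm; F; F-suc; 0≤F; pow-nonneg; expTerm-nonneg; ∑-mono-n; expSum-lipschitz; module Halving)
  open Rationals
  open import Data.Nat.Base as ℕ using (ℕ; zero; suc; _!)
  import Data.Nat.Properties as ℕ
  open import Data.Rational.Base
  import Data.Rational.Properties as ℚ
  open import Algebra.Definitions.RawSemiring +-*-rawSemiring using () renaming (_^_ to _^ℚ_)
  open import Data.Product.Base using (∃-syntax; _×_; _,_; proj₁; proj₂)
  open import Relation.Nullary using (yes; no; contradiction)
  open import Tactic.RingSolver using (solve-∀)
  open import Relation.Binary.PropositionalEquality

  prod : ℕ → (ℕ → ℚ) → ℚ
  prod zero    f = 1ℚ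
  prod (suc n) f = prod n f * (1ℚ + f n)

  ∑-nonneg : ∀ n f → (∀ k → k ℕ.< n → 0ℚ ≤ f k) → 0ℚ ≤ ∑ n f
  ∑-nonneg zero    f h = ℚ.≤-refl
  ∑-nonneg (suc n) f h = 0≤+ (∑-nonneg n f (λ k k<n → h k (ℕ.m<n⇒m<1+n k<n))) (h n ℕ.≤-refl)

  pow-add : ∀ {s a} n → 0ℚ ≤ s → 0ℚ ≤ a → s ^ℚ suc n + ι (suc n) * (a * s ^ℚ n) ≤ (s + a) ^ℚ suc n
  pow-add {s} {a} zero 0≤s 0≤a = ℚ.≤-reflexive (trans (cong (λ i → s * 1ℚ + i * (a * 1ℚ)) ι-1) (lem s a))
    where
    lem : ∀ s a → s * 1ℚ + 1ℚ * (a * 1ℚ) ≡ (s + a) * 1ℚ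
    lem = solve-∀ ℚ-ring
  pow-add {s} {a} (suc n) 0≤s 0≤a = ℚ.≤-trans
    (≤-by (ι (suc n) * (a * a * s ^ℚ n)) (0≤* (0≤ι (suc n)) (0≤* (0≤* 0≤a 0≤a) (pow-nonneg n 0≤s)))
      (trans (cong (λ i → s * (s * s ^ℚ n) + i * (a * (s * s ^ℚ n)) + ι (suc n) * (a * a * s ^ℚ n)) (ι-suc (suc n)))
        (lem s a (s ^ℚ n) (ι (suc n)))))
    (*-mono-l (0≤+ 0≤s 0≤a) (pow-add n 0≤s 0≤a))
    where
    lem : ∀ s a p i → s * (s * p) + (1ℚ + i) * (a * (s * p)) + i * (a * a * p) ≡ (s + a) * (s * p + i * (a * p))
    lem = solve-∀ ℚ-ring

  expTerm-add : ∀ {s a} n → 0ℚ ≤ s → 0ℚ ≤ a → expTerm (suc n) s + a * expTerm n s ≤ expTerm (suc n) (s + a)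
  expTerm-add {s} {a} n 0≤s 0≤a = subst (_≤ expTerm (suc n) (s + a))
    (trans (lem (s ^ℚ suc n) (ι (suc n)) a (s ^ℚ n) (F (suc n)))
      (cong (λ f → expTerm (suc n) s + a * (s ^ℚ n * f)) (trans (cong (_* F (suc n)) (ι-def (suc n))) (F-suc n))))
    (*-mono-r (0≤F (suc n)) (pow-add n 0≤s 0≤a))
    where
    lem : ∀ S i a p f → (S + i * (a * p)) * f ≡ S * f + a * (p * (i * f))
    lem = solve-∀ ℚ-ring

  -- A truncated form of e^s (1 + a) ≤ e^(s + a), from two terms of each binomial expansion. Every
  -- factor 1 + a costs one more term of the series.
  expSum-add : ∀ {s a} n → 0ℚ ≤ s → 0ℚ ≤ a → expSum (suc n) s + a * expSum n s ≤ expSum (suc n) (s + a)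
  expSum-add {s} {a} zero 0≤s 0≤a = ℚ.≤-reflexive (trans (cong (λ z → expSum 1 s + z) (ℚ.*-zeroʳ a)) (ℚ.+-identityʳ _))
  expSum-add {s} {a} (suc n) 0≤s 0≤a = subst (_≤ expSum (suc (suc n)) (s + a))
    (lem (expSum (suc n) s) a (expSum n s) (expTerm (suc n) s) (expTerm n s))
    (ℚ.+-mono-≤ (expSum-add n 0≤s 0≤a) (expTerm-add n 0≤s 0≤a))
    where
    lem : ∀ E a e T t → (E + a * e) + (T + a * t) ≡ (E + T) + a * (e + t)
    lem = solve-∀ ℚ-ring

  expSum-mono-n : ∀ {m n s} → 0ℚ ≤ s → m ℕ.≤ n → expSum m s ≤ expSum n s
  expSum-mono-n {s = s} 0≤s = ∑-mono-n (λ k → expTerm k s) (λ k → expTerm-nonneg k 0≤s)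

  pow-mono : ∀ {s t} n → 0ℚ ≤ s → s ≤ t → s ^ℚ n ≤ t ^ℚ n
  pow-mono zero    0≤s s≤t = ℚ.≤-refl
  pow-mono (suc n) 0≤s s≤t = *-mono (pow-nonneg n 0≤s) (ℚ.≤-trans 0≤s s≤t) s≤t (pow-mono n 0≤s s≤t)

  expSum-mono : ∀ {s t} n → 0ℚ ≤ s → s ≤ t → expSum n s ≤ expSum n t
  expSum-mono zero    0≤s s≤t = ℚ.≤-refl
  expSum-mono (suc n) 0≤s s≤t = ℚ.+-mono-≤ (expSum-mono n 0≤s s≤t) (*-mono-r (0≤F n) (pow-mono n 0≤s s≤t))

  expSum-nonneg : ∀ {s} n → 0ℚ ≤ s → 0ℚ ≤ expSum n s
  expSum-nonneg n 0≤s = ∑-nonneg n _ (λ k _ → expTerm-nonneg k 0≤s)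

  expSum-prod : ∀ {s} n m f → 0ℚ ≤ s → (∀ k → k ℕ.< m → 0ℚ ≤ f k) →
                expSum n s * prod m f ≤ expSum (n ℕ.+ m) (s + ∑ m f)
  expSum-prod {s} n zero f 0≤s 0≤f = ℚ.≤-reflexive (trans (ℚ.*-identityʳ _) (cong₂ expSum (sym (ℕ.+-identityʳ n)) (sym (ℚ.+-identityʳ s))))
  expSum-prod {s} n (suc m) f 0≤s 0≤f = begin
    expSum n s * (prod m f * (1ℚ + f m))       ≡⟨ lem₁ (expSum n s) (prod m f) (f m) ⟩
    expSum n s * prod m f + f m * (expSum n s * prod m f) ≤⟨ ℚ.+-mono-≤ (ℚ.≤-trans ih (expSum-mono-n 0≤S (ℕ.n≤1+n (n ℕ.+ m)))) (*-mono-l (0≤f m ℕ.≤-refl) ih) ⟩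
    expSum (suc (n ℕ.+ m)) S + f m * expSum (n ℕ.+ m) S ≤⟨ expSum-add (n ℕ.+ m) 0≤S (0≤f m ℕ.≤-refl) ⟩
    expSum (suc (n ℕ.+ m)) (S + f m)           ≡⟨ cong₂ expSum (sym (ℕ.+-suc n m)) (ℚ.+-assoc s (∑ m f) (f m)) ⟩
    expSum (n ℕ.+ suc m) (s + (∑ m f + f m))   ∎
    where
    open ℚ.≤-Reasoning
    0≤f′ : ∀ k → k ℕ.< m → 0ℚ ≤ f k
    0≤f′ k k<m = 0≤f k (ℕ.m<n⇒m<1+n k<m)
    S : ℚ
    S = s + ∑ m f
    0≤S : 0ℚ ≤ S
    0≤S = 0≤+ 0≤s (∑-nonneg m f 0≤f′)
    ih : expSum n s * prod m f ≤ expSum (n ℕ.+ m) S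
    ih = expSum-prod n m f 0≤s 0≤f′
    lem₁ : ∀ e p a → e * (p * (1ℚ + a)) ≡ e * p + a * (e * p)
    lem₁ = solve-∀ ℚ-ring

  expSum-1-0 : expSum 1 0ℚ ≡ 1ℚ
  expSum-1-0 = refl

  -- The second inequality becomes ln² x ≤ 2 x once the product telescopes to x; this suffices to
  -- compare log log q with log q.
  prod-quadratic : ∀ f → (∀ k → 0ℚ ≤ f k) → (∀ k → f k ≤ 1ℚ) → ∀ m →
                   (1ℚ + ∑ m f ≤ prod m f) × (∑ m f * ∑ m f ≤ prod m f + prod m f)
  prod-quadratic f 0≤f f≤1 zero    = ℚ.≤-reflexive (ℚ.+-identityʳ 1ℚ) , subst (_≤ 1ℚ + 1ℚ) (sym (ℚ.*-zeroˡ 0ℚ)) (0≤+ 0≤1 0≤1)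
  prod-quadratic f 0≤f f≤1 (suc m) with prod-quadratic f 0≤f f≤1 m
  ... | lower , square = ℚ.≤-trans (≤-by (a * S) (0≤* (0≤f m) 0≤S) (lem₁ a S)) (*-mono-r (0≤+ 0≤1 (0≤f m)) lower) ,
    ℚ.≤-trans (≤-by (a * (1ℚ - a) + a) (0≤+ (0≤* (0≤f m) (0≤- (f≤1 m))) (0≤f m)) (lem₂ a S))
      (ℚ.≤-trans (ℚ.+-mono-≤ square (*-mono-l (0≤+ (0≤f m) (0≤f m)) lower)) (ℚ.≤-reflexive (lem₃ a P)))
    where
    a S P : ℚ
    a = f m
    S = ∑ m f
    P = prod m f
    0≤S : 0ℚ ≤ S
    0≤S = ∑-nonneg m f (λ k _ → 0≤f k)
    lem₁ : ∀ a S → 1ℚ + (S + a) + a * S ≡ (1ℚ + S) * (1ℚ + a)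
    lem₁ = solve-∀ ℚ-ring
    lem₂ : ∀ a S → (S + a) * (S + a) + (a * (1ℚ - a) + a) ≡ S * S + (a + a) * (1ℚ + S)
    lem₂ = solve-∀ ℚ-ring
    lem₃ : ∀ a P → (P + P) + (a + a) * P ≡ P * (1ℚ + a) + P * (1ℚ + a)
    lem₃ = solve-∀ ℚ-ring

  module _ (x : ℚ) (1≤x : 1ℚ ≤ x) (n : ℕ) (0<n : 0 ℕ.< n) where

    private
      h : ℚ
      h = mesh n x

    node : ℕ → ℚ
    node k = 1ℚ + fromℕℚ k * h

    lnTerm : ℕ → ℚ
    lnTerm k = h * inv (node k)

    private
      0≤h : 0ℚ ≤ h
      0≤h = 0≤* (0≤- 1≤x) (0≤inv (fromℕℚ n) (Estimates.0<ι n 0<n))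

      1≤node : ∀ k → 1ℚ ≤ node k
      1≤node k = p≤p+q (0≤* (Estimates.0≤ι k) 0≤h)

      0<node : ∀ k → 0ℚ < node k
      0<node k = ℚ.<-≤-trans 0<1 (1≤node k)

    lnTerm-nonneg : ∀ k → 0ℚ ≤ lnTerm k
    lnTerm-nonneg k = 0≤* 0≤h (0≤inv (node k) (0<node k))

    lnTerm≤mesh : ∀ k → lnTerm k ≤ mesh n x
    lnTerm≤mesh k = subst (lnTerm k ≤_) (ℚ.*-identityʳ h) (*-mono-l 0≤h (inv-anti 0<1 (1≤node k)))

    -- The factor 1 + h / node m leads from one node to the next. So the product attached to the
    -- left Riemann sum of the integral of dt/t telescopes exactly, and inequalities between sums
    -- and products apply to `lnSum` without an error term.
    prod-nodes : ∀ m → prod m lnTerm ≡ node m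
    prod-nodes zero    = sym (trans (cong (1ℚ +_) (ℚ.*-zeroˡ h)) (ℚ.+-identityʳ 1ℚ))
    prod-nodes (suc m) = begin
      prod m lnTerm * (1ℚ + h * inv (node m))     ≡⟨ cong (_* (1ℚ + h * inv (node m))) (prod-nodes m) ⟩
      node m * (1ℚ + h * inv (node m))            ≡⟨ lem₁ (node m) h (inv (node m)) ⟩
      node m + h * (node m * inv (node m))        ≡⟨ cong (λ z → node m + h * z) (inv≡ (node m) (0<node m)) ⟩
      node m + h * 1ℚ                             ≡⟨ lem₂ (fromℕℚ m) h ⟩
      1ℚ + (1ℚ + fromℕℚ m) * h                    ≡⟨ cong (λ z → 1ℚ + z * h) (sym (Estimates.ι-suc m)) ⟩
      node (suc m)                                ∎
      where
      open ≡-Reasoning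
      lem₁ : ∀ u h i → u * (1ℚ + h * i) ≡ u + h * (u * i)
      lem₁ = solve-∀ ℚ-ring
      lem₂ : ∀ m h → 1ℚ + m * h + h * 1ℚ ≡ 1ℚ + (1ℚ + m) * h
      lem₂ = solve-∀ ℚ-ring

    node-end : node n ≡ x
    node-end = trans (cong (1ℚ +_) (trans (lem₁ (fromℕℚ n) (x - 1ℚ) (inv (fromℕℚ n)))
        (trans (cong (_* (x - 1ℚ)) (inv≡ (fromℕℚ n) (Estimates.0<ι n 0<n))) (ℚ.*-identityˡ (x - 1ℚ))))) (lem₂ x)
      where
      lem₁ : ∀ n y i → n * (y * i) ≡ (n * i) * y
      lem₁ = solve-∀ ℚ-ring
      lem₂ : ∀ x → 1ℚ + (x - 1ℚ) ≡ x
      lem₂ = solve-∀ ℚ-ring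

    prod-lnTerm : prod n lnTerm ≡ x
    prod-lnTerm = trans (prod-nodes n) node-end

    lnSum-nonneg : 0ℚ ≤ lnSum n x
    lnSum-nonneg = ∑-nonneg n lnTerm (λ k _ → lnTerm-nonneg k)

    x≤exp-ln : x ≤ expSum (suc n) (lnSum n x)
    x≤exp-ln = subst₂ _≤_ (trans (cong (_* prod n lnTerm) expSum-1-0) (trans (ℚ.*-identityˡ _) prod-lnTerm))
      (cong (expSum (suc n)) (ℚ.+-identityˡ (lnSum n x)))
      (expSum-prod {0ℚ} 1 n lnTerm ℚ.≤-refl (λ k _ → lnTerm-nonneg k))

    mesh≤ : ∀ {c} → x ≤ c * fromℕℚ n → mesh n x ≤ c
    mesh≤ {c} x≤ = subst (mesh n x ≤_) (trans (ℚ.*-assoc c (fromℕℚ n) _) (trans (cong (c *_) (inv≡ (fromℕℚ n) (Estimates.0<ι n 0<n))) (ℚ.*-identityʳ c)))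
      (*-mono-r {inv (fromℕℚ n)} {x - 1ℚ} {c * fromℕℚ n} (0≤inv (fromℕℚ n) (Estimates.0<ι n 0<n)) (ℚ.≤-trans (≤-by {x - 1ℚ} 1ℚ 0≤1 (lem x)) x≤))
      where
      lem : ∀ x → x - 1ℚ + 1ℚ ≡ x
      lem = solve-∀ ℚ-ring

    lnSum² : x ≤ fromℕℚ n → lnSum n x * lnSum n x ≤ x + x
    lnSum² x≤n = subst (λ z → lnSum n x * lnSum n x ≤ z + z) prod-lnTerm (proj₂ (prod-quadratic lnTerm lnTerm-nonneg
      (λ k → ℚ.≤-trans (lnTerm≤mesh k) (mesh≤ (ℚ.≤-trans x≤n (ℚ.≤-reflexive (sym (ℚ.*-identityˡ (fromℕℚ n))))))) n))

  four : ℚ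
  four = 1ℚ + 1ℚ + (1ℚ + 1ℚ)

  0<four : 0ℚ < four
  0<four = ℚ.positive⁻¹ four

  -- The sum is cut into runs of length about 1/2, over each of which the product at most doubles.
  prod-exponential : ∀ f → (∀ k → 0ℚ ≤ f k) → (∀ k → four * f k ≤ 1ℚ) → ∀ m →
    ∃[ i ] ∃[ σ ] (0ℚ ≤ σ × σ + σ ≤ 1ℚ × ι i + four * σ ≤ four * ∑ m f × prod m f * (1ℚ - σ) ≤ ι (2 ℕ.^ i))
  prod-exponential f 0≤f f≤¼ zero = 0 , 0ℚ , ℚ.≤-refl , 0≤1 ,
    ℚ.≤-reflexive (trans (cong (_+ four * 0ℚ) ι-0) refl) , ℚ.≤-reflexive (sym ι-1)
  prod-exponential f 0≤f f≤¼ (suc m) with prod-exponential f 0≤f f≤¼ m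
  ... | i , σ , 0≤σ , σ≤½ , lower , upper with σ + f m + (σ + f m) ℚ.≤? 1ℚ
  ...   | yes fits = i , σ + a , 0≤+ 0≤σ (0≤f m) , fits ,
          subst₂ _≤_ (lem₁ (ι i) four σ a) (sym (ℚ.*-distribˡ-+ four S a)) (ℚ.+-monoˡ-≤ (four * a) lower) ,
          ℚ.≤-trans (≤-by (P * (a * σ + a * a)) (0≤* 0≤P (0≤+ (0≤* (0≤f m) 0≤σ) (0≤* (0≤f m) (0≤f m)))) (lem₂ P a σ)) upper
    where
    a S P : ℚ
    a = f m
    S = ∑ m f
    P = prod m f
    0≤P : 0ℚ ≤ P
    0≤P = prod-nonneg m
      where
      prod-nonneg : ∀ m → 0ℚ ≤ prod m f
      prod-nonneg zero    = 0≤1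
      prod-nonneg (suc m) = 0≤* (prod-nonneg m) (0≤+ 0≤1 (0≤f m))
    lem₁ : ∀ i c s a → i + c * s + c * a ≡ i + c * (s + a)
    lem₁ = solve-∀ ℚ-ring
    lem₂ : ∀ P a s → P * (1ℚ + a) * (1ℚ - (s + a)) + P * (a * s + a * a) ≡ P * (1ℚ - s)
    lem₂ = solve-∀ ℚ-ring
  ...   | no overflow = suc i , a , 0≤f m , a≤½ ,
          ℚ.≤-trans (ℚ.≤-trans (ℚ.≤-reflexive (cong (_+ four * a) (ι-suc i))) (ℚ.≤-trans (ℚ.≤-reflexive (lem₁ (ι i) (four * a)))
            (ℚ.+-monoˡ-≤ (four * a) (ℚ.≤-trans (ℚ.+-monoʳ-≤ (ι i) 1≤4σ) lower)))) (ℚ.≤-reflexive (sym (ℚ.*-distribˡ-+ four S a))) ,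
          ℚ.≤-trans (≤-by (P * (a * a)) (0≤* 0≤P (0≤* (0≤f m) (0≤f m))) (lem₂ P a))
            (ℚ.≤-trans (≤-by (P * (1ℚ - (σ + σ))) (0≤* 0≤P (0≤- σ≤½)) (lem₃ P σ))
              (ℚ.≤-trans (ℚ.+-mono-≤ upper upper) (ℚ.≤-reflexive (sym (trans (cong ι (cong (2 ℕ.^ i ℕ.+_) (ℕ.+-identityʳ (2 ℕ.^ i)))) (ι-+ (2 ℕ.^ i) (2 ℕ.^ i)))))))
    where
    a S P : ℚ
    a = f m
    S = ∑ m f
    P = prod m f
    0≤P : 0ℚ ≤ P
    0≤P = prod-nonneg m
      where
      prod-nonneg : ∀ m → 0ℚ ≤ prod m f
      prod-nonneg zero    = 0≤1
      prod-nonneg (suc m) = 0≤* (prod-nonneg m) (0≤+ 0≤1 (0≤f m))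
    a≤½ : a + a ≤ 1ℚ
    a≤½ = ℚ.≤-trans (≤-by (a + a) (0≤+ (0≤f m) (0≤f m)) (lem a)) (f≤¼ m)
      where
      lem : ∀ a → a + a + (a + a) ≡ (1ℚ + 1ℚ + (1ℚ + 1ℚ)) * a
      lem = solve-∀ ℚ-ring
    -- The run exceeds 1/2 only with a last term of at most 1/4, so its length before was at least
    -- 1/4 and pays for one unit of i.
    1≤4σ : 1ℚ ≤ four * σ
    1≤4σ = cancel-+-≤ 1ℚ (ℚ.≤-trans (ℚ.+-mono-≤ (ℚ.<⇒≤ (ℚ.≰⇒> overflow)) (ℚ.<⇒≤ (ℚ.≰⇒> overflow)))
      (ℚ.≤-trans (ℚ.≤-reflexive (lem σ a)) (ℚ.+-monoˡ-≤ (four * σ) (f≤¼ m))))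
      where
      lem : ∀ s a → (s + a + (s + a)) + (s + a + (s + a)) ≡ (1ℚ + 1ℚ + (1ℚ + 1ℚ)) * a + (1ℚ + 1ℚ + (1ℚ + 1ℚ)) * s
      lem = solve-∀ ℚ-ring
    lem₁ : ∀ i b → 1ℚ + i + b ≡ i + 1ℚ + b
    lem₁ = solve-∀ ℚ-ring
    lem₂ : ∀ P a → P * (1ℚ + a) * (1ℚ - a) + P * (a * a) ≡ P
    lem₂ = solve-∀ ℚ-ring
    lem₃ : ∀ P s → P + P * (1ℚ - (s + s)) ≡ P * (1ℚ - s) + P * (1ℚ - s)
    lem₃ = solve-∀ ℚ-ring

  -- x is at most 2^(i+1) with i ≤ 4 ln x. The factor 4 stands in for 1 / ln 2, because a finished
  -- run is only known to have length at least 1/4.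
  ln-lower : ∀ x → 1ℚ ≤ x → ∀ n → 0 ℕ.< n → four * x ≤ fromℕℚ n → ∀ l → ι (2 ℕ.^ l) ≤ x → ι l ≤ 1ℚ + four * lnSum n x
  ln-lower x 1≤x n 0<n 4x≤n l 2^l≤x = from (prod-exponential (lnTerm x 1≤x n 0<n) (lnTerm-nonneg x 1≤x n 0<n) small n)
    where
    small : ∀ k → four * lnTerm x 1≤x n 0<n k ≤ 1ℚ
    small k = ℚ.≤-trans (*-mono-l (ℚ.<⇒≤ 0<four) (ℚ.≤-trans (lnTerm≤mesh x 1≤x n 0<n k)
      (mesh≤ x 1≤x n 0<n {inv four} (cancel-≤ 0<four (ℚ.≤-trans 4x≤n (ℚ.≤-reflexive (sym (trans (sym (ℚ.*-assoc four (inv four) (fromℕℚ n)))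
        (trans (cong (_* fromℕℚ n) (inv≡ four 0<four)) (ℚ.*-identityˡ (fromℕℚ n)))))))))))
      (ℚ.≤-reflexive (inv≡ four 0<four))
    from : ∃[ i ] ∃[ σ ] (0ℚ ≤ σ × σ + σ ≤ 1ℚ × ι i + four * σ ≤ four * lnSum n x ×
             prod n (lnTerm x 1≤x n 0<n) * (1ℚ - σ) ≤ ι (2 ℕ.^ i)) → ι l ≤ 1ℚ + four * lnSum n x
    from (i , σ , 0≤σ , σ≤½ , lower , upper) = ℚ.≤-trans (ι-mono l (suc i) l≤) (ℚ.≤-trans (ℚ.≤-reflexive (ι-suc i))
        (ℚ.+-monoʳ-≤ 1ℚ (ℚ.≤-trans (p≤p+q {ι i} {four * σ} (0≤* (ℚ.<⇒≤ 0<four) 0≤σ)) lower)))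
      where
      x≤ : x ≤ ι (2 ℕ.^ i) + ι (2 ℕ.^ i)
      x≤ = ℚ.≤-trans (≤-by (x * (1ℚ - (σ + σ))) (0≤* (ℚ.≤-trans 0≤1 1≤x) (0≤- σ≤½)) (lem x σ))
        (ℚ.+-mono-≤ up up)
        where
        up : x * (1ℚ - σ) ≤ ι (2 ℕ.^ i)
        up = subst (λ z → z * (1ℚ - σ) ≤ ι (2 ℕ.^ i)) (prod-lnTerm x 1≤x n 0<n) upper
        lem : ∀ x s → x + x * (1ℚ - (s + s)) ≡ x * (1ℚ - s) + x * (1ℚ - s)
        lem = solve-∀ ℚ-ring
      powers : 2 ℕ.^ l ℕ.≤ 2 ℕ.^ suc i
      powers = ι-cancel-≤ (ℚ.≤-trans 2^l≤x (ℚ.≤-trans x≤ (ℚ.≤-reflexive (sym (trans (cong ι (cong (2 ℕ.^ i ℕ.+_) (ℕ.+-identityʳ (2 ℕ.^ i)))) (ι-+ (2 ℕ.^ i) (2 ℕ.^ i)))))))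
      l≤ : l ℕ.≤ suc i
      l≤ = ℕ.≮⇒≥ (λ i<l → ℕ.<⇒≱ (ℕ.^-monoʳ-< 2 (ℕ.s≤s (ℕ.s≤s ℕ.z≤n)) i<l) powers)

  two : ℚ
  two = 1ℚ + 1ℚ

  exp-two-bounded : ∃[ G ] (0ℚ ≤ G × (∀ n → expSum n two ≤ G))
  exp-two-bounded = G 4 , E-bound 0 , E-bound
    where
    -- The terms of the series at 2 at least halve from index 4 on, as 2 + 2 ≤ 4.
    open Halving {two} (ℚ.nonNegative⁻¹ two) 4 (ℕ.s≤s ℕ.z≤n) (ℚ.≤-reflexive refl)
    G′ = G

  -- If ln x were below 1 + θ, then x ≤ exp (ln x) ≤ e + θ G up to a term 1 / n!, where the bound G
  -- of e² serves as a Lipschitz constant up to 2. With 4 θ G ≤ δ and 4 / n! ≤ δ this contradicts e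
  -- + δ ≤ x.
  ln-exceeds : ∀ δ → 0ℚ < δ → ∃[ τ ] ∃[ N ] (0 ℕ.< τ × (∀ n → N ℕ.≤ n → ∀ x → expSum n 1ℚ + δ ≤ x → 1ℚ + inv (ι τ) ≤ lnSum n x))
  ln-exceeds δ 0<δ = suc τ , suc N , ℕ.s≤s ℕ.z≤n , bound
    where
    G : ℚ
    G = proj₁ exp-two-bounded
    τ N : ℕ
    τ = proj₁ (archimedean (four * G * inv δ))
    N = proj₁ (archimedean (four * inv δ))
    θ : ℚ
    θ = inv (ι (suc τ))
    0≤θ : 0ℚ ≤ θ
    0≤θ = 0≤inv (ι (suc τ)) (0<ι (suc τ) (ℕ.s≤s ℕ.z≤n))
    scale : ∀ c k → 0 ℕ.< k → c * inv δ ≤ ι k → c * inv (ι k) ≤ δ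
    scale c k 0<k h = subst₂ _≤_ (trans (lem₁ δ (inv (ι k)) c (inv δ)) (trans (cong (λ z → c * inv (ι k) * z) (inv≡ δ 0<δ)) (ℚ.*-identityʳ (c * inv (ι k)))))
      (trans (lem₂ δ (inv (ι k)) (ι k)) (trans (cong (δ *_) (inv≡ (ι k) (0<ι k 0<k))) (ℚ.*-identityʳ δ)))
      (*-mono-l (0≤* (ℚ.<⇒≤ 0<δ) (0≤inv (ι k) (0<ι k 0<k))) h)
      where
      lem₁ : ∀ d i c j → d * i * (c * j) ≡ c * i * (d * j)
      lem₁ = solve-∀ ℚ-ring
      lem₂ : ∀ d i k → d * i * k ≡ d * (k * i)
      lem₂ = solve-∀ ℚ-ring
    4Gθ≤δ : four * G * θ ≤ δ
    4Gθ≤δ = scale (four * G) (suc τ) (ℕ.s≤s ℕ.z≤n) (ℚ.≤-trans (proj₂ (archimedean (four * G * inv δ))) (ι-mono τ (suc τ) (ℕ.n≤1+n τ)))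
    θ≤1 : θ ≤ 1ℚ
    θ≤1 = ℚ.≤-trans (inv-anti 0<1 (ℚ.≤-trans (ℚ.≤-reflexive (sym ι-1)) (ι-mono 1 (suc τ) (ℕ.s≤s ℕ.z≤n)))) (ℚ.≤-reflexive refl)
    bound : ∀ n → suc N ℕ.≤ n → ∀ x → expSum n 1ℚ + δ ≤ x → 1ℚ + θ ≤ lnSum n x
    bound n N<n x e+δ≤x with (1ℚ + θ) ℚ.≤? lnSum n x
    ... | yes le = le
    ... | no gt = contradiction 4δ≤2δ (<⇒≱ℚ (subst (_< four * δ) (ℚ.+-identityʳ (δ + δ)) (subst (λ z → δ + δ + 0ℚ < z) (lem₃ δ) (ℚ.+-monoʳ-< (δ + δ) (ℚ.+-mono-< 0<δ 0<δ)))))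
      where
      0<n : 0 ℕ.< n
      0<n = ℕ.≤-trans (ℕ.s≤s ℕ.z≤n) N<n
      1≤x : 1ℚ ≤ x
      1≤x = ℚ.≤-trans (expSum-mono-n {1} {n} 0≤1 0<n) (ℚ.≤-trans (p≤p+q (ℚ.<⇒≤ 0<δ)) e+δ≤x)
      4F≤δ : four * expTerm n 1ℚ ≤ δ
      4F≤δ = ℚ.≤-trans (*-mono-l (ℚ.<⇒≤ 0<four) (ℚ.≤-trans (ℚ.≤-reflexive (trans (cong (_* F n) (one^ n)) (ℚ.*-identityˡ (F n))))
          (ℚ.≤-trans (ℚ.≤-reflexive (cong inv (sym (ι-def (n !))))) (inv-anti (0<ι n 0<n) (ι-mono n (n !) (n≤n! n 0<n))))))
        (scale four n 0<n (ℚ.≤-trans (proj₂ (archimedean (four * inv δ))) (ι-mono N n (ℕ.<⇒≤ N<n))))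
        where
        one^ : ∀ n → 1ℚ ^ℚ n ≡ 1ℚ
        one^ zero    = refl
        one^ (suc n) = trans (ℚ.*-identityˡ _) (one^ n)
        n≤n! : ∀ n → 0 ℕ.< n → n ℕ.≤ n !
        n≤n! (suc n) _ = ℕ.m≤m*n (suc n) (n !) {{n ℕ.!≢0}}
      lip : expSum (suc n) (1ℚ + θ) ≤ expSum (suc n) 1ℚ + θ * G
      lip = ℚ.≤-trans (Estimates.p≤q+∣p-q∣ (expSum (suc n) (1ℚ + θ)) (expSum (suc n) 1ℚ)) (ℚ.+-monoʳ-≤ (expSum (suc n) 1ℚ)
        (ℚ.≤-trans (expSum-lipschitz {1ℚ + θ} {1ℚ} {two} n (ℚ.nonNegative⁻¹ two)
            (ℚ.≤-trans (ℚ.≤-reflexive (ℚ.0≤p⇒∣p∣≡p (0≤+ 0≤1 0≤θ))) (ℚ.+-monoʳ-≤ 1ℚ θ≤1)) (ℚ.≤-trans (p≤p+q 0≤1) (ℚ.≤-reflexive refl)))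
          (ℚ.≤-trans (*-mono-l (ℚ.0≤∣p∣ (1ℚ + θ - 1ℚ)) (proj₂ (proj₂ exp-two-bounded) n))
            (ℚ.≤-reflexive (cong (_* G) (trans (cong ∣_∣ (lem θ)) (ℚ.0≤p⇒∣p∣≡p 0≤θ)))))))
        where
        lem : ∀ t → 1ℚ + t - 1ℚ ≡ t
        lem = solve-∀ ℚ-ring
      x≤ : x ≤ expSum n 1ℚ + expTerm n 1ℚ + θ * G
      x≤ = ℚ.≤-trans (x≤exp-ln x 1≤x n 0<n) (ℚ.≤-trans (expSum-mono (suc n) (lnSum-nonneg x 1≤x n 0<n) (ℚ.<⇒≤ (ℚ.≰⇒> gt))) lip)
      δ≤ : δ ≤ expTerm n 1ℚ + θ * G
      δ≤ = cancel-+-≤ (expSum n 1ℚ) (ℚ.≤-trans e+δ≤x (ℚ.≤-trans x≤ (ℚ.≤-reflexive (ℚ.+-assoc (expSum n 1ℚ) (expTerm n 1ℚ) (θ * G)))))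
      4δ≤2δ : four * δ ≤ δ + δ
      4δ≤2δ = ℚ.≤-trans (*-mono-l (ℚ.<⇒≤ 0<four) δ≤) (ℚ.≤-trans (ℚ.≤-reflexive (lem₂ four (expTerm n 1ℚ) θ G)) (ℚ.+-mono-≤ 4F≤δ 4Gθ≤δ))
        where
        lem₂ : ∀ c f t g → c * (f + t * g) ≡ c * f + c * g * t
        lem₂ = solve-∀ ℚ-ring
      lem₃ : ∀ d → d + d + (d + d) ≡ (1ℚ + 1ℚ + (1ℚ + 1ℚ)) * d
      lem₃ = solve-∀ ℚ-ring

  harmonicBlock : ℕ → ℚ
  harmonicBlock N = ∑ N (λ i → inv (ι (N ℕ.+ i)))

  prod-harmonic : ∀ N → 0 ℕ.< N → ∀ m → ι N * prod m (λ i → inv (ι (N ℕ.+ i))) ≡ ι (N ℕ.+ m)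
  prod-harmonic N 0<N zero    = trans (ℚ.*-identityʳ (ι N)) (cong ι (sym (ℕ.+-identityʳ N)))
  prod-harmonic N 0<N (suc m) = begin
    ι N * (prod m f * (1ℚ + f m))   ≡⟨ sym (ℚ.*-assoc (ι N) (prod m f) (1ℚ + f m)) ⟩
    ι N * prod m f * (1ℚ + f m)     ≡⟨ cong (_* (1ℚ + f m)) (prod-harmonic N 0<N m) ⟩
    ι (N ℕ.+ m) * (1ℚ + f m)        ≡⟨ ℚ.*-distribˡ-+ (ι (N ℕ.+ m)) 1ℚ (f m) ⟩
    ι (N ℕ.+ m) * 1ℚ + ι (N ℕ.+ m) * f m ≡⟨ cong₂ _+_ (ℚ.*-identityʳ (ι (N ℕ.+ m))) (inv≡ (ι (N ℕ.+ m)) (0<ι (N ℕ.+ m) (ℕ.≤-trans 0<N (ℕ.m≤m+n N m)))) ⟩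
    ι (N ℕ.+ m) + 1ℚ                ≡⟨ trans (ℚ.+-comm (ι (N ℕ.+ m)) 1ℚ) (sym (ι-suc (N ℕ.+ m))) ⟩
    ι (suc (N ℕ.+ m))               ≡⟨ cong ι (sym (ℕ.+-suc N m)) ⟩
    ι (N ℕ.+ suc m)                 ∎
    where
    open ≡-Reasoning
    f : ℕ → ℚ
    f i = inv (ι (N ℕ.+ i))

  -- Over a block [N, 2N) the product of 1 + 1/x telescopes to 2.
  exp-blocks : ∀ N → 0 ℕ.< N → ∀ K → ι (2 ℕ.^ K) ≤ expSum (1 ℕ.+ K ℕ.* N) (ι K * harmonicBlock N)
  exp-blocks N 0<N zero = ℚ.≤-reflexive (trans ι-1 (sym (trans (cong (expSum 1) (trans (cong (_* harmonicBlock N) ι-0) (ℚ.*-zeroˡ (harmonicBlock N)))) expSum-1-0)))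
  exp-blocks N 0<N (suc K) = begin
    ι (2 ℕ.* 2 ℕ.^ K)                                        ≡⟨ trans (cong ι (ℕ.*-comm 2 (2 ℕ.^ K))) (trans (ι-* (2 ℕ.^ K) 2) (cong (ι (2 ℕ.^ K) *_) (sym double))) ⟩
    ι (2 ℕ.^ K) * prod N f                                   ≤⟨ *-mono-r 0≤prod (exp-blocks N 0<N K) ⟩
    expSum (1 ℕ.+ K ℕ.* N) (ι K * harmonicBlock N) * prod N f ≤⟨ expSum-prod (1 ℕ.+ K ℕ.* N) N f (0≤* (0≤ι K) 0≤block) (λ k _ → 0≤f k) ⟩
    expSum (1 ℕ.+ K ℕ.* N ℕ.+ N) (ι K * harmonicBlock N + harmonicBlock N)
      ≡⟨ cong₂ expSum (cong suc (ℕ.+-comm (K ℕ.* N) N)) (trans (lem (ι K) (harmonicBlock N)) (cong (_* harmonicBlock N) (sym (ι-suc K)))) ⟩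
    expSum (1 ℕ.+ suc K ℕ.* N) (ι (suc K) * harmonicBlock N) ∎
    where
    open ℚ.≤-Reasoning
    f : ℕ → ℚ
    f i = inv (ι (N ℕ.+ i))
    0≤f : ∀ k → 0ℚ ≤ f k
    0≤f k = 0≤inv (ι (N ℕ.+ k)) (0<ι (N ℕ.+ k) (ℕ.≤-trans 0<N (ℕ.m≤m+n N k)))
    0≤block : 0ℚ ≤ harmonicBlock N
    0≤block = ∑-nonneg N f (λ k _ → 0≤f k)
    double : prod N f ≡ ι 2
    double = trans (sym (inv-cancelˡ N 0<N)) (trans (cong (inv (ι N) *_) (trans (prod-harmonic N 0<N N)
      (trans (cong ι (sym (trans (ℕ.*-comm N 2) (cong (N ℕ.+_) (ℕ.+-identityʳ N))))) (ι-* N 2)))) (inv-cancelˡ N 0<N))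
    0≤prod : 0ℚ ≤ prod N f
    0≤prod = subst (0ℚ ≤_) (sym double) (0≤ι 2)
    lem : ∀ k b → k * b + b ≡ (1ℚ + k) * b
    lem = solve-∀ ℚ-ring

-- Harmonic sums over dyadic blocks, with some multiples left out.

module Harmonic where

  open import Defs using (inv; ∑; module Estimates)
  open Estimates using (∑-split)
  open Rationals
  open Counting using (sum<)
  open ExpLog using (harmonicBlock)
  open import Data.Bool.Base using (if_then_else_)
  open import Data.Nat.Base as ℕ using (ℕ; zero; suc)
  import Data.Nat.Properties as ℕ
  open import Data.Nat.Divisibility using (_∣_; _∣?_; divides)
  import Data.Nat.Tactic.RingSolver as ℕ-Ring
  open import Data.Rational.Base hiding (∣_∣)
  import Data.Rational.Properties as ℚ
  open import Data.Product.Base using (_×_; _,_; proj₁; proj₂)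
  open import Relation.Nullary using (¬_; Dec; yes; no; does)
  open import Relation.Nullary.Decidable using (¬?; _×-dec_)
  open import Tactic.RingSolver using (solve-∀)
  open import Relation.Binary.PropositionalEquality

  ∑-mono : ∀ n f g → (∀ k → k ℕ.< n → f k ≤ g k) → ∑ n f ≤ ∑ n g
  ∑-mono zero    f g h = ℚ.≤-refl
  ∑-mono (suc n) f g h = ℚ.+-mono-≤ (∑-mono n f g (λ k k<n → h k (ℕ.m<n⇒m<1+n k<n))) (h n ℕ.≤-refl)

  ∑-+ : ∀ n f g → ∑ n (λ k → f k + g k) ≡ ∑ n f + ∑ n g
  ∑-+ zero    f g = refl
  ∑-+ (suc n) f g = trans (cong (_+ (f n + g n)) (∑-+ n f g)) (lem (∑ n f) (∑ n g) (f n) (g n))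
    where
    lem : ∀ a b c d → a + b + (c + d) ≡ a + c + (b + d)
    lem = solve-∀ ℚ-ring

  ∑-ι : ∀ n (f : ℕ → ℕ) c → ∑ n (λ k → ι (f k) * c) ≡ ι (sum< n f) * c
  ∑-ι zero    f c = sym (trans (cong (_* c) ι-0) (ℚ.*-zeroˡ c))
  ∑-ι (suc n) f c = trans (cong (_+ ι (f n) * c) (∑-ι n f c))
    (trans (sym (ℚ.*-distribʳ-+ c (ι (sum< n f)) (ι (f n)))) (cong (_* c) (sym (ι-+ (sum< n f) (f n)))))

  ∑-shift : ∀ n f → ∑ n (λ k → f (suc k)) + f 0 ≡ ∑ n f + f n
  ∑-shift zero    f = refl
  ∑-shift (suc n) f = trans (lem (∑ n (λ k → f (suc k))) (f (suc n)) (f 0)) (cong (_+ f (suc n)) (∑-shift n f))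
    where
    lem : ∀ a b c → a + b + c ≡ a + c + b
    lem = solve-∀ ℚ-ring

  ∑-pairs : ∀ n f → ∑ (n ℕ.+ n) f ≡ ∑ n (λ k → f (k ℕ.+ k) + f (suc (k ℕ.+ k)))
  ∑-pairs zero    f = refl
  ∑-pairs (suc n) f = trans (cong (λ m → ∑ m f + f (n ℕ.+ suc n)) (ℕ.+-suc n n))
    (trans (cong₂ (λ a m → a + f (n ℕ.+ n) + f m) (∑-pairs n f) (ℕ.+-suc n n)) (ℚ.+-assoc (∑ n (λ k → f (k ℕ.+ k) + f (suc (k ℕ.+ k)))) (f (n ℕ.+ n)) (f (suc (n ℕ.+ n)))))

  multiples : ℕ → ℕ → ℕ
  multiples W i = if does (W ∣? i) then 1 else 0

  -- The count is n / W rounded up, because 0 is counted as a multiple.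
  multiples-count : ∀ W → 0 ℕ.< W → ∀ n → (n ℕ.≤ W ℕ.* sum< n (multiples W)) × (W ℕ.* sum< n (multiples W) ℕ.< n ℕ.+ W)
  multiples-count W 0<W zero = ℕ.z≤n , subst (ℕ._< W) (sym (ℕ.*-zeroʳ W)) 0<W
  multiples-count W 0<W (suc n) with multiples-count W 0<W n | W ∣? n
  ... | lo , hi | yes (divides q n≡qW) = subst (suc n ℕ.≤_) (sym c≡) (ℕ.≤-trans (ℕ.≤-reflexive (ℕ.+-comm 1 n)) (ℕ.+-monoʳ-≤ n 0<W)) ,
      subst (ℕ._< suc n ℕ.+ W) (sym c≡) ℕ.≤-refl
    where
    c : ℕ
    c = sum< n (multiples W)
    q≡c : c ≡ q
    q≡c = ℕ.≤-antisym
      (ℕ.≤-pred (ℕ.*-cancelˡ-< W c (suc q) (ℕ.<-≤-trans hi (ℕ.≤-reflexive (trans (cong (ℕ._+ W) n≡qW) (lem q W))))))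
      (ℕ.*-cancelˡ-≤ W {{ℕ.>-nonZero 0<W}} (ℕ.≤-trans (ℕ.≤-reflexive (trans (ℕ.*-comm W q) (sym n≡qW))) lo))
      where
      lem : ∀ q W → q ℕ.* W ℕ.+ W ≡ W ℕ.* suc q
      lem = ℕ-Ring.solve-∀
    c≡ : W ℕ.* (c ℕ.+ 1) ≡ n ℕ.+ W
    c≡ = trans (cong (λ z → W ℕ.* (z ℕ.+ 1)) q≡c) (trans (lem W q) (cong (ℕ._+ W) (sym n≡qW)))
      where
      lem : ∀ W q → W ℕ.* (q ℕ.+ 1) ≡ q ℕ.* W ℕ.+ W
      lem = ℕ-Ring.solve-∀
  ... | lo , hi | no W∤n = subst (suc n ℕ.≤_) (cong (W ℕ.*_) (sym (ℕ.+-identityʳ c)))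
        (ℕ.≤∧≢⇒< lo (λ n≡ → W∤n (divides c (trans n≡ (ℕ.*-comm W c))))) ,
      subst (ℕ._< suc n ℕ.+ W) (cong (W ℕ.*_) (sym (ℕ.+-identityʳ c))) (ℕ.m<n⇒m<1+n hi)
    where
    c : ℕ
    c = sum< n (multiples W)

  sum<-split : ∀ m n f → sum< (m ℕ.+ n) f ≡ sum< m f ℕ.+ sum< n (λ i → f (m ℕ.+ i))
  sum<-split m zero    f = trans (cong (λ k → sum< k f) (ℕ.+-identityʳ m)) (sym (ℕ.+-identityʳ _))
  sum<-split m (suc n) f = trans (cong (λ k → sum< k f) (ℕ.+-suc m n))
    (trans (cong (ℕ._+ f (m ℕ.+ n)) (sum<-split m n f)) (ℕ.+-assoc (sum< m f) _ _))

  multiples-in-block : ∀ W → 0 ℕ.< W → ∀ m n → W ℕ.* sum< n (λ i → multiples W (m ℕ.+ i)) ℕ.≤ n ℕ.+ W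
  multiples-in-block W 0<W m n = ℕ.+-cancelˡ-≤ m _ _ (begin
    m ℕ.+ W ℕ.* d                ≤⟨ ℕ.+-monoˡ-≤ (W ℕ.* d) (proj₁ (multiples-count W 0<W m)) ⟩
    W ℕ.* c ℕ.+ W ℕ.* d          ≡⟨ trans (sym (ℕ.*-distribˡ-+ W c d)) (cong (W ℕ.*_) (sym (sum<-split m n (multiples W)))) ⟩
    W ℕ.* sum< (m ℕ.+ n) (multiples W) ≤⟨ ℕ.<⇒≤ (proj₂ (multiples-count W 0<W (m ℕ.+ n))) ⟩
    m ℕ.+ n ℕ.+ W                ≡⟨ ℕ.+-assoc m n W ⟩
    m ℕ.+ (n ℕ.+ W)              ∎)
    where
    open ℕ.≤-Reasoning
    c d : ℕ
    c = sum< m (multiples W)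
    d = sum< n (λ i → multiples W (m ℕ.+ i))

  Good : ℕ → ℕ → ℕ → ℕ → Set
  Good W₁ W₂ W₃ x = ¬ W₁ ∣ x × ¬ W₂ ∣ x × ¬ W₃ ∣ x

  good? : ∀ W₁ W₂ W₃ x → Dec (Good W₁ W₂ W₃ x)
  good? W₁ W₂ W₃ x = ¬? (W₁ ∣? x) ×-dec (¬? (W₂ ∣? x) ×-dec ¬? (W₃ ∣? x))

  0≤inv-ι : ∀ m → 0 ℕ.< m → 0ℚ ≤ inv (ι m)
  0≤inv-ι m 0<m = 0≤inv (ι m) (0<ι m 0<m)

  inv-ι-anti : ∀ {m n} → 0 ℕ.< m → m ℕ.≤ n → inv (ι n) ≤ inv (ι m)
  inv-ι-anti {m} {n} 0<m m≤n = inv-anti (0<ι m 0<m) (ι-mono m n m≤n)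

  -- The block sums over (N, 2N] increase under N ↦ 2N, since 1/(2k-1) + 1/2k ≥ 1/k.
  rightBlock : ℕ → ℚ
  rightBlock N = ∑ N (λ i → inv (ι (N ℕ.+ suc i)))

  right≤left : ∀ N → 0 ℕ.< N → rightBlock N ≤ harmonicBlock N
  right≤left N 0<N = ∑-mono N _ _ (λ i _ → inv-ι-anti (ℕ.≤-trans 0<N (ℕ.m≤m+n N i)) (ℕ.+-monoʳ-≤ N (ℕ.n≤1+n i)))

  left≤right : ∀ N → 0 ℕ.< N → harmonicBlock N ≤ rightBlock N + inv (ι N)
  left≤right N 0<N = subst₂ _≤_ refl (trans (sym (∑-shift N f)) (cong (λ m → rightBlock N + inv (ι m)) (ℕ.+-identityʳ N)))
    (p≤p+q (0≤inv-ι (N ℕ.+ N) (ℕ.≤-trans 0<N (ℕ.m≤m+n N N))))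
    where
    f : ℕ → ℚ
    f i = inv (ι (N ℕ.+ i))

  right-double : ∀ N → 0 ℕ.< N → rightBlock N ≤ rightBlock (N ℕ.+ N)
  right-double N 0<N = ℚ.≤-trans (∑-mono N _ _ (λ k _ → pair k)) (ℚ.≤-reflexive (sym (∑-pairs N _)))
    where
    pair : ∀ k → inv (ι (N ℕ.+ suc k)) ≤ inv (ι (N ℕ.+ N ℕ.+ suc (k ℕ.+ k))) + inv (ι (N ℕ.+ N ℕ.+ suc (suc (k ℕ.+ k))))
    pair k = ℚ.≤-trans (ℚ.≤-reflexive half) (ℚ.+-monoˡ-≤ _ (inv-ι-anti 0<d (ℕ.+-monoʳ-≤ (N ℕ.+ N) (ℕ.n≤1+n _))))
      where
      0<d : 0 ℕ.< N ℕ.+ N ℕ.+ suc (k ℕ.+ k)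
      0<d = ℕ.≤-trans 0<N (ℕ.≤-trans (ℕ.m≤m+n N N) (ℕ.m≤m+n _ _))
      m : ℕ
      m = N ℕ.+ N ℕ.+ suc (suc (k ℕ.+ k))
      half : inv (ι (N ℕ.+ suc k)) ≡ inv (ι m) + inv (ι m)
      half = trans (inv-quotient {q = 2} (ℕ.≤-trans 0<N (ℕ.m≤m+n N _)) (ℕ.≤-trans 0<N (ℕ.≤-trans (ℕ.m≤m+n N N) (ℕ.m≤m+n _ _))) (lem N k))
        (trans (cong (_* inv (ι m)) (trans (ι-+ 1 1) (cong₂ _+_ ι-1 ι-1))) (lem₂ (inv (ι m))))
        where
        lem : ∀ N k → 2 ℕ.* (N ℕ.+ suc k) ≡ N ℕ.+ N ℕ.+ suc (suc (k ℕ.+ k))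
        lem = ℕ-Ring.solve-∀
        lem₂ : ∀ i → (1ℚ + 1ℚ) * i ≡ i + i
        lem₂ = solve-∀ ℚ-ring

  module Weighted (W₀ W₁ W₂ W₃ : ℕ) (0<W₀ : 0 ℕ.< W₀) (W₁≥ : W₀ ℕ.≤ W₁) (W₂≥ : W₀ ℕ.≤ W₂) (W₃≥ : W₀ ℕ.≤ W₃) where

    weight : ℕ → ℚ
    weight x = if does (good? W₁ W₂ W₃ x) then inv (ι x) else 0ℚ

    private
      six : ℚ
      six = ι 6

      -- A block contains at most (N + W) / W multiples of W, each of weight at most 1 / N, which
      -- loses 1 / W + 1 / N.
      share : ∀ W N → W₀ ℕ.≤ W → W₀ ℕ.≤ N → ι (sum< N (λ i → multiples W (N ℕ.+ i))) * inv (ι N) ≤ inv (ι W₀) + inv (ι W₀)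
      share W N W≥ N≥ = begin
        ι d * inv (ι N)                             ≤⟨ *-mono-r (0≤inv-ι N 0<N) (ι-≤-inv 0<W (multiples-in-block W 0<W N N)) ⟩
        inv (ι W) * ι (N ℕ.+ W) * inv (ι N)         ≡⟨ cong (λ z → inv (ι W) * z * inv (ι N)) (ι-+ N W) ⟩
        inv (ι W) * (ι N + ι W) * inv (ι N)         ≡⟨ lem (inv (ι W)) (ι N) (ι W) (inv (ι N)) ⟩
        ι N * inv (ι N) * inv (ι W) + ι W * inv (ι W) * inv (ι N)
          ≡⟨ cong₂ (λ a b → a * inv (ι W) + b * inv (ι N)) (inv≡ (ι N) (0<ι N 0<N)) (inv≡ (ι W) (0<ι W 0<W)) ⟩
        1ℚ * inv (ι W) + 1ℚ * inv (ι N)             ≡⟨ cong₂ _+_ (ℚ.*-identityˡ (inv (ι W))) (ℚ.*-identityˡ (inv (ι N))) ⟩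
        inv (ι W) + inv (ι N)                       ≤⟨ ℚ.+-mono-≤ (inv-ι-anti 0<W₀ W≥) (inv-ι-anti 0<W₀ N≥) ⟩
        inv (ι W₀) + inv (ι W₀)                     ∎
        where
        open ℚ.≤-Reasoning
        d : ℕ
        d = sum< N (λ i → multiples W (N ℕ.+ i))
        0<W : 0 ℕ.< W
        0<W = ℕ.≤-trans 0<W₀ W≥
        0<N : 0 ℕ.< N
        0<N = ℕ.≤-trans 0<W₀ N≥
        lem : ∀ w n v i → w * (n + v) * i ≡ n * i * w + v * w * i
        lem = solve-∀ ℚ-ring

      pointwise : ∀ N x → 0 ℕ.< N → N ℕ.≤ x →
        inv (ι x) ≤ weight x + (ι (multiples W₁ x) * inv (ι N) + (ι (multiples W₂ x) * inv (ι N) + ι (multiples W₃ x) * inv (ι N)))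
      pointwise N x 0<N N≤x with W₁ ∣? x | W₂ ∣? x | W₃ ∣? x
      ... | no _  | no _  | no _  = p≤p+q (0≤+ (0≤term 0) (0≤+ (0≤term 0) (0≤term 0)))
        where
        0≤term : ∀ a → 0ℚ ≤ ι a * inv (ι N)
        0≤term a = 0≤* (0≤ι a) (0≤inv-ι N 0<N)
      ... | yes _ | b     | c     = ℚ.≤-trans (ℚ.≤-trans (inv-ι-anti 0<N N≤x) (ℚ.≤-reflexive (sym (trans (cong (_* inv (ι N)) ι-1) (ℚ.*-identityˡ _)))))
          (ℚ.≤-trans (p≤p+q (0≤+ (0≤term _) (0≤term _))) (p≤q+p ℚ.≤-refl))
        where
        0≤term : ∀ a → 0ℚ ≤ ι a * inv (ι N)
        0≤term a = 0≤* (0≤ι a) (0≤inv-ι N 0<N)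
      ... | no _  | yes _ | c     = ℚ.≤-trans (ℚ.≤-trans (inv-ι-anti 0<N N≤x) (ℚ.≤-reflexive (sym (trans (cong (_* inv (ι N)) ι-1) (ℚ.*-identityˡ _)))))
          (ℚ.≤-trans (ℚ.≤-trans (p≤p+q (0≤term _)) (p≤q+p (0≤term 0))) (p≤q+p ℚ.≤-refl))
        where
        0≤term : ∀ a → 0ℚ ≤ ι a * inv (ι N)
        0≤term a = 0≤* (0≤ι a) (0≤inv-ι N 0<N)
      ... | no _  | no _  | yes _ = ℚ.≤-trans (ℚ.≤-trans (inv-ι-anti 0<N N≤x) (ℚ.≤-reflexive (sym (trans (cong (_* inv (ι N)) ι-1) (ℚ.*-identityˡ _)))))
          (ℚ.≤-trans (ℚ.≤-trans (p≤q+p (0≤term 0)) (p≤q+p (0≤term 0))) (p≤q+p ℚ.≤-refl))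
        where
        0≤term : ∀ a → 0ℚ ≤ ι a * inv (ι N)
        0≤term a = 0≤* (0≤ι a) (0≤inv-ι N 0<N)

      block-weight : ∀ N → W₀ ℕ.≤ N → harmonicBlock N ≤ ∑ N (λ i → weight (N ℕ.+ i)) + six * inv (ι W₀)
      block-weight N N≥ = begin
        harmonicBlock N
          ≤⟨ ∑-mono N _ _ (λ i _ → pointwise N (N ℕ.+ i) 0<N (ℕ.m≤m+n N i)) ⟩
        ∑ N (λ i → weight (N ℕ.+ i) + (t W₁ i + (t W₂ i + t W₃ i)))
          ≡⟨ trans (∑-+ N _ _) (cong (S +_) (trans (∑-+ N _ _) (cong₂ _+_ (∑-ι N _ _) (trans (∑-+ N _ _) (cong₂ _+_ (∑-ι N _ _) (∑-ι N _ _)))))) ⟩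
        S + (s W₁ + (s W₂ + s W₃))
          ≤⟨ ℚ.+-monoʳ-≤ S (ℚ.+-mono-≤ (share W₁ N W₁≥ N≥) (ℚ.+-mono-≤ (share W₂ N W₂≥ N≥) (share W₃ N W₃≥ N≥))) ⟩
        S + (i + i + (i + i + (i + i)))
          ≡⟨ cong (S +_) (trans (lem i) (cong (_* i) (sym six≡))) ⟩
        S + six * i ∎
        where
        open ℚ.≤-Reasoning
        0<N : 0 ℕ.< N
        0<N = ℕ.≤-trans 0<W₀ N≥
        S i : ℚ
        S = ∑ N (λ i → weight (N ℕ.+ i))
        i = inv (ι W₀)
        t : ℕ → ℕ → ℚ
        t W i = ι (multiples W (N ℕ.+ i)) * inv (ι N)
        s : ℕ → ℚ
        s W = ι (sum< N (λ i → multiples W (N ℕ.+ i))) * inv (ι N)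
        six≡ : six ≡ 1ℚ + (1ℚ + (1ℚ + (1ℚ + (1ℚ + 1ℚ))))
        six≡ = trans (ι-suc 5) (cong (1ℚ +_) (trans (ι-suc 4) (cong (1ℚ +_) (trans (ι-suc 3) (cong (1ℚ +_) (trans (ι-suc 2) (cong (1ℚ +_) (trans (ι-suc 1) (cong (1ℚ +_) ι-1)))))))))
        lem : ∀ i → i + i + (i + i + (i + i)) ≡ (1ℚ + (1ℚ + (1ℚ + (1ℚ + (1ℚ + 1ℚ))))) * i
        lem = solve-∀ ℚ-ring

    module From (I₀ : ℕ) (I₀≥ : W₀ ℕ.≤ I₀) where

      -- A lower bound for the weight of every block from I₀ on: 6 / W₀ is lost to the multiples of
      -- three moduli, and another 1 / W₀ ≥ 1 / I₀ to the passage from `harmonicBlock` to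
      -- `rightBlock`.
      rate : ℚ
      rate = harmonicBlock I₀ - ι 7 * inv (ι W₀)

      private
        0<I₀ : 0 ℕ.< I₀
        0<I₀ = ℕ.≤-trans 0<W₀ I₀≥

      scale : ℕ → ℕ
      scale zero    = I₀
      scale (suc j) = scale j ℕ.+ scale j

      scale≥ : ∀ j → I₀ ℕ.≤ scale j
      scale≥ zero    = ℕ.≤-refl
      scale≥ (suc j) = ℕ.≤-trans (scale≥ j) (ℕ.m≤m+n _ _)

      scale≡ : ∀ j → scale j ≡ I₀ ℕ.* 2 ℕ.^ j
      scale≡ zero    = sym (ℕ.*-identityʳ I₀)
      scale≡ (suc j) = trans (cong (λ z → z ℕ.+ z) (scale≡ j)) (lem I₀ (2 ℕ.^ j))
        where
        lem : ∀ a b → a ℕ.* b ℕ.+ a ℕ.* b ≡ a ℕ.* (2 ℕ.* b)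
        lem = ℕ-Ring.solve-∀

      private
        right-scale : ∀ j → rightBlock I₀ ≤ rightBlock (scale j)
        right-scale zero    = ℚ.≤-refl
        right-scale (suc j) = ℚ.≤-trans (right-scale j) (right-double (scale j) (ℕ.≤-trans 0<I₀ (scale≥ j)))

        rate≤block : ∀ j → rate ≤ ∑ (scale j) (λ i → weight (scale j ℕ.+ i))
        rate≤block j = ℚ.≤-trans (ℚ.+-monoˡ-≤ (- (ι 7 * w)) (ℚ.≤-trans (left≤right I₀ 0<I₀) (ℚ.+-mono-≤
            (ℚ.≤-trans (right-scale j) (ℚ.≤-trans (right≤left (scale j) (ℕ.≤-trans 0<I₀ (scale≥ j))) (block-weight (scale j) (ℕ.≤-trans I₀≥ (scale≥ j)))))
            (inv-ι-anti 0<W₀ I₀≥))))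
          (ℚ.≤-reflexive (trans (cong (λ z → S + six * w + w - z * w) (ι-suc 6)) (lem S six w)))
          where
          w S : ℚ
          w = inv (ι W₀)
          S = ∑ (scale j) (λ i → weight (scale j ℕ.+ i))
          lem : ∀ S s w → S + s * w + w - (1ℚ + s) * w ≡ S
          lem = solve-∀ ℚ-ring

      range : ℕ → ℕ
      range zero    = 0
      range (suc j) = range j ℕ.+ scale j

      I₀+range : ∀ j → I₀ ℕ.+ range j ≡ scale j
      I₀+range zero    = ℕ.+-identityʳ I₀
      I₀+range (suc j) = trans (sym (ℕ.+-assoc I₀ (range j) (scale j))) (cong (ℕ._+ scale j) (I₀+range j))

      total-weight : ∀ j → ι j * rate ≤ ∑ (range j) (λ i → weight (I₀ ℕ.+ i))
      total-weight zero    = ℚ.≤-reflexive (trans (cong (_* rate) ι-0) (ℚ.*-zeroˡ rate))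
      total-weight (suc j) = ℚ.≤-trans (ℚ.≤-reflexive (trans (cong (_* rate) (ι-suc j)) (lem (ι j) rate)))
        (ℚ.≤-trans (ℚ.+-mono-≤ (total-weight j) (rate≤block j)) (ℚ.≤-reflexive (sym (trans (∑-split (range j) (scale j) f)
          (cong (∑ (range j) f +_) (Estimates.∑-cong (scale j) _ _ (λ i → cong weight (trans (sym (ℕ.+-assoc I₀ (range j) i)) (cong (ℕ._+ i) (I₀+range j))))))))))
        where
        f : ℕ → ℚ
        f i = weight (I₀ ℕ.+ i)
        lem : ∀ j r → (1ℚ + j) * r ≡ j * r + r
        lem = solve-∀ ℚ-ring

-- The greedy choice of denominators.

module Greedy where

  open import Defs using (inv; ∑)
  open Arith
  open ListSum
  open Rationals
  open Counting using (sum<)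
  open Harmonic
  open import Data.Bool.Base using (if_then_else_; true; false)
  open import Data.Nat.Base
  open import Data.Nat.Properties
  open import Data.Nat.Divisibility using (_∣_)
  import Data.Nat.Tactic.RingSolver as ℕ-Ring
  open import Data.List.Base using (List; []; _∷_; length)
  open import Data.List.Relation.Unary.All as All using (All; []; _∷_)
  open import Data.List.Relation.Unary.AllPairs using ([]; _∷_)
  open import Data.List.Relation.Unary.Unique.Propositional using (Unique)
  open import Data.Rational.Base as ℚ using (ℚ)
  import Data.Rational.Properties as ℚ
  open import Data.Product.Base using (∃-syntax; _×_; _,_)
  open import Data.Sum.Base using (_⊎_; inj₁; inj₂)
  open import Relation.Nullary using (¬_; yes; no; contradiction; does)
  open import Relation.Nullary.Decidable using (dec-true; dec-false)
  open import Tactic.RingSolver using (solve-∀)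
  open import Relation.Binary.PropositionalEquality

  module _ (W₁ W₂ W₃ I₀ P G : ℕ) (2P≤I₀ : 2 * P ≤ I₀) (0<P : 0 < P) (0<G : 0 < G) where

    share : ℕ → ℕ
    share x = if does (good? W₁ W₂ W₃ x) then G ÷ x else 0

    share-bad : ∀ x → ¬ Good W₁ W₂ W₃ x → share x ≡ 0
    share-bad x ¬g = cong (λ b → if b then G ÷ x else 0) (dec-false (good? W₁ W₂ W₃ x) ¬g)

    share-good : ∀ x → Good W₁ W₂ W₃ x → share x ≡ G ÷ x
    share-good x g = cong (λ b → if b then G ÷ x else 0) (dec-true (good? W₁ W₂ W₃ x) g)

    -- T is what remains of the numerator T₀ over G. The factor P is there because T / G will be
    -- divided by P in the end, whereas the chosen reciprocals will not.
    record Chosen (m T₀ T : ℕ) : Set where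
      field
        us      : List ℕ
        unique  : Unique us
        members : All (λ x → I₀ ≤ x × x < I₀ + m × Good W₁ W₂ W₃ x) us
        short   : length us ≤ m
        sums    : T + P * sumBy (G ÷_) us ≡ T₀

    private
      0<I₀ : 0 < I₀
      0<I₀ = ≤-trans (≤-trans 0<P (m≤m+n P (P + 0))) 2P≤I₀

      widen : ∀ {m T₀ T} → Chosen m T₀ T → Chosen (suc m) T₀ T
      widen {m} c = record { us = us ; unique = unique ; sums = sums ; short = m≤n⇒m≤1+n short
        ; members = All.map (λ (lo , hi , g) → lo , ≤-trans hi (+-monoʳ-≤ I₀ (n≤1+n m)) , g) members }
        where open Chosen c

    Stopped : ℕ → ℕ → Set
    Stopped m T₀ = ∃[ T ] (Chosen m T₀ T × G ≤ 2 * T × T < G)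

    Running : ℕ → ℕ → Set
    Running m T₀ = ∃[ T ] ∃[ c ] (G ≤ T × sumBy (G ÷_) (Chosen.us {m} {T₀} {T} c) ≡ sum< m (λ i → share (I₀ + i)))

    greedy : ∀ m T₀ → (∀ i → i < m → I₀ + i ∣ G) → G ≤ 2 * T₀ → Stopped m T₀ ⊎ Running m T₀
    greedy zero T₀ _ G≤2T₀ with T₀ <? G
    ... | yes lt = inj₁ (T₀ , record { us = [] ; unique = [] ; members = [] ; short = z≤n ; sums = trans (cong (T₀ +_) (*-zeroʳ P)) (+-identityʳ T₀) } , G≤2T₀ , lt)
    ... | no ge  = inj₂ (T₀ , record { us = [] ; unique = [] ; members = [] ; short = z≤n ; sums = trans (cong (T₀ +_) (*-zeroʳ P)) (+-identityʳ T₀) } , ≮⇒≥ ge , refl)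
    greedy (suc m) T₀ div G≤2T₀ with greedy m T₀ (λ i i<m → div i (m<n⇒m<1+n i<m)) G≤2T₀
    ... | inj₁ (T , c , rest) = inj₁ (T , widen c , rest)
    ... | inj₂ (T , c , G≤T , total) with good? W₁ W₂ W₃ (I₀ + m)
    ...   | no ¬g = inj₂ (T , widen c , G≤T , trans total (trans (sym (+-identityʳ _)) (cong (λ z → sum< m (λ i → share (I₀ + i)) + z) (sym (share-bad (I₀ + m) ¬g)))))
    ...   | yes g with T ∸ P * (G ÷ (I₀ + m)) <? G
    ...     | yes lt = inj₁ (T ∸ P * (G ÷ (I₀ + m)) , chosen , half , lt)
      where
      open Chosen c
      x q : ℕ
      x = I₀ + m
      q = P * (G ÷ x)
      -- Since x ≥ 2 P, a choice removes at most G / 2, so the remainder cannot jump over the window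
      -- from G / 2 to G.
      2q≤G : 2 * q ≤ G
      2q≤G = begin
        2 * (P * (G ÷ x))  ≡⟨ sym (*-assoc 2 P (G ÷ x)) ⟩
        2 * P * (G ÷ x)    ≤⟨ *-monoˡ-≤ (G ÷ x) (≤-trans 2P≤I₀ (m≤m+n I₀ m)) ⟩
        x * (G ÷ x)        ≡⟨ trans (*-comm x (G ÷ x)) (÷-exact (div m ≤-refl)) ⟩
        G                  ∎
        where open ≤-Reasoning
      q≤T : q ≤ T
      q≤T = ≤-trans (m≤m+n q (q + 0)) (≤-trans 2q≤G G≤T)
      half : G ≤ 2 * (T ∸ q)
      half = +-cancelʳ-≤ (2 * q) G _ (≤-trans (≤-trans (+-monoʳ-≤ G 2q≤G) (+-mono-≤ G≤T G≤T))
        (≤-reflexive (trans (cong (λ t → t + t) (sym (m∸n+n≡m q≤T))) (lem (T ∸ q) q))))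
        where
        lem : ∀ a b → (a + b) + (a + b) ≡ 2 * a + 2 * b
        lem = ℕ-Ring.solve-∀
      chosen : Chosen (suc m) T₀ (T ∸ q)
      chosen = record
        { us = x ∷ us ; unique = All.map (λ (_ , hi , _) eq → <⇒≢ hi (sym eq)) members ∷ unique
        ; members = (m≤m+n I₀ m , ≤-reflexive (sym (+-suc I₀ m)) , g) ∷ Chosen.members (widen c) ; short = s≤s short
        ; sums = trans (lem (T ∸ q) P (G ÷ x) _) (trans (cong (_+ P * sumBy (G ÷_) us) (m∸n+n≡m q≤T)) sums) }
        where
        lem : ∀ t p a b → t + p * (a + b) ≡ t + p * a + p * b
        lem = ℕ-Ring.solve-∀
    ...     | no ge = inj₂ (T ∸ P * (G ÷ (I₀ + m)) , chosen , ≮⇒≥ ge ,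
              trans (cong₂ _+_ (sym (share-good x g)) total) (+-comm (share x) _))
      where
      open Chosen c
      x q : ℕ
      x = I₀ + m
      q = P * (G ÷ x)
      q≤T : q ≤ T
      q≤T = ≮⇒≥ (λ T<q → <⇒≱ 0<G (≤-trans (≮⇒≥ ge) (≤-reflexive (m≤n⇒m∸n≡0 (<⇒≤ T<q)))))
      chosen : Chosen (suc m) T₀ (T ∸ q)
      chosen = record
        { us = x ∷ us ; unique = All.map (λ (_ , hi , _) eq → <⇒≢ hi (sym eq)) members ∷ unique
        ; members = (m≤m+n I₀ m , ≤-reflexive (sym (+-suc I₀ m)) , g) ∷ Chosen.members (widen c) ; short = s≤s short
        ; sums = trans (lem (T ∸ q) P (G ÷ x) _) (trans (cong (_+ P * sumBy (G ÷_) us) (m∸n+n≡m q≤T)) sums) }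
        where
        lem : ∀ t p a b → t + p * (a + b) ≡ t + p * a + p * b
        lem = ℕ-Ring.solve-∀

    module _ (W₀ : ℕ) (0<W₀ : 0 < W₀) (W₁≥ : W₀ ≤ W₁) (W₂≥ : W₀ ≤ W₂) (W₃≥ : W₀ ≤ W₃) (I₀≥ : W₀ ≤ I₀) where

      open Weighted W₀ W₁ W₂ W₃ 0<W₀ W₁≥ W₂≥ W₃≥
      open From I₀ I₀≥

      private
        share-weight : ∀ x → 0 < x → x ∣ G → ι (share x) ≡ ι G ℚ.* weight x
        share-weight x 0<x x∣G with does (good? W₁ W₂ W₃ x)
        ... | false = trans ι-0 (sym (ℚ.*-zeroʳ (ι G)))
        ... | true  = sym (trans (cong (ι G ℚ.*_) (inv-quotient 0<x 0<G (÷-exact x∣G)))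
          (trans (lem (ι G) (ι (G ÷ x)) (inv (ι G))) (trans (cong (ι (G ÷ x) ℚ.*_) (inv≡ (ι G) (0<ι G 0<G))) (ℚ.*-identityʳ _))))
          where
          lem : ∀ g q i → g ℚ.* (q ℚ.* i) ≡ q ℚ.* (g ℚ.* i)
          lem = solve-∀ ℚ-ring

        shares : ∀ m → (∀ i → i < m → I₀ + i ∣ G) → ι (sum< m (λ i → share (I₀ + i))) ≡ ι G ℚ.* ∑ m (λ i → weight (I₀ + i))
        shares zero    div = trans ι-0 (sym (ℚ.*-zeroʳ (ι G)))
        shares (suc m) div = trans (ι-+ (sum< m (λ i → share (I₀ + i))) (share (I₀ + m)))
          (trans (cong₂ ℚ._+_ (shares m (λ i i<m → div i (m<n⇒m<1+n i<m))) (share-weight (I₀ + m) (≤-trans 0<I₀ (m≤m+n I₀ m)) (div m ≤-refl)))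
            (sym (ℚ.*-distribˡ-+ (ι G) _ _)))

      -- A run that stays above the window takes every good x, hence at least T₀ by the lower bound
      -- on the weight; but then nothing remains.
      greedy-stops : ∀ K T₀ a → (∀ i → i < range K → I₀ + i ∣ G) → G ≤ 2 * T₀ →
                     ι T₀ ℚ.≤ ι P ℚ.* (ι G ℚ.* a) → a ℚ.≤ ι K ℚ.* rate → Stopped (range K) T₀
      greedy-stops K T₀ a div G≤2T₀ T₀≤ a≤ with greedy (range K) T₀ div G≤2T₀
      ... | inj₁ stopped = stopped
      ... | inj₂ (T , c , G≤T , total) = contradiction (ι-cancel-≤ T₀≤PΣ) (<⇒≱ PΣ<T₀)
        where
        open Chosen c
        Σ : ℕ
        Σ = sumBy (G ÷_) us
        PΣ<T₀ : P * Σ < T₀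
        PΣ<T₀ = ≤-trans (+-monoˡ-≤ (P * Σ) (≤-trans 0<G G≤T)) (≤-reflexive sums)
        T₀≤PΣ : ι T₀ ℚ.≤ ι (P * Σ)
        T₀≤PΣ = ℚ.≤-trans T₀≤ (ℚ.≤-trans (*-mono-l (0≤ι P) (ℚ.≤-trans (*-mono-l (0≤ι G) (ℚ.≤-trans a≤ (total-weight K)))
          (ℚ.≤-reflexive (trans (sym (shares (range K) div)) (cong ι (sym total)))))) (ℚ.≤-reflexive (sym (ι-* P Σ))))

-- Putting the four families together.

module Assembly where

  open import Defs using (inv; Partition)
  open Arith
  open ListSum
  open Rationals
  open Recip
  open Tower
  open TowerBound
  open GrahamChains
  open Threshold using (partition)
  open Harmonic
  open Greedy
  open import Data.Nat.Base
  open import Data.Nat.Properties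
  open import Data.Nat.Divisibility
  open import Data.Nat.DivMod using (m≡m%n+[m/n]*n; m%n<n)
  open import Data.Nat.Coprimality using (Coprime; coprime-divisor)
  import Data.Nat.Tactic.RingSolver as ℕ-Ring
  open import Data.List.Base using (List; []; _∷_; _++_; map)
  open import Data.List.Membership.Propositional using (_∈_)
  open import Data.List.Membership.Propositional.Properties using (∈-map⁻; ∈-++⁻)
  open import Data.List.Relation.Unary.All as All using (All; []; _∷_)
  import Data.List.Relation.Unary.All.Properties as All
  open import Data.List.Relation.Unary.Unique.Propositional using (Unique)
  import Data.List.Relation.Unary.Unique.Propositional.Properties as Unique
  open import Data.Product.Base using (∃-syntax; _×_; _,_; proj₁; proj₂)
  open import Data.Sum.Base using (_⊎_; [_,_]′)
  open import Data.Rational.Base as ℚ using (ℚ; 1ℚ; ½)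
  import Data.Rational.Properties as ℚ
  open import Function.Base using (id)
  open import Relation.Nullary using (¬_)
  open import Tactic.RingSolver using (solve-∀)
  open import Relation.Binary.PropositionalEquality

  half-≤ : ∀ {G t} → G ≤ 2 * t → ½ ℚ.* ι G ℚ.≤ ι t
  half-≤ {G} {t} h = ℚ.≤-trans (*-mono-l (ℚ.nonNegative⁻¹ ½) (ι-mono G (2 * t) h))
    (ℚ.≤-reflexive (trans (cong (½ ℚ.*_) (trans (ι-* 2 t) (cong (ℚ._* ι t) (trans (ι-+ 1 1) (cong₂ ℚ._+_ ι-1 ι-1)))))
      (trans (sym (ℚ.*-assoc ½ (1ℚ ℚ.+ 1ℚ) (ι t))) (ℚ.*-identityˡ (ι t)))))

  -- A D - (D - q) is divided by q, and D - q is given back to the remainder. As 2 q ≤ D, this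
  -- places r in the window from D / 2 to D where expansions exist.
  split-off : ∀ A D q → 0 < q → suc q ≤ A → 2 * q ≤ D →
              ∃[ s ] ∃[ r ] (A * D ≡ s * q + r × D ≤ 2 * r × r < D × D ≤ s)
  split-off A D q@(suc _) _ q<A 2q≤D = s , r , AD≡ , D≤2r , r<D , D≤s
    where
    E X s r : ℕ
    E = D ∸ q
    X = A * D ∸ E
    s = X / q
    r = E + X % q
    q≤D : q ≤ D
    q≤D = ≤-trans (m≤m+n q (q + 0)) 2q≤D
    E+q : E + q ≡ D
    E+q = m∸n+n≡m q≤D
    E≤AD : E ≤ A * D
    E≤AD = ≤-trans (m∸n≤m D q) (m≤n*m D A {{>-nonZero (≤-trans (s≤s z≤n) q<A)}})
    AD≡ : A * D ≡ s * q + r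
    AD≡ = trans (sym (m+[n∸m]≡n E≤AD)) (trans (cong (E +_) (m≡m%n+[m/n]*n X q)) (lem E (X % q) (s * q)))
      where
      lem : ∀ a b c → a + (b + c) ≡ c + (a + b)
      lem = ℕ-Ring.solve-∀
    D≤2r : D ≤ 2 * r
    D≤2r = ≤-trans (+-cancelʳ-≤ (2 * q) D (2 * E) (≤-trans (+-monoʳ-≤ D 2q≤D)
      (≤-reflexive (trans (cong (λ z → z + z) (sym E+q)) (lem E q))))) (*-monoʳ-≤ 2 (m≤m+n E (X % q)))
      where
      lem : ∀ a b → (a + b) + (a + b) ≡ 2 * a + 2 * b
      lem = ℕ-Ring.solve-∀
    r<D : r < D
    r<D = ≤-trans (+-monoʳ-< E (m%n<n X q)) (≤-reflexive E+q)
    D≤s : D ≤ s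
    D≤s = *-cancelʳ-≤ D s q (+-cancelʳ-≤ D (D * q) (s * q) (begin
      D * q + D     ≡⟨ trans (+-comm (D * q) D) (trans (cong (λ z → D + z) (*-comm D q)) refl) ⟩
      suc q * D     ≤⟨ *-monoˡ-≤ D q<A ⟩
      A * D         ≡⟨ AD≡ ⟩
      s * q + r     ≤⟨ +-monoʳ-≤ (s * q) (<⇒≤ r<D) ⟩
      s * q + D     ∎))
      where open ≤-Reasoning

  module Assemble
    (n₀ W₀ P W₂ M T Mg u I₀ p q K k : ℕ)
    (0<W₀ : 0 < W₀) (W₀≤P : W₀ ≤ P) (W₀≤W₂ : W₀ ≤ W₂) (31∣P : 31 ∣ P) (4≤P : 4 ≤ P) (2P≤I₀ : 2 * P ≤ I₀)
    (Mg≡ : Mg ≡ M * W₂) (Mg-power : Mg ≡ base ^ suc T) (u≡ : u ≡ 43 * Mg + 1)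
    (0<p : 0 < p) (0<q : 0 < q) (q≤Mp : q ≤ M * p) (0<k : 0 < k)
    where

    open GadgetAt T Mg u Mg-power u≡

    -- The gadget leaves p / q - 44 / (129 M W₂) = a / (M P b). Written as a k / (M P Q), it allows
    -- an enlarged denominator Q.
    b a Q : ℕ
    b = 129 * W₂ * q
    a = P * (129 * W₂ * (M * p) ∸ 44 * q)
    Q = b * k

    0<P : 0 < P
    0<P = ≤-trans (s≤s z≤n) 4≤P

    0<W₂ : 0 < W₂
    0<W₂ = ≤-trans 0<W₀ W₀≤W₂

    0<b : 0 < b
    0<b = *-mono-≤ {1} (*-mono-≤ {1} {129} (s≤s z≤n) 0<W₂) 0<q

    0<Q : 0 < Q
    0<Q = *-mono-≤ 0<b 0<k

    0<M′ : 0 < M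
    0<M′ = n≢0⇒n>0 (λ M≡0 → <⇒≢ 0<q (sym (n≤0⇒n≡0 (≤-trans q≤Mp (≤-reflexive (cong (_* p) M≡0))))))

    private
      W₀≤u : W₀ ≤ u
      W₀≤u = ≤-trans W₀≤W₂ (≤-trans (m≤n*m W₂ M {{>-nonZero 0<M′}}) (≤-trans (≤-reflexive (sym Mg≡))
        (≤-trans (m≤n*m Mg 43) (≤-trans (m≤m+n (43 * Mg) 1) (≤-reflexive (sym u≡))))))

      W₀≤I₀ : W₀ ≤ I₀
      W₀≤I₀ = ≤-trans W₀≤P (≤-trans (m≤m+n P (P + 0)) 2P≤I₀)

      44q≤ : 44 * q ≤ 129 * W₂ * (M * p)
      44q≤ = *-mono-≤ {44} (≤-trans (≤ᵇ⇒≤ 44 129 _) (m≤m*n 129 W₂ {{>-nonZero 0<W₂}})) q≤Mp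

      gap : ℕ
      gap = 129 * W₂ * (M * p) ∸ 44 * q

      gap≡ : gap + 44 * q ≡ 129 * W₂ * (M * p)
      gap≡ = m∸n+n≡m 44q≤

      -- Through `split-off` this gives s ≥ D, so that the greedy choice does not start below its
      -- window.
      b<a : suc b ≤ a
      b<a = begin
        suc b                ≤⟨ +-monoˡ-≤ b 0<b ⟩
        b + b                ≤⟨ bb ⟩
        4 * gap              ≤⟨ *-monoˡ-≤ gap 4≤P ⟩
        P * gap              ∎
        where
        open ≤-Reasoning
        176q≤ : 176 * q ≤ b + b
        176q≤ = ≤-trans (*-monoˡ-≤ q (≤-trans (≤ᵇ⇒≤ 176 258 _) (m≤m*n 258 W₂ {{>-nonZero 0<W₂}}))) (≤-reflexive (lem W₂ q))
          where
          lem : ∀ W q → 258 * W * q ≡ 129 * W * q + 129 * W * q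
          lem = ℕ-Ring.solve-∀
        bb : b + b ≤ 4 * gap
        bb = +-cancelʳ-≤ (176 * q) (b + b) (4 * gap) (begin
          b + b + 176 * q                 ≤⟨ +-monoʳ-≤ (b + b) 176q≤ ⟩
          b + b + (b + b)                 ≡⟨ lem₁ b ⟩
          4 * b                           ≤⟨ *-monoʳ-≤ 4 (*-monoʳ-≤ (129 * W₂) q≤Mp) ⟩
          4 * (129 * W₂ * (M * p))        ≡⟨ cong (4 *_) (sym gap≡) ⟩
          4 * (gap + 44 * q)              ≡⟨ lem₂ gap q ⟩
          4 * gap + 176 * q               ∎)
          where
          lem₁ : ∀ b → b + b + (b + b) ≡ 4 * b
          lem₁ = ℕ-Ring.solve-∀
          lem₂ : ∀ g q → 4 * (g + 44 * q) ≡ 4 * g + 176 * q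
          lem₂ = ℕ-Ring.solve-∀

      Q<ak : suc Q ≤ a * k
      Q<ak = ≤-trans (+-monoˡ-≤ Q 0<k) (≤-trans (≤-reflexive (lem b k)) (*-monoˡ-≤ k b<a))
        where
        lem : ∀ b k → k + b * k ≡ suc b * k
        lem = ℕ-Ring.solve-∀

    open Weighted W₀ P W₂ u 0<W₀ W₀≤P W₀≤W₂ W₀≤u
    open From I₀ W₀≤I₀

    reach : scale K ≡ I₀ * 2 ^ K
    reach = scale≡ K

    module Parts (y y₁ c c₁ : ℕ) (y₁≤y : y₁ ≤ y) (reach≤y : scale K ≤ y)
      (reps : Reps (modulus n₀ y) ½ c) (reps₁ : Reps (modulus n₀ y₁) ½ c₁)
      (2Q≤D : 2 * Q ≤ modulus n₀ y₁) (c<Q : c < Q) (reach²≤Q : scale K * scale K ≤ Q)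
      (enough : ι (M * p) ℚ.* inv (ι q) ℚ.≤ ι K ℚ.* rate) where

      G D e : ℕ
      G = modulus n₀ y
      D = modulus n₀ y₁
      e = G ÷ D
      eD : e * D ≡ G
      eD = ÷-exact (modulus-mono n₀ y₁≤y)
      0<G : 0 < G
      0<G = modulus>0 n₀ y
      0<D : 0 < D
      0<D = modulus>0 n₀ y₁

      module _ (s r : ℕ) (akD≡ : a * k * D ≡ s * Q + r) (D≤2r : D ≤ 2 * r) (r<D : r < D) (D≤s : D ≤ s) where

        -- a k / Q = s / D + r / (Q D), and s / D = T₀ / G because G = e D. The first fraction goes
        -- to families (2) and (3), the second to family (4).
        T₀ : ℕ
        T₀ = s * e

        G≤2T₀ : G ≤ 2 * T₀
        G≤2T₀ = ≤-trans (≤-trans (≤-reflexive (trans (sym eD) (*-comm e D))) (*-monoˡ-≤ e D≤s)) (m≤m+n T₀ (T₀ + 0))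

        -- The greedy choice has to supply T₀ / (P G), which this bounds by M p / q, the quantity
        -- that `enough` compares with the available weight.
        qT₀≤ : q * T₀ ≤ P * (G * (M * p))
        qT₀≤ = *-cancelˡ-≤ (129 * W₂ * k) {{>-nonZero (*-mono-≤ {1} (*-mono-≤ {1} {129} (s≤s z≤n) 0<W₂) 0<k)}} (begin
          129 * W₂ * k * (q * (s * e))         ≡⟨ lem₁ (129 * W₂) k q s e ⟩
          s * Q * e                            ≤⟨ *-monoˡ-≤ e (≤-trans (m≤m+n (s * Q) r) (≤-reflexive (sym akD≡))) ⟩
          P * gap * k * D * e                  ≤⟨ *-monoˡ-≤ e (*-monoˡ-≤ D (*-monoˡ-≤ k (*-monoʳ-≤ P (≤-trans (m≤m+n gap (44 * q)) (≤-reflexive gap≡))))) ⟩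
          P * (129 * W₂ * (M * p)) * k * D * e ≡⟨ lem₂ P (129 * W₂) (M * p) k D e ⟩
          129 * W₂ * k * (P * (e * D * (M * p))) ≡⟨ cong (λ g → 129 * W₂ * k * (P * (g * (M * p)))) eD ⟩
          129 * W₂ * k * (P * (G * (M * p)))   ∎)
          where
          open ≤-Reasoning
          lem₁ : ∀ w k q s e → w * k * (q * (s * e)) ≡ s * (w * q * k) * e
          lem₁ = ℕ-Ring.solve-∀
          lem₂ : ∀ P w m k D e → P * (w * m) * k * D * e ≡ w * k * (P * (e * D * m))
          lem₂ = ℕ-Ring.solve-∀

        T₀≤ : ι T₀ ℚ.≤ ι P ℚ.* (ι G ℚ.* (ι (M * p) ℚ.* inv (ι q)))
        T₀≤ = ℚ.≤-trans (ι-≤-inv 0<q qT₀≤) (ℚ.≤-reflexive (trans (cong (inv (ι q) ℚ.*_) (trans (ι-* P (G * (M * p))) (cong (ι P ℚ.*_) (ι-* G (M * p)))))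
          (lem (inv (ι q)) (ι P) (ι G) (ι (M * p)))))
          where
          lem : ∀ i P G m → i ℚ.* (P ℚ.* (G ℚ.* m)) ≡ P ℚ.* (G ℚ.* (m ℚ.* i))
          lem = solve-∀ ℚ-ring

        reach∣G : ∀ i → i < range K → I₀ + i ∣ G
        reach∣G i i< = modulus-complete n₀ y (I₀ + i) (≤-trans (≤-trans 0<W₀ W₀≤I₀) (m≤m+n I₀ i))
          (≤-trans (≤-trans (+-monoʳ-≤ I₀ (<⇒≤ i<)) (≤-reflexive (I₀+range K))) reach≤y)

        stopped : Stopped P W₂ u I₀ P G 2P≤I₀ 0<P 0<G (range K) T₀
        stopped = greedy-stops P W₂ u I₀ P G 2P≤I₀ 0<P 0<G W₀ 0<W₀ W₀≤P W₀≤W₂ W₀≤u W₀≤I₀ K T₀ (ι (M * p) ℚ.* inv (ι q)) reach∣G G≤2T₀ T₀≤ enough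

        module Glue (T₁ : ℕ) (chosen : Chosen P W₂ u I₀ P G 2P≤I₀ 0<P 0<G (range K) T₀ T₁) (F : Rep G T₁ c) (R : Rep D r c₁) where

          module Chosen′ = Chosen chosen
          module F = Rep F
          module R = Rep R

          us : List ℕ
          us = Chosen′.us

          MP MPQ : ℕ
          MP = M * P
          MPQ = M * P * Q

          0<MP : 0 < MP
          0<MP = *-mono-≤ 0<M′ 0<P

          0<MPQ : 0 < MPQ
          0<MPQ = *-mono-≤ 0<MP 0<Q

          As Bs Cs fixed : List ℕ
          As = map (M *_) us
          Bs = map (MP *_) F.xs
          Cs = map (MPQ *_) R.xs
          fixed = As ++ (Bs ++ Cs)

          fixedSum : ℕ
          fixedSum = sumBy id fixed

          us-range : All (λ x → 0 < x × x ≤ scale K) us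
          us-range = All.map (λ (lo , hi , _) → ≤-trans (≤-trans 0<W₀ W₀≤I₀) lo , <⇒≤ (≤-trans hi (≤-reflexive (I₀+range K)))) Chosen′.members

          -- Families (2) and (3) cost at most M P Q each, by reach² ≤ Q and c < Q; the remaining M
          -- P Q c₁ is family (4).
          fixedSum≤ : fixedSum ≤ MPQ * (2 + c₁)
          fixedSum≤ = begin
            sumBy id fixed
              ≡⟨ trans (sumBy-++ id As _) (cong₂ _+_ (scaled M us) (trans (sumBy-++ id Bs Cs) (cong₂ _+_ (scaled MP F.xs) (scaled MPQ R.xs)))) ⟩
            M * sumBy id us + (MP * sumBy id F.xs + MPQ * sumBy id R.xs)
              ≤⟨ +-mono-≤ (*-monoʳ-≤ M us-sum) (+-mono-≤ (*-monoʳ-≤ MP (≤-trans F.cost (<⇒≤ c<Q))) (*-monoʳ-≤ MPQ R.cost)) ⟩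
            M * Q + (MP * Q + MPQ * c₁)
              ≤⟨ +-monoˡ-≤ _ (*-monoˡ-≤ Q (m≤m*n M P {{>-nonZero 0<P}})) ⟩
            MP * Q + (MP * Q + MPQ * c₁)
              ≡⟨ lem MPQ c₁ ⟩
            MPQ * (2 + c₁) ∎
            where
            open ≤-Reasoning
            scaled : ∀ m xs → sumBy id (map (m *_) xs) ≡ m * sumBy id xs
            scaled m xs = trans (sumBy-map id (m *_) xs) (sumBy-*ˡ m id xs)
            us-sum : sumBy id us ≤ Q
            us-sum = ≤-trans (sumBy-bound (scale K) (All.map proj₂ us-range)) (≤-trans (*-monoˡ-≤ (scale K)
              (≤-trans Chosen′.short (≤-trans (m≤n+m (range K) I₀) (≤-reflexive (I₀+range K))))) reach²≤Q)
            lem : ∀ m c → m + (m + m * c) ≡ m * (2 + c)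
            lem = ℕ-Ring.solve-∀

          private
            P∣-Bs : ∀ {x} → x ∈ Bs ++ Cs → ∃[ z ] (x ≡ M * (P * z))
            P∣-Bs x∈ = [ (λ ∈B → let z , _ , eq = ∈-map⁻ (MP *_) ∈B in z , trans eq (*-assoc M P z))
                       , (λ ∈C → let z , _ , eq = ∈-map⁻ (MPQ *_) ∈C in Q * z , trans eq (trans (*-assoc (M * P) Q z) (*-assoc M P (Q * z)))) ]′ (∈-++⁻ Bs x∈)

            A-B : ∀ {x} → x ∈ As → ¬ x ∈ Bs ++ Cs
            A-B ∈A ∈BC with ∈-map⁻ (M *_) ∈A | P∣-Bs ∈BC
            ... | v , v∈ , eq | z , eq′ = proj₁ (proj₂ (proj₂ (All.lookup Chosen′.members v∈)))
              (divides z (trans (*-cancelˡ-≡ v (P * z) M {{>-nonZero 0<M′}} (trans (sym eq) eq′)) (*-comm P z)))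

            -- A part of F is at most the total cost c < Q, whereas the parts of the last family
            -- carry the factor Q.
            B-C : ∀ {x} → x ∈ Bs → ¬ x ∈ Cs
            B-C ∈B ∈C with ∈-map⁻ (MP *_) ∈B | ∈-map⁻ (MPQ *_) ∈C
            ... | z , z∈ , eq | z′ , z′∈ , eq′ = <⇒≱ (≤-<-trans (≤-trans (∈⇒≤sumBy {id} z∈) F.cost) c<Q)
              (≤-trans (m≤m*n Q z′ {{>-nonZero (proj₁ (All.lookup R.members z′∈))}})
                (≤-reflexive (sym (*-cancelˡ-≡ z (Q * z′) MP {{>-nonZero 0<MP}} (trans (sym eq) (trans eq′ (*-assoc MP Q z′)))))))

            u-coprime-M : Coprime u M
            u-coprime-M {i} (i∣u , i∣M) = ∣1⇒≡1 (∣m+n∣m⇒∣n (subst (i ∣_) u≡ i∣u)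
              (∣-trans i∣M (∣-trans (m∣m*n W₂) (subst (λ z → M * W₂ ∣ 43 * z) (sym Mg≡) (n∣m*n 43)))))

            -- Mg = M W₂, and u is coprime to M. So a common part M v would make v a multiple of W₂
            -- or of u, both of which the greedy choice avoids.
            gadget-A : ∀ {x} → Mg ∣ x ⊎ u ∣ x → ¬ x ∈ As
            gadget-A shape ∈A with ∈-map⁻ (M *_) ∈A
            ... | v , v∈ , refl with All.lookup Chosen′.members v∈
            ...   | _ , _ , _ , W₂∤v , u∤v = [ (λ Mg∣ → W₂∤v (*-cancelˡ-∣ M {{>-nonZero 0<M′}} (subst (_∣ M * v) Mg≡ Mg∣)))
                                            , (λ u∣ → u∤v (coprime-divisor u-coprime-M u∣)) ]′ shape

            gadget-B : ∀ {x} → ¬ 31 ∣ x → ¬ x ∈ Bs ++ Cs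
            gadget-B 31∤x ∈BC with P∣-Bs ∈BC
            ... | z , refl = 31∤x (∣-trans 31∣P (∣-trans (m∣m*n z) (n∣m*n M)))

            iG iD m P′ Q′ ib : ℚ
            iG = inv (ι G)
            iD = inv (ι D)
            m = inv (ι M)
            P′ = inv (ι P)
            Q′ = inv (ι Q)
            ib = inv (ι b)

            0<Mb : 0 < M * b
            0<Mb = *-mono-≤ 0<M′ 0<b

            positive-Fs : All (0 <_) F.xs
            positive-Fs = All.map proj₁ F.members

            positive-Rs : All (0 <_) R.xs
            positive-Rs = All.map proj₁ R.members

          fixed-recip : recip fixed ≡ m ℚ.* ib ℚ.* ι gap
          fixed-recip = begin
            recip fixed
              ≡⟨ trans (recip-++ As _) (cong₂ ℚ._+_ recip-A (trans (recip-++ Bs Cs) (cong₂ ℚ._+_ recip-B recip-C))) ⟩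
            m ℚ.* (ι Σ ℚ.* iG) ℚ.+ (m ℚ.* P′ ℚ.* (ι T₁ ℚ.* iG) ℚ.+ m ℚ.* P′ ℚ.* Q′ ℚ.* (ι r ℚ.* iD))
              ≡⟨ cong (λ z → m ℚ.* z ℚ.+ (m ℚ.* P′ ℚ.* (ι T₁ ℚ.* iG) ℚ.+ m ℚ.* P′ ℚ.* Q′ ℚ.* (ι r ℚ.* iD))) (sym (trans (sym (ℚ.*-assoc (P′ ℚ.* ι P) (ι Σ) iG)) (cong (ℚ._* iG) (trans (cong (ℚ._* ι Σ) P′P) (ℚ.*-identityˡ (ι Σ)))))) ⟩
            m ℚ.* (P′ ℚ.* ι P ℚ.* (ι Σ ℚ.* iG)) ℚ.+ (m ℚ.* P′ ℚ.* (ι T₁ ℚ.* iG) ℚ.+ m ℚ.* P′ ℚ.* Q′ ℚ.* (ι r ℚ.* iD))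
              ≡⟨ lem₁ m P′ (ι P) (ι Σ) iG (ι T₁) Q′ (ι r ℚ.* iD) ⟩
            m ℚ.* P′ ℚ.* ((ι T₁ ℚ.+ ι P ℚ.* ι Σ) ℚ.* iG ℚ.+ Q′ ℚ.* (ι r ℚ.* iD))
              ≡⟨ cong (λ z → m ℚ.* P′ ℚ.* (z ℚ.* iG ℚ.+ Q′ ℚ.* (ι r ℚ.* iD))) (trans (cong (ι T₁ ℚ.+_) (sym (ι-* P Σ))) (trans (sym (ι-+ T₁ (P * Σ))) (trans (cong ι Chosen′.sums) (ι-* s e)))) ⟩
            m ℚ.* P′ ℚ.* (ι s ℚ.* ι e ℚ.* iG ℚ.+ Q′ ℚ.* (ι r ℚ.* iD))
              ≡⟨ cong (λ z → m ℚ.* P′ ℚ.* (z ℚ.+ Q′ ℚ.* (ι r ℚ.* iD))) (trans (ℚ.*-assoc (ι s) (ι e) iG) (trans (cong (ι s ℚ.*_) (sym (inv-quotient 0<D 0<G eD)))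
                   (trans (sym (ℚ.*-identityˡ (ι s ℚ.* iD))) (cong (ℚ._* (ι s ℚ.* iD)) (sym Q′Q))))) ⟩
            m ℚ.* P′ ℚ.* (Q′ ℚ.* ι Q ℚ.* (ι s ℚ.* iD) ℚ.+ Q′ ℚ.* (ι r ℚ.* iD))
              ≡⟨ lem₂ m P′ Q′ (ι Q) (ι s) iD (ι r) ⟩
            m ℚ.* P′ ℚ.* (Q′ ℚ.* ((ι s ℚ.* ι Q ℚ.+ ι r) ℚ.* iD))
              ≡⟨ cong (λ z → m ℚ.* P′ ℚ.* (Q′ ℚ.* (z ℚ.* iD))) (trans (cong (ℚ._+ ι r) (sym (ι-* s Q))) (trans (sym (ι-+ (s * Q) r)) (trans (cong ι (sym akD≡)) (trans (ι-* (a * k) D) (cong (ℚ._* ι D) (trans (ι-* a k) (cong (ℚ._* ι k) (ι-* P gap)))))))) ⟩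
            m ℚ.* P′ ℚ.* (Q′ ℚ.* (ι P ℚ.* ι gap ℚ.* ι k ℚ.* ι D ℚ.* iD))
              ≡⟨ cong (λ z → m ℚ.* P′ ℚ.* (z ℚ.* (ι P ℚ.* ι gap ℚ.* ι k ℚ.* ι D ℚ.* iD))) (inv-ι-* 0<b 0<k) ⟩
            m ℚ.* P′ ℚ.* (ib ℚ.* inv (ι k) ℚ.* (ι P ℚ.* ι gap ℚ.* ι k ℚ.* ι D ℚ.* iD))
              ≡⟨ lem₃ m P′ ib (inv (ι k)) (ι P) (ι gap) (ι k) (ι D) iD ⟩
            m ℚ.* ib ℚ.* ι gap ℚ.* (P′ ℚ.* ι P) ℚ.* (ι k ℚ.* inv (ι k)) ℚ.* (ι D ℚ.* iD)
              ≡⟨ cong₂ ℚ._*_ (cong₂ ℚ._*_ (trans (cong (m ℚ.* ib ℚ.* ι gap ℚ.*_) P′P) (ℚ.*-identityʳ (m ℚ.* ib ℚ.* ι gap))) (inv≡ (ι k) (0<ι k 0<k))) (inv≡ (ι D) (0<ι D 0<D)) ⟩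
            m ℚ.* ib ℚ.* ι gap ℚ.* 1ℚ ℚ.* 1ℚ
              ≡⟨ trans (ℚ.*-identityʳ (m ℚ.* ib ℚ.* ι gap ℚ.* 1ℚ)) (ℚ.*-identityʳ (m ℚ.* ib ℚ.* ι gap)) ⟩
            m ℚ.* ib ℚ.* ι gap ∎
            where
            open ≡-Reasoning
            Σ : ℕ
            Σ = sumBy (G ÷_) us
            P′P : P′ ℚ.* ι P ≡ 1ℚ
            P′P = trans (ℚ.*-comm P′ (ι P)) (inv≡ (ι P) (0<ι P 0<P))
            Q′Q : Q′ ℚ.* ι Q ≡ 1ℚ
            Q′Q = trans (ℚ.*-comm Q′ (ι Q)) (inv≡ (ι Q) (0<ι Q 0<Q))
            us-div : All (λ x → 0 < x × x ∣ G) us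
            us-div = All.map (λ {x} (0<x , x≤) → 0<x , modulus-complete n₀ y x 0<x (≤-trans x≤ reach≤y)) us-range
            recip-A : recip As ≡ m ℚ.* (ι Σ ℚ.* iG)
            recip-A = trans (recip-scale 0<M′ (All.map proj₁ us-range)) (cong (m ℚ.*_) (recip-quotients 0<G us-div))
            recip-B : recip Bs ≡ m ℚ.* P′ ℚ.* (ι T₁ ℚ.* iG)
            recip-B = trans (recip-scale 0<MP positive-Fs) (cong₂ ℚ._*_ (inv-ι-* 0<M′ 0<P)
              (trans (recip-quotients 0<G F.members) (cong (λ t → ι t ℚ.* iG) F.sums)))
            recip-C : recip Cs ≡ m ℚ.* P′ ℚ.* Q′ ℚ.* (ι r ℚ.* iD)
            recip-C = trans (recip-scale 0<MPQ positive-Rs) (cong₂ ℚ._*_ (trans (inv-ι-* 0<MP 0<Q) (cong (ℚ._* Q′) (inv-ι-* 0<M′ 0<P)))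
              (trans (recip-quotients 0<D R.members) (cong (λ t → ι t ℚ.* iD) R.sums)))
            lem₁ : ∀ m P′ P S g T Q′ R → m ℚ.* (P′ ℚ.* P ℚ.* (S ℚ.* g)) ℚ.+ (m ℚ.* P′ ℚ.* (T ℚ.* g) ℚ.+ m ℚ.* P′ ℚ.* Q′ ℚ.* R) ≡
                                        m ℚ.* P′ ℚ.* ((T ℚ.+ P ℚ.* S) ℚ.* g ℚ.+ Q′ ℚ.* R)
            lem₁ = solve-∀ ℚ-ring
            lem₂ : ∀ m P′ Q′ Q s d r → m ℚ.* P′ ℚ.* (Q′ ℚ.* Q ℚ.* (s ℚ.* d) ℚ.+ Q′ ℚ.* (r ℚ.* d)) ≡ m ℚ.* P′ ℚ.* (Q′ ℚ.* ((s ℚ.* Q ℚ.+ r) ℚ.* d))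
            lem₂ = solve-∀ ℚ-ring
            lem₃ : ∀ m P′ ib ik P g k D d → m ℚ.* P′ ℚ.* (ib ℚ.* ik ℚ.* (P ℚ.* g ℚ.* k ℚ.* D ℚ.* d)) ≡
                                            m ℚ.* ib ℚ.* g ℚ.* (P′ ℚ.* P) ℚ.* (k ℚ.* ik) ℚ.* (D ℚ.* d)
            lem₃ = solve-∀ ℚ-ring

          total-recip : ι 44 ℚ.* inv (ι (129 * Mg)) ℚ.+ m ℚ.* ib ℚ.* ι gap ≡ ι p ℚ.* inv (ι q)
          total-recip = begin
            ι 44 ℚ.* inv (ι (129 * Mg)) ℚ.+ m ℚ.* ib ℚ.* ι gap
              ≡⟨ cong₂ (λ x z → ι 44 ℚ.* x ℚ.+ z ℚ.* ι gap) (inv-quotient (*-mono-≤ {1} {129} (s≤s z≤n) 0<M) 0<Mb (trans (cong (λ z → q * (129 * z)) Mg≡) (lem₁ 129 q M W₂))) (sym (inv-ι-* 0<M′ 0<b)) ⟩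
            ι 44 ℚ.* (ι q ℚ.* i) ℚ.+ i ℚ.* ι gap
              ≡⟨ lem₂ (ι 44) (ι q) i (ι gap) ⟩
            (ι gap ℚ.+ ι 44 ℚ.* ι q) ℚ.* i
              ≡⟨ cong (ℚ._* i) (trans (cong (ι gap ℚ.+_) (sym (ι-* 44 q))) (trans (sym (ι-+ gap (44 * q))) (trans (cong ι (trans gap≡ (lem₃ 129 W₂ M p))) (ι-* p (129 * W₂ * M))))) ⟩
            ι p ℚ.* ι (129 * W₂ * M) ℚ.* i
              ≡⟨ trans (ℚ.*-assoc (ι p) _ i) (cong (ι p ℚ.*_) (sym (inv-quotient 0<q 0<Mb (lem₄ 129 W₂ M q)))) ⟩
            ι p ℚ.* inv (ι q) ∎
            where
            open ≡-Reasoning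
            i : ℚ
            i = inv (ι (M * b))
            lem₁ : ∀ c q M W → q * (c * (M * W)) ≡ M * (c * W * q)
            lem₁ = ℕ-Ring.solve-∀
            lem₂ : ∀ c q i g → c ℚ.* (q ℚ.* i) ℚ.+ i ℚ.* g ≡ (g ℚ.+ c ℚ.* q) ℚ.* i
            lem₂ = solve-∀ ℚ-ring
            lem₃ : ∀ c W M p → c * W * (M * p) ≡ p * (c * W * M)
            lem₃ = ℕ-Ring.solve-∀
            lem₄ : ∀ c W M q → c * W * M * q ≡ M * (c * W * q)
            lem₄ = ℕ-Ring.solve-∀

          combined : ∀ n → Gadget n → Partition (ι p ℚ.* inv (ι q)) (n + fixedSum)
          combined n g = partition (g′.xs ++ fixed)
            (Unique.++⁺ g′.unique (Unique.++⁺ (Unique.map⁺ (*-cancelˡ-≡ _ _ M {{>-nonZero 0<M′}}) Chosen′.unique)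
                (Unique.++⁺ (Unique.map⁺ (*-cancelˡ-≡ _ _ MP {{>-nonZero 0<MP}}) F.unique) (Unique.map⁺ (*-cancelˡ-≡ _ _ MPQ {{>-nonZero 0<MPQ}}) R.unique)
                  (λ (∈B , ∈C) → B-C ∈B ∈C))
                (λ (∈A , ∈BC) → A-B ∈A ∈BC))
              (λ (∈g , ∈fixed) → [ gadget-A (All.lookup g′.shape ∈g) , gadget-B (All.lookup g′.∤31 ∈g) ]′ (∈-++⁻ As ∈fixed)))
            (All.++⁺ g′.positive (All.++⁺ (All.map⁺ (All.map (λ (0<x , _) → *-mono-≤ 0<M′ 0<x) us-range))
              (All.++⁺ (All.map⁺ (All.map (*-mono-≤ 0<MP) positive-Fs)) (All.map⁺ (All.map (*-mono-≤ 0<MPQ) positive-Rs)))))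
            (trans (sumBy-++ id g′.xs fixed) (cong (_+ fixedSum) g′.sums))
            (trans (recip-++ g′.xs fixed) (trans (cong₂ ℚ._+_ g′.recips fixed-recip) total-recip))
            where module g′ = Gadget g

          all-large : ∀ X n → X ≡ 211244 * (Mg * Mg) → X + MPQ * (2 + c₁) ≤ n → Partition (ι p ℚ.* inv (ι q)) n
          all-large X n X≡ big = subst (Partition (ι p ℚ.* inv (ι q))) (m∸n+n≡m fixed≤n) (combined (n ∸ fixedSum) (gadget (n ∸ fixedSum)
              (subst (_≤ n ∸ fixedSum) X≡ (≤-trans (≤-reflexive (sym (m+n∸n≡m X fixedSum))) (∸-monoˡ-≤ fixedSum (≤-trans (+-monoʳ-≤ X fixedSum≤) big))))))
            where
            fixed≤n : fixedSum ≤ n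
            fixed≤n = ≤-trans fixedSum≤ (≤-trans (m≤n+m (MPQ * (2 + c₁)) X) big)

        Large : Set
        Large = ∀ X n → X ≡ 211244 * (Mg * Mg) → X + M * P * Q * (2 + c₁) ≤ n → Partition (ι p ℚ.* inv (ι q)) n

        glue : Stopped P W₂ u I₀ P G 2P≤I₀ 0<P 0<G (range K) T₀ → Large
        glue (T₁ , chosen , G≤2T₁ , T₁<G) = Glue.all-large T₁ chosen (reps T₁ T₁<G (half-≤ G≤2T₁)) (reps₁ r r<D (half-≤ D≤2r))

        glued : Large
        glued = glue stopped

      partitions : ∀ X n → X ≡ 211244 * (Mg * Mg) → X + M * P * Q * (2 + c₁) ≤ n → Partition (ι p ℚ.* inv (ι q)) n
      partitions = from (split-off (a * k) D Q 0<Q Q<ak 2Q≤D)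
        where
        from : ∃[ s ] ∃[ r ] (a * k * D ≡ s * Q + r × D ≤ 2 * r × r < D × D ≤ s) →
               ∀ X n → X ≡ 211244 * (Mg * Mg) → X + M * P * Q * (2 + c₁) ≤ n → Partition (ι p ℚ.* inv (ι q)) n
        from (s , r , akD≡ , D≤2r , r<D , D≤s) = glued s r akD≡ D≤2r r<D D≤s

-- Comparing powers of 2 with polynomials.

module Powers where

  open import Data.Nat.Base
  open import Data.Nat.Properties
  import Data.Nat.Tactic.RingSolver as ℕ-Ring
  open import Data.Product.Base using (∃-syntax; _×_; _,_; proj₁; proj₂)
  open import Function.Base using (_∘_)
  open import Relation.Nullary using (¬_; Dec; yes; no; contradiction)
  open import Relation.Binary.PropositionalEquality

  0<2^ : ∀ k → 0 < 2 ^ k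
  0<2^ k = n≢0⇒n>0 (≢-nonZero⁻¹ (2 ^ k) {{m^n≢0 2 k}})

  2^-double : ∀ k → 2 ^ k + 2 ^ k ≡ 2 ^ suc k
  2^-double k = cong (2 ^ k +_) (sym (+-identityʳ (2 ^ k)))

  n<2^n : ∀ n → n < 2 ^ n
  n<2^n zero    = s≤s z≤n
  n<2^n (suc n) = ≤-trans (s≤s (n<2^n n)) (≤-trans (+-monoˡ-≤ (2 ^ n) (0<2^ n)) (≤-reflexive (2^-double n)))

  least : {P : ℕ → Set} → (∀ n → Dec (P n)) → ∀ N → P N → ∃[ n ] (P n × (∀ m → suc m ≡ n → ¬ P m))
  least P? N PN with P? 0
  ... | yes P0 = 0 , P0 , λ m ()
  least P? zero    PN | no ¬P0 = contradiction PN ¬P0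
  least {P} P? (suc N) PN | no ¬P0 with least (P? ∘ suc) N PN
  ...   | zero , Pn , _    = 1 , Pn , λ { .0 refl → ¬P0 }
  ...   | suc n , Pn , min = suc (suc n) , Pn , λ { .(suc n) refl → min n refl }

  log₂ : ∀ n → 0 < n → ∃[ k ] (2 ^ k ≤ n × n < 2 ^ suc k)
  log₂ n 0<n with least (λ k → n <? 2 ^ suc k) n (<-≤-trans (n<2^n n) (^-monoʳ-≤ 2 (n≤1+n n)))
  ... | zero  , n< , _   = 0 , 0<n , n<
  ... | suc k , n< , min = suc k , ≮⇒≥ (min k refl) , n<

  -- At s = 2 m the product is at most 2 C (m + 1), and both 2 C and m + 1 are at most 2^m. From
  -- there on each step doubles the right side and at most doubles the left.
  linear-below-power : ∀ C s₁ → ∃[ s₀ ] (s₁ < s₀ × (∀ s → s₀ ≤ s → C * suc s ≤ 2 ^ s))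
  linear-below-power C s₁ = m + m , ≤-trans (s≤s (m≤n+m s₁ (C + C))) (m≤m+n m m) , λ s s₀≤s → from (≤⇒≤′ s₀≤s)
    where
    m : ℕ
    m = suc (C + C + s₁)
    base-case : C * suc (m + m) ≤ 2 ^ (m + m)
    base-case = begin
      C * suc (m + m)         ≤⟨ *-monoʳ-≤ C (≤-trans (n≤1+n _) (≤-reflexive (cong suc (sym (+-suc m m))))) ⟩
      C * (suc m + suc m)     ≡⟨ lem C (suc m) ⟩
      (C + C) * suc m         ≤⟨ *-mono-≤ (≤-trans (m≤m+n (C + C) s₁) (≤-trans (n≤1+n _) (<⇒≤ (n<2^n m)))) (n<2^n m) ⟩
      2 ^ m * 2 ^ m           ≡⟨ sym (^-distribˡ-+-* 2 m m) ⟩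
      2 ^ (m + m)             ∎
      where
      open ≤-Reasoning
      lem : ∀ C m → C * (m + m) ≡ (C + C) * m
      lem = ℕ-Ring.solve-∀
    from : ∀ {s} → m + m ≤′ s → C * suc s ≤ 2 ^ s
    from (≤′-reflexive refl) = base-case
    from {suc s} (≤′-step h) = ≤-trans (*-monoʳ-≤ C (s≤s (s≤s (m≤n+m s s)))) (≤-trans (≤-reflexive (lem C s))
      (≤-trans (+-mono-≤ (from h) (from h)) (≤-reflexive (2^-double s))))
      where
      lem : ∀ C s → C * (2 + (s + s)) ≡ C * suc s + C * suc s
      lem = ℕ-Ring.solve-∀

  cube-bound : ∀ s → suc s * (suc s * suc s) ≤ 8 * 2 ^ s
  cube-bound 0 = s≤s z≤n
  cube-bound 1 = ≤ᵇ⇒≤ 8 16 _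
  cube-bound 2 = ≤ᵇ⇒≤ 27 32 _
  cube-bound (suc (suc (suc m))) = go m
    where
    go : ∀ m → (4 + m) * ((4 + m) * (4 + m)) ≤ 8 * 2 ^ (3 + m)
    go zero    = ≤-refl
    go (suc m) = begin
      -- The added polynomial is 2 (4 + m)³ - (5 + m)³.
      (5 + m) * ((5 + m) * (5 + m))         ≤⟨ m≤m+n _ (3 + 21 * m + 9 * (m * m) + m * (m * m)) ⟩
      (5 + m) * ((5 + m) * (5 + m)) + (3 + 21 * m + 9 * (m * m) + m * (m * m)) ≡⟨ lem m ⟩
      2 * ((4 + m) * ((4 + m) * (4 + m)))   ≤⟨ *-monoʳ-≤ 2 (go m) ⟩
      2 * (8 * 2 ^ (3 + m))                 ≡⟨ lem₂ (2 ^ (3 + m)) ⟩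
      8 * 2 ^ (4 + m)                       ∎
      where
      open ≤-Reasoning
      lem : ∀ m → (5 + m) * ((5 + m) * (5 + m)) + (3 + 21 * m + 9 * (m * m) + m * (m * m)) ≡ 2 * ((4 + m) * ((4 + m) * (4 + m)))
      lem = ℕ-Ring.solve-∀
      lem₂ : ∀ a → 2 * (8 * a) ≡ 8 * (2 * a)
      lem₂ = ℕ-Ring.solve-∀

  -- Writing k between 4 s and 4 s + 4, both C and 2 k + c are at most 2 ^ s.
  cubic-below-power : ∀ C c → ∃[ k₀ ] (∀ k → k₀ ≤ k → C + (2 * k + c) * ((2 * k + c) * (2 * k + c)) < 2 ^ k)
  cubic-below-power C c = 4 * s₀ , bound
    where
    A s₀ : ℕ
    A = 8 + c + C
    s₀ = proj₁ (linear-below-power A 1)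
    bound : ∀ k → 4 * s₀ ≤ k → C + (2 * k + c) * ((2 * k + c) * (2 * k + c)) < 2 ^ k
    bound k 4s₀≤k = begin-strict
      C + L * (L * L)               ≤⟨ +-mono-≤ (≤-trans C≤ Y≤Y³) (*-mono-≤ L≤ (*-mono-≤ L≤ L≤)) ⟩
      Y * (Y * Y) + Y * (Y * Y)     ≡⟨ lem (Y * (Y * Y)) ⟩
      2 * (Y * (Y * Y))             <⟨ *-monoˡ-< (Y * (Y * Y)) {{>-nonZero (*-mono-≤ (0<2^ s) (*-mono-≤ (0<2^ s) (0<2^ s)))}} 2<Y ⟩
      Y * (Y * (Y * Y))             ≡⟨ trans (cong (λ z → Y * (Y * (Y * z))) (sym (*-identityʳ Y))) (^-*-assoc 2 s 4) ⟩
      2 ^ (s * 4)                   ≤⟨ ^-monoʳ-≤ 2 (m/n*n≤m k 4) ⟩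
      2 ^ k                         ∎
      where
      open ≤-Reasoning
      open import Data.Nat.DivMod using (m/n*n≤m; m≡m%n+[m/n]*n; m%n<n; /-monoˡ-≤; m*n/n≡m)
      s L Y : ℕ
      s = k / 4
      L = 2 * k + c
      Y = 2 ^ s
      s₀≤s : s₀ ≤ s
      s₀≤s = subst (_≤ s) (trans (cong (_/ 4) (*-comm 4 s₀)) (m*n/n≡m s₀ 4)) (/-monoˡ-≤ 4 4s₀≤k)
      A≤ : A * suc s ≤ Y
      A≤ = proj₂ (proj₂ (linear-below-power A 1)) s s₀≤s
      C≤ : C ≤ Y
      C≤ = ≤-trans (≤-trans (m≤n+m C (8 + c)) (m≤m*n A (suc s))) A≤
      L≤ : L ≤ Y
      L≤ = ≤-trans (≤-trans (+-mono-≤ (*-monoʳ-≤ 2 k≤) (m≤m*n c (suc s))) (≤-trans (≤-reflexive (lem₁ s c)) (*-monoˡ-≤ (suc s) (m≤m+n (8 + c) C)))) A≤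
        where
        k≤ : k ≤ 4 * suc s
        k≤ = ≤-trans (≤-reflexive (m≡m%n+[m/n]*n k 4)) (≤-trans (+-monoˡ-≤ (s * 4) (<⇒≤ (m%n<n k 4))) (≤-reflexive (trans (cong (4 +_) (*-comm s 4)) (sym (*-suc 4 s)))))
        lem₁ : ∀ s c → 2 * (4 * suc s) + c * suc s ≡ (8 + c) * suc s
        lem₁ = ℕ-Ring.solve-∀
      2<Y : 2 < Y
      2<Y = <-≤-trans (n<2^n 2) (^-monoʳ-≤ 2 (≤-trans (proj₁ (proj₂ (linear-below-power A 1))) s₀≤s))
      Y≤Y³ : Y ≤ Y * (Y * Y)
      Y≤Y³ = m≤m*n Y (Y * Y) {{>-nonZero (*-mono-≤ (0<2^ s) (0<2^ s))}}
      lem : ∀ a → a + a ≡ 2 * a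
      lem = ℕ-Ring.solve-∀

-- An explicit bound for the threshold in natural numbers.

module NatBound where

  open import Defs using (inv; Partition)
  open Arith
  open Powers
  open Rationals
  open Covering using (growthConstant)
  open Tower
  open TowerBound
  open GrahamChains using (base; base≡)
  open ExpLog using (harmonicBlock)
  open Harmonic
  open Assembly
  open import Data.Nat.Base
  open import Data.Nat.Properties
  open import Data.Nat.Divisibility
  open import Data.Nat.DivMod using (m≡m%n+[m/n]*n; m%n<n; m/n*n≤m)
  import Data.Nat.Tactic.RingSolver as ℕ-Ring
  open import Data.Product.Base using (∃-syntax; _×_; _,_; proj₁; proj₂)
  open import Data.Sum.Base using (_⊎_; inj₁; inj₂)
  open import Data.Rational.Base as ℚ using (ℚ; 0ℚ; ½)
  import Data.Rational.Properties as ℚ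
  open import Relation.Nullary using (¬_; Dec; yes; no)
  open import Tactic.RingSolver using (solve-∀)
  open import Relation.Binary.PropositionalEquality hiding (J)

  cube : ℕ → ℕ
  cube y = y * (y * y)

  base>1 : 1 < base
  base>1 = subst (1 <_) (sym base≡) (s≤s (s≤s z≤n))

  n<base^n : ∀ n → n < base ^ n
  n<base^n n = <-≤-trans (n<2^n n) (^-monoˡ-≤ n base>1)

  -- The multiplier M brings α = p / q up to size between 1 and 32, unless α ≥ 1 already.
  multiplier : ∀ p q → 0 < p → ∃[ t ] (q ≤ base ^ t * p × (base ^ t ≡ 1 ⊎ base ^ t * p ≤ 32 * q))
  multiplier p q 0<p = from (least (λ t → q ≤? base ^ t * p) q (≤-trans (<⇒≤ (n<base^n q)) (m≤m*n (base ^ q) p {{>-nonZero 0<p}})))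
    where
    from : ∃[ t ] (q ≤ base ^ t * p × (∀ m → suc m ≡ t → ¬ q ≤ base ^ m * p)) → _
    from (zero  , q≤ , _)   = 0 , q≤ , inj₁ refl
    from (suc t , q≤ , min) = suc t , q≤ , inj₂ (≤-trans (≤-reflexive (*-assoc base (base ^ t) p))
          (≤-trans (≤-reflexive (cong (_* (base ^ t * p)) base≡)) (*-monoʳ-≤ 32 (<⇒≤ (≰⇒> (min t refl))))))

  module Bounds
    (H s₀ W₀ P W₂ T₂ j₀ : ℕ) (44≤H : 44 ≤ H) (H<s₀ : H < s₀)
    (ready : ∀ s → s₀ ≤ s → growthConstant H * suc s ≤ 2 ^ s)
    (0<W₀ : 0 < W₀) (W₀≤P : W₀ ≤ P) (W₀≤W₂ : W₀ ≤ W₂) (31∣P : 31 ∣ P) (4≤P : 4 ≤ P) (2P≤I₀ : 2 * P ≤ 2 ^ j₀)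
    (W₂-power : W₂ ≡ base ^ suc T₂)
    where

    private
      0<H : 0 < H
      0<H = ≤-trans (s≤s z≤n) 44≤H
      instance
        H≢0 : NonZero H
        H≢0 = >-nonZero 0<H

      15≤H : 15 ≤ H
      15≤H = ≤-trans (≤ᵇ⇒≤ 15 44 _) 44≤H

    n₀ C₀ : ℕ
    n₀ = Blocks.n₀ H s₀ 0<H 15≤H H<s₀ ready
    C₀ = Blocks.C₀ H s₀ 0<H 15≤H H<s₀ ready

    cost : ℕ → ℕ → ℕ
    cost = Blocks.cost H s₀ 0<H 15≤H H<s₀ ready

    tower : ∀ s n → s₀ ≤ s → 2 ^ (H * s) ≤ n → n ≤ 2 ^ (H * suc s) → Reps (modulus n₀ n) ½ (cost s n)
    tower = Blocks.tower H s₀ 0<H 15≤H H<s₀ ready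

    I₀ : ℕ
    I₀ = 2 ^ j₀

    rate : ℚ
    rate = harmonicBlock I₀ ℚ.- ι 7 ℚ.* inv (ι W₀)

    module Rate (0<rate : 0ℚ ℚ.< rate) where

      -- At least s₀, so that the tower is available, and at least j₀, so that 2^(H σ) is not below
      -- I₀.
      σ₀ : ℕ
      σ₀ = s₀ + j₀

      -- From I₀ = 2^j₀ to 2^(H σ) there are H σ - j₀ dyadic blocks, each of weight at least `rate`.
      Enough : ℚ → ℕ → Set
      Enough a σ = a ℚ.≤ ι (H * σ ∸ j₀) ℚ.* rate

      enough-mono : ∀ {a σ σ′} → σ ≤ σ′ → Enough a σ → Enough a σ′
      enough-mono {σ = σ} {σ′} σ≤ h = ℚ.≤-trans h (*-mono-r (ℚ.<⇒≤ 0<rate) (ι-mono _ _ (∸-monoˡ-≤ j₀ (*-monoʳ-≤ H σ≤))))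

      opaque

        enough-exists : ∀ a → ∃[ i ] Enough a (σ₀ + i)
        enough-exists a = N , ℚ.≤-trans a≤ (*-mono-r (ℚ.<⇒≤ 0<rate) (ι-mono N (H * (σ₀ + N) ∸ j₀) N≤))
          where
          N : ℕ
          N = proj₁ (archimedean (a ℚ.* inv rate))
          a≤ : a ℚ.≤ ι N ℚ.* rate
          a≤ = ℚ.≤-trans (ℚ.≤-reflexive (sym (trans (ℚ.*-assoc a (inv rate) rate) (trans (cong (a ℚ.*_) (trans (ℚ.*-comm (inv rate) rate) (inv≡ rate 0<rate))) (ℚ.*-identityʳ a)))))
            (*-mono-r (ℚ.<⇒≤ 0<rate) (proj₂ (archimedean (a ℚ.* inv rate))))
          N≤ : N ≤ H * (σ₀ + N) ∸ j₀
          N≤ = ≤-trans (≤-reflexive (sym (m+n∸n≡m N j₀))) (∸-monoˡ-≤ j₀ (≤-trans (≤-reflexive (+-comm N j₀))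
            (≤-trans (+-monoˡ-≤ N (m≤n+m j₀ s₀)) (m≤n*m (σ₀ + N) H))))

      -- In the second alternative the failure at σ - 1 is what later bounds 2^(H σ) by an
      -- exponential in a.
      Least : ℚ → ℕ → Set
      Least a σ = σ₀ ≤ σ × Enough a σ × (σ ≡ σ₀ ⊎ ∃[ σ′ ] (σ ≡ suc σ′ × ¬ Enough a σ′))

      least-σ : ∀ a → ∃[ σ ] Least a σ
      least-σ a = from (least (λ i → a ℚ.≤? ι (H * (σ₀ + i) ∸ j₀) ℚ.* rate) (proj₁ (enough-exists a)) (proj₂ (enough-exists a)))
        where
        from : ∃[ i ] (Enough a (σ₀ + i) × (∀ m → suc m ≡ i → ¬ Enough a (σ₀ + m))) → ∃[ σ ] Least a σ
        from (zero  , h , _)   = σ₀ + 0 , m≤m+n σ₀ 0 , h , inj₁ (+-identityʳ σ₀)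
        from (suc i , h , min) = σ₀ + suc i , m≤m+n σ₀ (suc i) , h , inj₂ (σ₀ + i , +-suc σ₀ i , min i refl)

      σ-max : ℕ
      σ-max = σ₀ + proj₁ (enough-exists (ι 32))

      -- When the multiplier M is not 1, M α is at most 32, and the scale of the greedy choice is
      -- then bounded independently of p and q.
      least-bounded : ∀ {a σ} → a ℚ.≤ ι 32 → Least a σ → σ ≤ σ-max
      least-bounded a≤32 (_ , _ , inj₁ refl) = m≤m+n σ₀ _
      least-bounded {a} a≤32 (_ , _ , inj₂ (σ′ , refl , ¬h)) = ≰⇒> (λ le → ¬h (enough-mono le (ℚ.≤-trans a≤32 (proj₂ (enough-exists (ι 32))))))

      private
        c₀ : ℕ
        c₀ = 2 * n₀ + 5

        opaque
          cutoff : ∃[ k₀ ] (∀ k → k₀ ≤ k → C₀ + cube (2 * k + c₀) < 2 ^ k)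
          cutoff = cubic-below-power C₀ c₀

        k₀ : ℕ
        k₀ = proj₁ cutoff

        Q₀ : ℕ
        Q₀ = 2 ^ k₀

      -- The second branch of the construction replaces b by a multiple between X and 2 X.
      X : ℕ → ℕ
      X σ = suc (cost σ (2 ^ (H * σ)) + Q₀)

      -- `size` is the room required by `split-off`, `c<Q` allows the same expansion to serve for
      -- family (3) too, and z² ≤ y is the source of the factor y^(1/2) in the cost.
      record Cost (Q c : ℕ) : Set where
        field
          y λ′ s z : ℕ
          λ-lower : 2 ^ λ′ ≤ Q
          λ-upper : Q < 2 ^ suc λ′
          y≡      : y ≡ 2 * λ′ + c₀
          z≡      : z ≡ (2 ^ s) ^ 22
          z²≤y    : z * z ≤ y
          c≡      : c ≡ C₀ + y * y * z
          c<Q     : c < Q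
          size    : 2 * Q ≤ modulus n₀ y
          reps    : Reps (modulus n₀ y) ½ c

      cost-of : ∀ Q → Q₀ ≤ Q → ∃[ c ] Cost Q c
      cost-of Q Q₀≤Q = from (log₂ Q (≤-trans (0<2^ k₀) Q₀≤Q))
        where
        from : ∃[ k ] (2 ^ k ≤ Q × Q < 2 ^ suc k) → ∃[ c ] Cost Q c
        from (λ′ , lo , hi) = from-block (least (λ s → y <? 2 ^ (H * suc s)) y (<-≤-trans (n<2^n y) (^-monoʳ-≤ 2 (≤-trans (n≤1+n y) (m≤n*m (suc y) H)))))
          where
          J y : ℕ
          -- `complete-size` bounds the modulus of y = 2 J + 1 below by 2^J, which is at least 4 *
          -- 2^λ′ > 2 Q. The summand n₀ puts y into the range of the tower.
          J = λ′ + 2 + n₀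
          y = suc (J + J)
          y≡ : y ≡ 2 * λ′ + c₀
          y≡ = lem λ′ n₀
            where
            lem : ∀ l n → suc ((l + 2 + n) + (l + 2 + n)) ≡ 2 * l + (2 * n + 5)
            lem = ℕ-Ring.solve-∀
          n₀≤y : n₀ ≤ y
          n₀≤y = ≤-trans (m≤n+m n₀ (λ′ + 2)) (≤-trans (m≤m+n J J) (n≤1+n _))
          k₀≤λ : k₀ ≤ λ′
          k₀≤λ = ≮⇒≥ (λ λ<k₀ → <⇒≱ hi (≤-trans (^-monoʳ-≤ 2 λ<k₀) Q₀≤Q))
          size : 2 * Q ≤ modulus n₀ y
          size = ≤-trans (*-monoʳ-≤ 2 (<⇒≤ hi)) (≤-trans (^-monoʳ-≤ 2 {suc (suc λ′)} {J} (≤-trans (≤-reflexive (+-comm 2 λ′)) (m≤m+n (λ′ + 2) n₀)))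
            (complete-size J (modulus n₀ y) (modulus>0 n₀ y) (modulus-complete n₀ y)))
          from-block : ∃[ s ] (y < 2 ^ (H * suc s) × (∀ m → suc m ≡ s → ¬ y < 2 ^ (H * suc m))) → ∃[ c ] Cost Q c
          from-block (s , y< , min) = cost s y , record
            { y = y ; λ′ = λ′ ; s = s ; z = z ; λ-lower = lo ; λ-upper = hi ; y≡ = y≡ ; z≡ = refl
            ; z²≤y = z²≤y ; c≡ = refl ; c<Q = c<Q ; size = size ; reps = tower s y s₀≤s lower (<⇒≤ y<) }
            where
            z : ℕ
            z = (2 ^ s) ^ 22
            s₀≤s : s₀ ≤ s
            s₀≤s = ≮⇒≥ (λ s<s₀ → <⇒≱ y< (≤-trans (^-monoʳ-≤ 2 (*-monoʳ-≤ H s<s₀)) n₀≤y))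
            lower : 2 ^ (H * s) ≤ y
            lower = at s min
              where
              at : ∀ s → (∀ m → suc m ≡ s → ¬ y < 2 ^ (H * suc m)) → 2 ^ (H * s) ≤ y
              at zero    _ = ≤-trans (≤-reflexive (cong (2 ^_) (*-zeroʳ H))) (s≤s z≤n)
              at (suc m) h = ≮⇒≥ (h m refl)
            -- z² = 2^(44 s) is at most 2^(H s); this is the use of 44 ≤ H.
            z²≤y : z * z ≤ y
            z²≤y = begin
              z * z             ≡⟨ cong (λ a → a * a) (^-*-assoc 2 s 22) ⟩
              2 ^ (s * 22) * 2 ^ (s * 22) ≡⟨ sym (^-distribˡ-+-* 2 (s * 22) (s * 22)) ⟩
              2 ^ (s * 22 + s * 22) ≤⟨ ^-monoʳ-≤ 2 (≤-trans (≤-reflexive (trans (sym (*-distribˡ-+ s 22 22)) (*-comm s 44))) (*-monoˡ-≤ s 44≤H)) ⟩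
              2 ^ (H * s)       ≤⟨ lower ⟩
              y                 ∎
              where open ≤-Reasoning
            0<z : 0 < z
            0<z = n≢0⇒n>0 (≢-nonZero⁻¹ z {{m^n≢0 (2 ^ s) 22 {{m^n≢0 2 s}}}})
            c<Q : cost s y < Q
            c<Q = begin-strict
              C₀ + y * y * z              ≤⟨ +-monoʳ-≤ C₀ (≤-trans (*-monoʳ-≤ (y * y) (≤-trans (m≤m*n z z {{>-nonZero 0<z}}) z²≤y)) (≤-reflexive (*-assoc y y y))) ⟩
              C₀ + cube y                 ≡⟨ cong (λ a → C₀ + cube a) y≡ ⟩
              C₀ + cube (2 * λ′ + c₀)     <⟨ proj₂ cutoff λ′ k₀≤λ ⟩
              2 ^ λ′                      ≤⟨ lo ⟩
              Q                           ∎
              where open ≤-Reasoning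

      record Bound (p q : ℕ) : Set where
        field
          B M σ Q c : ℕ
          all-beyond : ∀ n → B ≤ n → Partition (ι p ℚ.* inv (ι q)) n
          B≡         : B ≡ 211244 * ((M * W₂) * (M * W₂)) + M * P * Q * (2 + c)
          M-small    : M ≡ 1 ⊎ M * p ≤ 32 * q
          σ-least    : Least (ι (M * p) ℚ.* inv (ι q)) σ
          Q-small    : Q ≡ 129 * W₂ * q ⊎ Q < 2 * X σ
          costs      : Cost Q c

      bound : ∀ p q → 0 < p → 0 < q → Bound p q
      bound p q 0<p 0<q = from-M (multiplier p q 0<p)
        where
        b : ℕ
        b = 129 * W₂ * q
        0<b : 0 < b
        0<b = *-mono-≤ {1} (*-mono-≤ {1} {129} (s≤s z≤n) (≤-trans 0<W₀ W₀≤W₂)) 0<q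
        from-M : ∃[ t ] (q ≤ base ^ t * p × (base ^ t ≡ 1 ⊎ base ^ t * p ≤ 32 * q)) → Bound p q
        from-M (t , q≤Mp , M-small) = from-σ (least-σ (ι (base ^ t * p) ℚ.* inv (ι q)))
          where
          M : ℕ
          M = base ^ t
          from-σ : ∃[ σ ] Least (ι (M * p) ℚ.* inv (ι q)) σ → Bound p q
          from-σ (σ , σ-least@(σ₀≤σ , enough , _)) = from-k (choose-k (X σ ≤? b))
            where
            s₀≤σ : s₀ ≤ σ
            s₀≤σ = ≤-trans (m≤m+n s₀ j₀) σ₀≤σ
            K Y : ℕ
            K = H * σ ∸ j₀
            Y = 2 ^ (H * σ)
            reach : I₀ * 2 ^ K ≡ Y
            reach = trans (sym (^-distribˡ-+-* 2 j₀ K)) (cong (2 ^_) (m+[n∸m]≡n (≤-trans (≤-trans (m≤n+m j₀ s₀) σ₀≤σ) (m≤n*m σ H))))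
            Choice : ℕ → Set
            Choice k = 0 < k × X σ ≤ b * k × (b * k ≡ b ⊎ b * k < 2 * X σ)
            choose-k : Dec (X σ ≤ b) → ∃[ k ] Choice k
            choose-k (yes X≤b) = 1 , s≤s z≤n , ≤-trans X≤b (≤-reflexive (sym (*-identityʳ b))) , inj₁ (*-identityʳ b)
            choose-k (no X≰b) = suc (X σ / b) , s≤s z≤n ,
                    ≤-trans (≤-reflexive (m≡m%n+[m/n]*n (X σ) b)) (≤-trans (+-monoˡ-≤ _ (<⇒≤ (m%n<n (X σ) b))) (≤-reflexive (sym bk))) ,
                    inj₂ (≤-trans (≤-reflexive (cong suc bk)) (≤-trans (+-mono-≤ (≰⇒> X≰b) (m/n*n≤m (X σ) b)) (≤-reflexive (cong (λ z → X σ + z) (sym (+-identityʳ (X σ)))))))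
              where
              instance
                b≢0 : NonZero b
                b≢0 = >-nonZero 0<b
              bk : b * suc (X σ / b) ≡ b + X σ / b * b
              bk = trans (*-suc b (X σ / b)) (cong (b +_) (*-comm b (X σ / b)))
            from-k : ∃[ k ] Choice k → Bound p q
            from-k (k , 0<k , X≤Q , Q-small) = from-cost (cost-of Q (≤-trans (≤-trans (m≤n+m Q₀ _) (n≤1+n _)) X≤Q))
              where
              Q : ℕ
              Q = b * k
              cσ<Q : cost σ Y < Q
              cσ<Q = ≤-trans (s≤s (m≤m+n _ Q₀)) X≤Q
              from-cost : ∃[ c ] Cost Q c → Bound p q
              from-cost (c , costs) = record
                { B = 211244 * ((M * W₂) * (M * W₂)) + M * P * Q * (2 + c) ; M = M ; σ = σ ; Q = Q ; c = c
                ; B≡ = refl ; M-small = M-small ; σ-least = σ-least ; Q-small = Q-small ; costs = costs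
                ; all-beyond = λ n → final (211244 * ((M * W₂) * (M * W₂))) n refl }
                where
                module C = Cost costs
                Mg≡ : M * W₂ ≡ base ^ suc (t + T₂)
                Mg≡ = trans (cong (M *_) W₂-power) (trans (sym (^-distribˡ-+-* base t (suc T₂))) (cong (base ^_) (+-suc t T₂)))
                partitions = Assemble.Parts.partitions n₀ W₀ P W₂ M (t + T₂) (M * W₂) (43 * (M * W₂) + 1) I₀ p q K k
                  0<W₀ W₀≤P W₀≤W₂ 31∣P 4≤P 2P≤I₀ refl Mg≡ refl 0<p 0<q q≤Mp 0<k
                end≡ = Assemble.reach n₀ W₀ P W₂ M (t + T₂) (M * W₂) (43 * (M * W₂) + 1) I₀ p q K k
                  0<W₀ W₀≤P W₀≤W₂ 31∣P 4≤P 2P≤I₀ refl Mg≡ refl 0<p 0<q q≤Mp 0<k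
                Y²≤Q : Y * Y ≤ Q
                Y²≤Q = ≤-trans (≤-trans (m≤m*n (Y * Y) ((2 ^ σ) ^ 22) {{m^n≢0 (2 ^ σ) 22 {{m^n≢0 2 σ}}}}) (m≤n+m _ C₀)) (<⇒≤ cσ<Q)
                scaled : ∀ {S} → S ≡ I₀ * 2 ^ K → S * S ≤ Q
                scaled eq = subst (λ z → z * z ≤ Q) (sym (trans eq reach)) Y²≤Q
                Final : Set
                Final = ∀ X n → X ≡ 211244 * ((M * W₂) * (M * W₂)) → X + M * P * Q * (2 + c) ≤ n → Partition (ι p ℚ.* inv (ι q)) n
                -- G has to be a multiple of the numbers up to 2^(H σ) for the greedy choice and of
                -- D for family (4), so it is taken at the larger of Y and y.
                at-y : Dec (C.y ≤ Y) → Final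
                at-y (yes y≤Y) = partitions Y C.y (cost σ Y) c y≤Y (≤-reflexive (trans end≡ reach))
                        (tower σ Y s₀≤σ ≤-refl (^-monoʳ-≤ 2 (*-monoʳ-≤ H (n≤1+n σ)))) C.reps C.size cσ<Q (scaled end≡) enough
                at-y (no y≰Y) = partitions C.y C.y c c ≤-refl (≤-trans (≤-reflexive (trans end≡ reach)) (<⇒≤ (≰⇒> y≰Y)))
                        C.reps C.reps C.size C.c<Q (scaled end≡) enough
                final : Final
                final = at-y (C.y ≤? Y)

      private
        power-sum : ∀ a b → a * 2 ^ b ≤ 2 ^ (a + b)
        power-sum a b = ≤-trans (*-monoˡ-≤ (2 ^ b) (<⇒≤ (n<2^n a))) (≤-reflexive (sym (^-distribˡ-+-* 2 a b)))

        exponent-< : ∀ {a b} → 2 ^ a < 2 ^ b → a < b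
        exponent-< h = ≰⇒> (λ b≤a → <⇒≱ h (^-monoʳ-≤ 2 b≤a))

      small-offset : ℕ
      small-offset = 2 * (129 * W₂) + c₀

      -- Here Q is a fixed multiple of q, so its binary logarithm exceeds that of q by a constant at
      -- most.
      small-log : ∀ {q c l} → q < 2 ^ suc l → (C : Cost (129 * W₂ * q) c) → Cost.y C ≤ 2 * l + small-offset
      small-log {q} {c} {l} q< C = begin
        y                              ≡⟨ y≡ ⟩
        2 * λ′ + c₀                    ≤⟨ +-monoˡ-≤ c₀ (*-monoʳ-≤ 2 (≤-pred (≤-trans λ< (≤-reflexive (+-suc w l))))) ⟩
        2 * (w + l) + c₀               ≡⟨ lem w l c₀ ⟩
        2 * l + (2 * w + c₀)           ∎
        where
        open ≤-Reasoning
        open Cost C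
        w : ℕ
        w = 129 * W₂
        λ< : λ′ < w + suc l
        λ< = exponent-< (≤-<-trans λ-lower (<-≤-trans (*-monoʳ-< w {{>-nonZero (*-mono-≤ {1} {129} (s≤s z≤n) (≤-trans 0<W₀ W₀≤W₂))}} q<) (power-sum w (suc l))))
        lem : ∀ w l c → 2 * (w + l) + c ≡ 2 * l + (2 * w + c)
        lem = ℕ-Ring.solve-∀

      opaque

        large-constant : ℕ
        large-constant = 2 ^ (2 * (C₀ + Q₀ + 2)) * (2 + C₀ + 8 * cube (2 * (2 * (C₀ + Q₀ + 2)) + c₀ + 2 * (2 * H + 22)))

        -- X σ is of order 2^((2 H + 22) σ): the square of 2^(H σ) times (2^σ)^22. Family (4)
        -- multiplies this by at most a cube of log Q, which is linear in σ, and `cube-bound`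
        -- absorbs it into one more factor 2^σ.
        large-cost : ∀ {Q c} σ → Q < 2 * X σ → Cost Q c → Q * (2 + c) ≤ large-constant * 2 ^ ((2 * H + 23) * σ)
        large-cost {Q} {c} σ Q< C = begin
          Q * (2 + c)
            ≤⟨ *-mono-≤ (<⇒≤ Q<2^) 2+c≤ ⟩
          2 ^ (c₁ + h * σ) * (A * 2 ^ σ)
            ≡⟨ cong (_* (A * 2 ^ σ)) (^-distribˡ-+-* 2 c₁ (h * σ)) ⟩
          2 ^ c₁ * 2 ^ (h * σ) * (A * 2 ^ σ)
            ≡⟨ lem₁ (2 ^ c₁) (2 ^ (h * σ)) A (2 ^ σ) ⟩
          2 ^ c₁ * A * (2 ^ (h * σ) * 2 ^ σ)
            ≡⟨ cong (2 ^ c₁ * A *_) (trans (sym (^-distribˡ-+-* 2 (h * σ) σ)) (cong (2 ^_) (lem₂ H σ))) ⟩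
          2 ^ c₁ * A * 2 ^ ((2 * H + 23) * σ) ∎
          where
          open ≤-Reasoning
          open Cost C
          a c₁ h A Cy D : ℕ
          a = C₀ + Q₀ + 2
          c₁ = 2 * a
          h = 2 * H + 22
          Cy = 2 * (2 * a) + c₀ + 2 * h
          A = 2 + C₀ + 8 * cube Cy
          D = 2 ^ (h * σ)
          lem₁ : ∀ a b c d → a * b * (c * d) ≡ a * c * (b * d)
          lem₁ = ℕ-Ring.solve-∀
          lem₂ : ∀ H σ → (2 * H + 22) * σ + σ ≡ (2 * H + 23) * σ
          lem₂ = ℕ-Ring.solve-∀
          D≡ : 2 ^ (H * σ) * 2 ^ (H * σ) * (2 ^ σ) ^ 22 ≡ D
          D≡ = trans (cong₂ _*_ (sym (^-distribˡ-+-* 2 (H * σ) (H * σ))) (^-*-assoc 2 σ 22))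
            (trans (sym (^-distribˡ-+-* 2 (H * σ + H * σ) (σ * 22))) (cong (2 ^_) (lem H σ 22)))
            where
            lem : ∀ H σ d → H * σ + H * σ + σ * d ≡ (2 * H + d) * σ
            lem = ℕ-Ring.solve-∀
          0<D : 0 < D
          0<D = 0<2^ (h * σ)
          X≤ : X σ ≤ a * D
          X≤ = begin
            suc (C₀ + 2 ^ (H * σ) * 2 ^ (H * σ) * (2 ^ σ) ^ 22 + Q₀) ≡⟨ cong (λ z → suc (C₀ + z + Q₀)) D≡ ⟩
            suc (C₀ + D + Q₀)        ≤⟨ s≤s (+-mono-≤ (+-monoˡ-≤ D (m≤m*n C₀ D {{>-nonZero 0<D}})) (m≤m*n Q₀ D {{>-nonZero 0<D}})) ⟩
            1 + (C₀ * D + D + Q₀ * D) ≤⟨ +-monoˡ-≤ _ 0<D ⟩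
            D + (C₀ * D + D + Q₀ * D) ≡⟨ lem D C₀ Q₀ ⟩
            (C₀ + Q₀ + 2) * D        ∎
            where
            lem : ∀ D C Q → D + (C * D + D + Q * D) ≡ (C + Q + 2) * D
            lem = ℕ-Ring.solve-∀
          Q<2^ : Q < 2 ^ (c₁ + h * σ)
          Q<2^ = <-≤-trans Q< (≤-trans (*-monoʳ-≤ 2 X≤) (≤-trans (≤-reflexive (sym (*-assoc 2 a D))) (power-sum (2 * a) (h * σ))))
          y≤ : y ≤ Cy * suc σ
          y≤ = begin
            y                           ≡⟨ y≡ ⟩
            2 * λ′ + c₀                 ≤⟨ +-monoˡ-≤ c₀ (*-monoʳ-≤ 2 (<⇒≤ (exponent-< {λ′} {c₁ + h * σ} (≤-<-trans λ-lower Q<2^)))) ⟩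
            2 * (c₁ + h * σ) + c₀       ≤⟨ m≤m+n _ ((2 * c₁ + c₀) * σ + 2 * h) ⟩
            2 * (c₁ + h * σ) + c₀ + ((2 * c₁ + c₀) * σ + 2 * h) ≡⟨ lem c₁ h σ c₀ ⟩
            (2 * c₁ + c₀ + 2 * h) * suc σ ∎
            where
            lem : ∀ c h σ d → 2 * (c + h * σ) + d + ((2 * c + d) * σ + 2 * h) ≡ (2 * c + d + 2 * h) * suc σ
            lem = ℕ-Ring.solve-∀
          z≤y : z ≤ y
          z≤y = ≤-trans (m≤m*n z z {{z≢0}}) z²≤y
            where
            z≢0 : NonZero z
            z≢0 = subst NonZero (sym z≡) (m^n≢0 (2 ^ s) 22 {{m^n≢0 2 s}})
          2+c≤ : 2 + c ≤ A * 2 ^ σ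
          2+c≤ = begin
            2 + c                                     ≡⟨ cong (2 +_) c≡ ⟩
            2 + (C₀ + y * y * z)                      ≤⟨ +-monoʳ-≤ 2 (+-monoʳ-≤ C₀ (≤-trans (*-monoʳ-≤ (y * y) z≤y) (≤-reflexive (*-assoc y y y)))) ⟩
            2 + (C₀ + cube y)                         ≤⟨ +-monoʳ-≤ 2 (+-monoʳ-≤ C₀ (*-mono-≤ y≤ (*-mono-≤ y≤ y≤))) ⟩
            2 + (C₀ + cube (Cy * suc σ))              ≡⟨ cong (λ w → 2 + (C₀ + w)) (lem Cy (suc σ)) ⟩
            2 + (C₀ + cube Cy * cube (suc σ))         ≤⟨ +-monoʳ-≤ 2 (+-monoʳ-≤ C₀ (*-monoʳ-≤ (cube Cy) (cube-bound σ))) ⟩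
            2 + (C₀ + cube Cy * (8 * 2 ^ σ))          ≡⟨ sym (+-assoc 2 C₀ _) ⟩
            2 + C₀ + cube Cy * (8 * 2 ^ σ)            ≤⟨ +-monoˡ-≤ _ (m≤m*n (2 + C₀) (2 ^ σ) {{m^n≢0 2 σ}}) ⟩
            (2 + C₀) * 2 ^ σ + cube Cy * (8 * 2 ^ σ)  ≡⟨ lem₃ (2 + C₀) (2 ^ σ) (cube Cy) ⟩
            (2 + C₀ + 8 * cube Cy) * 2 ^ σ            ∎
            where
            lem : ∀ a b → (a * b) * ((a * b) * (a * b)) ≡ (a * (a * a)) * (b * (b * b))
            lem = ℕ-Ring.solve-∀
            lem₃ : ∀ a b c → a * b + c * (8 * b) ≡ (a + 8 * c) * b
            lem₃ = ℕ-Ring.solve-∀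

-- Exponentials and logarithms in the final estimate.

module RealBound where

  open import Defs using (inv; fromℕℚ; expSum; lnSum)
  open Powers
  open Rationals
  open ExpLog
  open Harmonic using (∑-mono; 0≤inv-ι; inv-ι-anti)
  open import Data.Nat.Base as ℕ using (ℕ; suc)
  import Data.Nat.Properties as ℕ
  import Data.Nat.Tactic.RingSolver as ℕ-Ring
  open import Data.Rational.Base
  import Data.Rational.Properties as ℚ
  open import Data.Product.Base using (∃-syntax; _×_; _,_)
  open import Data.Sum.Base using (_⊎_; inj₁; inj₂; [_,_]′)
  open import Relation.Nullary using (¬_; yes; no; contradiction)
  open import Tactic.RingSolver using (solve-∀)
  open import Relation.Binary.PropositionalEquality

  half≤block : ∀ N → 0 ℕ.< N → 1ℚ ≤ harmonicBlock N + harmonicBlock N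
  half≤block N 0<N = ℚ.≤-trans (ℚ.≤-reflexive (sym total))
    (ℚ.+-mono-≤ bound bound)
    where
    open import Defs using (module Estimates)
    i : ℚ
    i = inv (ι (N ℕ.+ N))
    0<2N : 0 ℕ.< N ℕ.+ N
    0<2N = ℕ.≤-trans 0<N (ℕ.m≤m+n N N)
    total : ι N * i + ι N * i ≡ 1ℚ
    total = trans (sym (ℚ.*-distribʳ-+ i (ι N) (ι N))) (trans (cong (_* i) (sym (ι-+ N N))) (inv≡ (ι (N ℕ.+ N)) (0<ι (N ℕ.+ N) 0<2N)))
    bound : ι N * i ≤ harmonicBlock N
    bound = ℚ.≤-trans (ℚ.≤-reflexive (trans (cong (_* i) (ι-def N)) (sym (Estimates.∑-const N i))))
      (∑-mono N (λ _ → i) _ (λ k k<N → inv-ι-anti (ℕ.≤-trans 0<N (ℕ.m≤m+n N k)) (ℕ.+-monoʳ-≤ N (ℕ.<⇒≤ k<N))))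

  -- With v = θ/8 and μ ≥ 1/2, the loss v in the rate is outweighed by the gain θ in the exponent.
  rate-gain : ∀ μ v θ → 1ℚ ≤ μ + μ → 0ℚ ≤ v → θ ≡ four * (v + v) → θ ≤ 1ℚ →
              (two + θ) * μ ≤ two * (1ℚ + θ) * (μ - v)
  rate-gain μ v _ 1≤2μ 0≤v refl θ≤1 = ≤-by (four * v * (μ + μ - 1ℚ) + two * v * (1ℚ - four * (v + v)))
      (0≤+ (0≤* (0≤* (ℚ.<⇒≤ 0<four) 0≤v) (0≤- 1≤2μ)) (0≤* (0≤* (ℚ.nonNegative⁻¹ two) 0≤v) (0≤- θ≤1))) (lem μ v)
    where
    lem : ∀ μ v → (1ℚ + 1ℚ + (1ℚ + 1ℚ + (1ℚ + 1ℚ)) * (v + v)) * μ + ((1ℚ + 1ℚ + (1ℚ + 1ℚ)) * v * (μ + μ - 1ℚ) + (1ℚ + 1ℚ) * v * (1ℚ - (1ℚ + 1ℚ + (1ℚ + 1ℚ)) * (v + v))) ≡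
                  (1ℚ + 1ℚ) * (1ℚ + (1ℚ + 1ℚ + (1ℚ + 1ℚ)) * (v + v)) * (μ - v)
    lem = solve-∀ ℚ-ring

  ι-2 : ι 2 ≡ two
  ι-2 = trans (ι-+ 1 1) (cong₂ _+_ ι-1 ι-1)

  ι-4 : ι 4 ≡ four
  ι-4 = trans (ι-+ 2 2) (cong₂ _+_ ι-2 ι-2)

  1≤ι : ∀ n → 0 ℕ.< n → 1ℚ ≤ ι n
  1≤ι n 0<n = ℚ.≤-trans (ℚ.≤-reflexive (sym ι-1)) (ι-mono 1 n 0<n)

  module Exponent
    (H τ W₀ j₀ σ₀ : ℕ) (0<τ : 0 ℕ.< τ) (44τ≤H : 44 ℕ.* τ ℕ.≤ H) (W₀≡ : W₀ ≡ 56 ℕ.* τ)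
    where

    private
      I₀ : ℕ
      I₀ = 2 ℕ.^ j₀
      0<W₀ : 0 ℕ.< W₀
      0<W₀ = ℕ.≤-trans (ℕ.≤-trans 0<τ (ℕ.m≤n*m τ 56)) (ℕ.≤-reflexive (sym W₀≡))

    μ v θ : ℚ
    μ = harmonicBlock I₀
    v = ι 7 * inv (ι W₀)
    θ = inv (ι τ)

    0≤v : 0ℚ ≤ v
    0≤v = 0≤* (0≤ι 7) (0≤inv-ι W₀ 0<W₀)

    0≤θ : 0ℚ ≤ θ
    0≤θ = 0≤inv-ι τ 0<τ

    θ≤1 : θ ≤ 1ℚ
    θ≤1 = ℚ.≤-trans (inv-anti 0<1 (1≤ι τ 0<τ)) (ℚ.≤-reflexive refl)

    -- 56 = 8 * 7: the loss 7 / W₀ of the rate is exactly an eighth of θ.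
    θ≡8v : θ ≡ four * (v + v)
    θ≡8v = trans (inv-quotient {q = 56} 0<τ 0<W₀ (sym W₀≡)) (trans (cong (_* inv (ι W₀)) (trans (ι-* 8 7) (cong (_* ι 7) (trans (ι-+ 4 4) (cong₂ _+_ ι-4 ι-4)))))
      (lem (ι 7) (inv (ι W₀))))
      where
      lem : ∀ s w → ((1ℚ + 1ℚ + (1ℚ + 1ℚ)) + (1ℚ + 1ℚ + (1ℚ + 1ℚ))) * s * w ≡ (1ℚ + 1ℚ + (1ℚ + 1ℚ)) * (s * w + s * w)
      lem = solve-∀ ℚ-ring

    1≤2μ : 1ℚ ≤ μ + μ
    1≤2μ = half≤block I₀ (0<2^ j₀)

    gain : (two + θ) * μ ≤ two * (1ℚ + θ) * (μ - v)
    gain = rate-gain μ v θ 1≤2μ 0≤v θ≡8v θ≤1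

    0<rate : 0ℚ < μ - v
    0<rate = cancel-< (0<* (ℚ.positive⁻¹ two) (ℚ.<-≤-trans 0<1 (p≤p+q 0≤θ))) (ℚ.<-≤-trans
      (subst (_< (two + θ) * μ) (sym (ℚ.*-zeroʳ (two * (1ℚ + θ)))) (0<* (ℚ.<-≤-trans (ℚ.positive⁻¹ two) (p≤p+q 0≤θ)) 0<μ)) gain)
      where
      0<μ : 0ℚ < μ
      0<μ with μ ℚ.≤? 0ℚ
      ... | no h  = ℚ.≰⇒> h
      ... | yes h = contradiction (ℚ.≤-trans 1≤2μ (ℚ.+-mono-≤ h h)) (<⇒≱ℚ 0<1)

    private
      D : ℕ
      D = 2 ℕ.* H ℕ.+ 44 ℕ.+ 3 ℕ.* j₀ ℕ.+ (2 ℕ.* H ℕ.+ 23) ℕ.* σ₀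

    exponent-constant : ℕ
    exponent-constant = 2 ℕ.^ D

    -- As σ′ is not enough, the L = H σ′ - j₀ blocks give L (μ - v) < α. With E ≤ (2 + θ) L, `gain`
    -- yields E μ ≤ 2 (1 + θ) α, while 2^E ≤ exp (E μ). The summand R of E, which is 44 σ′ - j₀ and
    -- at most θ L by 44 τ ≤ H, pays for the excess 23 σ over 2 H σ.
    power-below-exp : ∀ α σ → 0ℚ ≤ α → σ ≡ σ₀ ⊎ (∃[ σ′ ] (σ ≡ suc σ′ × ¬ (α ≤ ι (H ℕ.* σ′ ℕ.∸ j₀) * (μ - v)))) →
      ∃[ N ] (∀ n → N ℕ.≤ n → ∀ z → two * (1ℚ + θ) * α ≤ z →
        ι (2 ℕ.^ ((2 ℕ.* H ℕ.+ 23) ℕ.* σ)) ≤ ι exponent-constant * expSum n z)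
    power-below-exp α σ 0≤α (inj₁ refl) = 1 , λ n 1≤n z z≥ → ℚ.≤-trans (ι-mono (2 ℕ.^ ((2 ℕ.* H ℕ.+ 23) ℕ.* σ)) exponent-constant (ℕ.^-monoʳ-≤ 2 (ℕ.m≤n+m ((2 ℕ.* H ℕ.+ 23) ℕ.* σ) (2 ℕ.* H ℕ.+ 44 ℕ.+ 3 ℕ.* j₀))))
      (ℚ.≤-trans (ℚ.≤-reflexive (sym (ℚ.*-identityʳ (ι exponent-constant)))) (*-mono-l (0≤ι exponent-constant)
        (expSum-mono-n {1} {n} (ℚ.≤-trans (0≤* (0≤* (ℚ.nonNegative⁻¹ two) (0≤+ 0≤1 0≤θ)) 0≤α) z≥) 1≤n)))
    power-below-exp α .(suc σ′) 0≤α (inj₂ (σ′ , refl , ¬enough)) = 1 ℕ.+ E ℕ.* I₀ , λ n N≤n z z≥ →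
      ℚ.≤-trans (ι-mono (2 ℕ.^ ((2 ℕ.* H ℕ.+ 23) ℕ.* suc σ′)) (exponent-constant ℕ.* 2 ℕ.^ E) powers) (ℚ.≤-trans (ℚ.≤-reflexive (ι-* exponent-constant (2 ℕ.^ E))) (*-mono-l (0≤ι exponent-constant)
        (ℚ.≤-trans (exp-blocks I₀ (0<2^ j₀) E) (ℚ.≤-trans (expSum-mono-n 0≤Eμ N≤n) (expSum-mono n 0≤Eμ (ℚ.≤-trans Eμ≤ z≥))))))
      where
      L R E : ℕ
      L = H ℕ.* σ′ ℕ.∸ j₀
      R = 44 ℕ.* σ′ ℕ.∸ j₀
      E = 2 ℕ.* L ℕ.+ R
      0≤μ : 0ℚ ≤ μ
      0≤μ = ∑-nonneg I₀ _ (λ k _ → 0≤inv-ι (I₀ ℕ.+ k) (ℕ.≤-trans (0<2^ j₀) (ℕ.m≤m+n I₀ k)))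
      0≤Eμ : 0ℚ ≤ ι E * μ
      0≤Eμ = 0≤* (0≤ι E) 0≤μ
      τR≤L : τ ℕ.* R ℕ.≤ L
      τR≤L = ℕ.≤-trans (ℕ.≤-reflexive (ℕ.*-distribˡ-∸ τ (44 ℕ.* σ′) j₀)) (ℕ.∸-mono
        (ℕ.≤-trans (ℕ.≤-reflexive (lem 44 τ σ′)) (ℕ.*-monoˡ-≤ σ′ 44τ≤H)) (ℕ.m≤n*m j₀ τ {{ℕ.>-nonZero 0<τ}}))
        where
        lem : ∀ c t s → t ℕ.* (c ℕ.* s) ≡ c ℕ.* t ℕ.* s
        lem = ℕ-Ring.solve-∀
      Eμ≤ : ι E * μ ≤ two * (1ℚ + θ) * α
      Eμ≤ = begin
        ι E * μ                                 ≡⟨ cong (_* μ) (trans (ι-+ (2 ℕ.* L) R) (cong (_+ ι R) (trans (ι-* 2 L) (cong (_* ι L) ι-2)))) ⟩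
        (two * ι L + ι R) * μ                   ≤⟨ *-mono-r 0≤μ (ℚ.+-monoʳ-≤ (two * ι L) (ι-≤-inv 0<τ τR≤L)) ⟩
        (two * ι L + θ * ι L) * μ               ≡⟨ lem₁ two (ι L) θ μ ⟩
        ι L * ((two + θ) * μ)                   ≤⟨ *-mono-l (0≤ι L) gain ⟩
        ι L * (two * (1ℚ + θ) * (μ - v))        ≡⟨ lem₂ (ι L) (two * (1ℚ + θ)) (μ - v) ⟩
        two * (1ℚ + θ) * (ι L * (μ - v))        ≤⟨ *-mono-l (0≤* (ℚ.nonNegative⁻¹ two) (0≤+ 0≤1 0≤θ)) (ℚ.<⇒≤ (ℚ.≰⇒> ¬enough)) ⟩
        two * (1ℚ + θ) * α                      ∎
        where
        open ℚ.≤-Reasoning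
        lem₁ : ∀ t l θ μ → (t * l + θ * l) * μ ≡ l * ((t + θ) * μ)
        lem₁ = solve-∀ ℚ-ring
        lem₂ : ∀ l c r → l * (c * r) ≡ c * (l * r)
        lem₂ = solve-∀ ℚ-ring
      exponents : (2 ℕ.* H ℕ.+ 23) ℕ.* suc σ′ ℕ.≤ D ℕ.+ E
      exponents = begin
        (2 ℕ.* H ℕ.+ 23) ℕ.* suc σ′                              ≤⟨ ℕ.*-monoˡ-≤ (suc σ′) (ℕ.+-monoʳ-≤ (2 ℕ.* H) (ℕ.≤ᵇ⇒≤ 23 44 _)) ⟩
        (2 ℕ.* H ℕ.+ 44) ℕ.* suc σ′                              ≡⟨ lem₁ H 44 σ′ ⟩
        2 ℕ.* H ℕ.+ 44 ℕ.+ (2 ℕ.* (H ℕ.* σ′) ℕ.+ 44 ℕ.* σ′)      ≤⟨ ℕ.+-monoʳ-≤ (2 ℕ.* H ℕ.+ 44) (ℕ.+-mono-≤ (ℕ.*-monoʳ-≤ 2 (ℕ.m≤n+m∸n (H ℕ.* σ′) j₀)) (ℕ.m≤n+m∸n (44 ℕ.* σ′) j₀)) ⟩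
        2 ℕ.* H ℕ.+ 44 ℕ.+ (2 ℕ.* (j₀ ℕ.+ L) ℕ.+ (j₀ ℕ.+ R))     ≡⟨ lem₂ (2 ℕ.* H ℕ.+ 44) j₀ L R ⟩
        2 ℕ.* H ℕ.+ 44 ℕ.+ 3 ℕ.* j₀ ℕ.+ E                        ≤⟨ ℕ.+-monoˡ-≤ E (ℕ.m≤m+n (2 ℕ.* H ℕ.+ 44 ℕ.+ 3 ℕ.* j₀) ((2 ℕ.* H ℕ.+ 23) ℕ.* σ₀)) ⟩
        D ℕ.+ E                                                  ∎
        where
        open ℕ.≤-Reasoning
        lem₁ : ∀ H c s → (2 ℕ.* H ℕ.+ c) ℕ.* suc s ≡ 2 ℕ.* H ℕ.+ c ℕ.+ (2 ℕ.* (H ℕ.* s) ℕ.+ c ℕ.* s)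
        lem₁ = ℕ-Ring.solve-∀
        lem₂ : ∀ h j L R → h ℕ.+ (2 ℕ.* (j ℕ.+ L) ℕ.+ (j ℕ.+ R)) ≡ h ℕ.+ 3 ℕ.* j ℕ.+ (2 ℕ.* L ℕ.+ R)
        lem₂ = ℕ-Ring.solve-∀
      powers : 2 ℕ.^ ((2 ℕ.* H ℕ.+ 23) ℕ.* suc σ′) ℕ.≤ exponent-constant ℕ.* 2 ℕ.^ E
      powers = ℕ.≤-trans (ℕ.^-monoʳ-≤ 2 exponents) (ℕ.≤-reflexive (ℕ.^-distribˡ-+-* 2 D E))

  module Logs (q : ℕ) (0<q : 0 ℕ.< q) (n : ℕ) (4q≤n : 4 ℕ.* q ℕ.≤ n) where

    x Λ₁ Λ₂ : ℚ
    x = fromℕℚ q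
    Λ₁ = 1ℚ ⊔ lnSum n x
    Λ₂ = 1ℚ ⊔ lnSum n Λ₁

    1≤Λ₁ : 1ℚ ≤ Λ₁
    1≤Λ₁ = ℚ.p≤p⊔q 1ℚ (lnSum n x)

    1≤Λ₂ : 1ℚ ≤ Λ₂
    1≤Λ₂ = ℚ.p≤p⊔q 1ℚ (lnSum n Λ₁)

    private
      0<n : 0 ℕ.< n
      0<n = ℕ.≤-trans (ℕ.≤-trans 0<q (ℕ.m≤n*m q 4)) 4q≤n
      1≤x : 1ℚ ≤ x
      1≤x = subst (1ℚ ≤_) (ι-def q) (1≤ι q 0<q)
      4x≤n : four * x ≤ fromℕℚ n
      4x≤n = subst₂ _≤_ (trans (ι-* 4 q) (cong₂ _*_ ι-4 (ι-def q))) (ι-def n) (ι-mono (4 ℕ.* q) n 4q≤n)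

      -- `lnSum²` at Λ₁ requires a subdivision with mesh at most 1; the crude bound ln x ≤ 2 x
      -- guarantees it.
      Λ₁≤n : Λ₁ ≤ fromℕℚ n
      Λ₁≤n = ℚ.⊔-lub (subst (1ℚ ≤_) (ι-def n) (1≤ι n 0<n)) (ℚ.≤-trans ln≤x+x (ℚ.≤-trans (≤-by (x + x) (0≤+ 0≤x 0≤x) (lem x)) 4x≤n))
        where
        0≤x : 0ℚ ≤ x
        0≤x = ℚ.≤-trans 0≤1 1≤x
        lem : ∀ x → x + x + (x + x) ≡ (1ℚ + 1ℚ + (1ℚ + 1ℚ)) * x
        lem = solve-∀ ℚ-ring
        x≤n : x ≤ fromℕℚ n
        x≤n = ℚ.≤-trans (≤-by (x + (x + x)) (0≤+ 0≤x (0≤+ 0≤x 0≤x)) (lem₂ x)) 4x≤n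
          where
          lem₂ : ∀ x → x + (x + (x + x)) ≡ (1ℚ + 1ℚ + (1ℚ + 1ℚ)) * x
          lem₂ = solve-∀ ℚ-ring
        ln≤x+x : lnSum n x ≤ x + x
        ln≤x+x = [ (λ le → ℚ.≤-trans le (ℚ.≤-trans 1≤x (p≤p+q 0≤x)))
                 , (λ ge → ℚ.≤-trans (ℚ.≤-trans (ℚ.≤-reflexive (sym (ℚ.*-identityʳ (lnSum n x)))) (*-mono-l (ℚ.≤-trans 0≤1 ge) ge))
                             (lnSum² x 1≤x n 0<n x≤n)) ]′ (ℚ.≤-total (lnSum n x) 1ℚ)

    log-lower : ∀ l → 2 ℕ.^ l ℕ.≤ q → ι l ≤ ι 5 * Λ₁
    log-lower l h = ℚ.≤-trans (ln-lower x 1≤x n 0<n 4x≤n l (subst (ι (2 ℕ.^ l) ≤_) (ι-def q) (ι-mono _ q h)))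
      (ℚ.≤-trans (ℚ.+-mono-≤ 1≤Λ₁ (*-mono-l (ℚ.<⇒≤ 0<four) (ℚ.p≤q⊔p 1ℚ (lnSum n x))))
        (ℚ.≤-reflexive (trans (lem Λ₁ four) (cong (_* Λ₁) (sym (trans (ι-suc 4) (cong (1ℚ +_) ι-4)))))))
      where
      lem : ∀ l f → l + f * l ≡ (1ℚ + f) * l
      lem = solve-∀ ℚ-ring

    Λ₂² : Λ₂ * Λ₂ ≤ Λ₁ + Λ₁
    Λ₂² = [ (λ eq → subst (λ z → z * z ≤ Λ₁ + Λ₁) (sym eq) (ℚ.≤-trans (ℚ.≤-reflexive (ℚ.*-identityʳ 1ℚ)) (ℚ.≤-trans 1≤Λ₁ (p≤p+q (ℚ.≤-trans 0≤1 1≤Λ₁)))))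
          , (λ eq → subst (λ z → z * z ≤ Λ₁ + Λ₁) (sym eq) (lnSum² Λ₁ 1≤Λ₁ n 0<n Λ₁≤n)) ]′ (ℚ.⊔-sel 1ℚ (lnSum n Λ₁))

-- Comparing the costs with the first term of the bound.

module Comparison where

  open import Defs using (inv)
  open Rationals
  open ExpLog using (two)
  open RealBound using (1≤ι; ι-2)
  open import Data.Nat.Base as ℕ using (ℕ)
  import Data.Nat.Properties as ℕ
  import Data.Nat.Tactic.RingSolver as ℕ-Ring
  open import Data.Rational.Base
  import Data.Rational.Properties as ℚ
  open import Data.Sum.Base using (_⊎_; inj₁; inj₂)
  open import Tactic.RingSolver using (solve-∀)
  open import Relation.Binary.PropositionalEquality

  ≤-*ˡ : ∀ {a b} → 1ℚ ≤ a → 0ℚ ≤ b → b ≤ a * b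
  ≤-*ˡ {a} {b} 1≤a 0≤b = subst (_≤ a * b) (ℚ.*-identityˡ b) (*-mono-r 0≤b 1≤a)

  product≤squares : ∀ {a b} → 0ℚ ≤ a → 0ℚ ≤ b → a * b ≤ a * a + b * b
  product≤squares {a} {b} 0≤a 0≤b with ℚ.≤-total a b
  ... | inj₁ a≤b = ℚ.≤-trans (*-mono-r 0≤b a≤b) (p≤q+p (0≤* 0≤a 0≤a))
  ... | inj₂ b≤a = ℚ.≤-trans (*-mono-l 0≤a b≤a) (p≤p+q (0≤* 0≤b 0≤b))

  module LogRatio (Λ₁ Λ₂ : ℚ) (1≤Λ₁ : 1ℚ ≤ Λ₁) (1≤Λ₂ : 1ℚ ≤ Λ₂) (Λ₂² : Λ₂ * Λ₂ ≤ Λ₁ + Λ₁) where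

    private
      0≤Λ₁ : 0ℚ ≤ Λ₁
      0≤Λ₁ = ℚ.≤-trans 0≤1 1≤Λ₁
      0<Λ₂ : 0ℚ < Λ₂
      0<Λ₂ = ℚ.<-≤-trans 0<1 1≤Λ₂
      0≤Λ₂ : 0ℚ ≤ Λ₂
      0≤Λ₂ = ℚ.<⇒≤ 0<Λ₂
      W : ℚ
      W = Λ₁ * (Λ₁ * Λ₁)
      0≤Λ₁² : 0ℚ ≤ Λ₁ * Λ₁
      0≤Λ₁² = 0≤* 0≤Λ₁ 0≤Λ₁
      0≤W : 0ℚ ≤ W
      0≤W = 0≤* 0≤Λ₁ 0≤Λ₁²
      Λ₁≤W : Λ₁ ≤ W
      Λ₁≤W = ℚ.≤-trans (≤-*ˡ 1≤Λ₁ 0≤Λ₁) (≤-*ˡ 1≤Λ₁ 0≤Λ₁²)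
      Λ₂≤ : Λ₂ ≤ W + W
      Λ₂≤ = ℚ.≤-trans (≤-*ˡ 1≤Λ₂ 0≤Λ₂) (ℚ.≤-trans Λ₂² (ℚ.+-mono-≤ Λ₁≤W Λ₁≤W))

    V : ℚ
    V = W * inv Λ₂

    0≤V : 0ℚ ≤ V
    0≤V = 0≤* 0≤W (0≤inv Λ₂ 0<Λ₂)

    private
      divide : ∀ {a b} → a * Λ₂ ≤ b * W → a ≤ b * V
      divide {a} {b} h = cancel-≤ 0<Λ₂ (subst₂ _≤_ (ℚ.*-comm a Λ₂) (sym
        (trans (lem Λ₂ b W (inv Λ₂)) (trans (cong (b * W *_) (inv≡ Λ₂ 0<Λ₂)) (ℚ.*-identityʳ (b * W))))) h)
        where
        lem : ∀ l b w i → l * (b * (w * i)) ≡ b * w * (l * i)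
        lem = solve-∀ ℚ-ring

    1≤2V : 1ℚ ≤ two * V
    1≤2V = divide {1ℚ} {two} (subst₂ _≤_ (sym (ℚ.*-identityˡ Λ₂)) (lem W) Λ₂≤)
      where
      lem : ∀ w → w + w ≡ (1ℚ + 1ℚ) * w
      lem = solve-∀ ℚ-ring

    -- The product z Λ₂ is at most z² + Λ₂², and both z² ≤ y and Λ₂² ≤ 2 Λ₁ are linear in Λ₁. So y²
    -- z Λ₂ is bounded by a multiple of Λ₁³: the factor y^(1/2) fits into log q / log log q.
    small-cost : ∀ A C {c} y z → ι y ≤ ι A * Λ₁ → z ℕ.* z ℕ.≤ y → c ≡ C ℕ.+ y ℕ.* y ℕ.* z →
                 ι (2 ℕ.+ c) ≤ ι (2 ℕ.* (2 ℕ.+ C) ℕ.+ A ℕ.* A ℕ.* (A ℕ.+ 2)) * V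
    small-cost A C y z y≤ z²≤y refl = divide {ι (2 ℕ.+ (C ℕ.+ y ℕ.* y ℕ.* z))} {ι (2 ℕ.* (2 ℕ.+ C) ℕ.+ A ℕ.* A ℕ.* (A ℕ.+ 2))} (begin
      ι (2 ℕ.+ (C ℕ.+ y ℕ.* y ℕ.* z)) * Λ₂
        ≡⟨ cong (_* Λ₂) (trans (cong ι (sym (ℕ.+-assoc 2 C (y ℕ.* y ℕ.* z)))) (trans (ι-+ (2 ℕ.+ C) (y ℕ.* y ℕ.* z)) (cong (ι (2 ℕ.+ C) +_) (trans (ι-* (y ℕ.* y) z) (cong (_* ι z) (ι-* y y)))))) ⟩
      (d + ι y * ι y * ι z) * Λ₂
        ≡⟨ lem₁ d (ι y) (ι z) Λ₂ ⟩
      d * Λ₂ + ι y * ι y * (ι z * Λ₂)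
        ≤⟨ ℚ.+-mono-≤ (*-mono-l (0≤ι (2 ℕ.+ C)) Λ₂≤) (*-mono (0≤* (0≤ι z) 0≤Λ₂) (0≤* 0≤AΛ 0≤AΛ) (*-mono (0≤ι y) 0≤AΛ y≤ y≤) zΛ₂≤) ⟩
      d * (W + W) + a * Λ₁ * (a * Λ₁) * (a * Λ₁ + (Λ₁ + Λ₁))
        ≡⟨ lem₂ d Λ₁ a ⟩
      (two * d + a * a * (a + two)) * W
        ≡⟨ cong (_* W) (sym (trans (ι-+ (2 ℕ.* (2 ℕ.+ C)) (A ℕ.* A ℕ.* (A ℕ.+ 2))) (cong₂ _+_ (trans (ι-* 2 (2 ℕ.+ C)) (cong (_* d) ι-2))
             (trans (ι-* (A ℕ.* A) (A ℕ.+ 2)) (cong₂ _*_ (ι-* A A) (trans (ι-+ A 2) (cong (a +_) ι-2))))))) ⟩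
      ι (2 ℕ.* (2 ℕ.+ C) ℕ.+ A ℕ.* A ℕ.* (A ℕ.+ 2)) * W ∎)
      where
      open ℚ.≤-Reasoning
      a d : ℚ
      a = ι A
      d = ι (2 ℕ.+ C)
      0≤AΛ : 0ℚ ≤ a * Λ₁
      0≤AΛ = 0≤* (0≤ι A) 0≤Λ₁
      zΛ₂≤ : ι z * Λ₂ ≤ a * Λ₁ + (Λ₁ + Λ₁)
      zΛ₂≤ = ℚ.≤-trans (product≤squares (0≤ι z) 0≤Λ₂) (ℚ.+-mono-≤ (ℚ.≤-trans (subst (_≤ ι y) (ι-* z z) (ι-mono (z ℕ.* z) y z²≤y)) y≤) Λ₂²)
      lem₁ : ∀ d y z l → (d + y * y * z) * l ≡ d * l + y * y * (z * l)
      lem₁ = solve-∀ ℚ-ring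
      lem₂ : ∀ d l a → d * (l * (l * l) + l * (l * l)) + a * l * (a * l) * (a * l + (l + l)) ≡ ((1ℚ + 1ℚ) * d + a * a * (a + (1ℚ + 1ℚ))) * (l * (l * l))
      lem₂ = solve-∀ ℚ-ring

  module Scale (p q : ℕ) (0<p : 0 ℕ.< p) (0<q : 0 ℕ.< q) (V : ℚ) (0≤V : 0ℚ ≤ V) (1≤2V : 1ℚ ≤ two * V) where

    -- T is the first term of the bound without its constant; V stands for log³ q / log log q.
    α ρ T : ℚ
    α = ι p * inv (ι q)
    ρ = inv (α ⊓ 1ℚ)
    T = ι q * (ρ * V)

    0<α : 0ℚ < α
    0<α = 0<* (0<ι p 0<p) (0<inv (ι q) (0<ι q 0<q))

    0<α⊓1 : 0ℚ < α ⊓ 1ℚ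
    0<α⊓1 with ℚ.⊓-sel α 1ℚ
    ... | inj₁ eq = subst (0ℚ <_) (sym eq) 0<α
    ... | inj₂ eq = subst (0ℚ <_) (sym eq) 0<1

    0≤ρ : 0ℚ ≤ ρ
    0≤ρ = 0≤inv (α ⊓ 1ℚ) 0<α⊓1

    1≤ρ : 1ℚ ≤ ρ
    1≤ρ = ℚ.≤-trans (ℚ.≤-reflexive refl) (inv-anti {q = 1ℚ} 0<α⊓1 (ℚ.p⊓q≤q α 1ℚ))

    0≤T : 0ℚ ≤ T
    0≤T = 0≤* (0≤ι q) (0≤* 0≤ρ 0≤V)

    ρ≤2T : ρ ≤ two * T
    ρ≤2T = begin
      ρ                     ≤⟨ ≤-*ˡ 1≤2V 0≤ρ ⟩
      two * V * ρ           ≤⟨ ≤-*ˡ (1≤ι q 0<q) (0≤* (0≤* (ℚ.nonNegative⁻¹ two) 0≤V) 0≤ρ) ⟩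
      ι q * (two * V * ρ)   ≡⟨ lem (ι q) two V ρ ⟩
      two * T               ∎
      where
      open ℚ.≤-Reasoning
      lem : ∀ q t v r → q * (t * v * r) ≡ t * (q * (r * v))
      lem = solve-∀ ℚ-ring

    1≤2T : 1ℚ ≤ two * T
    1≤2T = ℚ.≤-trans 1≤ρ ρ≤2T

    Mα≤ : ∀ {M} → M ℕ.* p ℕ.≤ 32 ℕ.* q → ι (M ℕ.* p) * inv (ι q) ≤ ι 32
    Mα≤ {M} h = ℚ.≤-trans (*-mono-r (0≤inv (ι q) (0<ι q 0<q)) (ι-mono (M ℕ.* p) (32 ℕ.* q) h))
      (ℚ.≤-reflexive (trans (cong (_* inv (ι q)) (ι-* 32 q)) (trans (ℚ.*-assoc (ι 32) (ι q) (inv (ι q)))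
        (trans (cong (ι 32 *_) (inv≡ (ι q) (0<ι q 0<q))) (ℚ.*-identityʳ (ι 32))))))

    -- M α ≤ 32 bounds M by 32 / α, hence by 32 over the minimum of α and 1.
    M≤ρ : ∀ {M} → M ≡ 1 ⊎ M ℕ.* p ℕ.≤ 32 ℕ.* q → ι M ≤ ι 32 * ρ
    M≤ρ (inj₁ refl) = ℚ.≤-trans (ℚ.≤-reflexive ι-1) (ℚ.≤-trans 1≤ρ (≤-*ˡ (1≤ι 32 (ℕ.s≤s ℕ.z≤n)) 0≤ρ))
    M≤ρ {M} (inj₂ h) = begin
      ι M                   ≡⟨ sym (trans (cong (ι M *_) (inv≡ α 0<α)) (ℚ.*-identityʳ (ι M))) ⟩
      ι M * (α * inv α)     ≡⟨ trans (lem (ι M) (ι p) (inv (ι q)) (inv α)) (cong (λ z → z * inv (ι q) * inv α) (sym (ι-* M p))) ⟩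
      ι (M ℕ.* p) * inv (ι q) * inv α ≤⟨ *-mono (0≤inv α 0<α) (0≤ι 32) (Mα≤ {M} h) (inv-anti 0<α⊓1 (ℚ.p⊓q≤p α 1ℚ)) ⟩
      ι 32 * ρ              ∎
      where
      open ℚ.≤-Reasoning
      lem : ∀ m p i j → m * (p * i * j) ≡ m * p * i * j
      lem = solve-∀ ℚ-ring

    M≤q : ∀ {M} → M ≡ 1 ⊎ M ℕ.* p ℕ.≤ 32 ℕ.* q → M ℕ.≤ 32 ℕ.* q
    M≤q (inj₁ refl) = ℕ.≤-trans 0<q (ℕ.m≤n*m q 32)
    M≤q {M} (inj₂ h) = ℕ.≤-trans (ℕ.m≤m*n M p {{ℕ.>-nonZero 0<p}}) h

    -- One factor M is at most 32 ρ and the other at most 32 q, so the square is linear in q ρ. The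
    -- constant 2048 is 2 * 32², with 2 from 1 ≤ 2 V.
    square-bound : ∀ k W {M} → M ≡ 1 ⊎ M ℕ.* p ℕ.≤ 32 ℕ.* q → ι (k ℕ.* ((M ℕ.* W) ℕ.* (M ℕ.* W))) ≤ ι (k ℕ.* (W ℕ.* W) ℕ.* 2048) * T
    square-bound k W {M} h = go 32 2048 (M≤ρ h) (M≤q h) (ℕ.≤ᵇ⇒≤ 2048 2048 _)
      where
      go : ∀ a b → ι M ≤ ι a * ρ → M ℕ.≤ a ℕ.* q → 2 ℕ.* (a ℕ.* a) ℕ.≤ b → ι (k ℕ.* ((M ℕ.* W) ℕ.* (M ℕ.* W))) ≤ ι (k ℕ.* (W ℕ.* W) ℕ.* b) * T
      go a b M≤ρ M≤q 2a²≤b = begin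
        ι (k ℕ.* ((M ℕ.* W) ℕ.* (M ℕ.* W)))
          ≡⟨ trans (cong ι (lem₁ k M W)) (trans (ι-* (k ℕ.* (W ℕ.* W)) (M ℕ.* M)) (cong (w *_) (ι-* M M))) ⟩
        w * (ι M * ι M)
          ≤⟨ *-mono-l (0≤ι (k ℕ.* (W ℕ.* W))) (*-mono (0≤ι M) (0≤* (0≤ι a) (0≤ι q)) (subst (ι M ≤_) (ι-* a q) (ι-mono M (a ℕ.* q) M≤q))
               (ℚ.≤-trans M≤ρ (*-mono-l (0≤ι a) (≤-*ˡ 1≤2V 0≤ρ)))) ⟩
        w * (ι a * ι q * (ι a * (two * V * ρ)))
          ≡⟨ lem₂ w (ι a) (ι q) V ρ ⟩
        w * (two * (ι a * ι a)) * T
          ≡⟨ cong (λ z → w * z * T) (sym (trans (ι-* 2 (a ℕ.* a)) (cong₂ _*_ ι-2 (ι-* a a)))) ⟩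
        w * ι (2 ℕ.* (a ℕ.* a)) * T
          ≤⟨ *-mono-r 0≤T (*-mono-l (0≤ι (k ℕ.* (W ℕ.* W))) (ι-mono (2 ℕ.* (a ℕ.* a)) b 2a²≤b)) ⟩
        w * ι b * T
          ≡⟨ cong (_* T) (sym (ι-* (k ℕ.* (W ℕ.* W)) b)) ⟩
        ι (k ℕ.* (W ℕ.* W) ℕ.* b) * T ∎
        where
        open ℚ.≤-Reasoning
        w : ℚ
        w = ι (k ℕ.* (W ℕ.* W))
        lem₁ : ∀ k M W → k ℕ.* ((M ℕ.* W) ℕ.* (M ℕ.* W)) ≡ k ℕ.* (W ℕ.* W) ℕ.* (M ℕ.* M)
        lem₁ = ℕ-Ring.solve-∀
        lem₂ : ∀ w a q v r → w * (a * q * (a * ((1ℚ + 1ℚ) * v * r))) ≡ w * ((1ℚ + 1ℚ) * (a * a)) * (q * (r * v))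
        lem₂ = solve-∀ ℚ-ring

    small-product : ∀ P w A {M c} → M ≡ 1 ⊎ M ℕ.* p ℕ.≤ 32 ℕ.* q → ι (2 ℕ.+ c) ≤ ι A * V →
                    ι (M ℕ.* P ℕ.* (w ℕ.* q) ℕ.* (2 ℕ.+ c)) ≤ ι (P ℕ.* w ℕ.* 32 ℕ.* A) * T
    small-product P w A {M} {c} h c≤ = go 32 (M≤ρ h) (2 ℕ.+ c) c≤
      where
      go : ∀ a → ι M ≤ ι a * ρ → ∀ d → ι d ≤ ι A * V → ι (M ℕ.* P ℕ.* (w ℕ.* q) ℕ.* d) ≤ ι (P ℕ.* w ℕ.* a ℕ.* A) * T
      go a M≤ d d≤ = begin
        ι (M ℕ.* P ℕ.* (w ℕ.* q) ℕ.* d)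
          ≡⟨ trans (cong ι (lem₁ M P w q d)) (trans (ι-* (P ℕ.* w ℕ.* q) (M ℕ.* d)) (cong₂ _*_ (ι-* (P ℕ.* w) q) (ι-* M d))) ⟩
        ι (P ℕ.* w) * ι q * (ι M * ι d)
          ≤⟨ *-mono-l (0≤* (0≤ι (P ℕ.* w)) (0≤ι q)) (*-mono (0≤ι d) (0≤* (0≤ι a) 0≤ρ) M≤ d≤) ⟩
        ι (P ℕ.* w) * ι q * (ι a * ρ * (ι A * V))
          ≡⟨ lem₂ (ι (P ℕ.* w)) (ι q) (ι a) ρ (ι A) V ⟩
        ι (P ℕ.* w) * ι a * ι A * T
          ≡⟨ cong (_* T) (sym (trans (ι-* (P ℕ.* w ℕ.* a) A) (cong (_* ι A) (ι-* (P ℕ.* w) a)))) ⟩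
        ι (P ℕ.* w ℕ.* a ℕ.* A) * T ∎
        where
        open ℚ.≤-Reasoning
        lem₁ : ∀ M P w q d → M ℕ.* P ℕ.* (w ℕ.* q) ℕ.* d ≡ P ℕ.* w ℕ.* q ℕ.* (M ℕ.* d)
        lem₁ = ℕ-Ring.solve-∀
        lem₂ : ∀ w q a r b v → w * q * (a * r * (b * v)) ≡ w * a * b * (q * (r * v))
        lem₂ = solve-∀ ℚ-ring

    large-product : ∀ P L {M} → M ≡ 1 ⊎ M ℕ.* p ℕ.≤ 32 ℕ.* q → ∀ d → d ℕ.≤ L → ι (M ℕ.* P ℕ.* d) ≤ ι (P ℕ.* L ℕ.* 64) * T
    large-product P L {M} h d d≤L = go 32 64 (M≤ρ h) (ℕ.≤ᵇ⇒≤ 64 64 _)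
      where
      go : ∀ a b → ι M ≤ ι a * ρ → 2 ℕ.* a ℕ.≤ b → ι (M ℕ.* P ℕ.* d) ≤ ι (P ℕ.* L ℕ.* b) * T
      go a b M≤ 2a≤b = begin
        ι (M ℕ.* P ℕ.* d)
          ≤⟨ ι-mono (M ℕ.* P ℕ.* d) (M ℕ.* P ℕ.* L) (ℕ.*-monoʳ-≤ (M ℕ.* P) d≤L) ⟩
        ι (M ℕ.* P ℕ.* L)
          ≡⟨ trans (cong ι (lem₁ M P L)) (ι-* (P ℕ.* L) M) ⟩
        ι (P ℕ.* L) * ι M
          ≤⟨ *-mono-l (0≤ι (P ℕ.* L)) (ℚ.≤-trans M≤ (*-mono-l (0≤ι a) ρ≤2T)) ⟩
        ι (P ℕ.* L) * (ι a * (two * T))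
          ≡⟨ trans (lem₂ (ι (P ℕ.* L)) (ι a) two T) (cong (λ z → ι (P ℕ.* L) * z * T) (sym (trans (ι-* 2 a) (cong (_* ι a) ι-2)))) ⟩
        ι (P ℕ.* L) * ι (2 ℕ.* a) * T
          ≤⟨ *-mono-r 0≤T (*-mono-l (0≤ι (P ℕ.* L)) (ι-mono (2 ℕ.* a) b 2a≤b)) ⟩
        ι (P ℕ.* L) * ι b * T
          ≡⟨ cong (_* T) (sym (ι-* (P ℕ.* L) b)) ⟩
        ι (P ℕ.* L ℕ.* b) * T ∎
        where
        open ℚ.≤-Reasoning
        lem₁ : ∀ M P L → M ℕ.* P ℕ.* L ≡ P ℕ.* L ℕ.* M
        lem₁ = ℕ-Ring.solve-∀
        lem₂ : ∀ w a t x → w * (a * (t * x)) ≡ w * (t * a) * x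
        lem₂ = solve-∀ ℚ-ring

-- The threshold is bounded, with one constant for all p and q.

module Final where

  open import Defs using (inv; fromℕℚ; expSum; lnSum; IsThreshold)
  open Rationals
  open Powers using (log₂)
  open Covering using (growthConstant)
  open Threshold using (threshold)
  open GrahamChains using (base)
  open ExpLog using (two; expSum-nonneg)
  open NatBound
  open RealBound
  open Comparison
  open import Data.Nat.Base as ℕ using (ℕ; suc)
  import Data.Nat.Properties as ℕ
  open import Data.Nat.Divisibility using (_∣_)
  open import Data.Rational.Base hiding (∣_∣)
  import Data.Rational.Properties as ℚ
  open import Data.Product.Base using (∃-syntax; _×_; _,_; proj₂)
  open import Data.Sum.Base using (_⊎_; inj₁; inj₂; [_,_]′)
  open import Tactic.RingSolver using (solve-∀)
  open import Relation.Binary.PropositionalEquality hiding (J)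

  capped-log : ℕ → ℚ → ℚ
  capped-log n x = 1ℚ ⊔ lnSum n x

  -- The n-th approximation of the right side of the theorem, where x n approximates e + ε; the
  -- powers are left in the form to which the real expression unfolds.
  bound-term : ℕ → ℚ → (ℕ → ℚ) → ℕ → ℕ → ℚ
  bound-term C α x q n =
    fromℕℚ C * fromℕℚ q * (L * (L * (L * 1ℚ))) * inv ((α ⊓ 1ℚ) * capped-log n L)
    + fromℕℚ C * expSum n (fromℕℚ 2 * α * lnSum n (x n))
    where
    L : ℚ
    L = capped-log n (fromℕℚ q)

  EventuallyBounded : (ℕ → ℚ) → ℕ → Set
  EventuallyBounded x C = ∀ p q → 0 ℕ.< p → 0 ℕ.< q → ∀ α → α ≡ ι p * inv (ι q) →
    ∃[ N ] (IsThreshold α N × (∃[ n₀ ] (∀ n → n₀ ℕ.≤ n → fromℕℚ N + 1ℚ ≤ bound-term C α x q n)))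

  module Estimate
    (H τ s₀ W₀ P W₂ T₂ j₀ : ℕ) (44≤H : 44 ℕ.≤ H) (H<s₀ : H ℕ.< s₀)
    (ready : ∀ s → s₀ ℕ.≤ s → growthConstant H ℕ.* suc s ℕ.≤ 2 ℕ.^ s)
    (0<W₀ : 0 ℕ.< W₀) (W₀≤P : W₀ ℕ.≤ P) (W₀≤W₂ : W₀ ℕ.≤ W₂) (31∣P : 31 ∣ P) (4≤P : 4 ℕ.≤ P) (2P≤I₀ : 2 ℕ.* P ℕ.≤ 2 ℕ.^ j₀)
    (W₂-power : W₂ ≡ base ℕ.^ suc T₂)
    (0<τ : 0 ℕ.< τ) (44τ≤H : 44 ℕ.* τ ℕ.≤ H) (W₀≡ : W₀ ≡ 56 ℕ.* τ)
    (x : ℕ → ℚ) (N₁ : ℕ) (ln-large : ∀ n → N₁ ℕ.≤ n → 1ℚ + inv (ι τ) ≤ lnSum n (x n))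
    where

    private
      open Exponent H τ W₀ j₀ (s₀ ℕ.+ j₀) 0<τ 44τ≤H W₀≡
      open Bounds H s₀ W₀ P W₂ T₂ j₀ 44≤H H<s₀ ready 0<W₀ W₀≤P W₀≤W₂ 31∣P 4≤P 2P≤I₀ W₂-power
      open Rate 0<rate

      A A₃ large k₁ k₂ k₃ k₄ : ℕ
      A     = 10 ℕ.+ small-offset
      A₃    = 2 ℕ.* (2 ℕ.+ C₀) ℕ.+ A ℕ.* A ℕ.* (A ℕ.+ 2)
      large = large-constant ℕ.* 2 ℕ.^ ((2 ℕ.* H ℕ.+ 23) ℕ.* σ-max)
      k₁    = 211244 ℕ.* (W₂ ℕ.* W₂) ℕ.* 2048
      k₂    = P ℕ.* (129 ℕ.* W₂) ℕ.* 32 ℕ.* A₃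
      k₃    = P ℕ.* large ℕ.* 64
      k₄    = P ℕ.* large-constant ℕ.* exponent-constant

    -- k₁ is for the gadget and k₂ for Q proportional to q; k₃ and k₄ are for an enlarged Q, with M
    -- α ≤ 32 and with M = 1. The 4 pays for the 1 in `suc B` and for the gap 1, each at most 2 T.
    constant : ℕ
    constant = k₁ ℕ.+ (k₂ ℕ.+ k₃ ℕ.+ k₄) ℕ.+ 4

    module At (p q : ℕ) (0<p : 0 ℕ.< p) (0<q : 0 ℕ.< q) where

      private
        α : ℚ
        α = ι p * inv (ι q)
        0≤α : 0ℚ ≤ α
        0≤α = 0≤* (0≤ι p) (0≤inv (ι q) (0<ι q 0<q))

      z : ℕ → ℚ
      z n = two * α * lnSum n (x n)

      private
        z≥ : ∀ n → N₁ ℕ.≤ n → two * (1ℚ + θ) * α ≤ z n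
        z≥ n h = ℚ.≤-trans (ℚ.≤-reflexive (lem two (1ℚ + θ) α)) (*-mono-l (0≤* (ℚ.nonNegative⁻¹ two) 0≤α) (ln-large n h))
          where
          lem : ∀ t s a → t * s * a ≡ t * a * s
          lem = solve-∀ ℚ-ring

        0≤z : ∀ n → N₁ ℕ.≤ n → 0ℚ ≤ z n
        0≤z n h = ℚ.≤-trans (0≤* (0≤* (ℚ.nonNegative⁻¹ two) (0≤+ 0≤1 0≤θ)) 0≤α) (z≥ n h)

      module Approximation (n : ℕ) (4q≤n : 4 ℕ.* q ℕ.≤ n) where
        open Logs q 0<q n 4q≤n public
        open LogRatio Λ₁ Λ₂ 1≤Λ₁ 1≤Λ₂ Λ₂² public
        open Scale p q 0<p 0<q V 0≤V 1≤2V public hiding (α)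

      Estimated : ℕ → Set
      Estimated N = ∃[ n₀ ] (∀ n → n₀ ℕ.≤ n → ∃[ 4q≤n ] (ι N + 1ℚ ≤ ι constant * Approximation.T n 4q≤n + ι constant * expSum n (z n)))

      module With (bd : Bound p q) where
        open Bound bd

        Y : ℕ
        Y = M ℕ.* P ℕ.* Q ℕ.* (2 ℕ.+ c)

        Remainder : Set
        Remainder = ∃[ N ] (∀ n → N ℕ.≤ n → N₁ ℕ.≤ n → (4q≤n : 4 ℕ.* q ℕ.≤ n) →
          ι Y ≤ ι k₂ * Approximation.T n 4q≤n + ι k₃ * Approximation.T n 4q≤n + ι k₄ * expSum n (z n))

        module _ (n : ℕ) (N₁≤n : N₁ ℕ.≤ n) (4q≤n : 4 ℕ.* q ℕ.≤ n) where
          open Approximation n 4q≤n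

          0≤kT : ∀ k → 0ℚ ≤ ι k * T
          0≤kT k = 0≤* (0≤ι k) 0≤T

          0≤kE : ∀ k → 0ℚ ≤ ι k * expSum n (z n)
          0≤kE k = 0≤* (0≤ι k) (expSum-nonneg n (0≤z n N₁≤n))

        small-case : Q ≡ 129 ℕ.* W₂ ℕ.* q → Remainder
        small-case Q≡ = from (subst (λ Q → Cost Q c) Q≡ costs)
          where
          from : Cost (129 ℕ.* W₂ ℕ.* q) c → Remainder
          from C = 0 , λ n _ N₁≤n 4q≤n → let open Approximation n 4q≤n in
            ℚ.≤-trans (ℚ.≤-trans (ℚ.≤-trans (ℚ.≤-reflexive (cong (λ Q → ι (M ℕ.* P ℕ.* Q ℕ.* (2 ℕ.+ c))) Q≡))
              (small-product P (129 ℕ.* W₂) A₃ M-small (small-cost A C₀ C.y C.z (y≤ n 4q≤n (log₂ q 0<q)) C.z²≤y C.c≡)))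
              (p≤p+q (0≤kT n N₁≤n 4q≤n k₃))) (p≤p+q (0≤kE n N₁≤n 4q≤n k₄))
            where
            module C = Cost C
            y≤ : ∀ n 4q≤n → ∃[ l ] (2 ℕ.^ l ℕ.≤ q × q ℕ.< 2 ℕ.^ suc l) → ι C.y ≤ ι A * Approximation.Λ₁ n 4q≤n
            y≤ n 4q≤n (l , lo , hi) = begin
              ι C.y                              ≤⟨ ι-mono C.y (2 ℕ.* l ℕ.+ small-offset) (small-log {q} {c} {l} hi C) ⟩
              ι (2 ℕ.* l ℕ.+ small-offset)       ≡⟨ trans (ι-+ (2 ℕ.* l) small-offset) (cong (_+ ι small-offset) (ι-* 2 l)) ⟩
              ι 2 * ι l + ι small-offset         ≤⟨ ℚ.+-mono-≤ (*-mono-l (0≤ι 2) (log-lower l lo))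
                                                      (ℚ.≤-trans (≤-*ˡ 1≤Λ₁ (0≤ι small-offset)) (ℚ.≤-reflexive (ℚ.*-comm Λ₁ (ι small-offset)))) ⟩
              ι 2 * (ι 5 * Λ₁) + ι small-offset * Λ₁ ≡⟨ trans (lem (ι 2) (ι 5) Λ₁ (ι small-offset))
                                                      (cong (_* Λ₁) (trans (cong (_+ ι small-offset) (sym (ι-* 2 5))) (sym (ι-+ 10 small-offset)))) ⟩
              ι A * Λ₁                           ∎
              where
              open Approximation n 4q≤n using (Λ₁; 1≤Λ₁; log-lower)
              open ℚ.≤-Reasoning
              lem : ∀ a b l o → a * (b * l) + o * l ≡ (a * b + o) * l
              lem = solve-∀ ℚ-ring

        large-case : Q ℕ.< 2 ℕ.* X σ → Remainder
        large-case Q< = by M-small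
          where
          Y≡ : Y ≡ M ℕ.* P ℕ.* (Q ℕ.* (2 ℕ.+ c))
          Y≡ = ℕ.*-assoc (M ℕ.* P) Q (2 ℕ.+ c)
          cost≤ : Q ℕ.* (2 ℕ.+ c) ℕ.≤ large-constant ℕ.* 2 ℕ.^ ((2 ℕ.* H ℕ.+ 23) ℕ.* σ)
          cost≤ = large-cost σ Q< costs
          -- If M α ≤ 32, the scale σ is bounded and so is the cost up to the factor M P. If M = 1,
          -- the scale is governed by α, and the exponential term takes the cost.
          by : M ≡ 1 ⊎ M ℕ.* p ℕ.≤ 32 ℕ.* q → Remainder
          by (inj₂ h) = 0 , λ n _ N₁≤n 4q≤n → let open Approximation n 4q≤n in
            ℚ.≤-trans (ℚ.≤-trans (ℚ.≤-reflexive (cong ι Y≡)) (ℚ.≤-trans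
              (large-product P large M-small (Q ℕ.* (2 ℕ.+ c)) (ℕ.≤-trans cost≤ (ℕ.*-monoʳ-≤ large-constant (ℕ.^-monoʳ-≤ 2 (ℕ.*-monoʳ-≤ (2 ℕ.* H ℕ.+ 23)
                (least-bounded (Mα≤ {M} h) σ-least))))))
              (p≤q+p (0≤kT n N₁≤n 4q≤n k₂)))) (p≤p+q (0≤kE n N₁≤n 4q≤n k₄))
          by (inj₁ M≡1) = from (power-below-exp α σ 0≤α (subst (λ m → Least (ι m * inv (ι q)) σ) (trans (cong (ℕ._* p) M≡1) (ℕ.*-identityˡ p)) σ-least .proj₂ .proj₂))
            where
            E≥ : ∀ e → ι (2 ℕ.^ ((2 ℕ.* H ℕ.+ 23) ℕ.* σ)) ≤ ι exponent-constant * e → ι Y ≤ ι k₄ * e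
            E≥ e h = begin
              ι Y
                ≤⟨ ι-mono Y (P ℕ.* large-constant ℕ.* w) (ℕ.≤-trans (ℕ.≤-reflexive (trans Y≡ (cong (ℕ._* (Q ℕ.* (2 ℕ.+ c))) (trans (cong (ℕ._* P) M≡1) (ℕ.*-identityˡ P)))))
                     (ℕ.≤-trans (ℕ.*-monoʳ-≤ P cost≤) (ℕ.≤-reflexive (sym (ℕ.*-assoc P large-constant w))))) ⟩
              ι (P ℕ.* large-constant ℕ.* w)
                ≡⟨ ι-* (P ℕ.* large-constant) w ⟩
              ι (P ℕ.* large-constant) * ι w
                ≤⟨ *-mono-l (0≤ι (P ℕ.* large-constant)) h ⟩
              ι (P ℕ.* large-constant) * (ι exponent-constant * e)
                ≡⟨ trans (sym (ℚ.*-assoc (ι (P ℕ.* large-constant)) (ι exponent-constant) e)) (cong (_* e) (sym (ι-* (P ℕ.* large-constant) exponent-constant))) ⟩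
              ι k₄ * e ∎
              where
              open ℚ.≤-Reasoning
              w : ℕ
              w = 2 ℕ.^ ((2 ℕ.* H ℕ.+ 23) ℕ.* σ)
            from : ∃[ N ] (∀ n → N ℕ.≤ n → ∀ z → two * (1ℚ + θ) * α ≤ z →
                     ι (2 ℕ.^ ((2 ℕ.* H ℕ.+ 23) ℕ.* σ)) ≤ ι exponent-constant * expSum n z) → Remainder
            from (N , h) = N , λ n N≤n N₁≤n 4q≤n →
              ℚ.≤-trans (E≥ (expSum n (z n)) (h n N≤n (z n) (z≥ n N₁≤n))) (p≤q+p (0≤+ (0≤kT n N₁≤n 4q≤n k₂) (0≤kT n N₁≤n 4q≤n k₃)))

        remainder : Remainder
        remainder = [ small-case , large-case ]′ Q-small

        estimate : ∀ N → N ℕ.≤ suc B → Estimated N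
        estimate N N≤ = from remainder
          where
          from : Remainder → Estimated N
          from (N₂ , h) = N₂ ℕ.+ N₁ ℕ.+ 4 ℕ.* q , λ n n≥ →
            let 4q≤n = ℕ.≤-trans (ℕ.m≤n+m (4 ℕ.* q) (N₂ ℕ.+ N₁)) n≥
                N₁≤n = ℕ.≤-trans (ℕ.≤-trans (ℕ.m≤n+m N₁ N₂) (ℕ.m≤m+n (N₂ ℕ.+ N₁) (4 ℕ.* q))) n≥
                N₂≤n = ℕ.≤-trans (ℕ.≤-trans (ℕ.m≤m+n N₂ N₁) (ℕ.m≤m+n (N₂ ℕ.+ N₁) (4 ℕ.* q))) n≥
            in 4q≤n , at n N₁≤n 4q≤n (h n N₂≤n N₁≤n 4q≤n)
            where
            at : ∀ n → N₁ ℕ.≤ n → (4q≤n : 4 ℕ.* q ℕ.≤ n) →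
                 ι Y ≤ ι k₂ * Approximation.T n 4q≤n + ι k₃ * Approximation.T n 4q≤n + ι k₄ * expSum n (z n) →
                 ι N + 1ℚ ≤ ι constant * Approximation.T n 4q≤n + ι constant * expSum n (z n)
            at n N₁≤n 4q≤n Y≤ = begin
              ι N + 1ℚ
                ≤⟨ ℚ.+-monoˡ-≤ 1ℚ (ι-mono N (suc B) N≤) ⟩
              ι (suc B) + 1ℚ
                ≡⟨ cong (_+ 1ℚ) (trans (ι-suc B) (cong (1ℚ +_) (trans (cong ι B≡) (ι-+ (211244 ℕ.* ((M ℕ.* W₂) ℕ.* (M ℕ.* W₂))) Y)))) ⟩
              1ℚ + (ι (211244 ℕ.* ((M ℕ.* W₂) ℕ.* (M ℕ.* W₂))) + ι Y) + 1ℚ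
                ≤⟨ ℚ.+-mono-≤ (ℚ.+-mono-≤ 1≤2T (ℚ.+-mono-≤ (square-bound 211244 W₂ M-small) Y≤)) 1≤2T ⟩
              two * T + (ι k₁ * T + (ι k₂ * T + ι k₃ * T + ι k₄ * e)) + two * T
                -- Nonnegative terms are added until both coefficients are the same constant.
                ≤⟨ p≤p+q (0≤+ (0≤kT n N₁≤n 4q≤n k₄) (0≤* (0≤+ (0≤+ (0≤ι k₁) (0≤+ (0≤ι k₂) (0≤ι k₃))) (0≤ι 4)) (expSum-nonneg n (0≤z n N₁≤n)))) ⟩
              two * T + (ι k₁ * T + (ι k₂ * T + ι k₃ * T + ι k₄ * e)) + two * T + (ι k₄ * T + (ι k₁ + (ι k₂ + ι k₃) + ι 4) * e)
                ≡⟨ trans (cong (λ f → two * T + (ι k₁ * T + (ι k₂ * T + ι k₃ * T + ι k₄ * e)) + two * T + (ι k₄ * T + (ι k₁ + (ι k₂ + ι k₃) + f) * e)) ι-4)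
                     (trans (lem (ι k₁) (ι k₂) (ι k₃) (ι k₄) T e) (cong₂ (λ a b → a * T + b * e) (sym constant≡) (sym constant≡))) ⟩
              ι constant * T + ι constant * e ∎
              where
              open Approximation n 4q≤n
              open ℚ.≤-Reasoning
              e : ℚ
              e = expSum n (z n)
              constant≡ : ι constant ≡ ι k₁ + (ι k₂ + ι k₃ + ι k₄) + (two + two)
              constant≡ = trans (ι-+ (k₁ ℕ.+ (k₂ ℕ.+ k₃ ℕ.+ k₄)) 4) (cong₂ _+_ (trans (ι-+ k₁ (k₂ ℕ.+ k₃ ℕ.+ k₄))
                (cong (ι k₁ +_) (trans (ι-+ (k₂ ℕ.+ k₃) k₄) (cong (_+ ι k₄) (ι-+ k₂ k₃))))) ι-4)
              lem : ∀ a b c d t e → (1ℚ + 1ℚ) * t + (a * t + (b * t + c * t + d * e)) + (1ℚ + 1ℚ) * t + (d * t + (a + (b + c) + (1ℚ + 1ℚ + (1ℚ + 1ℚ))) * e) ≡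
                    (a + (b + c + d) + (1ℚ + 1ℚ + (1ℚ + 1ℚ))) * t + (a + (b + c + d) + (1ℚ + 1ℚ + (1ℚ + 1ℚ))) * e
              lem = solve-∀ ℚ-ring

      threshold-estimate : ∃[ N ] (IsThreshold α N × Estimated N)
      threshold-estimate = from (bound p q 0<p 0<q)
        where
        from : Bound p q → ∃[ N ] (IsThreshold α N × Estimated N)
        from bd = from-threshold (threshold α B (λ n h → all-beyond n (ℕ.≤-trans (ℕ.n≤1+n B) h)))
          where
          open Bound bd
          from-threshold : ∃[ N ] (IsThreshold α N × N ℕ.≤ suc B) → ∃[ N ] (IsThreshold α N × Estimated N)
          from-threshold (N , isThreshold , N≤) = N , isThreshold , With.estimate bd N N≤

      bounded-at : ∃[ N ] (IsThreshold α N × (∃[ n₀ ] (∀ n → n₀ ℕ.≤ n → fromℕℚ N + 1ℚ ≤ bound-term constant α x q n)))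
      bounded-at = from threshold-estimate
        where
        from : ∃[ N ] (IsThreshold α N × Estimated N) →
               ∃[ N ] (IsThreshold α N × (∃[ n₀ ] (∀ n → n₀ ℕ.≤ n → fromℕℚ N + 1ℚ ≤ bound-term constant α x q n)))
        from (N , isThreshold , n₀ , h) = N , isThreshold , n₀ , λ n n≥ → convert n (h n n≥)
          where
          convert : ∀ n → ∃[ 4q≤n ] (ι N + 1ℚ ≤ ι constant * Approximation.T n 4q≤n + ι constant * expSum n (z n)) →
                    fromℕℚ N + 1ℚ ≤ bound-term constant α x q n
          convert n (4q≤n , le) = subst₂ _≤_ (cong (_+ 1ℚ) (ι-def N)) (cong₂ _+_ first second) le
            where
            open Approximation n 4q≤n using (Λ₁; Λ₂; 1≤Λ₂; ρ; 0<α⊓1)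
            first : ι constant * (ι q * (ρ * (Λ₁ * (Λ₁ * Λ₁) * inv Λ₂))) ≡
                    fromℕℚ constant * fromℕℚ q * (Λ₁ * (Λ₁ * (Λ₁ * 1ℚ))) * inv ((α ⊓ 1ℚ) * Λ₂)
            first = trans (lem (ι constant) (ι q) ρ Λ₁ (inv Λ₂))
              (cong₂ _*_ (cong₂ (λ c q → c * q * (Λ₁ * (Λ₁ * (Λ₁ * 1ℚ)))) (ι-def constant) (ι-def q))
                (sym (inv-* 0<α⊓1 (ℚ.<-≤-trans 0<1 1≤Λ₂))))
              where
              lem : ∀ c q r l i → c * (q * (r * (l * (l * l) * i))) ≡ c * q * (l * (l * (l * 1ℚ))) * (r * i)
              lem = solve-∀ ℚ-ring
            second : ι constant * expSum n (two * α * lnSum n (x n)) ≡ fromℕℚ constant * expSum n (fromℕℚ 2 * α * lnSum n (x n))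
            second = cong₂ (λ c t → c * expSum n (t * α * lnSum n (x n))) (ι-def constant) (trans (sym ι-2) (ι-def 2))

    bounded : ∃[ C ] EventuallyBounded x C
    bounded = constant , λ { p q 0<p 0<q _ refl → At.bounded-at p q 0<p 0<q }

-- Choosing the parameters from ε.

module Conclusion where

  open import Defs using (inv; expSum; lnSum; module Estimates)
  open Rationals
  open Powers using (linear-below-power; n<2^n)
  open Covering using (growthConstant)
  open GrahamChains using (base)
  open ExpLog using (ln-exceeds)
  open NatBound using (n<base^n)
  open Final using (EventuallyBounded; module Estimate)
  open import Data.Nat.Base as ℕ using (ℕ; zero; suc)
  import Data.Nat.Properties as ℕ
  open import Data.Nat.Divisibility using (_∣_; m∣m*n)
  import Data.Integer.Base as ℤ
  import Data.Integer.Properties as ℤ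
  open import Data.Rational.Base hiding (∣_∣)
  import Data.Rational.Properties as ℚ
  open import Data.Product.Base using (∃-syntax; _×_; _,_)
  open import Relation.Nullary using (contradiction)
  open import Relation.Binary.PropositionalEquality

  fraction : ∀ p q .{{_ : ℕ.NonZero q}} → (ℤ.+ p) / q ≡ ι p * inv (ι q)
  fraction p zero {{q≢0}} = contradiction refl (ℕ.≢-nonZero⁻¹ 0 {{q≢0}})
  fraction p (suc m) = sym (trans (cong₂ (λ a b → a * inv b) (trans (ι-def p) (Estimates.ι≡ p)) (trans (ι-def (suc m)) (Estimates.ι≡ (suc m))))
    (ℚ./-cong (ℤ.*-identityʳ (ℤ.+ p)) (ℕ.*-identityˡ (suc m))))

  opaque

    estimated : ∀ δ → 0ℚ < δ → ∀ (f : ℕ → ℚ) N₀ → (∀ n → N₀ ℕ.≤ n → δ ≤ f n) → ∃[ C ] EventuallyBounded (λ n → expSum n 1ℚ + f n) C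
    estimated δ 0<δ f N₀ f≥ = with-τ (ln-exceeds δ 0<δ)
      where
      x : ℕ → ℚ
      x n = expSum n 1ℚ + f n

      with-τ : ∃[ τ ] ∃[ N ] (0 ℕ.< τ × (∀ n → N ℕ.≤ n → ∀ x → expSum n 1ℚ + δ ≤ x → 1ℚ + inv (ι τ) ≤ lnSum n x)) → ∃[ C ] EventuallyBounded x C
      with-τ (τ , N₁ , 0<τ , ln-large) = with-constants (44 ℕ.* τ) (56 ℕ.* τ) 31 refl refl
        (ℕ.m≤m*n 44 τ {{ℕ.>-nonZero 0<τ}}) (ℕ.≤-trans 0<τ (ℕ.m≤n*m τ 56)) (ℕ.≤ᵇ⇒≤ 4 31 _) refl
        where
        with-constants : ∀ H W₀ r → H ≡ 44 ℕ.* τ → W₀ ≡ 56 ℕ.* τ → 44 ℕ.≤ H → 0 ℕ.< W₀ → 4 ℕ.≤ r → r ≡ 31 → ∃[ C ] EventuallyBounded x C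
        with-constants H W₀ r H≡ W₀≡ 44≤H 0<W₀ 4≤r r≡31 = with-s (linear-below-power (growthConstant H) H)
          where
          P : ℕ
          P = r ℕ.* W₀
          instance
            r≢0 : ℕ.NonZero r
            r≢0 = ℕ.>-nonZero (ℕ.≤-trans (ℕ.s≤s ℕ.z≤n) 4≤r)
            W₀≢0 : ℕ.NonZero W₀
            W₀≢0 = ℕ.>-nonZero 0<W₀
          with-s : ∃[ s₀ ] (H ℕ.< s₀ × (∀ s → s₀ ℕ.≤ s → growthConstant H ℕ.* suc s ℕ.≤ 2 ℕ.^ s)) → ∃[ C ] EventuallyBounded x C
          -- P = 31 W₀, W₂ = base^(W₀ + 1) and I₀ = 2^(2 P) only have to be large, apart from 31
          -- dividing P and W₂ being a power of `base`, as the gadget requires.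
          with-s (s₀ , H<s₀ , ready) = Estimate.bounded H τ s₀ W₀ P (base ℕ.^ suc W₀) W₀ (2 ℕ.* P) 44≤H H<s₀ ready 0<W₀ W₀≤P W₀≤W₂ 31∣P
            4≤P 2P≤I₀ refl 0<τ 44τ≤H W₀≡ x (N₁ ℕ.+ N₀) large
            where
            W₀≤P : W₀ ℕ.≤ P
            W₀≤P = ℕ.m≤n*m W₀ r
            W₀≤W₂ : W₀ ℕ.≤ base ℕ.^ suc W₀
            W₀≤W₂ = ℕ.≤-trans (ℕ.n≤1+n W₀) (ℕ.<⇒≤ (n<base^n (suc W₀)))
            31∣P : 31 ∣ P
            31∣P = subst (λ r → 31 ∣ r ℕ.* W₀) (sym r≡31) (m∣m*n W₀)
            4≤P : 4 ℕ.≤ P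
            4≤P = ℕ.≤-trans 4≤r (ℕ.m≤m*n r W₀)
            2P≤I₀ : 2 ℕ.* P ℕ.≤ 2 ℕ.^ (2 ℕ.* P)
            2P≤I₀ = ℕ.<⇒≤ (n<2^n (2 ℕ.* P))
            44τ≤H : 44 ℕ.* τ ℕ.≤ H
            44τ≤H = ℕ.≤-reflexive (sym H≡)
            large : ∀ n → N₁ ℕ.+ N₀ ℕ.≤ n → 1ℚ + inv (ι τ) ≤ lnSum n (x n)
            large n h = ln-large n (ℕ.≤-trans (ℕ.m≤m+n N₁ N₀) h) (x n)
              (ℚ.+-monoʳ-≤ (expSum n 1ℚ) (f≥ n (ℕ.≤-trans (ℕ.m≤n+m N₀ N₁) h)))

open Final using (EventuallyBounded; bound-term)
open Conclusion
open import Defs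
open import Data.Nat.Base as ℕ using (ℕ)
open import Data.Nat.Properties using (n≢0⇒n>0)
open import Data.Integer.Base using (+_)
open import Data.Rational.Base as ℚ using (ℚ; 1ℚ)
import Data.Rational.Properties as ℚ
open import Data.Product.Base as Product using (∃-syntax; _×_; _,_)
open import Relation.Binary.PropositionalEquality using (_≡_; trans; subst)

-- The margin 1 in the estimate is the gap demanded by the strict order of reals; everything else
-- agrees by unfolding.
with-gap : ∀ (ε : ℝ) {{_ : Positive ε}} C (α : ℚ) .{{_ : ℚ.Positive α}} (q : ℕ) .{{_ : ℕ.NonZero q}} →
  ∃[ N ] (IsThreshold α N × (∃[ n₀ ] (∀ n → n₀ ℕ.≤ n → fromℕℚ N ℚ.+ 1ℚ ℚ.≤ bound-term C α (λ n → expSum n 1ℚ ℚ.+ ε .seq n) q n))) →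
  ∃[ nα ] (IsThreshold α nα ×
    fromℕ nα < fromℕ C * fromℕ q * log (fromℕ q) ^ 3 / ((fromℚ α ⊓ 1ℝ) * log (log (fromℕ q)))
               + fromℕ C * (e + ε) ^ᵣ (fromℕ 2 * fromℚ α))
with-gap ε C α q (N , isThreshold , below) = N , isThreshold , 1ℚ , ℚ.positive⁻¹ 1ℚ , below

bounded-above : ∀ ε → 0ℝ < ε → ∃[ C ] EventuallyBounded (λ n → expSum n 1ℚ ℚ.+ ε .seq n) C
bounded-above ε (δ , 0<δ , N₀ , ε≥) =
  estimated δ 0<δ (ε .seq) N₀ (λ n N₀≤n → subst (ℚ._≤ ε .seq n) (ℚ.+-identityˡ δ) (ε≥ n N₀≤n))

theorem1 : (ε : ℝ) {{_ : Positive ε}} →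
    ∃[ c ] ((α : ℚ) .{{_ : ℚ.Positive α}} (p q : ℕ) .{{_ : ℕ.NonZero p}} .{{_ : ℕ.NonZero q}} →
      α ≡ + p ℚ./ q →
      ∃[ nα ] (IsThreshold α nα ×
        fromℕ nα < c * fromℕ q * log (fromℕ q) ^ 3 / ((fromℚ α ⊓ 1ℝ) * log (log (fromℕ q)))
                   + c * (e + ε) ^ᵣ (fromℕ 2 * fromℚ α)))
theorem1 ε {{ε>0}} = Product.map fromℕ
  (λ {C} h α p q α≡ → with-gap ε C α q
    (h p q (n≢0⇒n>0 (ℕ.≢-nonZero⁻¹ p)) (n≢0⇒n>0 (ℕ.≢-nonZero⁻¹ q)) α (trans α≡ (fraction p q))))
  (bounded-above ε (ε>0 .0<x))
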